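{- A binary matroid is strongly Rayleigh if and only if it is regular.
   Context: For a matroid $\mathcal{M}$ on a finite set $E$ with variables $\mathbf{y}=\{y_c:c\in E\}$ and disjoint $I,J\subseteq E$, $M_I^J(\mathbf{y}):=\sum_B\prod_{c\in B\setminus I}y_c$, summed over bases $B$ with $I\subseteq B$, $B\cap J=\varnothing$. For distinct $e,f$: $\Delta M\{e,f\}:=M_e^fM_f^e-M_{ef}M^{ef}$. $\mathcal{M}$ is strongly Rayleigh if $\Delta M\{e,f\}(\mathbf{y})\ge0$ for all distinct $e,f\in E$ and all real $\mathbf{y}\in\mathbb{R}^E$ (positive, negative or zero).
   Formalization: Strongly Rayleigh is stated with ΔM{e,f}(y) ≥ 0 for all rational y instead of all real y; the two conditions agree because ΔM{e,f} is a polynomial and rational points are dense. -}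

module Defs where

open import Level using (Level; _⊔_; 0ℓ; Setω) renaming (suc to lsuc)
open import Data.Nat using (ℕ; zero; suc)
open import Data.Bool using (Bool; true; false; _∧_; _∨_; not; if_then_else_)
open import Data.Bool.Properties using (xor-∧-commutativeRing)
open import Data.Fin using (Fin)
open import Data.Vec using (Vec; []; _∷_)
open import Data.List using (List; []; _∷_; _++_; map; foldr)
open import Data.Fin.Subset using (Subset; _∈_; _∉_; _⊆_; _∩_; _∪_; ∁; ⁅_⁆; ⊥) renaming (_-_ to _－_)
open import Data.Product using (Σ; ∃; _×_; _,_)
open import Data.Rational using (ℚ; 0ℚ; 1ℚ)
import Data.Rational as Q
open import Algebra.Bundles using (CommutativeRing)
open import Relation.Binary.PropositionalEquality using (_≡_; _≢_)
open import Relation.Nullary using (¬_)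

record Matroid (n : ℕ) : Set where
  field
    isBasis  : Subset n → Bool
    nonempty : ∃ λ B → isBasis B ≡ true
    exchange : ∀ B₁ B₂ → isBasis B₁ ≡ true → isBasis B₂ ≡ true →
               ∀ x → x ∈ B₁ → x ∉ B₂ →
               ∃ λ y → y ∈ B₂ × y ∉ B₁ × isBasis ((B₁ － x) ∪ ⁅ y ⁆) ≡ true

open Matroid public

Independent : ∀ {n} → Matroid n → Subset n → Set
Independent M X = ∃ λ B → isBasis M B ≡ true × X ⊆ B

module _ {c ℓ} (R : CommutativeRing c ℓ) where
  open CommutativeRing R renaming (Carrier to K; _+_ to _+R_; _*_ to _*R_)

  ∑ : ∀ {n} → (Fin n → K) → K
  ∑ {zero}  f = 0#
  ∑ {suc n} f = f Fin.zero +R ∑ (λ i → f (Fin.suc i))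

  LinIndep : ∀ {r n} → (Fin r → Fin n → K) → Subset n → Set (c ⊔ ℓ)
  LinIndep A X = ∀ (γ : Fin _ → K) →
    (∀ i → i ∉ X → γ i ≈ 0#) →
    (∀ k → ∑ (λ i → γ i *R A k i) ≈ 0#) →
    ∀ i → γ i ≈ 0#

  Representable : ∀ {n} → Matroid n → Set (c ⊔ ℓ)
  Representable {n} M = Σ ℕ λ r → Σ (Fin r → Fin n → K) λ A →
    ∀ X → (Independent M X → LinIndep A X) × (LinIndep A X → Independent M X)

record Field (c ℓ : Level) : Set (lsuc (c ⊔ ℓ)) where
  field
    commutativeRing : CommutativeRing c ℓ
  open CommutativeRing commutativeRing
  field
    1≉0     : ¬ (1# ≈ 0#)
    inverse : ∀ x → ¬ (x ≈ 0#) → ∃ λ y → (x * y) ≈ 1#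

Binary : ∀ {n} → Matroid n → Set
Binary M = Representable xor-∧-commutativeRing M

Regular : ∀ {n} → Matroid n → Setω
Regular M = ∀ {c ℓ} (F : Field c ℓ) → Representable (Field.commutativeRing F) M

allSubsets : ∀ n → List (Subset n)
allSubsets zero    = [] ∷ []
allSubsets (suc n) = map (true ∷_) (allSubsets n) ++ map (false ∷_) (allSubsets n)

admissible : ∀ {n} → Subset n → Subset n → Subset n → Bool
admissible []      []      []      = true
admissible (i ∷ I) (j ∷ J) (b ∷ B) =
  (not i ∨ b) ∧ not (j ∧ b) ∧ admissible I J B

prodOn : ∀ {n} → Subset n → (Fin n → ℚ) → ℚ
prodOn []          y = 1ℚ
prodOn (true ∷ S)  y = y Fin.zero Q.* prodOn S (λ i → y (Fin.suc i))
prodOn (false ∷ S) y = prodOn S (λ i → y (Fin.suc i))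

MIJ : ∀ {n} → Matroid n → Subset n → Subset n → (Fin n → ℚ) → ℚ
MIJ {n} M I J y = foldr Q._+_ 0ℚ (map term (allSubsets n))
  where
  term : Subset n → ℚ
  term B = if isBasis M B ∧ admissible I J B then prodOn (B ∩ ∁ I) y else 0ℚ

ΔM : ∀ {n} → Matroid n → Fin n → Fin n → (Fin n → ℚ) → ℚ
ΔM M e f y =
  (MIJ M ⁅ e ⁆ ⁅ f ⁆ y Q.* MIJ M ⁅ f ⁆ ⁅ e ⁆ y)
  Q.- (MIJ M (⁅ e ⁆ ∪ ⁅ f ⁆) ⊥ y Q.* MIJ M ⊥ (⁅ e ⁆ ∪ ⁅ f ⁆) y)

-- strongly Rayleigh (real points replaced by rational points)
StronglyRayleigh : ∀ {n} → Matroid n → Set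
StronglyRayleigh {n} M = ∀ (e f : Fin n) → e ≢ f → ∀ (y : Fin n → ℚ) → 0ℚ Q.≤ ΔM M e f y

record _⇔ω_ (A : Set) (B : Setω) : Setω where
  field
    to   : A → B
    from : B → A

{-# OPTIONS --safe #-}
-- Regular ⇒ strongly Rayleigh. A representation over F₃ has entries 0, ±1 in every basis, and since
-- M is also binary a 2 × 2 minor without zero entries vanishes; hence the entries lift to 0, ±1 in
-- any ring, compatibly with exchanges. Over ℚ the wedge ω of the rows satisfies ω(B)² = 1 or 0
-- according to whether B is a basis, and two Plücker relations for ω give
-- ΔM{e,f} = (Σ_S ± ω(S + e) ω(S + f) y^S)².
--
-- Strongly Rayleigh ⇒ regular. Taking limits y_o → 0, ∞, minors of M are strongly Rayleigh, while
-- for the Fano matroid and its dual ΔM{e,f} takes negative values. As in Gerards' proof of Tutte's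
-- theorem, a binary matroid without these minors is signed over F₃ by induction on the ground set:
-- one picks x, y on the same side of the exchange graph whose removal keeps the neighbours of x
-- connected, glues the signings of the deletions of x and of y (unique up to scaling), and any
-- 2 × 2 minor in the columns x, y that violates the signing can be pivoted to a Fano minor along a
-- path connecting its rows. The F₃-signing again lifts to every field.
module Submission where

open import Defs
open import Level using (_⊔_; 0ℓ)
open import Function using (_∘_; id)
open import Data.Empty using (⊥; ⊥-elim)
open import Data.Product using (∃; _×_; _,_; proj₁; proj₂)
open import Data.Sum using (_⊎_; inj₁; inj₂)
open import Data.Bool as Bool using (Bool; true; false; if_then_else_; not; _xor_; _∧_; _∨_)
import Data.Bool.Properties as Boolₚ
open import Data.Bool.Properties using (xor-∧-commutativeRing)
open import Data.Nat as ℕ using (ℕ; zero; suc; _≤_; _<_; z≤n; s≤s)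
import Data.Nat.Properties as ℕₚ
open import Data.Nat.Induction using (<-wellFounded)
open import Data.Rational as ℚ using (ℚ; 0ℚ; 1ℚ)
import Data.Rational.Properties as ℚₚ
open import Data.Fin using (Fin; zero; suc; splitAt)
import Data.Fin.Properties as Finₚ
open import Data.Fin.Subset using (Subset; _∈_; _∉_; _⊆_; _⊂_; _⊃_; _∪_; _∩_; ∁; ⁅_⁆; ⊤; ∣_∣) renaming (_-_ to _－_; ⊥ to ∅)
import Data.Fin.Subset.Properties as Subsetₚ
open import Data.Fin.Subset.Induction using (⊂-wellFounded; ⊃-wellFounded)
open import Data.Vec using (Vec; []; _∷_; lookup; updateAt; zipWith; tabulate)
import Data.Vec.Properties as Vecₚ
open import Data.Maybe as Maybe using (Maybe; just; nothing)
open import Data.List using (List; []; _∷_; _++_; foldr; map)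
import Data.List.Properties as Listₚ
open import Data.List.Relation.Unary.All as All using (All; []; _∷_)
open import Data.List.Relation.Unary.Any as Any using (here; there)
open import Data.List.Relation.Unary.AllPairs using (AllPairs; []; _∷_)
open import Data.List.Membership.Propositional using () renaming (_∈_ to _∈ₗ_)
open import Induction.WellFounded using (Acc; acc)
open import Algebra.Bundles using (CommutativeRing; RawRing)
import Algebra.Properties.Ring as RingProperties
import Algebra.Properties.AbelianGroup as AbelianGroupProperties
import Algebra.Properties.CommutativeSemigroup as CommutativeSemigroupProperties
import Algebra.Properties.Semiring.Mult.TCOptimised as Mult
import Algebra.Solver.Ring
open import Algebra.Solver.Ring.AlmostCommutativeRing using (fromCommutativeRing; _-Raw-AlmostCommutative⟶_)
open import Relation.Nullary using (¬_; Dec; yes; no; does)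
open import Relation.Nullary.Decidable using (_×-dec_; _→-dec_; ¬?; decidable-stable; dec⇒maybe; from-yes; from-no)
import Relation.Nullary.Decidable as Decidable
open import Relation.Binary.Definitions using (tri<; tri≈; tri>)
import Relation.Binary.Reasoning.Setoid as SetoidReasoning
open import Relation.Binary.PropositionalEquality as ≡ using (_≡_; _≢_)

-- Rows and columns of a representation are never separated: relative to a basis B it is stored as
-- an alternating matrix on the whole ground set whose nonzero entries join B to its complement. An
-- exchange is then a principal pivot on a pair {k , l}, by one formula whichever of the two lies in
-- B, and the bases are the sets B ⊕ X for which the principal submatrix on X is nonsingular. No
-- determinants occur: nonsingularity and representability speak of kernels, and a pivot acts on the
-- pairs (z , S z) by exchanging coordinates. Over F₂ and F₃ each nonzero entry is its own inverse,
-- so pivots involve no division. Two obstacles shape the proof. Signs do not lift additively from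
-- F₃, where 1 + 1 = - 1; the pivot rule over F₂ excludes exactly the sums in which this would
-- matter. And equality in an arbitrary field is not decidable; hence all searches for exchanges and
-- circuits take place among Booleans or in F₃, and only the resulting identities are carried over
-- to the field.

-- A pair (m , n) of naturals is the integer coefficient m - n; unlike the library's solvers
-- this one cancels x - x in a ring whose equality is not decidable.
module IntegerSolver {c ℓ} (R : CommutativeRing c ℓ) where
  open CommutativeRing R hiding (zero)
  open RingProperties (CommutativeRing.ring R)
  open AbelianGroupProperties +-abelianGroup using (⁻¹-∙-comm)
  open CommutativeSemigroupProperties +-commutativeSemigroup using (interchange)
  private module +ₛ = CommutativeSemigroupProperties +-commutativeSemigroup
  open Mult semiring renaming (_×_ to _·_)
  open SetoidReasoning setoid

  differences : RawRing _ _
  differences = record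
    { Carrier = ℕ × ℕ
    ; _≈_ = _≡_
    ; _+_ = λ { (m , n) (p , q) → m ℕ.+ p , n ℕ.+ q }
    ; _*_ = λ { (m , n) (p , q) → m ℕ.* p ℕ.+ n ℕ.* q , m ℕ.* q ℕ.+ n ℕ.* p }
    ; -_ = λ { (m , n) → n , m }
    ; 0# = 0 , 0
    ; 1# = 1 , 0
    }

  -- Splitting off n = 0 makes the constants (0 , 0) and (1 , 0) denote `0#` and `1#`
  -- definitionally, with no trailing subtraction of zero.
  ⟦_⟧ᵈ : ℕ × ℕ → Carrier
  ⟦ m , zero ⟧ᵈ = m · 1#
  ⟦ m , suc n ⟧ᵈ = m · 1# - suc n · 1#

  ⟦⟧ᵈ≈ : ∀ m n → ⟦ m , n ⟧ᵈ ≈ m · 1# - n · 1#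
  ⟦⟧ᵈ≈ m zero = sym (trans (+-congˡ -0#≈0#) (+-identityʳ _))
  ⟦⟧ᵈ≈ m (suc n) = refl

  expand : ∀ a b x y → (a - b) * (x - y) ≈ (a * x + b * y) - (a * y + b * x)
  expand a b x y = begin
    (a - b) * (x - y)
      ≈⟨ distribʳ _ _ _ ⟩
    a * (x - y) + - b * (x - y)
      ≈⟨ +-cong (distribˡ _ _ _) (distribˡ _ _ _) ⟩
    (a * x + a * - y) + (- b * x + - b * - y)
      ≈⟨ +-cong (+-congˡ (sym (-‿distribʳ-* a y)))
                (+-cong (sym (-‿distribˡ-* b x)) (trans (sym (-‿distribˡ-* b (- y)))
                  (trans (-‿cong (sym (-‿distribʳ-* b y))) (-‿involutive _)))) ⟩
    (a * x - a * y) + (- (b * x) + b * y)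
      ≈⟨ +-congˡ (+-comm _ _) ⟩
    (a * x - a * y) + (b * y - b * x)
      ≈⟨ interchange _ _ _ _ ⟩
    (a * x + b * y) + (- (a * y) - b * x)
      ≈⟨ +-congˡ (⁻¹-∙-comm _ _) ⟩
    (a * x + b * y) - (a * y + b * x) ∎

  morphism : differences -Raw-AlmostCommutative⟶ fromCommutativeRing R
  morphism = record
    { ⟦_⟧ = ⟦_⟧ᵈ
    ; +-homo = λ { (m , n) (p , q) → trans (⟦⟧ᵈ≈ _ (n ℕ.+ q)) (begin
        (m ℕ.+ p) · 1# - (n ℕ.+ q) · 1#
          ≈⟨ +-cong (×-homo-+ 1# m p) (-‿cong (×-homo-+ 1# n q)) ⟩
        (m · 1# + p · 1#) - (n · 1# + q · 1#)
          ≈⟨ +-congˡ (sym (⁻¹-∙-comm _ _)) ⟩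
        (m · 1# + p · 1#) + (- (n · 1#) - q · 1#)
          ≈⟨ interchange _ _ _ _ ⟩
        (m · 1# - n · 1#) + (p · 1# - q · 1#)
          ≈⟨ +-cong (sym (⟦⟧ᵈ≈ m n)) (sym (⟦⟧ᵈ≈ p q)) ⟩
        ⟦ m , n ⟧ᵈ + ⟦ p , q ⟧ᵈ ∎) }
    ; *-homo = λ { (m , n) (p , q) → trans (⟦⟧ᵈ≈ _ (m ℕ.* q ℕ.+ n ℕ.* p)) (begin
        (m ℕ.* p ℕ.+ n ℕ.* q) · 1# - (m ℕ.* q ℕ.+ n ℕ.* p) · 1#
          ≈⟨ +-cong (×-homo-+ 1# (m ℕ.* p) (n ℕ.* q)) (-‿cong (×-homo-+ 1# (m ℕ.* q) (n ℕ.* p))) ⟩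
        ((m ℕ.* p) · 1# + (n ℕ.* q) · 1#) - ((m ℕ.* q) · 1# + (n ℕ.* p) · 1#)
          ≈⟨ +-cong (+-cong (×1-homo-* m p) (×1-homo-* n q))
                    (-‿cong (+-cong (×1-homo-* m q) (×1-homo-* n p))) ⟩
        (m · 1# * p · 1# + n · 1# * q · 1#) - (m · 1# * q · 1# + n · 1# * p · 1#)
          ≈⟨ sym (expand _ _ _ _) ⟩
        (m · 1# - n · 1#) * (p · 1# - q · 1#)
          ≈⟨ *-cong (sym (⟦⟧ᵈ≈ m n)) (sym (⟦⟧ᵈ≈ p q)) ⟩
        ⟦ m , n ⟧ᵈ * ⟦ p , q ⟧ᵈ ∎) }
    ; -‿homo = λ { (m , n) → trans (⟦⟧ᵈ≈ n m) (begin
        n · 1# - m · 1#               ≈⟨ +-comm _ _ ⟩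
        - (m · 1#) + n · 1#           ≈⟨ +-congˡ (sym (-‿involutive _)) ⟩
        - (m · 1#) - - (n · 1#)       ≈⟨ ⁻¹-∙-comm _ _ ⟩
        - (m · 1# - n · 1#)           ≈⟨ -‿cong (sym (⟦⟧ᵈ≈ m n)) ⟩
        - ⟦ m , n ⟧ᵈ                  ∎) }
    ; 0-homo = refl
    ; 1-homo = refl
    }

  difference≟ : ∀ x y → Maybe (⟦ x ⟧ᵈ ≈ ⟦ y ⟧ᵈ)
  difference≟ (m , n) (p , q) = Maybe.map equal (dec⇒maybe (m ℕ.+ q ℕ.≟ p ℕ.+ n))
    where
    equal : m ℕ.+ q ≡ p ℕ.+ n → ⟦ m , n ⟧ᵈ ≈ ⟦ p , q ⟧ᵈ
    equal e = trans (⟦⟧ᵈ≈ m n) (trans (begin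
      M - N                     ≈⟨ +-congˡ (sym (+-identityʳ _)) ⟩
      M + (- N + 0#)            ≈⟨ +-congˡ (+-congˡ (sym (-‿inverseʳ Q))) ⟩
      M + (- N + (Q - Q))       ≈⟨ +-congˡ (+ₛ.x∙yz≈y∙xz _ _ _) ⟩
      M + (Q + (- N - Q))       ≈⟨ sym (+-assoc _ _ _) ⟩
      (M + Q) + (- N - Q)       ≈⟨ +-congʳ same ⟩
      (P + N) + (- N - Q)       ≈⟨ interchange _ _ _ _ ⟩
      (P - N) + (N - Q)         ≈⟨ +-assoc _ _ _ ⟩
      P + (- N + (N - Q))       ≈⟨ +-congˡ (sym (+-assoc _ _ _)) ⟩
      P + ((- N + N) - Q)       ≈⟨ +-congˡ (trans (+-congʳ (-‿inverseˡ N)) (+-identityˡ _)) ⟩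
      P - Q                     ∎) (sym (⟦⟧ᵈ≈ p q)))
      where
      M = m · 1#
      N = n · 1#
      P = p · 1#
      Q = q · 1#
      same : M + Q ≈ P + N
      same = begin
        M + Q                 ≈⟨ sym (×-homo-+ 1# m q) ⟩
        (m ℕ.+ q) · 1#        ≈⟨ reflexive (≡.cong (_· 1#) e) ⟩
        (p ℕ.+ n) · 1#        ≈⟨ ×-homo-+ 1# p n ⟩
        P + N                 ∎

  open Algebra.Solver.Ring differences (fromCommutativeRing R) morphism difference≟ public
    using (Polynomial; solve; _:=_; _:+_; _:*_; _:-_; :-_; con)

-- Finite sums, alternating matrices and principal pivots.

module Sums {c ℓ} (R : CommutativeRing c ℓ) where
  open CommutativeRing R renaming (Carrier to K) hiding (zero)
  open RingProperties (CommutativeRing.ring R)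
  open IntegerSolver R

  sum-cong : ∀ n {f g : Fin n → K} → (∀ i → f i ≈ g i) → ∑ R f ≈ ∑ R g
  sum-cong zero e = refl
  sum-cong (suc n) e = +-cong (e zero) (sum-cong n λ i → e (suc i))

  sum-0 : ∀ n {f : Fin n → K} → (∀ i → f i ≈ 0#) → ∑ R f ≈ 0#
  sum-0 zero e = refl
  sum-0 (suc n) e = trans (+-cong (e zero) (sum-0 n λ i → e (suc i))) (+-identityˡ 0#)

  sum-+ : ∀ n (f g : Fin n → K) → ∑ R (λ i → f i + g i) ≈ ∑ R f + ∑ R g
  sum-+ zero f g = sym (+-identityˡ 0#)
  sum-+ (suc n) f g = trans (+-congˡ (sum-+ n (λ i → f (suc i)) (λ i → g (suc i))))
    (solve 4 (λ a b c d → (a :+ b) :+ (c :+ d) := (a :+ c) :+ (b :+ d)) refl _ _ _ _)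

  sum-*ˡ : ∀ n x (f : Fin n → K) → ∑ R (λ i → x * f i) ≈ x * ∑ R f
  sum-*ˡ zero x f = sym (zeroʳ x)
  sum-*ˡ (suc n) x f = trans (+-congˡ (sum-*ˡ n x λ i → f (suc i))) (sym (distribˡ x _ _))

  sum-neg : ∀ n (f : Fin n → K) → ∑ R (λ i → - f i) ≈ - ∑ R f
  sum-neg zero f = sym -0#≈0#
  sum-neg (suc n) f = trans (+-congˡ (sum-neg n λ i → f (suc i))) (solve 2 (λ a b → :- a :+ :- b := :- (a :+ b)) refl _ _)

  sum-comm : ∀ m n (f : Fin m → Fin n → K) →
             ∑ R (λ i → ∑ R (f i)) ≈ ∑ R (λ j → ∑ R λ i → f i j)
  sum-comm zero n f = sym (sum-0 n λ j → refl)
  sum-comm (suc m) n f = trans (+-congˡ (sum-comm m n λ i → f (suc i)))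
    (sym (sum-+ n (f zero) λ j → ∑ R λ i → f (suc i) j))

  sum-only : ∀ {n} (k : Fin n) {f : Fin n → K} → (∀ v → v ≢ k → f v ≈ 0#) → ∑ R f ≈ f k
  sum-only {suc n} zero e = trans (+-congˡ (sum-0 n λ i → e (suc i) λ ())) (+-identityʳ _)
  sum-only (suc k) e = trans (+-cong (e zero λ ()) (sum-only k λ v v≢k → e (suc v) λ q → v≢k (Finₚ.suc-injective q)))
    (+-identityˡ _)

  sum-two : ∀ {n} (k l : Fin n) {f : Fin n → K} → k ≢ l → (∀ v → v ≢ k → v ≢ l → f v ≈ 0#) →
            ∑ R f ≈ f k + f l
  sum-two zero zero k≢l e = ⊥-elim (k≢l ≡.refl)
  sum-two zero (suc l) k≢l e = +-congˡ (sum-only l λ v v≢l → e (suc v) (λ ()) λ q → v≢l (Finₚ.suc-injective q))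
  sum-two (suc k) zero k≢l e = trans (+-comm _ _) (+-congʳ (sum-only k λ v v≢k → e (suc v) (λ q → v≢k (Finₚ.suc-injective q)) λ ()))
  sum-two (suc k) (suc l) k≢l e =
    trans (+-cong (e zero (λ ()) λ ())
      (sum-two k l (λ q → k≢l (≡.cong suc q)) λ v v≢k v≢l →
        e (suc v) (λ q → v≢k (Finₚ.suc-injective q)) λ q → v≢l (Finₚ.suc-injective q)))
    (+-identityˡ _)

module LinearAlgebra {c ℓ} (R : CommutativeRing c ℓ) (n : ℕ) where
  open CommutativeRing R renaming (Carrier to K) hiding (zero)
  open RingProperties (CommutativeRing.ring R)
  open IntegerSolver R
  open SetoidReasoning setoid
  private module Sₙ = Sums R

  sum : (Fin n → K) → K
  sum = ∑ R

  sum-cong : {f g : Fin n → K} → (∀ i → f i ≈ g i) → sum f ≈ sum g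
  sum-cong = Sₙ.sum-cong n

  sum-0 : {f : Fin n → K} → (∀ i → f i ≈ 0#) → sum f ≈ 0#
  sum-0 = Sₙ.sum-0 n

  sum-+ : (f g : Fin n → K) → sum (λ i → f i + g i) ≈ sum f + sum g
  sum-+ = Sₙ.sum-+ n

  sum-*ˡ : ∀ x (f : Fin n → K) → sum (λ i → x * f i) ≈ x * sum f
  sum-*ˡ = Sₙ.sum-*ˡ n

  sum-*ʳ : ∀ (f : Fin n → K) x → sum (λ i → f i * x) ≈ sum f * x
  sum-*ʳ f x = trans (sum-cong λ i → *-comm (f i) x) (trans (sum-*ˡ x f) (*-comm x _))

  sum-neg : (f : Fin n → K) → sum (λ i → - f i) ≈ - sum f
  sum-neg = Sₙ.sum-neg n

  sum-comm : (f : Fin n → Fin n → K) → sum (λ i → sum (f i)) ≈ sum (λ j → sum λ i → f i j)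
  sum-comm = Sₙ.sum-comm n n

  sum-only : (k : Fin n) {f : Fin n → K} → (∀ v → v ≢ k → f v ≈ 0#) → sum f ≈ f k
  sum-only = Sₙ.sum-only

  sum-two : (k l : Fin n) {f : Fin n → K} → k ≢ l → (∀ v → v ≢ k → v ≢ l → f v ≈ 0#) → sum f ≈ f k + f l
  sum-two = Sₙ.sum-two

  δ : Fin n → Fin n → K
  δ k v = if does (k Finₚ.≟ v) then 1# else 0#

  δ-refl : ∀ (k : Fin n) → δ k k ≡ 1#
  δ-refl k with k Finₚ.≟ k
  ... | yes _ = ≡.refl
  ... | no k≢k = ⊥-elim (k≢k ≡.refl)

  δ-≢ : ∀ {k v : Fin n} → k ≢ v → δ k v ≡ 0#
  δ-≢ {k = k} {v} k≢v with k Finₚ.≟ v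
  ... | yes k≡v = ⊥-elim (k≢v k≡v)
  ... | no _ = ≡.refl

  sum-δ : ∀ (k : Fin n) (f : Fin n → K) → sum (λ v → f v * δ k v) ≈ f k
  sum-δ k f = trans (sum-only k λ v v≢k → trans (*-congˡ (reflexive (δ-≢ (λ q → v≢k (≡.sym q))))) (zeroʳ _))
    (trans (*-congˡ (reflexive (δ-refl k))) (*-identityʳ _))

  Matrix : Set c
  Matrix = Fin n → Fin n → K

  -- The zero diagonal is demanded separately because over F₂ skew-symmetry says only that the
  -- matrix is symmetric.
  Alternating : Matrix → Set ℓ
  Alternating S = (∀ u → S u u ≈ 0#) × (∀ u v → S u v ≈ - S v u)

  -- The 1 subtracted at k lets the single formula of `pivot` give the right rows and columns at k
  -- and l as well, with no case distinction.
  deleted : Fin n → Matrix → Fin n → K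
  deleted k S u = S u k - δ k u

  -- The principal pivot transform on {k , l}, up to signs, when a = S k l and a * a = 1:
  -- it exchanges, up to sign, the coordinates k and l of z with those of S z (see pivot-graph).
  pivot : K → Fin n → Fin n → Matrix → Matrix
  pivot a k l S u v = S u v + a * (deleted l S u * deleted k S v - deleted k S u * deleted l S v)

  -- At k and l the value of z is replaced by that of - w. Writing this as a subtraction of
  -- multiples of `δ` lets a sum against `swap` be split by linearity.
  swap : Fin n → Fin n → (Fin n → K) → (Fin n → K) → Fin n → K
  swap k l z w v = z v - (δ k v * (w k + z k) + δ l v * (w l + z l))

  swap-k : ∀ {k l} z w → k ≢ l → swap k l z w k ≈ - w k
  swap-k {k} {l} z w k≢l = trans (+-congˡ (-‿cong (+-cong (*-congʳ (reflexive (δ-refl k))) (*-congʳ (reflexive (δ-≢ λ q → k≢l (≡.sym q)))))))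
    (trans (+-congˡ (-‿cong (+-cong (*-identityˡ _) (zeroˡ _)))) (solve 2 (λ z w → z :- ((w :+ z) :+ con (0 , 0)) := :- w) refl _ _))

  swap-l : ∀ {k l} z w → k ≢ l → swap k l z w l ≈ - w l
  swap-l {k} {l} z w k≢l = trans (+-congˡ (-‿cong (+-cong (*-congʳ (reflexive (δ-≢ k≢l))) (*-congʳ (reflexive (δ-refl l))))))
    (trans (+-congˡ (-‿cong (+-cong (zeroˡ _) (*-identityˡ _)))) (solve 2 (λ z w → z :- (con (0 , 0) :+ (w :+ z)) := :- w) refl _ _))

  swap-other : ∀ {k l v} z w → v ≢ k → v ≢ l → swap k l z w v ≈ z v
  swap-other {k} {l} {v} z w v≢k v≢l = trans (+-congˡ (-‿cong (+-cong (*-congʳ (reflexive (δ-≢ λ q → v≢k (≡.sym q)))) (*-congʳ (reflexive (δ-≢ λ q → v≢l (≡.sym q)))))))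
    (solve 3 (λ z a b → z :- (con (0 , 0) :* a :+ con (0 , 0) :* b) := z) refl _ _ _)

  _·_ : Matrix → (Fin n → K) → Fin n → K
  (S · z) u = sum λ v → S u v * z v

  -- `a` is kept apart from `S k l`: the reverse pivot is taken with - a, which agrees with the new
  -- entry only up to ≈.
  module Pivot {S : Matrix} (alt : Alternating S) {k l : Fin n} (k≢l : k ≢ l)
               {a : K} (a≈ : a ≈ S k l) (a² : a * a ≈ 1#) where

    S′ : Matrix
    S′ = pivot a k l S

    deleted-kk : deleted k S k ≈ - 1#
    deleted-kk = trans (+-cong (proj₁ alt k) (-‿cong (reflexive (δ-refl k)))) (+-identityˡ _)

    deleted-ll : deleted l S l ≈ - 1#
    deleted-ll = trans (+-cong (proj₁ alt l) (-‿cong (reflexive (δ-refl l)))) (+-identityˡ _)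

    deleted-lk : deleted l S k ≈ a
    deleted-lk = trans (+-cong (sym a≈) (-‿cong (reflexive (δ-≢ λ q → k≢l (≡.sym q)))))
      (solve 1 (λ a → a :- con (0 , 0) := a) refl _)

    deleted-kl : deleted k S l ≈ - a
    deleted-kl = trans (+-cong (trans (proj₂ alt l k) (-‿cong (sym a≈))) (-‿cong (reflexive (δ-≢ k≢l))))
      (solve 1 (λ a → :- a :- con (0 , 0) := :- a) refl _)

    deleted-other : ∀ {j u} → u ≢ j → deleted j S u ≈ S u j
    deleted-other u≢j = trans (+-congˡ (-‿cong (reflexive (δ-≢ λ q → u≢j (≡.sym q)))))
      (solve 1 (λ a → a :- con (0 , 0) := a) refl _)

    pivot-other : ∀ {u v} → u ≢ k → u ≢ l → v ≢ k → v ≢ l →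
                  S′ u v ≈ S u v + a * (S u l * S v k - S u k * S v l)
    pivot-other uk ul vk vl = +-congˡ (*-congˡ (+-cong (*-cong (deleted-other ul) (deleted-other vk))
      (-‿cong (*-cong (deleted-other uk) (deleted-other vl)))))

    alternating : Alternating S′
    alternating =
      (λ u → trans (+-cong (proj₁ alt u) (solve 3 (λ a p q → a :* (q :* p :- p :* q) := con (0 , 0)) refl a (deleted k S u) (deleted l S u)))
                   (+-identityˡ 0#)) ,
      (λ u v → trans (+-congʳ (proj₂ alt u v))
        (solve 6 (λ s a p q p′ q′ → :- s :+ a :* (q :* p′ :- p :* q′) := :- (s :+ a :* (q′ :* p :- p′ :* q))) refl
          (S v u) a (deleted k S u) (deleted l S u) (deleted k S v) (deleted l S v)))

    pivot-k : ∀ v → S′ k v ≈ a * deleted l S v - δ k v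
    pivot-k v = begin
      S k v + a * (deleted l S k * deleted k S v - deleted k S k * deleted l S v)
        ≈⟨ +-cong (proj₂ alt k v) (*-congˡ (+-cong (*-congʳ deleted-lk) (-‿cong (*-congʳ deleted-kk)))) ⟩
      - S v k + a * (a * deleted k S v - - 1# * deleted l S v)
        ≈⟨ solve 4 (λ s a d q → :- s :+ a :* (a :* (s :- d) :- (:- con (1 , 0)) :* q)
                      := (a :* a :- con (1 , 0)) :* (s :- d) :+ (a :* q :- d)) refl (S v k) a (δ k v) (deleted l S v) ⟩
      (a * a - 1#) * (S v k - δ k v) + (a * deleted l S v - δ k v)
        ≈⟨ +-congʳ (trans (*-congʳ (trans (+-congʳ a²) (-‿inverseʳ 1#))) (zeroˡ _)) ⟩
      0# + (a * deleted l S v - δ k v)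
        ≈⟨ +-identityˡ _ ⟩
      a * deleted l S v - δ k v ∎

    pivot-l : ∀ v → S′ l v ≈ - (a * deleted k S v) - δ l v
    pivot-l v = begin
      S l v + a * (deleted l S l * deleted k S v - deleted k S l * deleted l S v)
        ≈⟨ +-cong (proj₂ alt l v) (*-congˡ (+-cong (*-congʳ deleted-ll) (-‿cong (*-congʳ deleted-kl)))) ⟩
      - S v l + a * (- 1# * deleted k S v - - a * deleted l S v)
        ≈⟨ solve 4 (λ s a d p → :- s :+ a :* ((:- con (1 , 0)) :* p :- (:- a) :* (s :- d))
                      := (a :* a :- con (1 , 0)) :* (s :- d) :+ (:- (a :* p) :- d)) refl (S v l) a (δ l v) (deleted k S v) ⟩
      (a * a - 1#) * (S v l - δ l v) + (- (a * deleted k S v) - δ l v)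
        ≈⟨ +-congʳ (trans (*-congʳ (trans (+-congʳ a²) (-‿inverseʳ 1#))) (zeroˡ _)) ⟩
      0# + (- (a * deleted k S v) - δ l v)
        ≈⟨ +-identityˡ _ ⟩
      - (a * deleted k S v) - δ l v ∎

    pivot-kv : ∀ {v} → v ≢ k → v ≢ l → S′ k v ≈ - (a * S l v)
    pivot-kv {v} vk vl = trans (pivot-k v) (trans (+-cong (*-congˡ (trans (deleted-other vl) (proj₂ alt v l)))
      (-‿cong (reflexive (δ-≢ λ q → vk (≡.sym q))))) (solve 2 (λ a s → a :* (:- s) :- con (0 , 0) := :- (a :* s)) refl _ _))

    pivot-lv : ∀ {v} → v ≢ k → v ≢ l → S′ l v ≈ a * S k v
    pivot-lv {v} vk vl = trans (pivot-l v) (trans (+-cong (-‿cong (*-congˡ (trans (deleted-other vk) (proj₂ alt v k))))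
      (-‿cong (reflexive (δ-≢ λ q → vl (≡.sym q))))) (solve 2 (λ a s → :- (a :* (:- s)) :- con (0 , 0) := a :* s) refl _ _))

    pivot-kl : S′ k l ≈ - a
    pivot-kl = trans (pivot-k l) (trans (+-cong (*-congˡ deleted-ll) (-‿cong (reflexive (δ-≢ k≢l))))
      (solve 1 (λ a → a :* (:- con (1 , 0)) :- con (0 , 0) := :- a) refl _))

    -- If p and q are the deleted columns at k and l, those of `S′` are - a q and a p. The second
    -- correction is therefore - a³ times the 2 × 2 expression that the first one adds a times, and
    -- a² = 1.
    involutive : ∀ u v → pivot (- a) k l S′ u v ≈ S u v
    involutive u v = begin
      S′ u v + - a * (deleted l S′ u * deleted k S′ v - deleted k S′ u * deleted l S′ v)
        ≈⟨ +-congˡ (*-congˡ (+-cong (*-cong (Q u) (P v)) (-‿cong (*-cong (P u) (Q v))))) ⟩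
      S′ u v + - a * (a * p u * - (a * q v) - - (a * q u) * (a * p v))
        ≈⟨ solve 6 (λ s a p q p′ q′ →
             (s :+ a :* (q :* p′ :- p :* q′)) :+ (:- a) :* (a :* p :* (:- (a :* q′)) :- (:- (a :* q)) :* (a :* p′))
             := s :+ (con (1 , 0) :- a :* a) :* (a :* (q :* p′ :- p :* q′))) refl (S u v) a (p u) (q u) (p v) (q v) ⟩
      S u v + (1# - a * a) * (a * (q u * p v - p u * q v))
        ≈⟨ +-congˡ (trans (*-congʳ (trans (+-congˡ (-‿cong a²)) (-‿inverseʳ 1#))) (zeroˡ _)) ⟩
      S u v + 0#
        ≈⟨ +-identityʳ _ ⟩
      S u v ∎
      where
      p q : Fin n → K
      p = deleted k S
      q = deleted l S
      P : ∀ u → deleted k S′ u ≈ - (a * q u)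
      P u = trans (+-congʳ (trans (proj₂ alternating u k) (-‿cong (pivot-k u))))
        (solve 2 (λ x d → :- (x :- d) :- d := :- x) refl _ _)
      Q : ∀ u → deleted l S′ u ≈ a * p u
      Q u = trans (+-congʳ (trans (proj₂ alternating u l) (-‿cong (pivot-l u))))
        (solve 2 (λ x d → :- (:- x :- d) :- d := x) refl _ _)

    -- Kernels and nonsingularity are both read off the pairs (z , S z), so this one lemma
    -- transports either through a pivot. The deleted columns at k and l pair with `swap k l z w` to
    -- a β and - a α; what is left over is a multiple of a² - 1.
    pivot-graph : ∀ {z w} → (∀ u → (S · z) u ≈ w u) → ∀ u → (S′ · swap k l z w) u ≈ swap k l w z u
    pivot-graph {z} {w} Sz≈w u = begin
      sum (λ v → (S u v + a * (Q u * P v - P u * Q v)) * z′ v)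
        ≈⟨ sum-cong (λ v → solve 7 (λ s a p q p′ q′ z → (s :+ a :* (q :* p′ :- p :* q′)) :* z
               := s :* z :+ (a :* q :* (p′ :* z) :- a :* p :* (q′ :* z))) refl (S u v) a (P u) (Q u) (P v) (Q v) (z′ v)) ⟩
      sum (λ v → S u v * z′ v + (a * Q u * (P v * z′ v) - a * P u * (Q v * z′ v)))
        ≈⟨ sum-+ (λ v → S u v * z′ v) _ ⟩
      sum (λ v → S u v * z′ v) + sum (λ v → a * Q u * (P v * z′ v) - a * P u * (Q v * z′ v))
        ≈⟨ +-congˡ (sum-+ (λ v → a * Q u * (P v * z′ v)) _) ⟩
      (S · z′) u + (sum (λ v → a * Q u * (P v * z′ v)) + sum (λ v → - (a * P u * (Q v * z′ v))))
        ≈⟨ +-cong (apply u) (+-cong (trans (sum-*ˡ (a * Q u) (λ v → P v * z′ v)) (*-congˡ sumP))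
             (trans (sum-neg (λ v → a * P u * (Q v * z′ v))) (-‿cong (trans (sum-*ˡ (a * P u) (λ v → Q v * z′ v)) (*-congˡ sumQ))))) ⟩
      (w u - (S u k * α + S u l * β)) + (a * Q u * (a * β) - a * P u * - (a * α))
        ≈⟨ solve 8 (λ w k α l β a dk dl →
             (w :- (k :* α :+ l :* β)) :+ (a :* (l :- dl) :* (a :* β) :- a :* (k :- dk) :* (:- (a :* α)))
             := (w :- (dk :* α :+ dl :* β)) :+ (a :* a :- con (1 , 0)) :* ((l :- dl) :* β :+ (k :- dk) :* α)) refl
             (w u) (S u k) α (S u l) β a (δ k u) (δ l u) ⟩
      (w u - (δ k u * α + δ l u * β)) + (a * a - 1#) * (Q u * β + P u * α)
        ≈⟨ +-cong (+-congˡ (-‿cong (+-cong (*-congˡ (+-comm _ _)) (*-congˡ (+-comm _ _)))))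
             (trans (*-congʳ (trans (+-congʳ a²) (-‿inverseʳ 1#))) (zeroˡ _)) ⟩
      swap k l w z u + 0#
        ≈⟨ +-identityʳ _ ⟩
      swap k l w z u ∎
      where
      α β : K
      α = w k + z k
      β = w l + z l
      P Q z′ : Fin n → K
      P = deleted k S
      Q = deleted l S
      z′ = swap k l z w
      apply : ∀ u → (S · z′) u ≈ w u - (S u k * α + S u l * β)
      apply u = begin
        sum (λ v → S u v * (z v - (δ k v * α + δ l v * β)))
          ≈⟨ sum-cong (λ v → solve 6 (λ s z k α l β → s :* (z :- (k :* α :+ l :* β))
                := s :* z :- (s :* k :* α :+ s :* l :* β)) refl (S u v) (z v) (δ k v) α (δ l v) β) ⟩
        sum (λ v → S u v * z v - (S u v * δ k v * α + S u v * δ l v * β))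
          ≈⟨ trans (sum-+ (λ v → S u v * z v) _) (+-congˡ (trans (sum-neg _) (-‿cong (sum-+ (λ v → S u v * δ k v * α) _)))) ⟩
        (S · z) u - (sum (λ v → S u v * δ k v * α) + sum (λ v → S u v * δ l v * β))
          ≈⟨ +-cong (Sz≈w u) (-‿cong (+-cong (trans (sum-*ʳ _ α) (*-congʳ (sum-δ k (S u))))
               (trans (sum-*ʳ _ β) (*-congʳ (sum-δ l (S u)))))) ⟩
        w u - (S u k * α + S u l * β) ∎
      sum-deleted : ∀ j → sum (λ v → deleted j S v * z′ v) ≈ - ((S · z′) j) - z′ j
      sum-deleted j = begin
        sum (λ v → (S v j - δ j v) * z′ v)
          ≈⟨ sum-cong (λ v → trans (*-congʳ (+-congʳ (proj₂ alt v j)))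
               (solve 3 (λ s d z → (:- s :- d) :* z := :- (s :* z) :- z :* d) refl (S j v) (δ j v) (z′ v))) ⟩
        sum (λ v → - (S j v * z′ v) - z′ v * δ j v)
          ≈⟨ trans (sum-+ _ _) (+-cong (sum-neg _) (trans (sum-neg _) (-‿cong (sum-δ j z′)))) ⟩
        - ((S · z′) j) - z′ j ∎
      sumP : sum (λ v → P v * z′ v) ≈ a * β
      sumP = trans (sum-deleted k) (trans (+-cong (-‿cong (trans (apply k)
          (+-congˡ (-‿cong (+-cong (*-congʳ (proj₁ alt k)) (*-congʳ (sym a≈))))))) (-‿cong (swap-k z w k≢l)))
        (solve 4 (λ w α a β → :- (w :- (con (0 , 0) :* α :+ a :* β)) :- (:- w) := a :* β) refl (w k) α a β))
      sumQ : sum (λ v → Q v * z′ v) ≈ - (a * α)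
      sumQ = trans (sum-deleted l) (trans (+-cong (-‿cong (trans (apply l)
          (+-congˡ (-‿cong (+-cong (*-congʳ (trans (proj₂ alt l k) (-‿cong (sym a≈)))) (*-congʳ (proj₁ alt l))))))) (-‿cong (swap-l z w k≢l)))
        (solve 4 (λ w α a β → :- (w :- ((:- a) :* α :+ con (0 , 0) :* β)) :- (:- w) := :- (a :* α)) refl (w l) α a β))

-- Subsets under symmetric difference and elementary matroid theory.

true≢false : true ≢ false
true≢false ()

¬true⇒false : ∀ {b} → b ≢ true → b ≡ false
¬true⇒false {false} _ = ≡.refl
¬true⇒false {true} q = ⊥-elim (q ≡.refl)

bool-ext : ∀ {a b} → (a ≡ true → b ≡ true) → (b ≡ true → a ≡ true) → a ≡ b
bool-ext {true} f g = ≡.sym (f ≡.refl)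
bool-ext {false} {true} f g = g ≡.refl
bool-ext {false} {false} f g = ≡.refl

infixl 6 _△_ _⊕_

opaque
  -- Adding and removing are one involution, so B △ u △ v is the exchange between u and v whichever
  -- of them lies in B.
  _△_ : ∀ {n} → Subset n → Fin n → Subset n
  B △ u = updateAt B u not

  _⊕_ : ∀ {n} → Subset n → Subset n → Subset n
  _⊕_ = zipWith _xor_

  △-same : ∀ {n} (B : Subset n) u → lookup (B △ u) u ≡ not (lookup B u)
  △-same B u = Vecₚ.lookup∘updateAt u B

  △-other : ∀ {n} (B : Subset n) {u v} → v ≢ u → lookup (B △ u) v ≡ lookup B v
  △-other B {u} {v} v≢u = Vecₚ.lookup∘updateAt′ v u v≢u B

  lookup-⊕ : ∀ {n} (A B : Subset n) u → lookup (A ⊕ B) u ≡ lookup A u xor lookup B u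
  lookup-⊕ A B u = Vecₚ.lookup-zipWith _xor_ u A B

  －≡△ : ∀ {n} (B : Subset n) u → lookup B u ≡ true → B － u ≡ B △ u
  －≡△ (true ∷ B) zero _ = ≡.cong (false ∷_) (Subsetₚ.p─⊥≡p B)
  －≡△ (b ∷ B) (suc u) u∈B = ≡.cong (b ∷_) (－≡△ B u u∈B)

  ∪≡△ : ∀ {n} (B : Subset n) u → lookup B u ≡ false → B ∪ ⁅ u ⁆ ≡ B △ u
  ∪≡△ (false ∷ B) zero _ = ≡.cong (true ∷_) (Subsetₚ.∪-identityʳ B)
  ∪≡△ (b ∷ B) (suc u) u∉B = ≡.cong₂ _∷_ (Boolₚ.∨-identityʳ b) (∪≡△ B u u∉B)

module _ {n : ℕ} where

  subset-ext : {A B : Subset n} → (∀ u → lookup A u ≡ lookup B u) → A ≡ B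
  subset-ext {A} {B} e = ≡.trans (≡.sym (Vecₚ.tabulate∘lookup A)) (≡.trans (Vecₚ.tabulate-cong e) (Vecₚ.tabulate∘lookup B))

  subset-ext-at : ∀ {A B : Subset n} u → lookup A u ≡ lookup B u → (∀ v → v ≢ u → lookup A v ≡ lookup B v) → A ≡ B
  subset-ext-at {A} {B} u same other = subset-ext helper
    where
    helper : ∀ v → lookup A v ≡ lookup B v
    helper v with v Finₚ.≟ u
    ... | yes ≡.refl = same
    ... | no v≢u = other v v≢u

  △-involutive : ∀ (B : Subset n) u → B △ u △ u ≡ B
  △-involutive B u = subset-ext-at u
    (≡.trans (△-same (B △ u) u) (≡.trans (≡.cong not (△-same B u)) (Boolₚ.not-involutive _)))
    λ v v≢u → ≡.trans (△-other (B △ u) v≢u) (△-other B v≢u)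

  △-comm : ∀ (B : Subset n) u v → B △ u △ v ≡ B △ v △ u
  △-comm B u v with u Finₚ.≟ v
  ... | yes ≡.refl = ≡.refl
  ... | no u≢v = subset-ext-at u
    (≡.trans (△-other (B △ u) u≢v) (≡.trans (△-same B u) (≡.sym (≡.trans (△-same (B △ v) u) (≡.cong not (△-other B u≢v))))))
    λ w w≢u → ≡.trans (helper w w≢u) (≡.sym (△-other (B △ v) w≢u))
    where
    helper : ∀ w → w ≢ u → lookup (B △ u △ v) w ≡ lookup (B △ v) w
    helper w w≢u with w Finₚ.≟ v
    ... | yes ≡.refl = ≡.trans (△-same (B △ u) w) (≡.trans (≡.cong not (△-other B w≢u)) (≡.sym (△-same B w)))
    ... | no w≢v = ≡.trans (△-other (B △ u) w≢v) (≡.trans (△-other B w≢u) (≡.sym (△-other B w≢v)))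

  △△-∈ : ∀ B {u v : Fin n} → u ≢ v → lookup (B △ u △ v) u ≡ not (lookup B u)
  △△-∈ B {u} {v} u≢v = ≡.trans (△-other (B △ u) u≢v) (△-same B u)

  △△-∈′ : ∀ B {u v : Fin n} → u ≢ v → lookup (B △ u △ v) v ≡ not (lookup B v)
  △△-∈′ B {u} {v} u≢v = ≡.trans (△-same (B △ u) v) (≡.cong not (△-other B (u≢v ∘ ≡.sym)))

  △△-other : ∀ B {u v w : Fin n} → w ≢ u → w ≢ v → lookup (B △ u △ v) w ≡ lookup B w
  △△-other B {u} {v} w≢u w≢v = ≡.trans (△-other (B △ u) w≢v) (△-other B w≢u)

  △△-involutive : ∀ (B : Subset n) u v → B △ u △ v △ u △ v ≡ B
  △△-involutive B u v = ≡.trans (≡.cong (_△ v) (≡.trans (≡.cong (_△ u) (△-comm B u v)) (△-involutive (B △ v) u))) (△-involutive B v)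

  lookup-∅ : ∀ (u : Fin n) → lookup ∅ u ≡ false
  lookup-∅ u = Vecₚ.lookup-replicate u false

  △-⊕ : ∀ (A B : Subset n) u → (A △ u) ⊕ B ≡ (A ⊕ B) △ u
  △-⊕ A B u = subset-ext λ v → ≡.trans (lookup-⊕ (A △ u) B v) (helper v)
    where
    not-xor : ∀ a b → not a xor b ≡ not (a xor b)
    not-xor true b = ≡.sym (Boolₚ.not-involutive b)
    not-xor false b = ≡.refl
    helper : ∀ v → lookup (A △ u) v xor lookup B v ≡ lookup ((A ⊕ B) △ u) v
    helper v with v Finₚ.≟ u
    ... | yes ≡.refl = ≡.trans (≡.cong (_xor lookup B u) (△-same A u))
      (≡.trans (not-xor (lookup A u) _) (≡.sym (≡.trans (△-same (A ⊕ B) u) (≡.cong not (lookup-⊕ A B u)))))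
    ... | no v≢u = ≡.trans (≡.cong (_xor lookup B v) (△-other A v≢u))
      (≡.sym (≡.trans (△-other (A ⊕ B) v≢u) (lookup-⊕ A B v)))

  ⊕-comm : ∀ (A B : Subset n) → A ⊕ B ≡ B ⊕ A
  ⊕-comm A B = subset-ext λ u → ≡.trans (lookup-⊕ A B u) (≡.trans (Boolₚ.xor-comm (lookup A u) _) (≡.sym (lookup-⊕ B A u)))

  ⊕-△ : ∀ (A B : Subset n) u → A ⊕ (B △ u) ≡ (A ⊕ B) △ u
  ⊕-△ A B u = ≡.trans (⊕-comm A (B △ u)) (≡.trans (△-⊕ B A u) (≡.cong (_△ u) (⊕-comm B A)))

  ⊕-∅ : ∀ (A : Subset n) → A ⊕ ∅ ≡ A
  ⊕-∅ A = subset-ext λ u → ≡.trans (lookup-⊕ A ∅ u) (≡.trans (≡.cong (lookup A u xor_) (lookup-∅ u)) (Boolₚ.xor-identityʳ _))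

  ∈⇒true : ∀ {X : Subset n} {u} → u ∈ X → lookup X u ≡ true
  ∈⇒true = Vecₚ.[]=⇒lookup

  true⇒∈ : ∀ {X : Subset n} {u} → lookup X u ≡ true → u ∈ X
  true⇒∈ = Vecₚ.lookup⇒[]= _ _

  false⇒∉ : ∀ {X : Subset n} {u} → lookup X u ≡ false → u ∉ X
  false⇒∉ e u∈X = true≢false (≡.trans (≡.sym (∈⇒true u∈X)) e)

  ∉⇒false : ∀ {X : Subset n} {u} → u ∉ X → lookup X u ≡ false
  ∉⇒false u∉X = ¬true⇒false (u∉X ∘ true⇒∈)

  differ : ∀ {X : Subset n} {u v} → lookup X u ≡ true → lookup X v ≡ false → u ≢ v
  differ p q ≡.refl = true≢false (≡.trans (≡.sym p) q)

  lookup-⁅⁆-≢ : ∀ {u v : Fin n} → v ≢ u → lookup ⁅ u ⁆ v ≡ false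
  lookup-⁅⁆-≢ v≢u = ∉⇒false λ v∈ → v≢u (Subsetₚ.x∈⁅y⁆⇒x≡y _ v∈)

module _ {n : ℕ} {P : Fin n → Set} (P? : ∀ u → Dec (P u)) where

  comprehension : Subset n
  comprehension = tabulate λ u → does (P? u)

  comprehension⇒ : ∀ {u} → lookup comprehension u ≡ true → P u
  comprehension⇒ {u} e = helper (P? u) (≡.trans (≡.sym (Vecₚ.lookup∘tabulate (λ u → does (P? u)) u)) e)
    where
    helper : (d : Dec (P u)) → does d ≡ true → P u
    helper (yes p) _ = p
    helper (no _) ()

  ⇒comprehension : ∀ {u} → P u → lookup comprehension u ≡ true
  ⇒comprehension {u} p = ≡.trans (Vecₚ.lookup∘tabulate (λ u → does (P? u)) u) (helper (P? u))
    where
    helper : (d : Dec (P u)) → does d ≡ true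
    helper (yes _) = ≡.refl
    helper (no ¬p) = ⊥-elim (¬p p)

module MatroidFacts {n : ℕ} (M : Matroid n) where

  β : Subset n → Bool
  β = isBasis M

  Basis : Subset n → Set
  Basis B = β B ≡ true

  Adj : Subset n → Fin n → Fin n → Set
  Adj B u v = u ≢ v × Basis (B △ u △ v)

  exchange△ : ∀ {B C} → Basis B → Basis C → ∀ {u} → lookup B u ≡ true → lookup C u ≡ false →
              ∃ λ v → lookup C v ≡ true × lookup B v ≡ false × Basis (B △ u △ v)
  exchange△ {B} {C} bB bC {u} u∈B u∉C with exchange M B C bB bC u (true⇒∈ u∈B) (false⇒∉ u∉C)
  ... | v , v∈C , v∉B , b = v , ∈⇒true v∈C , ∉⇒false v∉B , ≡.trans (≡.cong β (≡.sym replaced)) b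
    where
    v≢u : v ≢ u
    v≢u ≡.refl = v∉B (true⇒∈ u∈B)
    replaced : (B － u) ∪ ⁅ v ⁆ ≡ B △ u △ v
    replaced = ≡.trans (≡.cong (_∪ ⁅ v ⁆) (－≡△ B u u∈B)) (∪≡△ (B △ u) v (≡.trans (△-other B v≢u) (∉⇒false v∉B)))

  basis-antichain : ∀ {B C} → Basis B → Basis C → (∀ u → lookup C u ≡ true → lookup B u ≡ true) → B ≡ C
  basis-antichain {B} {C} bB bC C⊆B = subset-ext same
    where
    same : ∀ u → lookup B u ≡ lookup C u
    same u with lookup B u in p | lookup C u in q
    ... | true | true = ≡.refl
    ... | false | false = ≡.refl
    ... | false | true = ≡.trans (≡.sym p) (C⊆B u q)
    ... | true | false with exchange△ bB bC p q
    ...   | v , v∈C , v∉B , _ = ⊥-elim (true≢false (≡.trans (≡.sym (C⊆B v v∈C)) v∉B))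

  Adj-sym : ∀ {B u v} → Adj B u v → Adj B v u
  Adj-sym {B} {u} {v} (u≢v , b) = u≢v ∘ ≡.sym , ≡.trans (≡.cong β (△-comm B v u)) b

  -- With u and v on the same side, B and B △ u △ v would be comparable and hence equal by
  -- `basis-antichain`, although they differ at u.
  Adj⇒differ : ∀ {B} → Basis B → ∀ {u v} → Adj B u v → lookup B v ≡ not (lookup B u)
  Adj⇒differ {B} bB {u} {v} (u≢v , b) with lookup B u in p | lookup B v in q
  ... | true | false = ≡.refl
  ... | false | true = ≡.refl
  ... | true | true = ⊥-elim (true≢false (≡.trans (≡.sym p) (≡.trans (≡.cong (λ X → lookup X u) B≡) u∉)))
    where
    u∉ : lookup (B △ u △ v) u ≡ false
    u∉ = ≡.trans (△-other (B △ u) u≢v) (≡.trans (△-same B u) (≡.cong not p))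
    sub : ∀ w → lookup (B △ u △ v) w ≡ true → lookup B w ≡ true
    sub w w∈ with w Finₚ.≟ u | w Finₚ.≟ v
    ... | yes ≡.refl | _ = p
    ... | no _ | yes ≡.refl = q
    ... | no w≢u | no w≢v = ≡.trans (≡.sym (≡.trans (△-other (B △ u) w≢v) (△-other B w≢u))) w∈
    B≡ : B ≡ B △ u △ v
    B≡ = basis-antichain bB b sub
  ... | false | false = ⊥-elim (true≢false (≡.trans (≡.sym u∈) (≡.trans (≡.cong (λ X → lookup X u) B≡) p)))
    where
    u∈ : lookup (B △ u △ v) u ≡ true
    u∈ = ≡.trans (△-other (B △ u) u≢v) (≡.trans (△-same B u) (≡.cong not p))
    sub : ∀ w → lookup B w ≡ true → lookup (B △ u △ v) w ≡ true
    sub w w∈ = ≡.trans (△-other (B △ u) (λ { ≡.refl → true≢false (≡.trans (≡.sym w∈) q) }))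
      (≡.trans (△-other B (λ { ≡.refl → true≢false (≡.trans (≡.sym w∈) p) })) w∈)
    B≡ : B △ u △ v ≡ B
    B≡ = basis-antichain b bB sub

  -- Cardinalities are avoided. An element w of C beyond B △ u △ v could be exchanged only for u,
  -- since C already contains the rest of B; the resulting basis would contain B together with v.
  basis-above : ∀ {B C} → Basis B → Basis C → ∀ {u v} → lookup B u ≡ true → lookup B v ≡ false →
                (∀ w → lookup (B △ u △ v) w ≡ true → lookup C w ≡ true) → Basis (B △ u △ v)
  basis-above {B} {C} bB bC {u} {v} u∈B v∉B sub = ≡.trans (≡.cong β (subset-ext same)) bC
    where
    u≢v : u ≢ v
    u≢v = differ {X = B} u∈B v∉B
    v∈ : lookup (B △ u △ v) v ≡ true
    v∈ = ≡.trans (△△-∈′ B u≢v) (≡.cong not v∉B)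
    v∈C : lookup C v ≡ true
    v∈C = sub v v∈
    B-u⊆C : ∀ w → w ≢ u → lookup B w ≡ true → lookup C w ≡ true
    B-u⊆C w w≢u w∈B = sub w (≡.trans (△△-other B w≢u (differ {X = B} w∈B v∉B)) w∈B)
    not-above : ∀ {D} → Basis D → (∀ w → lookup B w ≡ true → lookup D w ≡ true) → lookup D v ≡ false
    not-above bD B⊆D = ≡.trans (≡.cong (λ X → lookup X v) (basis-antichain bD bB B⊆D)) v∉B
    u∉C : lookup C u ≡ false
    u∉C with lookup C u in q
    ... | false = ≡.refl
    ... | true = ⊥-elim (true≢false (≡.trans (≡.sym v∈C) (not-above bC B⊆C)))
      where
      B⊆C : ∀ w → lookup B w ≡ true → lookup C w ≡ true
      B⊆C w w∈B with w Finₚ.≟ u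
      ... | yes ≡.refl = q
      ... | no w≢u = B-u⊆C w w≢u w∈B
    same : ∀ w → lookup (B △ u △ v) w ≡ lookup C w
    same w with lookup (B △ u △ v) w in p | lookup C w in q
    ... | true | true = ≡.refl
    ... | false | false = ≡.refl
    ... | true | false = ⊥-elim (true≢false (≡.trans (≡.sym (sub w p)) q))
    ... | false | true with exchange△ bC bB q w∉B
      where
      w≢u : w ≢ u
      w≢u ≡.refl = true≢false (≡.trans (≡.sym q) u∉C)
      w≢v : w ≢ v
      w≢v ≡.refl = true≢false (≡.trans (≡.sym v∈) p)
      w∉B : lookup B w ≡ false
      w∉B = ≡.trans (≡.sym (△△-other B w≢u w≢v)) p
    ...   | y , y∈B , y∉C , bD with y Finₚ.≟ u
    ...     | no y≢u = ⊥-elim (true≢false (≡.trans (≡.sym (B-u⊆C y y≢u y∈B)) y∉C))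
    ...     | yes ≡.refl = ⊥-elim (true≢false (≡.trans (≡.sym v∈D) (not-above bD B⊆D)))
      where
      D : Subset n
      D = C △ w △ y
      w≢y : w ≢ y
      w≢y ≡.refl = true≢false (≡.trans (≡.sym q) y∉C)
      v≢w : v ≢ w
      v≢w ≡.refl = true≢false (≡.trans (≡.sym v∈) p)
      v∈D : lookup D v ≡ true
      v∈D = ≡.trans (△△-other C v≢w (u≢v ∘ ≡.sym)) v∈C
      B⊆D : ∀ z → lookup B z ≡ true → lookup D z ≡ true
      B⊆D z z∈B with z Finₚ.≟ y
      ... | yes ≡.refl = ≡.trans (△△-∈′ C w≢y) (≡.cong not y∉C)
      ... | no z≢y = ≡.trans (△△-other C z≢w z≢y) (B-u⊆C z z≢y z∈B)
        where
        z≢w : z ≢ w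
        z≢w ≡.refl = true≢false (≡.trans (≡.sym z∈B) (≡.trans (≡.sym (△△-other B (λ { ≡.refl → true≢false (≡.trans (≡.sym q) u∉C) }) (v≢w ∘ ≡.sym))) p))

-- Standard representations and their kernels.

-- The rows of [ I | S ], with the identity in the columns of B, span a matroid representation;
-- InKernel B S γ says that γ is orthogonal to them.
module Kernel {c ℓ} (R : CommutativeRing c ℓ) (n : ℕ) where
  open CommutativeRing R renaming (Carrier to K) hiding (zero)
  open RingProperties (CommutativeRing.ring R) using (-0#≈0#; -‿involutive)
  open LinearAlgebra R n
  open IntegerSolver R

  off on : Subset n → (Fin n → K) → Fin n → K
  off B γ v = if lookup B v then 0# else γ v
  on B γ v = if lookup B v then γ v else 0#

  off-∉ : ∀ {B γ v} → lookup B v ≡ false → off B γ v ≡ γ v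
  off-∉ p rewrite p = ≡.refl
  on-∈ : ∀ {B γ v} → lookup B v ≡ true → on B γ v ≡ γ v
  on-∈ p rewrite p = ≡.refl
  on-∉ : ∀ {B γ v} → lookup B v ≡ false → on B γ v ≡ 0#
  on-∉ p rewrite p = ≡.refl

  record InKernel (B : Subset n) (S : Matrix) (γ : Fin n → K) : Set ℓ where
    constructor in-kernel
    field at : ∀ u → (S · off B γ) u ≈ - on B γ u

  open InKernel public

  InKernel-cong : ∀ {B S T γ} → (∀ u v → S u v ≈ T u v) → InKernel B S γ → InKernel B T γ
  InKernel-cong S≈T ker = in-kernel λ u → trans (sum-cong λ v → *-congʳ (sym (S≈T u v))) (ker .at u)

  module _ {S : Matrix} (alt : Alternating S) {k l : Fin n} (k≢l : k ≢ l)
           {a : K} (a≈ : a ≈ S k l) (a² : a * a ≈ 1#) where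
    open Pivot alt k≢l a≈ a²

    -- Moving k and l across B exchanges their coordinates between `off` and `on`. The minus sign in
    -- `InKernel` and the one in `swap` cancel, so the kernel itself does not change.
    toggled : ∀ B γ v → swap k l (off B γ) (λ u → - on B γ u) v ≈ off (B △ k △ l) γ v
    toggled B γ v with v Finₚ.≟ k
    ... | yes ≡.refl = trans (swap-k _ _ k≢l) (trans (-‿involutive _) (reflexive (helper (△△-∈ B k≢l))))
      where
      helper : lookup (B △ v △ l) v ≡ not (lookup B v) → on B γ v ≡ off (B △ v △ l) γ v
      helper e rewrite e with lookup B v
      ... | true = ≡.refl
      ... | false = ≡.refl
    ... | no v≢k with v Finₚ.≟ l
    ...   | yes ≡.refl = trans (swap-l _ _ k≢l) (trans (-‿involutive _) (reflexive (helper (△△-∈′ B k≢l))))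
      where
      helper : lookup (B △ k △ v) v ≡ not (lookup B v) → on B γ v ≡ off (B △ k △ v) γ v
      helper e rewrite e with lookup B v
      ... | true = ≡.refl
      ... | false = ≡.refl
    ...   | no v≢l = trans (swap-other _ _ v≢k v≢l) (reflexive (≡.cong (if_then 0# else γ v) (≡.sym (△△-other B v≢k v≢l))))

    toggled′ : ∀ B γ v → swap k l (λ u → - on B γ u) (off B γ) v ≈ - on (B △ k △ l) γ v
    toggled′ B γ v with v Finₚ.≟ k
    ... | yes ≡.refl = trans (swap-k _ _ k≢l) (-‿cong (reflexive (helper (△△-∈ B k≢l))))
      where
      helper : lookup (B △ v △ l) v ≡ not (lookup B v) → off B γ v ≡ on (B △ v △ l) γ v
      helper e rewrite e with lookup B v
      ... | true = ≡.refl
      ... | false = ≡.refl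
    ... | no v≢k with v Finₚ.≟ l
    ...   | yes ≡.refl = trans (swap-l _ _ k≢l) (-‿cong (reflexive (helper (△△-∈′ B k≢l))))
      where
      helper : lookup (B △ k △ v) v ≡ not (lookup B v) → off B γ v ≡ on (B △ k △ v) γ v
      helper e rewrite e with lookup B v
      ... | true = ≡.refl
      ... | false = ≡.refl
    ...   | no v≢l = trans (swap-other _ _ v≢k v≢l) (-‿cong (reflexive (≡.cong (if_then γ v else 0#) (≡.sym (△△-other B v≢k v≢l)))))

    kernel-pivot : ∀ {B γ} → InKernel B S γ → InKernel (B △ k △ l) S′ γ
    kernel-pivot {B} {γ} ker = in-kernel λ u → trans (sum-cong λ v → *-congˡ (sym (toggled B γ v)))
      (trans (pivot-graph (ker .at) u) (toggled′ B γ u))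

  kernel-unpivot : ∀ {S} (alt : Alternating S) {k l} (k≢l : k ≢ l) {a} (a≈ : a ≈ S k l) (a² : a * a ≈ 1#) →
                   ∀ {B γ} → InKernel (B △ k △ l) (pivot a k l S) γ → InKernel B S γ
  kernel-unpivot alt k≢l {a} a≈ a² {B} {γ} ker = ≡.subst (λ X → InKernel X _ γ) (△△-involutive B _ _)
    (InKernel-cong (Pivot.involutive alt k≢l a≈ a²)
      (kernel-pivot (Pivot.alternating alt k≢l a≈ a²) k≢l (sym (Pivot.pivot-kl alt k≢l a≈ a²))
        (trans (solve 1 (λ a → :- a :* :- a := a :* a) refl a) a²) ker))

-- `square` singles out F₂ and F₃ and makes each nonzero entry its own inverse, which is what a
-- pivot asks for. `search` replaces excluded middle: it turns the failure of linear independence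
-- into an actual dependency.
record SmallField : Set₁ where
  field
    ring : CommutativeRing 0ℓ 0ℓ
  open CommutativeRing ring public renaming (Carrier to K) hiding (zero; ring)
  field
    _≟_ : ∀ x y → Dec (x ≈ y)
    1≉0 : ¬ 1# ≈ 0#
    square : ∀ {x} → ¬ x ≈ 0# → x * x ≈ 1#
    search : ∀ {P : K → Set} → (∀ x → Dec (P x)) → Dec (∃ P)

module Represented (F : SmallField) {n : ℕ} (M : Matroid n) (rep : Representable (SmallField.ring F) M) where
  open SmallField F
  open MatroidFacts M
  open LinearAlgebra ring n
  open Kernel ring n
  open IntegerSolver ring
  open RingProperties (CommutativeRing.ring ring) using (-0#≈0#; -‿involutive; -‿distribˡ-*; -‿distribʳ-*)
  open SetoidReasoning setoid

  r : ℕ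
  r = proj₁ rep

  A : Fin r → Fin n → K
  A = proj₁ (proj₂ rep)

  Killed : (Fin n → K) → Set
  Killed γ = ∀ k → sum (λ i → γ i * A k i) ≈ 0#

  Killed-comb : ∀ (c : Fin n → K) (Γ : Fin n → Fin n → K) → (∀ v → ¬ c v ≈ 0# → Killed (Γ v)) →
                Killed (λ i → sum λ v → c v * Γ v i)
  Killed-comb c Γ killed k = begin
    sum (λ i → sum (λ v → c v * Γ v i) * A k i)
      ≈⟨ sum-cong (λ i → sym (sum-*ʳ (λ v → c v * Γ v i) (A k i))) ⟩
    sum (λ i → sum λ v → c v * Γ v i * A k i)
      ≈⟨ sum-comm (λ i v → c v * Γ v i * A k i) ⟩
    sum (λ v → sum λ i → c v * Γ v i * A k i)
      ≈⟨ sum-0 (λ v → trans (sum-cong λ i → *-assoc (c v) (Γ v i) (A k i)) (trans (sum-*ˡ (c v) (λ i → Γ v i * A k i)) (each v))) ⟩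
    0# ∎
    where
    each : ∀ v → c v * sum (λ i → Γ v i * A k i) ≈ 0#
    each v with c v ≟ 0#
    ... | yes c≈0 = trans (*-congʳ c≈0) (zeroˡ _)
    ... | no c≉0 = trans (*-congˡ (killed v c≉0 k)) (zeroʳ _)

  basis-independent : ∀ {B} → Basis B → ∀ γ → (∀ i → lookup B i ≡ false → γ i ≈ 0#) → Killed γ → ∀ i → γ i ≈ 0#
  basis-independent {B} bB γ supp killed =
    proj₁ (proj₂ (proj₂ rep) B) (B , bB , id) γ (λ i i∉B → supp i (∉⇒false i∉B)) killed

  searchVec : ∀ m {P : Vec K m → Set} → (∀ x → Dec (P x)) → Dec (∃ P)
  searchVec zero P? = Decidable.map′ (λ p → [] , p) (λ { ([] , p) → p }) (P? [])
  searchVec (suc m) P? = Decidable.map′ (λ { (a , x , p) → a ∷ x , p }) (λ { (a ∷ x , p) → a , x , p })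
    (search λ a → searchVec m λ x → P? (a ∷ x))

  dependency : ∀ X → ¬ Independent M X →
               ∃ λ γ → (∀ i → lookup X i ≡ false → γ i ≈ 0#) × Killed γ × ∃ λ i → ¬ γ i ≈ 0#
  dependency X dep with searchVec n dependency?
    where
    Dependency : Vec K n → Set
    Dependency x = (∀ i → lookup X i ≡ false → lookup x i ≈ 0#) × Killed (lookup x) × ∃ λ i → ¬ lookup x i ≈ 0#
    dependency? : ∀ x → Dec (Dependency x)
    dependency? x = Finₚ.all? (λ i → (lookup X i Boolₚ.≟ false) →-dec (lookup x i ≟ 0#)) ×-dec
      Finₚ.all? (λ k → sum (λ i → lookup x i * A k i) ≟ 0#) ×-dec Finₚ.any? λ i → ¬? (lookup x i ≟ 0#)
  ... | yes (x , p) = lookup x , p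
  ... | no none = ⊥-elim (dep (proj₂ (proj₂ (proj₂ rep) X) λ γ supp killed i →
        decidable-stable (γ i ≟ 0#) λ γi≉0 → none (tabulate γ ,
          (λ i i∉X → trans (tab γ i) (supp i (false⇒∉ i∉X))) ,
          (λ k → trans (sum-cong λ i → *-congʳ (tab γ i)) (killed k)) ,
          i , λ e → γi≉0 (trans (sym (tab γ i)) e))))
    where
    tab : ∀ (γ : Fin n → K) i → lookup (tabulate γ) i ≈ γ i
    tab γ i = reflexive (Vecₚ.lookup∘tabulate γ i)

  -- The set B + v lies in no basis, so it carries a dependency. This is nonzero at v because B is
  -- independent, and multiplying it by its own value at v makes that value 1.
  fundamental : ∀ {B} → Basis B → ∀ v → lookup B v ≡ false →
                ∃ λ γ → (∀ i → lookup B i ≡ false → i ≢ v → γ i ≈ 0#) × Killed γ × γ v ≈ 1#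
  fundamental {B} bB v v∉B with dependency (B △ v) not-independent
    where
    not-independent : ¬ Independent M (B △ v)
    not-independent (C , bC , sub) = true≢false (≡.trans (≡.sym v∈C)
      (≡.trans (≡.cong (λ X → lookup X v) (basis-antichain bC bB B⊆C)) v∉B))
      where
      v∈C : lookup C v ≡ true
      v∈C = ∈⇒true (sub (true⇒∈ (≡.trans (△-same B v) (≡.cong not v∉B))))
      B⊆C : ∀ w → lookup B w ≡ true → lookup C w ≡ true
      B⊆C w w∈B = ∈⇒true (sub (true⇒∈ (≡.trans (△-other B (differ {X = B} w∈B v∉B)) w∈B)))
  ... | γ , supp , killed , j , γj≉0 = (λ i → γ v * γ i) ,
        (λ i i∉B i≢v → trans (*-congˡ (supp i (≡.trans (△-other B i≢v) i∉B))) (zeroʳ _)) ,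
        (λ k → trans (sum-cong λ i → *-assoc (γ v) (γ i) (A k i)) (trans (sum-*ˡ (γ v) (λ i → γ i * A k i)) (trans (*-congˡ (killed k)) (zeroʳ _)))) ,
        square γv≉0
    where
    γv≉0 : ¬ γ v ≈ 0#
    γv≉0 γv≈0 = γj≉0 (basis-independent bB γ supp′ killed j)
      where
      supp′ : ∀ i → lookup B i ≡ false → γ i ≈ 0#
      supp′ i i∉B with i Finₚ.≟ v
      ... | yes ≡.refl = γv≈0
      ... | no i≢v = supp i (≡.trans (△-other B i≢v) i∉B)

  -- The link between S and the given matrix `A` is equality of kernels, which pivots preserve,
  -- instead of a row equivalence of matrices.
  record State (B : Subset n) (S : Matrix) : Set where
    field
      basis : Basis B
      alt : Alternating S
      bipartite : ∀ u v → lookup B u ≡ lookup B v → S u v ≈ 0#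
      killed⇒kernel : ∀ γ → Killed γ → InKernel B S γ
      kernel⇒killed : ∀ γ → InKernel B S γ → Killed γ

  module Standard {B : Subset n} (bB : Basis B) where

    column : ∀ v b → lookup B v ≡ b → Fin n → K
    column v true _ = λ _ → 0#
    column v false v∉B = proj₁ (fundamental bB v v∉B)

    Γ : Fin n → Fin n → K
    Γ v = column v (lookup B v) ≡.refl

    Γ-other : ∀ v i → lookup B i ≡ false → i ≢ v → Γ v i ≈ 0#
    Γ-other v i i∉B i≢v = helper (lookup B v) ≡.refl
      where
      helper : ∀ b e → column v b e i ≈ 0#
      helper true _ = refl
      helper false v∉B = proj₁ (proj₂ (fundamental bB v v∉B)) i i∉B i≢v

    Γ-∉ : ∀ v → lookup B v ≡ false → Killed (Γ v) × Γ v v ≈ 1#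
    Γ-∉ v v∉B = helper (lookup B v) ≡.refl v∉B
      where
      helper : ∀ b e → b ≡ false → Killed (column v b e) × column v b e v ≈ 1#
      helper false e _ = proj₂ (proj₂ (fundamental bB v e))

    -- For u in B and v outside, `S u v` is - Γ_v(u), the sign that puts Γ_v into the kernel; the
    -- other block is the negative transpose.
    entry : Bool → Bool → K → K → K
    entry true true x y = 0#
    entry true false x y = - y
    entry false true x y = x
    entry false false x y = 0#

    S : Matrix
    S u v = entry (lookup B u) (lookup B v) (Γ u v) (Γ v u)

    alternating : Alternating S
    alternating = (λ u → same (lookup B u)) , λ u v → skew (lookup B u) (lookup B v)
      where
      same : ∀ b {x y} → entry b b x y ≈ 0#
      same true = refl
      same false = refl
      skew : ∀ b c {x y} → entry b c x y ≈ - entry c b y x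
      skew true true = sym -0#≈0#
      skew true false = refl
      skew false true = sym (-‿involutive _)
      skew false false = sym -0#≈0#

    S-row : ∀ γ u → lookup B u ≡ true → (S · off B γ) u ≈ - sum (λ v → off B γ v * Γ v u)
    S-row γ u u∈B = trans (sum-cong λ v → each (lookup B u) (lookup B v) {g = γ v} u∈B) (sum-neg _)
      where
      each : ∀ b c {x y g} → b ≡ true → entry b c x y * (if c then 0# else g) ≈ - ((if c then 0# else g) * y)
      each true true _ = solve 1 (λ x → con (0 , 0) :* con (0 , 0) := :- (con (0 , 0) :* x)) refl _
      each true false _ = solve 2 (λ x y → (:- x) :* y := :- (y :* x)) refl _ _

    -- Every killed γ is the combination Σ γ_v Γ_v over v ∉ B, both sides being killed and equal off B.
    comb : (Fin n → K) → Fin n → K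
    comb γ i = sum λ v → off B γ v * Γ v i

    comb-killed : ∀ γ → Killed (comb γ)
    comb-killed γ = Killed-comb (off B γ) Γ λ v nz → proj₁ (Γ-∉ v (not-basis v nz))
      where
      not-basis : ∀ v → ¬ off B γ v ≈ 0# → lookup B v ≡ false
      not-basis v nz with lookup B v
      ... | true = ⊥-elim (nz refl)
      ... | false = ≡.refl

    comb-off : ∀ γ i → lookup B i ≡ false → comb γ i ≈ γ i
    comb-off γ i i∉B = trans (sum-only i λ v v≢i → trans (*-congˡ (Γ-other v i i∉B (v≢i ∘ ≡.sym))) (zeroʳ _))
      (trans (*-cong (reflexive (off-∉ {B} {γ} {i} i∉B)) (proj₂ (Γ-∉ i i∉B))) (*-identityʳ _))

    state : State B S
    state = record
      { basis = bB ; alt = alternating ; bipartite = bip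
      ; killed⇒kernel = to ; kernel⇒killed = from }
      where
      bip : ∀ u v → lookup B u ≡ lookup B v → S u v ≈ 0#
      bip u v e = helper (lookup B u) (lookup B v) e
        where
        helper : ∀ b c {x y} → b ≡ c → entry b c x y ≈ 0#
        helper true true _ = refl
        helper false false _ = refl
      to : ∀ γ → Killed γ → InKernel B S γ
      to γ killed = in-kernel to-at
       where
       to-at : ∀ u → (S · off B γ) u ≈ - on B γ u
       to-at u with lookup B u Boolₚ.≟ true
       ... | no p = trans (sum-0 λ v → each (lookup B u) (lookup B v) {g = γ v} (¬true⇒false p))
               (sym (trans (-‿cong (reflexive (on-∉ {B} {γ} {u} (¬true⇒false p)))) -0#≈0#))
         where
         each : ∀ b c {x y g} → b ≡ false → entry b c x y * (if c then 0# else g) ≈ 0#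
         each false true _ = zeroʳ _
         each false false _ = zeroˡ _
       ... | yes p = trans (S-row γ u p) (-‿cong (trans (sym equal) (reflexive (≡.sym (on-∈ {B} {γ} {u} p)))))
         where
         equal : γ u ≈ comb γ u
         equal = trans (sym (trans (+-congˡ (sym (basis-independent bB (λ i → γ i - comb γ i)
             (λ i i∉B → trans (+-congˡ (-‿cong (comb-off γ i i∉B))) (-‿inverseʳ _))
             (λ k → trans (sum-cong λ i → trans (distribʳ (A k i) (γ i) (- comb γ i)) (+-congˡ (sym (-‿distribˡ-* (comb γ i) (A k i)))))
                (trans (sum-+ (λ i → γ i * A k i) (λ i → - (comb γ i * A k i)))
                  (trans (+-cong (killed k) (trans (sum-neg (λ i → comb γ i * A k i)) (-‿cong (comb-killed γ k))))
                    (trans (+-congˡ -0#≈0#) (+-identityˡ 0#))))) u)))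
             (solve 2 (λ x y → y :+ (x :- y) := x) refl (γ u) (comb γ u)))) (+-identityʳ _)
      from : ∀ γ → InKernel B S γ → Killed γ
      from γ ker k = trans (sum-cong λ i → *-congʳ (equal i)) (comb-killed γ k)
        where
        equal : ∀ i → γ i ≈ comb γ i
        equal i with lookup B i in p
        ... | false = sym (comb-off γ i p)
        ... | true = trans (sym (-‿involutive _)) (trans (-‿cong (trans (-‿cong (reflexive (≡.sym (on-∈ {B} {γ} {i} p)))) (trans (sym (ker .at i)) (S-row γ i p)))) (-‿involutive _))

  module _ {B : Subset n} {S : Matrix} (st : State B S) where
    open State st

    private
      -- A killed vector γ supported on B - u + v satisfies S u v * γ v = 0 by row u, so it vanishes
      -- at v and then everywhere. Independence only places B - u + v inside some basis;
      -- `basis-above` identifies the two.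
      nonzero⇒basis-∈ : ∀ {u v} → lookup B u ≡ true → lookup B v ≡ false → ¬ S u v ≈ 0# → Basis (B △ u △ v)
      nonzero⇒basis-∈ {u} {v} u∈B v∉B nz with proj₂ (proj₂ (proj₂ rep) (B △ u △ v)) independent
        where
        u≢v : u ≢ v
        u≢v = differ {X = B} u∈B v∉B
        independent : LinIndep ring A (B △ u △ v)
        independent γ supp killed = all-zero
          where
          ker : InKernel B S γ
          ker = killed⇒kernel γ killed
          outside : ∀ i → lookup B i ≡ false → i ≢ v → γ i ≈ 0#
          outside i i∉B i≢v = supp i (false⇒∉ (≡.trans (△△-other B (differ {X = B} u∈B i∉B ∘ ≡.sym) i≢v) i∉B))
          γu≈0 : γ u ≈ 0#
          γu≈0 = supp u (false⇒∉ (≡.trans (△△-∈ B u≢v) (≡.cong not u∈B)))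
          only-v : ∀ w i → i ≢ v → S w i * off B γ i ≈ 0#
          only-v w i i≢v with lookup B i in p
          ... | true = zeroʳ _
          ... | false = trans (*-congˡ (outside i p i≢v)) (zeroʳ _)
          row : ∀ w → S w v * γ v ≈ - on B γ w
          row w = trans (*-congˡ (reflexive (≡.sym (off-∉ {B} {γ} {v} v∉B)))) (trans (sym (sum-only v (only-v w))) (ker .at w))
          γv≈0 : γ v ≈ 0#
          γv≈0 = begin
            γ v                     ≈⟨ trans (sym (*-identityˡ _)) (*-congʳ (sym (square nz))) ⟩
            S u v * S u v * γ v     ≈⟨ *-assoc _ _ _ ⟩
            S u v * (S u v * γ v)   ≈⟨ *-congˡ (trans (row u) (trans (-‿cong (trans (reflexive (on-∈ {B} {γ} {u} u∈B)) γu≈0)) -0#≈0#)) ⟩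
            S u v * 0#              ≈⟨ zeroʳ _ ⟩
            0#                      ∎
          all-zero : ∀ i → γ i ≈ 0#
          all-zero i with i Finₚ.≟ v
          ... | yes ≡.refl = γv≈0
          ... | no i≢v with lookup B i in p
          ...   | false = outside i p i≢v
          ...   | true = trans (sym (-‿involutive _)) (trans (-‿cong (trans (-‿cong (reflexive (≡.sym (on-∈ {B} {γ} {i} p))))
                           (trans (sym (row i)) (trans (*-congˡ γv≈0) (zeroʳ _))))) -0#≈0#)
      ... | C , bC , sub = basis-above basis bC u∈B v∉B λ w w∈ → ∈⇒true (sub (true⇒∈ w∈))

      -- If the entry were 0, column v of S would give a dependency supported on B - u + v with
      -- value 1 at v.
      basis⇒nonzero-∈ : ∀ {u v} → lookup B u ≡ true → lookup B v ≡ false → Basis (B △ u △ v) → ¬ S u v ≈ 0#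
      basis⇒nonzero-∈ {u} {v} u∈B v∉B b Suv≈0 =
        1≉0 (trans (sym γv≈1) (basis-independent b γ supp (kernel⇒killed γ (in-kernel ker)) v))
        where
        u≢v : u ≢ v
        u≢v = differ {X = B} u∈B v∉B
        γ : Fin n → K
        γ i = δ v i - S i v
        γv≈1 : γ v ≈ 1#
        γv≈1 = trans (+-cong (reflexive (δ-refl v)) (-‿cong (proj₁ alt v))) (trans (+-congˡ -0#≈0#) (+-identityʳ _))
        γ-other : ∀ {i} → i ≢ v → γ i ≈ - S i v
        γ-other i≢v = trans (+-congʳ (reflexive (δ-≢ (i≢v ∘ ≡.sym)))) (+-identityˡ _)
        γ-∉ : ∀ i → lookup B i ≡ false → i ≢ v → γ i ≈ 0#
        γ-∉ i i∉B i≢v = trans (γ-other i≢v) (trans (-‿cong (bipartite i v (≡.trans i∉B (≡.sym v∉B)))) -0#≈0#)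
        only-v : ∀ w i → i ≢ v → S w i * off B γ i ≈ 0#
        only-v w i i≢v with lookup B i in p
        ... | true = zeroʳ _
        ... | false = trans (*-congˡ (γ-∉ i p i≢v)) (zeroʳ _)
        ker : ∀ w → (S · off B γ) w ≈ - on B γ w
        ker w = trans (sum-only v (only-v w)) (trans (*-congˡ (trans (reflexive (off-∉ {B} {γ} {v} v∉B)) γv≈1)) (trans (*-identityʳ _) (column w)))
          where
          column : ∀ w → S w v ≈ - on B γ w
          column w with lookup B w in p
          ... | true = trans (sym (-‿involutive _)) (-‿cong (sym (γ-other (differ {X = B} p v∉B))))
          ... | false = trans (bipartite w v (≡.trans p (≡.sym v∉B))) (sym -0#≈0#)
        supp : ∀ i → lookup (B △ u △ v) i ≡ false → γ i ≈ 0#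
        supp i i∉ with i Finₚ.≟ u
        ... | yes ≡.refl = trans (γ-other u≢v) (trans (-‿cong Suv≈0) -0#≈0#)
        ... | no i≢u with i Finₚ.≟ v
        ...   | yes ≡.refl = ⊥-elim (true≢false (≡.trans (≡.sym (≡.trans (△△-∈′ B u≢v) (≡.cong not v∉B))) i∉))
        ...   | no i≢v = γ-∉ i (≡.trans (≡.sym (△△-other B i≢u i≢v)) i∉) i≢v

    nonzero⇒basis : ∀ {u v} → ¬ S u v ≈ 0# → Basis (B △ u △ v)
    nonzero⇒basis {u} {v} nz with lookup B u in p | lookup B v in q
    ... | true | false = nonzero⇒basis-∈ p q nz
    ... | false | true = ≡.trans (≡.cong β (△-comm B u v)) (nonzero⇒basis-∈ q p λ e → nz (trans (proj₂ alt u v) (trans (-‿cong e) -0#≈0#)))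
    ... | true | true = ⊥-elim (nz (bipartite u v (≡.trans p (≡.sym q))))
    ... | false | false = ⊥-elim (nz (bipartite u v (≡.trans p (≡.sym q))))

    basis⇒nonzero : ∀ {u v} → Adj B u v → ¬ S u v ≈ 0#
    basis⇒nonzero {u} {v} uv e with lookup B u in p
    ... | true = basis⇒nonzero-∈ p (≡.trans (Adj⇒differ basis uv) (≡.cong not p)) (proj₂ uv) e
    ... | false = basis⇒nonzero-∈ (≡.trans (Adj⇒differ basis uv) (≡.cong not p)) p
          (≡.trans (≡.cong β (△-comm B v u)) (proj₂ uv)) (trans (proj₂ alt v u) (trans (-‿cong e) -0#≈0#))

    -- Kernels are transported by `kernel-pivot`; the work is in showing that S′ joins only opposite
    -- sides. Away from k and l a nonzero product in the correction needs u opposite to one of k, l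
    -- and v opposite to the other, which is impossible when u and v are on one side, as k and l are
    -- not.
    pivot-state : ∀ {k l} → k ≢ l → ¬ S k l ≈ 0# → State (B △ k △ l) (pivot (S k l) k l S)
    pivot-state {k} {l} k≢l nz = record
      { basis = nonzero⇒basis nz
      ; alt = alternating
      ; bipartite = bip
      ; killed⇒kernel = λ γ killed → kernel-pivot alt k≢l refl a² (killed⇒kernel γ killed)
      ; kernel⇒killed = λ γ ker → kernel⇒killed γ (kernel-unpivot alt k≢l refl a² ker)
      }
      where
      a² : S k l * S k l ≈ 1#
      a² = square nz
      open Pivot alt k≢l refl a²
      kl : lookup B l ≡ not (lookup B k)
      kl = Boolₚ.¬-not λ e → nz (bipartite k l (≡.sym e))
      B′k : lookup (B △ k △ l) k ≡ lookup B l
      B′k = ≡.trans (△△-∈ B k≢l) (≡.sym kl)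
      B′l : lookup (B △ k △ l) l ≡ lookup B k
      B′l = ≡.trans (△△-∈′ B k≢l) (≡.trans (≡.cong not kl) (Boolₚ.not-involutive _))
      zero-k : ∀ {v} → v ≢ k → v ≢ l → lookup (B △ k △ l) k ≡ lookup (B △ k △ l) v → S′ k v ≈ 0#
      zero-k {v} v≢k v≢l e = trans (pivot-kv v≢k v≢l) (trans (-‿cong (trans (*-congˡ (bipartite l v
        (≡.trans (≡.sym B′k) (≡.trans e (△△-other B v≢k v≢l))))) (zeroʳ _))) -0#≈0#)
      zero-l : ∀ {v} → v ≢ k → v ≢ l → lookup (B △ k △ l) l ≡ lookup (B △ k △ l) v → S′ l v ≈ 0#
      zero-l {v} v≢k v≢l e = trans (pivot-lv v≢k v≢l) (trans (*-congˡ (bipartite k v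
        (≡.trans (≡.sym B′l) (≡.trans e (△△-other B v≢k v≢l))))) (zeroʳ _))
      transpose : ∀ {u v} → S′ v u ≈ 0# → S′ u v ≈ 0#
      transpose {u} {v} e = trans (proj₂ alternating u v) (trans (-‿cong e) -0#≈0#)
      kl-differ : lookup (B △ k △ l) k ≢ lookup (B △ k △ l) l
      kl-differ e = Boolₚ.not-¬ (≡.trans (≡.sym B′k) (≡.trans e B′l)) kl
      bip : ∀ u v → lookup (B △ k △ l) u ≡ lookup (B △ k △ l) v → S′ u v ≈ 0#
      bip u v e with u Finₚ.≟ v
      ... | yes ≡.refl = proj₁ alternating u
      ... | no u≢v with u Finₚ.≟ k | v Finₚ.≟ k | u Finₚ.≟ l | v Finₚ.≟ l
      ...   | yes ≡.refl | yes ≡.refl | _ | _ = ⊥-elim (u≢v ≡.refl)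
      ...   | _ | _ | yes ≡.refl | yes ≡.refl = ⊥-elim (u≢v ≡.refl)
      ...   | yes ≡.refl | _ | _ | yes ≡.refl = ⊥-elim (kl-differ e)
      ...   | _ | yes ≡.refl | yes ≡.refl | _ = ⊥-elim (kl-differ (≡.sym e))
      ...   | yes ≡.refl | no v≢k | _ | no v≢l = zero-k v≢k v≢l e
      ...   | no u≢k | yes ≡.refl | no u≢l | _ = transpose (zero-k u≢k u≢l (≡.sym e))
      ...   | _ | no v≢k | yes ≡.refl | no v≢l = zero-l v≢k v≢l e
      ...   | no u≢k | _ | no u≢l | yes ≡.refl = transpose (zero-l u≢k u≢l (≡.sym e))
      ...   | no u≢k | no v≢k | no u≢l | no v≢l = trans (pivot-other u≢k u≢l v≢k v≢l)
              (trans (+-cong (bipartite u v same) (*-congˡ (+-cong (product l k lk) (-‿cong (product k l kl)))))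
                (solve 1 (λ a → con (0 , 0) :+ a :* (con (0 , 0) :- con (0 , 0)) := con (0 , 0)) refl _))
        where
        same : lookup B u ≡ lookup B v
        same = ≡.trans (≡.sym (△△-other B u≢k u≢l)) (≡.trans e (△△-other B v≢k v≢l))
        lk : lookup B k ≡ not (lookup B l)
        lk = ≡.sym (≡.trans (≡.cong not kl) (Boolₚ.not-involutive (lookup B k)))
        product : ∀ x y → lookup B y ≡ not (lookup B x) → S u x * S v y ≈ 0#
        product x y yx with lookup B u Boolₚ.≟ lookup B x
        ... | yes ux = trans (*-congʳ (bipartite u x ux)) (zeroˡ _)
        ... | no ux = trans (*-congˡ (bipartite v y (≡.trans (≡.sym same) (≡.trans (Boolₚ.¬-not ux) (≡.sym yx))))) (zeroʳ _)

-- The fields with two and three elements and the exchange graph of a binary matroid.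

F₂ : SmallField
F₂ = record
  { ring = xor-∧-commutativeRing
  ; _≟_ = Bool._≟_
  ; 1≉0 = λ ()
  ; square = λ { {true} _ → ≡.refl ; {false} q → ⊥-elim (q ≡.refl) }
  ; search = λ P? → helper (P? true) (P? false)
  }
  where
  helper : ∀ {P : Bool → Set} → Dec (P true) → Dec (P false) → Dec (∃ P)
  helper (yes p) _ = yes (true , p)
  helper (no _) (yes q) = yes (false , q)
  helper (no ¬p) (no ¬q) = no λ { (true , p) → ¬p p ; (false , q) → ¬q q }

pattern 0₃ = zero
pattern 1₃ = suc zero
pattern 2₃ = suc (suc zero)

infixl 6 _+₃_
infixl 7 _*₃_
infix 8 -₃_

_+₃_ _*₃_ : Fin 3 → Fin 3 → Fin 3
0₃ +₃ y = y
x +₃ 0₃ = x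
1₃ +₃ 1₃ = 2₃
1₃ +₃ 2₃ = 0₃
2₃ +₃ 1₃ = 0₃
2₃ +₃ 2₃ = 1₃
0₃ *₃ y = 0₃
1₃ *₃ y = y
2₃ *₃ 0₃ = 0₃
2₃ *₃ 1₃ = 2₃
2₃ *₃ 2₃ = 1₃

-₃_ : Fin 3 → Fin 3
-₃ 0₃ = 0₃
-₃ 1₃ = 2₃
-₃ 2₃ = 1₃

F₃-ring : CommutativeRing 0ℓ 0ℓ
F₃-ring = record
  { Carrier = Fin 3
  ; _≈_ = _≡_
  ; _+_ = _+₃_
  ; _*_ = _*₃_
  ; -_ = -₃_
  ; 0# = 0₃
  ; 1# = 1₃
  ; isCommutativeRing = record
    { isRing = record
      { +-isAbelianGroup = record
        { isGroup = record
          { isMonoid = record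
            { isSemigroup = record
              { isMagma = record { isEquivalence = ≡.isEquivalence ; ∙-cong = ≡.cong₂ _+₃_ }
              ; assoc = from-yes (Finₚ.all? λ x → Finₚ.all? λ y → Finₚ.all? λ z → (x +₃ y) +₃ z Finₚ.≟ x +₃ (y +₃ z))
              }
            ; identity = (λ _ → ≡.refl) , from-yes (Finₚ.all? λ x → x +₃ 0₃ Finₚ.≟ x)
            }
          ; inverse = from-yes (Finₚ.all? λ x → -₃ x +₃ x Finₚ.≟ 0₃) , from-yes (Finₚ.all? λ x → x +₃ -₃ x Finₚ.≟ 0₃)
          ; ⁻¹-cong = ≡.cong -₃_
          }
        ; comm = from-yes (Finₚ.all? λ x → Finₚ.all? λ y → x +₃ y Finₚ.≟ y +₃ x)
        }
      ; *-cong = ≡.cong₂ _*₃_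
      ; *-assoc = from-yes (Finₚ.all? λ x → Finₚ.all? λ y → Finₚ.all? λ z → (x *₃ y) *₃ z Finₚ.≟ x *₃ (y *₃ z))
      ; *-identity = (λ _ → ≡.refl) , from-yes (Finₚ.all? λ x → x *₃ 1₃ Finₚ.≟ x)
      ; distrib = from-yes (Finₚ.all? λ x → Finₚ.all? λ y → Finₚ.all? λ z → x *₃ (y +₃ z) Finₚ.≟ x *₃ y +₃ x *₃ z)
                , from-yes (Finₚ.all? λ x → Finₚ.all? λ y → Finₚ.all? λ z → (y +₃ z) *₃ x Finₚ.≟ y *₃ x +₃ z *₃ x)
      }
    ; *-comm = from-yes (Finₚ.all? λ x → Finₚ.all? λ y → x *₃ y Finₚ.≟ y *₃ x)
    }
  }

square₃ : ∀ {x} → x ≢ 0₃ → x *₃ x ≡ 1₃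
square₃ {0₃} q = ⊥-elim (q ≡.refl)
square₃ {1₃} _ = ≡.refl
square₃ {2₃} _ = ≡.refl

F₃ : SmallField
F₃ = record
  { ring = F₃-ring
  ; _≟_ = Finₚ._≟_
  ; 1≉0 = λ ()
  ; square = square₃
  ; search = Finₚ.any?
  }

F₃-field : Field 0ℓ 0ℓ
F₃-field = record { commutativeRing = F₃-ring ; 1≉0 = λ () ; inverse = λ x x≉0 → x , square₃ x≉0 }

module _ {n : ℕ} (M : Matroid n) where
  open MatroidFacts M

  opaque
    adj : Subset n → Fin n → Fin n → Bool
    adj B u v = not (does (u Finₚ.≟ v)) ∧ β (B △ u △ v)

    Adj⇒adj : ∀ {B u v} → Adj B u v → adj B u v ≡ true
    Adj⇒adj {B} {u} {v} (u≢v , b) with u Finₚ.≟ v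
    ... | yes u≡v = ⊥-elim (u≢v u≡v)
    ... | no _ = b

    adj⇒Adj : ∀ {B u v} → adj B u v ≡ true → Adj B u v
    adj⇒Adj {B} {u} {v} e with u Finₚ.≟ v
    ... | no u≢v = u≢v , e

  -- The support of a binary representation is forced, so it transforms under pivots.
  BinaryPivots : Set
  BinaryPivots = ∀ {B} → Basis B → ∀ {k l u v} → Adj B k l → u ≢ k → u ≢ l → v ≢ k → v ≢ l →
                 adj (B △ k △ l) u v ≡ adj B u v xor ((adj B u l ∧ adj B v k) xor (adj B u k ∧ adj B v l))

  binary-pivots : Binary M → BinaryPivots
  binary-pivots rep {B} bB {k} {l} {u} {v} kl u≢k u≢l v≢k v≢l = ≡.trans (≡.sym (support st′ u v))
    (≡.trans (pivot-other u≢k u≢l v≢k v≢l) (≡.cong₂ _xor_ (support st u v)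
      (≡.trans (≡.cong (λ a → a ∧ ((S u l ∧ S v k) xor (S u k ∧ S v l))) Skl)
        (≡.cong₂ _xor_ (≡.cong₂ _∧_ (support st u l) (support st v k)) (≡.cong₂ _∧_ (support st u k) (support st v l))))))
    where
    open Represented F₂ M rep
    open LinearAlgebra xor-∧-commutativeRing n
    S : Matrix
    S = Standard.S bB
    st : State B S
    st = Standard.state bB
    support : ∀ {B S} → State B S → ∀ u v → S u v ≡ adj B u v
    support {B} {S} st u v = bool-ext
      (λ e → Adj⇒adj ((λ { ≡.refl → true≢false (≡.trans (≡.sym e) (proj₁ (State.alt st) u)) }) ,
        nonzero⇒basis st λ z → true≢false (≡.trans (≡.sym e) z)))
      λ e → Boolₚ.¬-not {S u v} {false} (basis⇒nonzero st (adj⇒Adj e))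
    Skl : S k l ≡ true
    Skl = ≡.trans (support st k l) (Adj⇒adj kl)
    nz : S k l ≢ false
    nz z = true≢false (≡.trans (≡.sym Skl) z)
    st′ : State (B △ k △ l) (pivot (S k l) k l S)
    st′ = pivot-state st (proj₁ kl) nz
    open Pivot (State.alt st) (proj₁ kl) ≡.refl (SmallField.square F₂ nz)

-- Signings over F₃ and their lift to arbitrary rings.

-- A ternary signing that follows the basis exchanges of M: the states (B , S) are closed under
-- pivots and the support of S always consists of the exchanges available at B.
record Signing {n : ℕ} (M : Matroid n) : Set₁ where
  open MatroidFacts M
  open LinearAlgebra F₃-ring n
  field
    State : Subset n → Matrix → Set
    basis : ∀ {B S} → State B S → Basis B
    alt : ∀ {B S} → State B S → Alternating S
    nonzero⇒basis : ∀ {B S u v} → State B S → S u v ≢ 0₃ → Basis (B △ u △ v)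
    basis⇒nonzero : ∀ {B S u v} → State B S → Adj B u v → S u v ≢ 0₃
    pivot-state : ∀ {B S k l} → State B S → k ≢ l → S k l ≢ 0₃ → State (B △ k △ l) (pivot (S k l) k l S)
    base : Subset n
    S₀ : Matrix
    base-state : State base S₀

representation⇒signing : ∀ {n} (M : Matroid n) → Representable F₃-ring M → Signing M
representation⇒signing M rep = record
  { State = State
  ; basis = State.basis
  ; alt = State.alt
  ; nonzero⇒basis = λ st → nonzero⇒basis st
  ; basis⇒nonzero = λ st → basis⇒nonzero st
  ; pivot-state = λ st → pivot-state st
  ; base-state = Standard.state (proj₂ (nonempty M))
  }
  where open Represented F₃ M rep

lift : ∀ {c ℓ} (R : CommutativeRing c ℓ) → Fin 3 → CommutativeRing.Carrier R
lift R 0₃ = CommutativeRing.0# R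
lift R 1₃ = CommutativeRing.1# R
lift R 2₃ = CommutativeRing.-_ R (CommutativeRing.1# R)

module Signed {n : ℕ} {M : Matroid n} (bin : BinaryPivots M) (Σ₃ : Signing M) where
  open MatroidFacts M
  open Signing Σ₃
  private
    module L₃ = LinearAlgebra F₃-ring n
  open L₃ using (Matrix; pivot; Alternating)

  module _ {B : Subset n} {S : Matrix} (st : State B S) where

    nonzero⇒≢ : ∀ {u v} → S u v ≢ 0₃ → u ≢ v
    nonzero⇒≢ nz ≡.refl = nz (proj₁ (alt st) _)

    nonzero⇒Adj : ∀ {u v} → S u v ≢ 0₃ → Adj B u v
    nonzero⇒Adj nz = nonzero⇒≢ nz , nonzero⇒basis st nz

    nonzero⇒adj : ∀ {u v} → S u v ≢ 0₃ → adj M B u v ≡ true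
    nonzero⇒adj nz = Adj⇒adj M (nonzero⇒Adj nz)

    zero⇒adj : ∀ {u v} → S u v ≡ 0₃ → adj M B u v ≡ false
    zero⇒adj z = ¬true⇒false λ e → basis⇒nonzero st (adj⇒Adj M e) z

    same-side : ∀ {u v} → lookup B u ≡ lookup B v → S u v ≡ 0₃
    same-side {u} {v} e = decidable-stable (S u v Finₚ.≟ 0₃) λ nz →
      Boolₚ.not-¬ (≡.sym e) (Adj⇒differ (basis st) (nonzero⇒Adj nz))

  -- Exchanges into X are made as long as S allows one; each removes an element of B outside X. At
  -- the end the fundamental circuit of every element of X outside B′ lies inside X. `Φ` is whatever
  -- invariant is to be carried along the pivots.
  towards : ∀ {p} (Φ : Subset n → Matrix → Set p) →
            (∀ {B S k l} → State B S → Φ B S → k ≢ l → S k l ≢ 0₃ → Φ (B △ k △ l) (pivot (S k l) k l S)) →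
            ∀ X {B S} → State B S → Φ B S → ∃ λ B′ → ∃ λ S′ → State B′ S′ × Φ B′ S′ ×
            (∀ u v → lookup B′ u ≡ true → lookup X u ≡ false → lookup X v ≡ true → lookup B′ v ≡ false → S′ u v ≡ 0₃)
  towards Φ Φ-pivot X {B} {S} st φ = go B S st φ (⊂-wellFounded (B ∩ ∁ X))
    where
    Exchange : (B : Subset n) (S : Matrix) (u v : Fin n) → Set
    Exchange B S u v = lookup B u ≡ true × lookup X u ≡ false × lookup X v ≡ true × lookup B v ≡ false × S u v ≢ 0₃
    exchange? : ∀ B S u v → Dec (Exchange B S u v)
    exchange? B S u v = (lookup B u Boolₚ.≟ true) ×-dec (lookup X u Boolₚ.≟ false) ×-dec
      (lookup X v Boolₚ.≟ true) ×-dec (lookup B v Boolₚ.≟ false) ×-dec ¬? (S u v Finₚ.≟ 0₃)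
    ∈-diff : ∀ {B u} → lookup B u ≡ true → lookup X u ≡ false → u ∈ B ∩ ∁ X
    ∈-diff u∈B u∉X = Subsetₚ.x∈p∩q⁺ (true⇒∈ u∈B , Subsetₚ.x∉p⇒x∈∁p (false⇒∉ u∉X))
    diff-∈ : ∀ {B u} → u ∈ B ∩ ∁ X → lookup B u ≡ true × lookup X u ≡ false
    diff-∈ {B} u∈ = ∈⇒true (proj₁ (Subsetₚ.x∈p∩q⁻ B (∁ X) u∈)) , ∉⇒false (Subsetₚ.x∈∁p⇒x∉p (proj₂ (Subsetₚ.x∈p∩q⁻ B (∁ X) u∈)))
    shrinks : ∀ {B S u v} → Exchange B S u v → (B △ u △ v) ∩ ∁ X ⊂ B ∩ ∁ X
    shrinks {B} {S} {u} {v} (u∈B , u∉X , v∈X , v∉B , nz) = sub , u , ∈-diff u∈B u∉X , gone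
      where
      u≢v : u ≢ v
      u≢v = differ {X = B} u∈B v∉B
      gone : u ∉ (B △ u △ v) ∩ ∁ X
      gone u∈ = true≢false (≡.trans (≡.sym (proj₁ (diff-∈ u∈))) (≡.trans (△△-∈ B u≢v) (≡.cong not u∈B)))
      sub : (B △ u △ v) ∩ ∁ X ⊆ B ∩ ∁ X
      sub {w} w∈ with diff-∈ w∈
      ... | w∈B′ , w∉X = ∈-diff (≡.trans (≡.sym (△△-other B w≢u (differ {X = X} v∈X w∉X ∘ ≡.sym))) w∈B′) w∉X
        where
        w≢u : w ≢ u
        w≢u ≡.refl = gone w∈
    go : ∀ B S → State B S → Φ B S → Acc _⊂_ (B ∩ ∁ X) → ∃ λ B′ → ∃ λ S′ → State B′ S′ × Φ B′ S′ ×
         (∀ u v → lookup B′ u ≡ true → lookup X u ≡ false → lookup X v ≡ true → lookup B′ v ≡ false → S′ u v ≡ 0₃)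
    go B S st φ (acc rec) with Finₚ.any? (λ u → Finₚ.any? (λ v → exchange? B S u v))
    ... | yes (u , v , ex@(u∈B , u∉X , v∈X , v∉B , nz)) = go (B △ u △ v) (pivot (S u v) u v S)
          (pivot-state st (differ {X = B} u∈B v∉B) nz) (Φ-pivot st φ (differ {X = B} u∈B v∉B) nz) (rec (shrinks {B} {S} ex))
    ... | no none = B , S , st , φ , λ u v u∈B u∉X v∈X v∉B →
          decidable-stable (S u v Finₚ.≟ 0₃) λ nz → none (u , v , u∈B , u∉X , v∈X , v∉B , nz)

  reached : ∀ {B S C} → State B S → Basis C →
            (∀ u v → lookup B u ≡ true → lookup C u ≡ false → lookup C v ≡ true → lookup B v ≡ false → S u v ≡ 0₃) → C ≡ B
  reached {B} {S} {C} st bC final = basis-antichain bC (basis st) sub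
    where
    sub : ∀ u → lookup B u ≡ true → lookup C u ≡ true
    sub u u∈B with lookup C u in u∉C
    ... | true = ≡.refl
    ... | false with exchange△ (basis st) bC u∈B u∉C
    ...   | v , v∈C , v∉B , b = ⊥-elim (basis⇒nonzero st (differ {X = B} u∈B v∉B , b) (final u v u∈B u∉C v∈C v∉B))

  module Lift {c ℓ} (R : CommutativeRing c ℓ) where
    open CommutativeRing R renaming (Carrier to K) hiding (zero)
    open RingProperties (CommutativeRing.ring R) using (-0#≈0#; -‿involutive; -‿distribˡ-*; -‿distribʳ-*)
    open IntegerSolver R
    private module L = LinearAlgebra R n

    ⟪_⟫ : Matrix → L.Matrix
    ⟪ S ⟫ u v = lift R (S u v)

    lift-neg : ∀ x → lift R (-₃ x) ≈ - lift R x
    lift-neg 0₃ = sym -0#≈0#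
    lift-neg 1₃ = refl
    lift-neg 2₃ = sym (-‿involutive 1#)

    lift-* : ∀ x y → lift R (x *₃ y) ≈ lift R x * lift R y
    lift-* 0₃ y = sym (zeroˡ _)
    lift-* 1₃ y = sym (*-identityˡ _)
    lift-* 2₃ 0₃ = sym (zeroʳ _)
    lift-* 2₃ 1₃ = sym (*-identityʳ _)
    lift-* 2₃ 2₃ = solve 0 (con (1 , 0) := (:- con (1 , 0)) :* (:- con (1 , 0))) refl

    lift-square : ∀ {x} → x ≢ 0₃ → lift R x * lift R x ≈ 1#
    lift-square {x} nz = trans (sym (lift-* x x)) (reflexive (≡.cong (lift R) (square₃ nz)))

    -- 1 + 1 = -1 in F₃ but not in R, so sums lift only when no such carry occurs.
    lift-+ : ∀ x y → (x ≢ 0₃ → y ≢ 0₃ → x +₃ y ≡ 0₃) → lift R (x +₃ y) ≈ lift R x + lift R y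
    lift-+ 0₃ y _ = sym (+-identityˡ _)
    lift-+ 1₃ 0₃ _ = sym (+-identityʳ _)
    lift-+ 2₃ 0₃ _ = sym (+-identityʳ _)
    lift-+ 1₃ 2₃ _ = sym (-‿inverseʳ 1#)
    lift-+ 2₃ 1₃ _ = sym (-‿inverseˡ 1#)
    lift-+ 1₃ 1₃ q with q (λ ()) (λ ())
    ... | ()
    lift-+ 2₃ 2₃ q with q (λ ()) (λ ())
    ... | ()

    lift-alternating : ∀ {S} → Alternating S → L.Alternating ⟪ S ⟫
    lift-alternating {S} alt = (λ u → reflexive (≡.cong (lift R) (proj₁ alt u))) ,
      λ u v → trans (reflexive (≡.cong (lift R) (proj₂ alt u v))) (lift-neg (S v u))

    module _ {B : Subset n} {S : Matrix} (st : State B S) {k l : Fin n} (k≢l : k ≢ l) (nz : S k l ≢ 0₃) where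
      private
        module P₃ = L₃.Pivot (alt st) k≢l ≡.refl (square₃ nz)
        module P = L.Pivot (lift-alternating (alt st)) k≢l refl (lift-square nz)

        st′ : State (B △ k △ l) P₃.S′
        st′ = pivot-state st k≢l nz

        kl : lookup B l ≡ not (lookup B k)
        kl = Adj⇒differ (basis st) (nonzero⇒Adj st {k} {l} nz)

        k-row : ∀ {v} → v ≢ k → v ≢ l → lift R (P₃.S′ k v) ≈ P.S′ k v
        k-row {v} v≢k v≢l = trans (reflexive (≡.cong (lift R) (P₃.pivot-kv v≢k v≢l)))
          (trans (lift-neg (S k l *₃ S l v)) (trans (-‿cong (lift-* (S k l) (S l v))) (sym (P.pivot-kv v≢k v≢l))))

        l-row : ∀ {v} → v ≢ k → v ≢ l → lift R (P₃.S′ l v) ≈ P.S′ l v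
        l-row {v} v≢k v≢l = trans (reflexive (≡.cong (lift R) (P₃.pivot-lv v≢k v≢l)))
          (trans (lift-* (S k l) (S k v)) (sym (P.pivot-lv v≢k v≢l)))

        kl-entry : lift R (P₃.S′ k l) ≈ P.S′ k l
        kl-entry = trans (reflexive (≡.cong (lift R) P₃.pivot-kl)) (trans (lift-neg (S k l)) (sym P.pivot-kl))

        transpose : ∀ {u v} → lift R (P₃.S′ v u) ≈ P.S′ v u → lift R (P₃.S′ u v) ≈ P.S′ u v
        transpose {u} {v} e = trans (reflexive (≡.cong (lift R) (proj₂ P₃.alternating u v)))
          (trans (lift-neg (P₃.S′ v u)) (trans (-‿cong e) (sym (proj₂ P.alternating u v))))

        other : ∀ {u v} → u ≢ k → u ≢ l → v ≢ k → v ≢ l → lift R (P₃.S′ u v) ≈ P.S′ u v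
        other {u} {v} u≢k u≢l v≢k v≢l = trans (reflexive (≡.cong (lift R) (P₃.pivot-other u≢k u≢l v≢k v≢l)))
          (trans (lift-+ (S u v) (a *₃ (p +₃ -₃ q)) carry-free)
            (trans (+-congˡ (trans (lift-* a (p +₃ -₃ q)) (*-congˡ (trans (lift-+ p (-₃ q) one-zero)
               (+-cong (lift-* (S u l) (S v k)) (trans (lift-neg q) (-‿cong (lift-* (S u k) (S v l)))))))))
            (sym (P.pivot-other u≢k u≢l v≢k v≢l))))
          where
          a p q : Fin 3
          a = S k l
          p = S u l *₃ S v k
          q = S u k *₃ S v l
          factors : ∀ x y → x *₃ y ≢ 0₃ → x ≢ 0₃ × y ≢ 0₃
          factors 0₃ y nz = ⊥-elim (nz ≡.refl)
          factors 1₃ y nz = (λ ()) , nz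
          factors 2₃ 0₃ nz = ⊥-elim (nz ≡.refl)
          factors 2₃ 1₃ nz = (λ ()) , λ ()
          factors 2₃ 2₃ nz = (λ ()) , λ ()
          -- A nonzero p puts u opposite to l, hence on the side of k, where S u k = 0.
          p⇒q≡0 : p ≢ 0₃ → q ≡ 0₃
          p⇒q≡0 p≢0 = ≡.cong (_*₃ S v l) (same-side st
            (≡.trans (≡.trans (≡.sym (Boolₚ.not-involutive _)) (≡.cong not (≡.sym (Adj⇒differ (basis st) (nonzero⇒Adj st (proj₁ (factors (S u l) (S v k) p≢0))))))) (≡.trans (≡.cong not kl) (Boolₚ.not-involutive _))))
          neg-nonzero : ∀ {x} → -₃ x ≢ 0₃ → x ≢ 0₃
          neg-nonzero nz ≡.refl = nz ≡.refl
          one-zero : p ≢ 0₃ → -₃ q ≢ 0₃ → p +₃ -₃ q ≡ 0₃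
          one-zero p≢0 -q≢0 = ⊥-elim (neg-nonzero -q≢0 (p⇒q≡0 p≢0))
          product-adj : ∀ x y x′ y′ → (S x y *₃ S x′ y′ ≢ 0₃ → adj M B x y ∧ adj M B x′ y′ ≡ true) ×
                                      (S x y *₃ S x′ y′ ≡ 0₃ → adj M B x y ∧ adj M B x′ y′ ≡ false)
          product-adj x y x′ y′ = (λ nz → ≡.cong₂ _∧_ (nonzero⇒adj st (proj₁ (factors (S x y) _ nz))) (nonzero⇒adj st (proj₂ (factors (S x y) _ nz)))) ,
            zero-case
            where
            zero-case : S x y *₃ S x′ y′ ≡ 0₃ → adj M B x y ∧ adj M B x′ y′ ≡ false
            zero-case z with S x y Finₚ.≟ 0₃ | S x′ y′ Finₚ.≟ 0₃
            ... | yes e | _ = ≡.cong (_∧ adj M B x′ y′) (zero⇒adj st e)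
            ... | no _ | yes e = ≡.trans (≡.cong (adj M B x y ∧_) (zero⇒adj st e)) (Boolₚ.∧-zeroʳ _)
            ... | no a | no b = ⊥-elim (nonzero* a b z)
              where
              nonzero* : ∀ {x y} → x ≢ 0₃ → y ≢ 0₃ → x *₃ y ≢ 0₃
              nonzero* {0₃} a b = ⊥-elim (a ≡.refl)
              nonzero* {1₃} a b = b
              nonzero* {2₃} {0₃} a b = ⊥-elim (b ≡.refl)
              nonzero* {2₃} {1₃} a b = λ ()
              nonzero* {2₃} {2₃} a b = λ ()
          minor-adj : p +₃ -₃ q ≢ 0₃ → (adj M B u l ∧ adj M B v k) xor (adj M B u k ∧ adj M B v l) ≡ true
          minor-adj nz with p Finₚ.≟ 0₃ | q Finₚ.≟ 0₃
          ... | yes p≡0 | yes q≡0 = ⊥-elim (nz (≡.cong₂ (λ p q → p +₃ -₃ q) p≡0 q≡0))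
          ... | no p≢0 | yes q≡0 = ≡.cong₂ _xor_ (proj₁ (product-adj u l v k) p≢0) (proj₂ (product-adj u k v l) q≡0)
          ... | yes p≡0 | no q≢0 = ≡.cong₂ _xor_ (proj₂ (product-adj u l v k) p≡0) (proj₁ (product-adj u k v l) q≢0)
          ... | no p≢0 | no q≢0 = ⊥-elim (q≢0 (p⇒q≡0 p≢0))
          a*nonzero : ∀ x {y} → x *₃ y ≢ 0₃ → y ≢ 0₃
          a*nonzero x nz = proj₂ (factors x _ nz)
          -- Here binary representability enters: if both summands are nonzero, the F₂ rule makes u
          -- and v non-adjacent after the pivot, so the sum is 0 in F₃ and the two signs were
          -- opposite.
          carry-free : S u v ≢ 0₃ → a *₃ (p +₃ -₃ q) ≢ 0₃ → S u v +₃ a *₃ (p +₃ -₃ q) ≡ 0₃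
          carry-free s≢0 t≢0 = ≡.trans (≡.sym (P₃.pivot-other u≢k u≢l v≢k v≢l))
            (decidable-stable (P₃.S′ u v Finₚ.≟ 0₃) λ nz′ → true≢false (≡.trans (≡.sym (nonzero⇒adj st′ nz′))
              (≡.trans (bin (basis st) (nonzero⇒Adj st nz) u≢k u≢l v≢k v≢l)
                (≡.cong₂ _xor_ (nonzero⇒adj st s≢0) (minor-adj (a*nonzero a t≢0))))))

      lift-pivot : ∀ u v → lift R (P₃.S′ u v) ≈ P.S′ u v
      lift-pivot u v with u Finₚ.≟ v
      ... | yes ≡.refl = trans (proj₁ (lift-alternating P₃.alternating) u) (sym (proj₁ P.alternating u))
      ... | no u≢v with u Finₚ.≟ k | v Finₚ.≟ k | u Finₚ.≟ l | v Finₚ.≟ l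
      ...   | yes ≡.refl | yes ≡.refl | _ | _ = ⊥-elim (u≢v ≡.refl)
      ...   | _ | _ | yes ≡.refl | yes ≡.refl = ⊥-elim (u≢v ≡.refl)
      ...   | yes ≡.refl | _ | _ | yes ≡.refl = kl-entry
      ...   | _ | yes ≡.refl | yes ≡.refl | _ = transpose kl-entry
      ...   | yes ≡.refl | no v≢k | _ | no v≢l = k-row v≢k v≢l
      ...   | no u≢k | yes ≡.refl | no u≢l | _ = transpose (k-row u≢k u≢l)
      ...   | _ | no v≢k | yes ≡.refl | no v≢l = l-row v≢k v≢l
      ...   | no u≢k | _ | no u≢l | yes ≡.refl = transpose (l-row u≢k u≢l)
      ...   | no u≢k | no v≢k | no u≢l | no v≢l = other u≢k u≢l v≢k v≢l

    open Kernel R n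

    SameKernel : Subset n → Matrix → Set _
    SameKernel B S = ∀ γ → (InKernel base ⟪ S₀ ⟫ γ → InKernel B ⟪ S ⟫ γ) × (InKernel B ⟪ S ⟫ γ → InKernel base ⟪ S₀ ⟫ γ)

    same-kernel-pivot : ∀ {B S k l} → State B S → SameKernel B S → k ≢ l → S k l ≢ 0₃ →
                        SameKernel (B △ k △ l) (pivot (S k l) k l S)
    same-kernel-pivot st same k≢l nz γ =
      (λ ker → InKernel-cong (λ u v → sym (lift-pivot st k≢l nz u v))
        (kernel-pivot (lift-alternating (alt st)) k≢l refl (lift-square nz) (proj₁ (same γ) ker))) ,
      λ ker → proj₂ (same γ) (kernel-unpivot (lift-alternating (alt st)) k≢l refl (lift-square nz)
        (InKernel-cong (lift-pivot st k≢l nz) ker))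

    -- The matrix [ I | S₀ ] with a row for every element of the ground set; the rows indexed
    -- outside `base` vanish, which saves an enumeration of `base`.
    row : Fin n → Fin n → K
    row u v = if lookup base v then L.δ u v else lift R (S₀ u v)

    row-apply : ∀ γ u → L.sum (λ v → γ v * row u v) ≈ (⟪ S₀ ⟫ L.· off base γ) u + on base γ u
    row-apply γ u = trans (L.sum-cong split) (trans (L.sum-+ (λ v → lift R (S₀ u v) * off base γ v) (λ v → on base γ v * L.δ u v))
      (+-congˡ (L.sum-δ u (on base γ))))
      where
      split : ∀ v → γ v * row u v ≈ lift R (S₀ u v) * off base γ v + on base γ v * L.δ u v
      split v with lookup base v
      ... | true = sym (trans (+-congʳ (zeroʳ _)) (+-identityˡ _))
      ... | false = trans (*-comm _ _) (sym (trans (+-congˡ (zeroˡ _)) (+-identityʳ _)))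

    row-kernel : ∀ γ → (∀ u → L.sum (λ v → γ v * row u v) ≈ 0#) → InKernel base ⟪ S₀ ⟫ γ
    row-kernel γ killed = in-kernel λ u → trans (solve 2 (λ x y → x := (x :+ y) :- y) refl _ _)
      (trans (+-congʳ (trans (sym (row-apply γ u)) (killed u))) (+-identityˡ _))

    row-killed : ∀ γ → InKernel base ⟪ S₀ ⟫ γ → ∀ u → L.sum (λ v → γ v * row u v) ≈ 0#
    row-killed γ ker u = trans (row-apply γ u) (trans (+-congʳ (ker .at u)) (-‿inverseˡ _))

    circuit : Matrix → Fin n → Fin n → K
    circuit S v i = L.δ v i - lift R (S i v)

    circuit-self : ∀ {B S} → State B S → ∀ v → circuit S v v ≈ 1#
    circuit-self st v = trans (+-cong (reflexive (L.δ-refl v)) (-‿cong (reflexive (≡.cong (lift R) (proj₁ (alt st) v)))))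
      (trans (+-congˡ -0#≈0#) (+-identityʳ _))

    circuit-other : ∀ S {v i} → i ≢ v → circuit S v i ≈ - lift R (S i v)
    circuit-other S i≢v = trans (+-congʳ (reflexive (L.δ-≢ (i≢v ∘ ≡.sym)))) (+-identityˡ _)

    circuit-zero : ∀ S {v i} → i ≢ v → S i v ≡ 0₃ → circuit S v i ≈ 0#
    circuit-zero S i≢v z = trans (circuit-other S i≢v) (trans (-‿cong (reflexive (≡.cong (lift R) z))) -0#≈0#)

    circuit-kernel : ∀ {B S} → State B S → ∀ v → lookup B v ≡ false → InKernel B ⟪ S ⟫ (circuit S v)
    circuit-kernel {B} {S} st v v∉B = in-kernel λ w → trans (L.sum-only v (only-v w))
      (trans (*-congˡ (trans (reflexive (off-∉ {B} {circuit S v} {v} v∉B)) (circuit-self st v))) (trans (*-identityʳ _) (column w)))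
      where
      only-v : ∀ w i → i ≢ v → lift R (S w i) * off B (circuit S v) i ≈ 0#
      only-v w i i≢v with lookup B i in p
      ... | true = zeroʳ _
      ... | false = trans (*-congˡ (circuit-zero S i≢v (same-side st (≡.trans p (≡.sym v∉B))))) (zeroʳ _)
      column : ∀ w → lift R (S w v) ≈ - on B (circuit S v) w
      column w with lookup B w in p
      ... | true = trans (sym (-‿involutive _)) (-‿cong (sym (circuit-other S (differ {X = B} p v∉B))))
      ... | false = trans (reflexive (≡.cong (lift R) (same-side st (≡.trans p (≡.sym v∉B))))) (sym -0#≈0#)

    same-kernel-base : SameKernel base S₀
    same-kernel-base γ = id , id

    Final : Subset n → Subset n → Matrix → Set
    Final X B S = ∀ u v → lookup B u ≡ true → lookup X u ≡ false → lookup X v ≡ true → lookup B v ≡ false → S u v ≡ 0₃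

    reach : ∀ X → ∃ λ B → ∃ λ S → State B S × SameKernel B S × Final X B S
    reach X = towards SameKernel same-kernel-pivot X base-state same-kernel-base

    kernel-inside-basis : ∀ {B S} γ → InKernel B ⟪ S ⟫ γ → (∀ i → lookup B i ≡ false → γ i ≈ 0#) → ∀ i → γ i ≈ 0#
    kernel-inside-basis {B} {S} γ ker outside i with lookup B i in p
    ... | false = outside i p
    ... | true = trans (reflexive (≡.sym (on-∈ {B} {γ} {i} p))) (trans (sym (-‿involutive _))
          (trans (-‿cong (trans (sym (ker .at i)) (L.sum-0 λ v → trans (*-congˡ (off-zero v)) (zeroʳ _)))) -0#≈0#))
      where
      off-zero : ∀ v → off B γ v ≈ 0#
      off-zero v with lookup B v in p
      ... | true = refl
      ... | false = outside v p

    circuit-inside : ∀ {X B S} → State B S → Final X B S → ∀ {v} → lookup X v ≡ true → lookup B v ≡ false →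
                     ∀ i → lookup X i ≡ false → circuit S v i ≈ 0#
    circuit-inside {X} {B} {S} st final {v} v∈X v∉B i i∉X = circuit-zero S (differ {X = X} v∈X i∉X ∘ ≡.sym) zero-entry
      where
      zero-entry : S i v ≡ 0₃
      zero-entry with lookup B i in p
      ... | true = final i v p i∉X v∈X v∉B
      ... | false = same-side st (≡.trans p (≡.sym v∉B))

    -- The state is moved to the basis C containing X. There the kernel condition expresses the
    -- coordinates in the basis by those outside, and the latter are 0.
    independent⇒ : ∀ X → Independent M X → LinIndep R row X
    independent⇒ X (C , bC , X⊆C) γ supp killed = finish (reach C)
      where
      finish : (∃ λ B → ∃ λ S → State B S × SameKernel B S × Final C B S) → ∀ i → γ i ≈ 0#
      finish (B , S , st , same , final) = kernel-inside-basis {B} {S} γ (proj₁ (same γ) (row-kernel γ killed)) outside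
        where
        outside : ∀ i → lookup B i ≡ false → γ i ≈ 0#
        outside i i∉B = supp i λ i∈X → false⇒∉ (≡.trans (≡.cong (λ Y → lookup Y i) (reached st bC final)) i∉B) (X⊆C i∈X)

    -- The state is moved as far into X as possible. An element v of X still outside B would have
    -- its circuit inside X, and linear independence would then give 1 = 0. Equality in R is never
    -- decided.
    independent⇐ : ¬ 1# ≈ 0# → ∀ X → LinIndep R row X → Independent M X
    independent⇐ 1≉0 X ind = finish (reach X)
      where
      finish : (∃ λ B → ∃ λ S → State B S × SameKernel B S × Final X B S) → Independent M X
      finish (B , S , st , same , final) = B , basis st , λ {v} v∈X → true⇒∈ (inside v (∈⇒true v∈X))
        where
        inside : ∀ v → lookup X v ≡ true → lookup B v ≡ true
        inside v v∈X with lookup B v in v∉B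
        ... | true = ≡.refl
        ... | false = ⊥-elim (1≉0 (trans (sym (circuit-self st v))
              (ind (circuit S v) (λ i i∉X → circuit-inside {X} st final v∈X v∉B i (∉⇒false i∉X))
                (row-killed (circuit S v) (proj₂ (same (circuit S v)) (circuit-kernel st v v∉B))) v)))

    representable : ¬ 1# ≈ 0# → Representable R M
    representable 1≉0 = n , row , λ X → independent⇒ X , independent⇐ 1≉0 X

-- Exchange graphs under pivots, and nonsingular principal submatrices over F₃.

_⊆ᵇ_ : ∀ {n} → Subset n → Subset n → Set
X ⊆ᵇ W = ∀ u → lookup X u ≡ true → lookup W u ≡ true

module AdjacencyFacts {n : ℕ} (M : Matroid n) where
  open MatroidFacts M

  adj-sym : ∀ B u v → adj M B u v ≡ adj M B v u
  adj-sym B u v = bool-ext (λ e → Adj⇒adj M (Adj-sym (adj⇒Adj M e))) (λ e → Adj⇒adj M (Adj-sym (adj⇒Adj M e)))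

  adj-irrefl : ∀ B {u v} → adj M B u v ≡ true → u ≢ v
  adj-irrefl B e = proj₁ (adj⇒Adj M {B} e)

  adj-refl : ∀ B u → adj M B u u ≡ false
  adj-refl B u = ¬true⇒false λ e → adj-irrefl B e ≡.refl

  module _ {B : Subset n} (bB : Basis B) where

    adj-colour : ∀ {u v} → adj M B u v ≡ true → lookup B v ≡ not (lookup B u)
    adj-colour e = Adj⇒differ bB (adj⇒Adj M e)

    same-colour : ∀ {u v} → lookup B u ≡ lookup B v → adj M B u v ≡ false
    same-colour e = ¬true⇒false λ uv → Boolₚ.not-¬ (≡.sym e) (adj-colour uv)

    two-steps : ∀ {u v w} → adj M B u v ≡ true → adj M B v w ≡ true → lookup B u ≡ lookup B w
    two-steps {u} uv vw = ≡.sym (≡.trans (adj-colour vw) (≡.trans (≡.cong not (adj-colour uv)) (Boolₚ.not-involutive (lookup B u))))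

module PivotAdjacency {n : ℕ} (M : Matroid n) (bin : BinaryPivots M) where
  open MatroidFacts M
  open AdjacencyFacts M

  module _ {B : Subset n} (bB : Basis B) {k l : Fin n} (kl : adj M B k l ≡ true) where

    pivot-basis : Basis (B △ k △ l)
    pivot-basis = proj₂ (adj⇒Adj M kl)

    pivot-value : ∀ {u v a b c d e} → u ≢ k → u ≢ l → v ≢ k → v ≢ l → adj M B u v ≡ a →
                  adj M B u l ≡ b → adj M B v k ≡ c → adj M B u k ≡ d → adj M B v l ≡ e →
                  adj M (B △ k △ l) u v ≡ a xor ((b ∧ c) xor (d ∧ e))
    pivot-value u≢k u≢l v≢k v≢l ea eb ec ed ee = ≡.trans (bin bB (adj⇒Adj M kl) u≢k u≢l v≢k v≢l)
      (≡.cong₂ _xor_ ea (≡.cong₂ _xor_ (≡.cong₂ _∧_ eb ec) (≡.cong₂ _∧_ ed ee)))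

    differs-from-k : ∀ {u} → adj M B u l ≡ false → u ≢ k
    differs-from-k e ≡.refl = true≢false (≡.trans (≡.sym kl) e)

    differs-from-l : ∀ {u} → adj M B u k ≡ false → u ≢ l
    differs-from-l e ≡.refl = true≢false (≡.trans (≡.sym kl) (≡.trans (adj-sym B k l) e))

    -- Both products in the pivot rule contain an adjacency of u with k or l.
    keep : ∀ {u v} → adj M B u k ≡ false → adj M B u l ≡ false → adj M B u v ≡ true → adj M (B △ k △ l) u v ≡ true
    keep {u} {v} uk ul uv = ≡.trans (pivot-value (differs-from-k ul) (differs-from-l uk)
      (λ { ≡.refl → true≢false (≡.trans (≡.sym uv) uk) }) (λ { ≡.refl → true≢false (≡.trans (≡.sym uv) ul) })
      uv ul ≡.refl uk ≡.refl) ≡.refl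

    -- A pivot exchanges the neighbourhoods of k and l elsewhere, because B △ k △ l △ k is B △ l.
    adj-k : ∀ {v} → v ≢ k → v ≢ l → adj M (B △ k △ l) k v ≡ adj M B l v
    adj-k {v} v≢k v≢l = bool-ext
      (λ e → Adj⇒adj M (v≢l ∘ ≡.sym , ≡.trans (≡.cong β (≡.sym same)) (proj₂ (adj⇒Adj M e))))
      (λ e → Adj⇒adj M (v≢k ∘ ≡.sym , ≡.trans (≡.cong β same) (proj₂ (adj⇒Adj M e))))
      where
      same : B △ k △ l △ k △ v ≡ B △ l △ v
      same = ≡.cong (_△ v) (≡.trans (≡.cong (_△ k) (△-comm B k l)) (△-involutive (B △ l) k))

    adj-l : ∀ {v} → v ≢ k → v ≢ l → adj M (B △ k △ l) l v ≡ adj M B k v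
    adj-l {v} v≢k v≢l = bool-ext
      (λ e → Adj⇒adj M (v≢k ∘ ≡.sym , ≡.trans (≡.cong β (≡.sym same)) (proj₂ (adj⇒Adj M e))))
      (λ e → Adj⇒adj M (v≢l ∘ ≡.sym , ≡.trans (≡.cong β same) (proj₂ (adj⇒Adj M e))))
      where
      same : B △ k △ l △ l △ v ≡ B △ k △ v
      same = ≡.cong (_△ v) (△-involutive (B △ k) l)

    adj-kl : adj M (B △ k △ l) k l ≡ true
    adj-kl = Adj⇒adj M (proj₁ (adj⇒Adj M kl) , ≡.trans (≡.cong β (△△-involutive B k l)) bB)

module TotallyUnimodular {n : ℕ} (M : Matroid n) where
  open MatroidFacts M
  open AdjacencyFacts M
  open LinearAlgebra F₃-ring n public
  open CommutativeRing F₃-ring using (zeroʳ; *-identityʳ)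

  -- Injectivity of the principal submatrix of S on X, the substitute for a nonvanishing
  -- determinant.
  Nonsingular : Matrix → Subset n → Set
  Nonsingular S X = ∀ (z : Fin n → Fin 3) → (∀ u → lookup X u ≡ false → z u ≡ 0₃) →
                    (∀ u → lookup X u ≡ true → (S · z) u ≡ 0₃) → ∀ u → z u ≡ 0₃

  nonsingular-cong : ∀ {S T X} → (∀ u v → lookup X u ≡ true → lookup X v ≡ true → S u v ≡ T u v) →
                     Nonsingular S X → Nonsingular T X
  nonsingular-cong {S} {T} {X} e ns z supp ker = ns z supp λ u u∈X → ≡.trans (sum-cong (same u u∈X)) (ker u u∈X)
    where
    same : ∀ u → lookup X u ≡ true → ∀ v → S u v *₃ z v ≡ T u v *₃ z v
    same u u∈X v with lookup X v in v∈X
    ... | true = ≡.cong (_*₃ z v) (e u v u∈X v∈X)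
    ... | false rewrite supp v v∈X = ≡.trans (zeroʳ (S u v)) (≡.sym (zeroʳ (T u v)))

  module _ {S : Matrix} (alt : Alternating S) {k l : Fin n} (k≢l : k ≢ l) (nz : S k l ≢ 0₃) where
    open Pivot alt k≢l ≡.refl (square₃ nz)

    neg-zero : ∀ {x} → -₃ x ≡ 0₃ → x ≡ 0₃
    neg-zero {0₃} _ = ≡.refl
    neg-zero {1₃} ()
    neg-zero {2₃} ()

    pivot-nonzero : S′ k l ≢ 0₃
    pivot-nonzero e = nz (neg-zero (≡.trans (≡.sym pivot-kl) e))

    -- The condition at a coordinate concerns z outside X and S z inside X. A pivot exchanges z and
    -- S z at k and l up to sign, and toggling k and l in X exchanges the two conditions there.
    nonsingular-pivot : ∀ {X} → Nonsingular S X → Nonsingular S′ (X △ k △ l)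
    nonsingular-pivot {X} ns z′ supp′ ker′ = z′-zero
      where
      w′ z w : Fin n → Fin 3
      w′ = S′ · z′
      z = swap k l z′ w′
      w = swap k l w′ z′
      Sz≡w : ∀ u → (S · z) u ≡ w u
      Sz≡w u = ≡.trans (sum-cong λ v → ≡.cong (_*₃ z v) (≡.sym (involutive u v)))
        (Pivot.pivot-graph alternating k≢l (≡.sym pivot-kl)
          (≡.trans (neg-square (S k l)) (square₃ nz)) (λ u → ≡.refl) u)
        where
        neg-square : ∀ a → (-₃ a) *₃ (-₃ a) ≡ a *₃ a
        neg-square 0₃ = ≡.refl
        neg-square 1₃ = ≡.refl
        neg-square 2₃ = ≡.refl
      in-X′-k : ∀ {b} → lookup X k ≡ b → lookup (X △ k △ l) k ≡ not b
      in-X′-k e = ≡.trans (△△-∈ X k≢l) (≡.cong not e)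
      in-X′-l : ∀ {b} → lookup X l ≡ b → lookup (X △ k △ l) l ≡ not b
      in-X′-l e = ≡.trans (△△-∈′ X k≢l) (≡.cong not e)
      supp : ∀ u → lookup X u ≡ false → z u ≡ 0₃
      supp u u∉X with u Finₚ.≟ k
      ... | yes ≡.refl = ≡.trans (swap-k z′ w′ k≢l) (≡.cong -₃_ (ker′ u (in-X′-k u∉X)))
      ... | no u≢k with u Finₚ.≟ l
      ...   | yes ≡.refl = ≡.trans (swap-l z′ w′ k≢l) (≡.cong -₃_ (ker′ u (in-X′-l u∉X)))
      ...   | no u≢l = ≡.trans (swap-other z′ w′ u≢k u≢l) (supp′ u (≡.trans (△△-other X u≢k u≢l) u∉X))
      ker : ∀ u → lookup X u ≡ true → (S · z) u ≡ 0₃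
      ker u u∈X with u Finₚ.≟ k
      ... | yes ≡.refl = ≡.trans (Sz≡w u) (≡.trans (swap-k w′ z′ k≢l) (≡.cong -₃_ (supp′ u (in-X′-k u∈X))))
      ... | no u≢k with u Finₚ.≟ l
      ...   | yes ≡.refl = ≡.trans (Sz≡w u) (≡.trans (swap-l w′ z′ k≢l) (≡.cong -₃_ (supp′ u (in-X′-l u∈X))))
      ...   | no u≢l = ≡.trans (Sz≡w u) (≡.trans (swap-other w′ z′ u≢k u≢l) (ker′ u (≡.trans (△△-other X u≢k u≢l) u∈X)))
      z-zero : ∀ u → z u ≡ 0₃
      z-zero = ns z supp ker
      w-zero : ∀ u → w u ≡ 0₃
      w-zero u = ≡.trans (≡.sym (Sz≡w u)) (sum-0 λ v → ≡.trans (≡.cong (S u v *₃_) (z-zero v)) (zeroʳ (S u v)))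
      z′-zero : ∀ u → z′ u ≡ 0₃
      z′-zero u with u Finₚ.≟ k
      ... | yes ≡.refl = neg-zero (≡.trans (≡.sym (swap-k w′ z′ k≢l)) (w-zero u))
      ... | no u≢k with u Finₚ.≟ l
      ...   | yes ≡.refl = neg-zero (≡.trans (≡.sym (swap-l w′ z′ k≢l)) (w-zero u))
      ...   | no u≢l = ≡.trans (≡.sym (swap-other z′ w′ u≢k u≢l)) (z-zero u)

  nonsingular-unpivot : ∀ {S} (alt : Alternating S) {k l} (k≢l : k ≢ l) (nz : S k l ≢ 0₃) {X} →
                        Nonsingular (pivot (S k l) k l S) (X △ k △ l) → Nonsingular S X
  nonsingular-unpivot {S} alt {k} {l} k≢l nz {X} ns = ≡.subst (Nonsingular S) (△△-involutive X k l)
    (nonsingular-cong {X = X △ k △ l △ k △ l} (λ u v _ _ → ≡.trans (≡.cong (λ a → pivot a k l P.S′ u v) P.pivot-kl) (P.involutive u v))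
      (nonsingular-pivot P.alternating k≢l (pivot-nonzero alt k≢l nz) {X △ k △ l} ns))
    where module P = Pivot alt k≢l ≡.refl (square₃ nz)

  -- S signs the exchange graph of B on W so that its principal minors detect the bases.
  record TU (W B : Subset n) (S : Matrix) : Set where
    field
      alt : Alternating S
      nonsingular⇒basis : ∀ X → X ⊆ᵇ W → Nonsingular S X → Basis (B ⊕ X)
      basis⇒nonsingular : ∀ X → X ⊆ᵇ W → Basis (B ⊕ X) → Nonsingular S X

  △△-⊕ : ∀ (B X : Subset n) k l → (B △ k △ l) ⊕ X ≡ (B ⊕ X) △ k △ l
  △△-⊕ B X k l = ≡.trans (△-⊕ (B △ k) X l) (≡.cong (_△ l) (△-⊕ B X k))

  ⊕-△△ : ∀ (B X : Subset n) k l → B ⊕ (X △ k △ l) ≡ (B ⊕ X) △ k △ l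
  ⊕-△△ B X k l = ≡.trans (⊕-△ B (X △ k) l) (≡.cong (_△ l) (⊕-△ B X k))

  △△-⊆ : ∀ {X W : Subset n} {k l} → X ⊆ᵇ W → lookup W k ≡ true → lookup W l ≡ true → (X △ k △ l) ⊆ᵇ W
  △△-⊆ {X} {W} {k} {l} X⊆W k∈W l∈W u u∈ with u Finₚ.≟ k | u Finₚ.≟ l
  ... | yes ≡.refl | _ = k∈W
  ... | no _ | yes ≡.refl = l∈W
  ... | no u≢k | no u≢l = X⊆W u (≡.trans (≡.sym (△△-other X u≢k u≢l)) u∈)

  pair : Fin n → Fin n → Subset n
  pair u v = ∅ △ u △ v

  pair-other : ∀ {u v w} → w ≢ u → w ≢ v → lookup (pair u v) w ≡ false
  pair-other {w = w} w≢u w≢v = ≡.trans (△△-other ∅ w≢u w≢v) (lookup-∅ w)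

  pair-⊆ : ∀ {W u v} → lookup W u ≡ true → lookup W v ≡ true → pair u v ⊆ᵇ W
  pair-⊆ {W} = △△-⊆ {∅} {W} λ u u∈ → ⊥-elim (true≢false (≡.trans (≡.sym u∈) (lookup-∅ u)))

  ⊕-pair : ∀ B u v → B ⊕ pair u v ≡ B △ u △ v
  ⊕-pair B u v = ≡.trans (⊕-△△ B ∅ u v) (≡.cong (λ X → X △ u △ v) (⊕-∅ B))

  product-zero : ∀ {x y} → x ≢ 0₃ → x *₃ y ≡ 0₃ → y ≡ 0₃
  product-zero {0₃} nz _ = ⊥-elim (nz ≡.refl)
  product-zero {1₃} _ e = e
  product-zero {2₃} {0₃} _ _ = ≡.refl
  product-zero {2₃} {1₃} _ ()
  product-zero {2₃} {2₃} _ ()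

  nonsingular-pair⇒ : ∀ {S u v} → Alternating S → u ≢ v → Nonsingular S (pair u v) → S u v ≢ 0₃
  nonsingular-pair⇒ {S} {u} {v} alt u≢v ns z = 1≢0 (≡.trans (≡.sym (δ-refl u)) (ns (δ u) supp ker u))
    where
    1≢0 : 1₃ ≢ 0₃
    1≢0 ()
    supp : ∀ w → lookup (pair u v) w ≡ false → δ u w ≡ 0₃
    supp w w∉ with u Finₚ.≟ w
    ... | no _ = ≡.refl
    ... | yes ≡.refl = ⊥-elim (true≢false (≡.trans (≡.sym (≡.trans (△△-∈ ∅ u≢v) (≡.cong not (lookup-∅ w)))) w∉))
    ker : ∀ w → lookup (pair u v) w ≡ true → (S · δ u) w ≡ 0₃
    ker w w∈ = ≡.trans (sum-δ u (S w)) (entry w w∈)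
      where
      entry : ∀ w → lookup (pair u v) w ≡ true → S w u ≡ 0₃
      entry w w∈ with w Finₚ.≟ u | w Finₚ.≟ v
      ... | yes ≡.refl | _ = proj₁ alt w
      ... | no _ | yes ≡.refl = ≡.trans (proj₂ alt w u) (≡.cong -₃_ z)
      ... | no w≢u | no w≢v = ⊥-elim (true≢false (≡.trans (≡.sym w∈) (pair-other w≢u w≢v)))

  nonsingular-pair⇐ : ∀ {S u v} → Alternating S → u ≢ v → S u v ≢ 0₃ → Nonsingular S (pair u v)
  nonsingular-pair⇐ {S} {u} {v} alt u≢v nz z supp ker w with w Finₚ.≟ u | w Finₚ.≟ v
  ... | no w≢u | no w≢v = supp w (pair-other w≢u w≢v)
  ... | no _ | yes ≡.refl = product-zero nz (≡.trans (≡.sym (sum-only w only)) (ker u (≡.trans (△△-∈ ∅ u≢v) (≡.cong not (lookup-∅ u)))))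
    where
    only : ∀ i → i ≢ w → S u i *₃ z i ≡ 0₃
    only i i≢w with i Finₚ.≟ u
    ... | yes ≡.refl = ≡.cong (_*₃ z i) (proj₁ alt i)
    ... | no i≢u = ≡.trans (≡.cong (S u i *₃_) (supp i (pair-other i≢u i≢w))) (zeroʳ (S u i))
  ... | yes ≡.refl | _ = product-zero nz′ (≡.trans (≡.sym (sum-only w only)) (ker v (≡.trans (△△-∈′ ∅ u≢v) (≡.cong not (lookup-∅ v)))))
    where
    nz′ : S v w ≢ 0₃
    nz′ e = nz (≡.trans (proj₂ alt w v) (≡.cong -₃_ e))
    only : ∀ i → i ≢ w → S v i *₃ z i ≡ 0₃
    only i i≢w with i Finₚ.≟ v
    ... | yes ≡.refl = ≡.cong (_*₃ z i) (proj₁ alt i)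
    ... | no i≢v = ≡.trans (≡.cong (S v i *₃_) (supp i (pair-other i≢w i≢v))) (zeroʳ (S v i))

  nonsingular-∅ : ∀ S → Nonsingular S ∅
  nonsingular-∅ S z supp ker u = supp u (lookup-∅ u)

  module _ {W B : Subset n} {S : Matrix} (tu : TU W B S) where
    open TU tu

    TU-basis : Basis B
    TU-basis = ≡.trans (≡.cong β (≡.sym (⊕-∅ B)))
      (nonsingular⇒basis ∅ (λ u u∈ → ⊥-elim (true≢false (≡.trans (≡.sym u∈) (lookup-∅ u)))) (nonsingular-∅ S))

    nonzero⇒adj : ∀ {u v} → lookup W u ≡ true → lookup W v ≡ true → S u v ≢ 0₃ → adj M B u v ≡ true
    nonzero⇒adj {u} {v} u∈W v∈W nz = Adj⇒adj M (u≢v , ≡.trans (≡.cong β (≡.sym (⊕-pair B u v)))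
      (nonsingular⇒basis (pair u v) (pair-⊆ {W} u∈W v∈W) (nonsingular-pair⇐ alt u≢v nz)))
      where
      u≢v : u ≢ v
      u≢v ≡.refl = nz (proj₁ alt u)

    adj⇒nonzero : ∀ {u v} → lookup W u ≡ true → lookup W v ≡ true → adj M B u v ≡ true → S u v ≢ 0₃
    adj⇒nonzero {u} {v} u∈W v∈W e = nonsingular-pair⇒ alt (proj₁ (adj⇒Adj M {B} e))
      (basis⇒nonsingular (pair u v) (pair-⊆ {W} u∈W v∈W) (≡.trans (≡.cong β (⊕-pair B u v)) (proj₂ (adj⇒Adj M {B} e))))

    non-adj⇒zero : ∀ {u v} → lookup W u ≡ true → lookup W v ≡ true → adj M B u v ≡ false → S u v ≡ 0₃
    non-adj⇒zero {u} {v} u∈W v∈W e = decidable-stable (S u v Finₚ.≟ 0₃) λ nz →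
      true≢false (≡.trans (≡.sym (nonzero⇒adj u∈W v∈W nz)) e)

    -- Toggling k and l in B and pivoting S both have the effect of toggling k and l in X, so the
    -- two sides of the equivalence move together and `W` stays the same.
    TU-pivot : ∀ {k l} → lookup W k ≡ true → lookup W l ≡ true → adj M B k l ≡ true →
               TU W (B △ k △ l) (pivot (S k l) k l S)
    TU-pivot {k} {l} k∈W l∈W kl = record
      { alt = Pivot.alternating alt k≢l ≡.refl (square₃ nz)
      ; nonsingular⇒basis = λ X X⊆W ns → ≡.trans (≡.cong β (≡.trans (△△-⊕ B X k l) (≡.sym (⊕-△△ B X k l))))
          (nonsingular⇒basis (X △ k △ l) (△△-⊆ {X} {W} X⊆W k∈W l∈W) (nonsingular-unpivot alt k≢l nz (≡.subst (Nonsingular _) (≡.sym (△△-involutive X k l)) ns)))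
      ; basis⇒nonsingular = λ X X⊆W b → ≡.subst (Nonsingular _) (△△-involutive X k l) (nonsingular-pivot alt k≢l nz
          (basis⇒nonsingular (X △ k △ l) (△△-⊆ {X} {W} X⊆W k∈W l∈W) (≡.trans (≡.cong β (≡.trans (⊕-△△ B X k l) (≡.sym (△△-⊕ B X k l)))) b)))
      }
      where
      k≢l : k ≢ l
      k≢l = proj₁ (adj⇒Adj M {B} kl)
      nz : S k l ≢ 0₃
      nz = adj⇒nonzero k∈W l∈W kl

  Detects : Matrix → Subset n → Subset n → Set
  Detects S B X = (Nonsingular S X → Basis (B ⊕ X)) × (Basis (B ⊕ X) → Nonsingular S X)

  detects-unpivot : ∀ {S} (alt : Alternating S) {k l} (k≢l : k ≢ l) (nz : S k l ≢ 0₃) {B X} →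
                    Detects (pivot (S k l) k l S) (B △ k △ l) (X △ k △ l) → Detects S B X
  detects-unpivot alt {k} {l} k≢l nz {B} {X} (to , from) =
    (λ ns → ≡.trans (≡.cong β (≡.sym same)) (to (nonsingular-pivot alt k≢l nz ns))) ,
    λ b → nonsingular-unpivot alt k≢l nz (from (≡.trans (≡.cong β same) b))
    where
    same : (B △ k △ l) ⊕ (X △ k △ l) ≡ B ⊕ X
    same = ≡.trans (⊕-△△ (B △ k △ l) X k l) (≡.trans (≡.cong (λ Y → Y △ k △ l) (△△-⊕ B X k l)) (△△-involutive (B ⊕ X) k l))

  -- The base case of the later reductions. The submatrix on X is zero, so it is nonsingular only
  -- for empty X; and a basis B ⊕ X with X nonempty would provide an exchange starting at B, that is
  -- an edge, between two elements of X.
  detects-no-edge : ∀ {S B} X → Alternating S → Basis B →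
                    (∀ u v → lookup X u ≡ true → lookup X v ≡ true → S u v ≡ 0₃ × adj M B u v ≡ false) → Detects S B X
  detects-no-edge {S} {B} X alt bB no-edge with Finₚ.any? (λ x → lookup X x Boolₚ.≟ true)
  ... | no empty = ≡.subst (Detects S B) (≡.sym X≡∅)
        ((λ _ → ≡.trans (≡.cong β (⊕-∅ B)) bB) , λ _ → nonsingular-∅ S)
    where
    X≡∅ : X ≡ ∅
    X≡∅ = subset-ext λ u → ≡.trans (¬true⇒false λ e → empty (u , e)) (≡.sym (lookup-∅ u))
  ... | yes (x , x∈X) = (λ ns → ⊥-elim (singular ns)) , λ b → ⊥-elim (not-basis b)
    where
    singular : ¬ Nonsingular S X
    singular ns with ≡.trans (≡.sym (δ-refl x)) (ns (δ x) supp (λ u u∈X → ≡.trans (sum-δ x (S u)) (proj₁ (no-edge u x u∈X x∈X))) x)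
      where
      supp : ∀ w → lookup X w ≡ false → δ x w ≡ 0₃
      supp w w∉X = δ-≢ (differ {X = X} x∈X w∉X)
    ... | ()
    inside : ∀ {y} → lookup X y ≡ true → lookup (B ⊕ X) y ≡ not (lookup B y)
    inside {y} y∈X = ≡.trans (lookup-⊕ B X y) (≡.trans (≡.cong (lookup B y xor_) y∈X) (xor-true (lookup B y)))
      where
      xor-true : ∀ b → b xor true ≡ not b
      xor-true true = ≡.refl
      xor-true false = ≡.refl
    changed : ∀ {y} → lookup (B ⊕ X) y ≡ not (lookup B y) → lookup X y ≡ true
    changed {y} e with lookup X y in p
    ... | true = ≡.refl
    ... | false = ⊥-elim (Boolₚ.not-¬ (≡.trans (lookup-⊕ B X y) (≡.trans (≡.cong (lookup B y xor_) p) (Boolₚ.xor-identityʳ _))) e)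
    leaves : Basis (B ⊕ X) → ∀ {y} → lookup X y ≡ true → lookup B y ≢ true
    leaves b {y} y∈X y∈B with exchange△ bB b y∈B (≡.trans (inside y∈X) (≡.cong not y∈B))
    ... | v , v∈C , v∉B , b′ = true≢false (≡.trans (≡.sym (Adj⇒adj M (differ {X = B} y∈B v∉B , b′)))
          (proj₂ (no-edge y v y∈X (changed (≡.trans v∈C (≡.cong not (≡.sym v∉B)))))))
    not-basis : ¬ Basis (B ⊕ X)
    not-basis b with lookup B x in p
    ... | true = leaves b x∈X p
    ... | false with exchange△ b bB (≡.trans (inside x∈X) (≡.cong not p)) p
    ...   | v , v∈B , v∉C , _ = leaves b (changed (≡.trans v∉C (≡.cong not (≡.sym v∈B)))) v∈B

-- Fano configurations and the comparison of signs along paths.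

module _ {n : ℕ} (M : Matroid n) where
  open MatroidFacts M

  -- Over the rows i, k, j the columns are x = 111, y = 101, c = 110 and d = 011: with the unit
  -- vectors these form the Fano matroid (or its dual, if i, k, j lie outside B).
  NoFano : Set
  NoFano = ∀ {B} → Basis B → ∀ {i k j x y c d} →
    adj M B i x ≡ true → adj M B i y ≡ true → adj M B i c ≡ true → adj M B i d ≡ false →
    adj M B k x ≡ true → adj M B k y ≡ false → adj M B k c ≡ true → adj M B k d ≡ true →
    adj M B j x ≡ true → adj M B j y ≡ true → adj M B j c ≡ false → adj M B j d ≡ true → ⊥

module PathLemma {n : ℕ} (M : Matroid n) (bin : BinaryPivots M) (noFano : NoFano M) where
  open MatroidFacts M
  open AdjacencyFacts M
  open PivotAdjacency M bin
  open TotallyUnimodular M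

  private
    E : Subset n → Fin n → Fin n → Bool
    E = adj M

    rank-one : ∀ p q r s t → p ≢ 0₃ → q ≢ 0₃ → r ≢ 0₃ → s ≢ 0₃ →
               s +₃ p *₃ (q *₃ (-₃ r) +₃ -₃ (0₃ *₃ t)) ≡ 0₃ → p *₃ q ≡ r *₃ s
    rank-one p q r s t = from-yes (Finₚ.all? λ p → Finₚ.all? λ q → Finₚ.all? λ r → Finₚ.all? λ s →
      ¬? (p Finₚ.≟ 0₃) →-dec (¬? (q Finₚ.≟ 0₃) →-dec (¬? (r Finₚ.≟ 0₃) →-dec (¬? (s Finₚ.≟ 0₃) →-dec
        ((s +₃ p *₃ (q *₃ (-₃ r) +₃ 0₃) Finₚ.≟ 0₃) →-dec (p *₃ q Finₚ.≟ r *₃ s)))))) p q r s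

    cross : ∀ p q p′ q′ → p ≢ 0₃ → q ≢ 0₃ → p′ ≢ 0₃ → q′ ≢ 0₃ → p *₃ q ≡ p′ *₃ q′ → p *₃ p′ ≡ q *₃ q′
    cross = from-yes (Finₚ.all? λ p → Finₚ.all? λ q → Finₚ.all? λ r → Finₚ.all? λ s →
      ¬? (p Finₚ.≟ 0₃) →-dec (¬? (q Finₚ.≟ 0₃) →-dec (¬? (r Finₚ.≟ 0₃) →-dec (¬? (s Finₚ.≟ 0₃) →-dec
        ((p *₃ q Finₚ.≟ r *₃ s) →-dec (p *₃ r Finₚ.≟ q *₃ s))))))

  -- For distinct rows and columns the minor has no zero entry, so the pivot on {i , x} removes the
  -- edge j c over F₂ and must make that entry 0 over F₃. Since the entries are ± 1, the vanishing
  -- can be written as an equality of products.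
  common-column : ∀ {W B S} → TU W B S → ∀ {i j x c} → lookup W i ≡ true → lookup W j ≡ true →
                  lookup W x ≡ true → lookup W c ≡ true → E B i x ≡ true → E B j x ≡ true →
                  E B i c ≡ true → E B j c ≡ true → S i x *₃ S j x ≡ S i c *₃ S j c
  common-column {W} {B} {S} tu {i} {j} {x} {c} i∈ j∈ x∈ c∈ ix jx ic jc with i Finₚ.≟ j | c Finₚ.≟ x
  ... | _ | yes ≡.refl = ≡.refl
  ... | yes ≡.refl | no _ = ≡.trans (square₃ (adj⇒nonzero tu i∈ x∈ ix)) (≡.sym (square₃ (adj⇒nonzero tu i∈ c∈ ic)))
  ... | no i≢j | no c≢x = rank-one (S i x) (S j x) (S i c) (S j c) (S c x)
          (adj⇒nonzero tu i∈ x∈ ix) (adj⇒nonzero tu j∈ x∈ jx) (adj⇒nonzero tu i∈ c∈ ic) (adj⇒nonzero tu j∈ c∈ jc)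
          (≡.trans (≡.cong (λ e → S j c +₃ S i x *₃ e) (≡.cong₂ (λ e f → S j x *₃ e +₃ -₃ (f *₃ S c x))
             (≡.sym (proj₂ (TU.alt tu) c i)) (≡.sym (non-adj⇒zero tu j∈ i∈ ji))))
           (≡.trans (≡.sym (Pivot.pivot-other (TU.alt tu) (adj-irrefl B ix) ≡.refl (square₃ (adj⇒nonzero tu i∈ x∈ ix))
              (i≢j ∘ ≡.sym) (adj-irrefl B jx) (adj-irrefl B ic ∘ ≡.sym) c≢x))
            (non-adj⇒zero (TU-pivot tu i∈ x∈ ix) j∈ c∈ gone)))
    where
    bB : Basis B
    bB = TU-basis tu
    ji : E B j i ≡ false
    ji = same-colour bB (two-steps bB jx (≡.trans (adj-sym B x i) ix))
    gone : E (B △ i △ x) j c ≡ false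
    gone = pivot-value bB ix (i≢j ∘ ≡.sym) (adj-irrefl B jx) (adj-irrefl B ic ∘ ≡.sym) c≢x
      jc jx (≡.trans (adj-sym B c i) ic) ji ≡.refl

  module _ {S : Matrix} (alt : Alternating S) {k l : Fin n} (k≢l : k ≢ l) (nz : S k l ≢ 0₃) where
    open Pivot alt k≢l ≡.refl (square₃ nz)

    pivot-fixes-row : ∀ {u} → u ≢ k → u ≢ l → S u k ≡ 0₃ → S u l ≡ 0₃ → ∀ v → S′ u v ≡ S u v
    pivot-fixes-row {u} u≢k u≢l uk ul v =
      ≡.trans (≡.cong₂ (λ p q → S u v +₃ S k l *₃ (q *₃ deleted k S v +₃ -₃ (p *₃ deleted l S v)))
        (≡.trans (deleted-other u≢k) uk) (≡.trans (deleted-other u≢l) ul))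
      (trivial (S u v) (S k l))
      where
      trivial : ∀ x a → x +₃ a *₃ 0₃ ≡ x
      trivial = from-yes (Finₚ.all? λ x → Finₚ.all? λ a → x +₃ a *₃ 0₃ Finₚ.≟ x)

    pivot-fixes-column : ∀ {v} → v ≢ k → v ≢ l → S v k ≡ 0₃ → S v l ≡ 0₃ → ∀ u → S′ u v ≡ S u v
    pivot-fixes-column {v} v≢k v≢l vk vl u = ≡.trans (proj₂ alternating u v)
      (≡.trans (≡.cong -₃_ (pivot-fixes-row v≢k v≢l vk vl u)) (≡.sym (proj₂ alt u v)))

  -- Two partial signings that agree on N, one reaching x and the other y. It is used with x = y to
  -- compare two signings of one set, and with x ≠ y to glue signings of sets that miss y and x
  -- respectively.
  record Context (N B : Subset n) (S₁ S₂ : Matrix) (x y : Fin n) : Set where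
    field
      W₁ W₂ : Subset n
      tu₁ : TU W₁ B S₁
      tu₂ : TU W₂ B S₂
      N⊆W₁ : N ⊆ᵇ W₁
      N⊆W₂ : N ⊆ᵇ W₂
      x∈W₁ : lookup W₁ x ≡ true
      y∈W₂ : lookup W₂ y ≡ true
      agree : ∀ u v → lookup N u ≡ true → lookup N v ≡ true → S₁ u v ≡ S₂ u v

  -- A step leads from one row to the next through a column, so the index counts double edges and
  -- all rows lie on one side of B.
  data Path (N B : Subset n) : ℕ → Fin n → Fin n → Set where
    nil : ∀ {i} → Path N B zero i i
    step : ∀ {s i k j} c → lookup N c ≡ true → lookup N k ≡ true → E B i c ≡ true → E B c k ≡ true →
           Path N B s k j → Path N B (suc s) i j

  Avoids : ∀ {N B s i j} → Fin n → Path N B s i j → Set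
  Avoids {B = B} {i = i} d nil = E B i d ≡ false
  Avoids {B = B} {i = i} d (step c _ _ _ _ p) = E B i d ≡ false × Avoids d p

  -- Decides between a shortcut and a pivot: a row adjacent to d allows a jump through d to a
  -- remainder that is no longer, while a path avoiding d survives a pivot at d by `path-keep`.
  scan : ∀ {N B s i j} d → lookup N i ≡ true → (p : Path N B s i j) →
         (∃ λ s′ → ∃ λ r → s′ ≤ s × lookup N r ≡ true × E B r d ≡ true × Path N B s′ r j) ⊎ Avoids d p
  scan {B = B} {i = i} d i∈N nil with E B i d in e
  ... | true = inj₁ (zero , i , z≤n , i∈N , e , nil)
  ... | false = inj₂ ≡.refl
  scan {B = B} {s} {i} d i∈N q@(step c c∈N k∈N ic ck p) with E B i d in e
  ... | true = inj₁ (s , i , ℕₚ.≤-refl , i∈N , e , q)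
  ... | false with scan d k∈N p
  ...   | inj₁ (s′ , r , s′≤s , rest) = inj₁ (s′ , r , ℕₚ.m≤n⇒m≤1+n s′≤s , rest)
  ...   | inj₂ avoids = inj₂ (≡.refl , avoids)

  first-avoids : ∀ {N B s i j d} (p : Path N B s i j) → Avoids d p → E B i d ≡ false
  first-avoids nil e = e
  first-avoids (step _ _ _ _ _ _) (e , _) = e

  last-avoids : ∀ {N B s i j d} (p : Path N B s i j) → Avoids d p → E B j d ≡ false
  last-avoids nil e = e
  last-avoids (step _ _ _ _ _ p) (_ , av) = last-avoids p av

  path-colour : ∀ {N B s i j} → Basis B → Path N B s i j → lookup B i ≡ lookup B j
  path-colour bB nil = ≡.refl
  path-colour bB (step c _ _ ic ck p) = ≡.trans (two-steps bB ic ck) (path-colour bB p)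

  path-keep : ∀ {N B s i j k d} (bB : Basis B) (kd : E B k d ≡ true) → lookup B i ≡ lookup B k →
              (p : Path N B s i j) → Avoids d p → Path N (B △ k △ d) s i j
  path-keep bB kd col nil av = nil
  path-keep {B = B} bB kd col (step c c∈N k∈N ic ck p) (av , avs) = step c c∈N k∈N
    (keep bB kd (same-colour bB col) av ic)
    (≡.trans (adj-sym _ c _) (keep bB kd (same-colour bB col′) (first-avoids p avs) (≡.trans (adj-sym B _ c) ck)))
    (path-keep bB kd col′ p avs)
    where
    col′ = ≡.trans (≡.sym (two-steps bB ic ck)) col

  module _ {N : Subset n} where

    pivot-context : ∀ {B S₁ S₂ x y} → Context N B S₁ S₂ x y → ∀ {k l} → lookup N k ≡ true → lookup N l ≡ true →
                    E B k l ≡ true → Context N (B △ k △ l) (pivot (S₁ k l) k l S₁) (pivot (S₂ k l) k l S₂) x y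
    pivot-context {B} {S₁} {S₂} ctx {k} {l} k∈N l∈N kl = record
      { tu₁ = TU-pivot tu₁ (N⊆W₁ k k∈N) (N⊆W₁ l l∈N) kl
      ; tu₂ = TU-pivot tu₂ (N⊆W₂ k k∈N) (N⊆W₂ l l∈N) kl
      ; N⊆W₁ = N⊆W₁ ; N⊆W₂ = N⊆W₂ ; x∈W₁ = x∈W₁ ; y∈W₂ = y∈W₂
      ; agree = λ u v u∈N v∈N → ≡.cong₂ _+₃_ (agree u v u∈N v∈N) (≡.cong₂ _*₃_ (agree k l k∈N l∈N)
          (≡.cong₂ _+₃_ (≡.cong₂ _*₃_ (del u u∈N l∈N) (del v v∈N k∈N)) (≡.cong -₃_ (≡.cong₂ _*₃_ (del u u∈N k∈N) (del v v∈N l∈N)))))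
      }
      where
      open Context ctx
      del : ∀ u → lookup N u ≡ true → ∀ {j} → lookup N j ≡ true → deleted j S₁ u ≡ deleted j S₂ u
      del u u∈N {j} j∈N = ≡.cong (_+₃ -₃ δ j u) (agree u j u∈N j∈N)

    -- If two rows meeting both x and y are connected inside N, the 2 × 2 minor of those rows and
    -- of the columns x (taken from S₁) and y (from S₂) vanishes: pivots shorten the connecting path,
    -- and a path with a single intermediate row leads to a Fano minor.
    signs-agree : ∀ {B S₁ S₂ x y} → Context N B S₁ S₂ x y → ∀ {i j} → lookup N i ≡ true → lookup N j ≡ true →
                  E B i x ≡ true → E B i y ≡ true → E B j x ≡ true → E B j y ≡ true →
                  ∀ {s} → Path N B s i j → Acc _<_ s → S₁ i x *₃ S₂ i y ≡ S₁ j x *₃ S₂ j y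
    signs-agree ctx i∈N j∈N ix iy jx jy nil _ = ≡.refl
    -- Rows i and j have the column c in common; the products in the columns x and y both equal the
    -- product in column c, on which the two signings agree.
    signs-agree {B} {S₁} {S₂} {x} {y} ctx {i} {j} i∈N j∈N ix iy jx jy (step c c∈N _ ic cj nil) _ =
      cross (S₁ i x) (S₁ j x) (S₂ i y) (S₂ j y)
        (adj⇒nonzero tu₁ (N⊆W₁ i i∈N) x∈W₁ ix) (adj⇒nonzero tu₁ (N⊆W₁ j j∈N) x∈W₁ jx)
        (adj⇒nonzero tu₂ (N⊆W₂ i i∈N) y∈W₂ iy) (adj⇒nonzero tu₂ (N⊆W₂ j j∈N) y∈W₂ jy)
        (≡.trans (common-column tu₁ (N⊆W₁ i i∈N) (N⊆W₁ j j∈N) x∈W₁ (N⊆W₁ c c∈N) ix jx ic jc)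
          (≡.trans (≡.cong₂ _*₃_ (agree i c i∈N c∈N) (agree j c j∈N c∈N))
            (≡.sym (common-column tu₂ (N⊆W₂ i i∈N) (N⊆W₂ j j∈N) y∈W₂ (N⊆W₂ c c∈N) iy jy ic jc))))
      where
      open Context ctx
      jc : E B j c ≡ true
      jc = ≡.trans (adj-sym B j c) cj
    signs-agree {B} {S₁} {S₂} {x} {y} ctx {i} {j} i∈N j∈N ix iy jx jy
      (step {k = k} c c∈N k∈N ic ck (step d d∈N _ kd dj nil)) (acc rec) with E B i d in id | E B j c in jc
    ... | true | _ = signs-agree ctx i∈N j∈N ix iy jx jy (step d d∈N j∈N id dj nil) (rec (s≤s (s≤s z≤n)))
    ... | false | true = signs-agree ctx i∈N j∈N ix iy jx jy (step c c∈N j∈N ic (≡.trans (adj-sym B c j) jc) nil) (rec (s≤s (s≤s z≤n)))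
    ... | false | false with E B k x in kx | E B k y in ky
    ...   | true | true = ≡.trans
            (signs-agree ctx i∈N k∈N ix iy kx ky (step c c∈N k∈N ic ck nil) (rec (s≤s (s≤s z≤n))))
            (signs-agree ctx k∈N j∈N kx ky jx jy (step d d∈N j∈N kd dj nil) (rec (s≤s (s≤s z≤n))))
    -- Row k meets exactly one of x and y; together with c and d this is the Fano pattern, in the
    -- next case with x and y exchanged.
    ...   | true | false = ⊥-elim (noFano (TU-basis (Context.tu₁ ctx)) ix iy ic id kx ky (≡.trans (adj-sym B k c) ck) kd jx jy jc (≡.trans (adj-sym B j d) dj))
    ...   | false | true = ⊥-elim (noFano (TU-basis (Context.tu₁ ctx)) iy ix ic id ky kx (≡.trans (adj-sym B k c) ck) kd jy jx jc (≡.trans (adj-sym B j d) dj))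
    -- Row k meets neither column: the pivot on {k , c} makes i adjacent to d and leaves the columns
    -- x and y as they are.
    ...   | false | false = ≡.trans (≡.sym (fixed i)) (≡.trans
            (signs-agree ctx′ i∈N j∈N (x-keep ix) (y-keep iy) (x-keep jx) (y-keep jy)
              (step d d∈N j∈N id′ dj′ nil) (rec (s≤s (s≤s z≤n)))) (fixed j))
      where
      open Context ctx
      bB : Basis B
      bB = TU-basis tu₁
      kc : E B k c ≡ true
      kc = ≡.trans (adj-sym B k c) ck
      ctx′ = pivot-context ctx k∈N c∈N kc
      ik : E B i k ≡ false
      ik = same-colour bB (two-steps bB ic ck)
      xk : E B x k ≡ false
      xk = ≡.trans (adj-sym B x k) kx
      yk : E B y k ≡ false
      yk = ≡.trans (adj-sym B y k) ky
      xc : E B x c ≡ false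
      xc = same-colour bB (two-steps bB (≡.trans (adj-sym B x i) ix) ic)
      yc : E B y c ≡ false
      yc = same-colour bB (two-steps bB (≡.trans (adj-sym B y i) iy) ic)
      x-keep : ∀ {u} → E B u x ≡ true → E (B △ k △ c) u x ≡ true
      x-keep ux = ≡.trans (adj-sym _ _ x) (keep bB kc xk xc (≡.trans (adj-sym B x _) ux))
      y-keep : ∀ {u} → E B u y ≡ true → E (B △ k △ c) u y ≡ true
      y-keep uy = ≡.trans (adj-sym _ _ y) (keep bB kc yk yc (≡.trans (adj-sym B y _) uy))
      id′ : E (B △ k △ c) i d ≡ true
      id′ = pivot-value bB kc (λ { ≡.refl → true≢false (≡.trans (≡.sym kd) id) }) (adj-irrefl B ic)
        (adj-irrefl B kd ∘ ≡.sym) (λ { ≡.refl → true≢false (≡.trans (≡.sym ic) id) })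
        id ic (≡.trans (adj-sym B d k) kd) ik ≡.refl
      dj′ : E (B △ k △ c) d j ≡ true
      dj′ = ≡.trans (adj-sym _ d j) (keep bB kc (same-colour bB (two-steps bB (≡.trans (adj-sym B j d) dj) (≡.trans (adj-sym B d k) kd))) jc (≡.trans (adj-sym B j d) dj))
      fixed : ∀ u → pivot (S₁ k c) k c S₁ u x *₃ pivot (S₂ k c) k c S₂ u y ≡ S₁ u x *₃ S₂ u y
      fixed u = ≡.cong₂ _*₃_
        (pivot-fixes-column (TU.alt tu₁) (adj-irrefl B kc) (adj⇒nonzero tu₁ (N⊆W₁ k k∈N) (N⊆W₁ c c∈N) kc)
          (differs-from-k bB kc xc) (differs-from-l bB kc xk)
          (non-adj⇒zero tu₁ x∈W₁ (N⊆W₁ k k∈N) xk) (non-adj⇒zero tu₁ x∈W₁ (N⊆W₁ c c∈N) xc) u)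
        (pivot-fixes-column (TU.alt tu₂) (adj-irrefl B kc) (adj⇒nonzero tu₂ (N⊆W₂ k k∈N) (N⊆W₂ c c∈N) kc)
          (differs-from-k bB kc yc) (differs-from-l bB kc yk)
          (non-adj⇒zero tu₂ y∈W₂ (N⊆W₂ k k∈N) yk) (non-adj⇒zero tu₂ y∈W₂ (N⊆W₂ c c∈N) yc) u)
    signs-agree {B} {S₁} {S₂} {x} {y} ctx {i} {j} i∈N j∈N ix iy jx jy
      (step {k = k} c c∈N k∈N ic ck (step {k = r} d d∈N r∈N kd dr (step {k = q} e e∈N q∈N re eq p))) (acc rec)
      with E B i d in id | E B r c in rc | E B k e in ke | scan d q∈N p
    ... | true | _ | _ | _ = signs-agree ctx i∈N j∈N ix iy jx jy (step d d∈N r∈N id dr (step e e∈N q∈N re eq p)) (rec ℕₚ.≤-refl)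
    ... | false | true | _ | _ = signs-agree ctx i∈N j∈N ix iy jx jy (step c c∈N r∈N ic (≡.trans (adj-sym B c r) rc) (step e e∈N q∈N re eq p)) (rec ℕₚ.≤-refl)
    ... | false | false | true | _ = signs-agree ctx i∈N j∈N ix iy jx jy (step c c∈N k∈N ic ck (step e e∈N q∈N ke eq p)) (rec ℕₚ.≤-refl)
    -- A later row w is adjacent to d, so the path jumps from d to w.
    ... | false | false | false | inj₁ (s′ , w , s′≤s , w∈N , wd , p′) =
          signs-agree ctx i∈N j∈N ix iy jx jy (step c c∈N k∈N ic ck (step d d∈N w∈N kd (≡.trans (adj-sym B d w) wd) p′)) (rec (s≤s (s≤s (s≤s s′≤s))))
    -- No shortcut exists. The pivot on {k , d} joins c to r and thereby drops k from the path,
    -- while the rows i and j, adjacent to neither k nor d, keep their entries.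
    ... | false | false | false | inj₂ avoids = ≡.trans (≡.sym (fixed i∈N ik id)) (≡.trans
          (signs-agree ctx′ i∈N j∈N (keep bB kd ik id ix) (keep bB kd ik id iy) (keep bB kd jk jd jx) (keep bB kd jk jd jy)
            (step c c∈N r∈N (keep bB kd ik id ic) cr′ (step e e∈N q∈N re′ eq′ (path-keep bB kd qk-colour p avoids))) (rec ℕₚ.≤-refl))
          (fixed j∈N jk jd))
      where
      open Context ctx
      bB : Basis B
      bB = TU-basis tu₁
      ctx′ = pivot-context ctx k∈N d∈N kd
      rk-colour : lookup B r ≡ lookup B k
      rk-colour = ≡.sym (two-steps bB kd dr)
      qk-colour : lookup B q ≡ lookup B k
      qk-colour = ≡.trans (≡.sym (two-steps bB re eq)) rk-colour
      ik : E B i k ≡ false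
      ik = same-colour bB (two-steps bB ic ck)
      jk : E B j k ≡ false
      jk = same-colour bB (≡.trans (≡.sym (path-colour bB p)) qk-colour)
      jd : E B j d ≡ false
      jd = last-avoids p avoids
      rk : E B r k ≡ false
      rk = same-colour bB rk-colour
      cr′ : E (B △ k △ d) c r ≡ true
      cr′ = ≡.trans (adj-sym _ c r) (pivot-value bB kd
        (λ { ≡.refl → true≢false (≡.trans (≡.sym (≡.trans (adj-sym B r c) ck)) rc) })
        (adj-irrefl B dr ∘ ≡.sym) (adj-irrefl B ck) (λ { ≡.refl → true≢false (≡.trans (≡.sym ic) id) })
        rc (≡.trans (adj-sym B r d) dr) ck rk ≡.refl)
      re′ : E (B △ k △ d) r e ≡ true
      re′ = pivot-value bB kd
        (λ { ≡.refl → true≢false (≡.trans (≡.sym (≡.trans (adj-sym B r c) ck)) rc) })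
        (adj-irrefl B dr ∘ ≡.sym) (λ { ≡.refl → true≢false (≡.trans (≡.sym re) rk) })
        (λ { ≡.refl → true≢false (≡.trans (≡.sym kd) ke) })
        re (≡.trans (adj-sym B r d) dr) (≡.trans (adj-sym B e k) ke) rk ≡.refl
      eq′ : E (B △ k △ d) e q ≡ true
      eq′ = ≡.trans (adj-sym _ e q) (keep bB kd (same-colour bB qk-colour) (first-avoids p avoids) (≡.trans (adj-sym B q e) eq))
      fixed : ∀ {u} → lookup N u ≡ true → E B u k ≡ false → E B u d ≡ false →
              pivot (S₁ k d) k d S₁ u x *₃ pivot (S₂ k d) k d S₂ u y ≡ S₁ u x *₃ S₂ u y
      fixed {u} u∈N uk ud = ≡.cong₂ _*₃_
        (pivot-fixes-row (TU.alt tu₁) (adj-irrefl B kd) (adj⇒nonzero tu₁ (N⊆W₁ k k∈N) (N⊆W₁ d d∈N) kd)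
          (differs-from-k bB kd ud) (differs-from-l bB kd uk)
          (non-adj⇒zero tu₁ (N⊆W₁ u u∈N) (N⊆W₁ k k∈N) uk) (non-adj⇒zero tu₁ (N⊆W₁ u u∈N) (N⊆W₁ d d∈N) ud) x)
        (pivot-fixes-row (TU.alt tu₂) (adj-irrefl B kd) (adj⇒nonzero tu₂ (N⊆W₂ k k∈N) (N⊆W₂ d d∈N) kd)
          (differs-from-k bB kd ud) (differs-from-l bB kd uk)
          (non-adj⇒zero tu₂ (N⊆W₂ u u∈N) (N⊆W₂ k k∈N) uk) (non-adj⇒zero tu₂ (N⊆W₂ u u∈N) (N⊆W₂ d d∈N) ud) y)

-- Uniqueness and gluing of partial signings.

module _ {n : ℕ} where

  add-⊃ : ∀ {T : Subset n} {v} → lookup T v ≡ false → T ⊂ T △ v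
  add-⊃ {T} {v} v∉T = (λ {w} w∈T → true⇒∈ (≡.trans (△-other T (differ {X = T} (∈⇒true w∈T) v∉T)) (∈⇒true w∈T))) ,
    v , true⇒∈ (≡.trans (△-same T v) (≡.cong not v∉T)) , false⇒∉ v∉T

  remove-⊂ : ∀ {T : Subset n} {v} → lookup T v ≡ true → T △ v ⊂ T
  remove-⊂ {T} {v} v∈T = sub , v , true⇒∈ v∈T , false⇒∉ (≡.trans (△-same T v) (≡.cong not v∈T))
    where
    sub : T △ v ⊆ T
    sub {w} w∈ with w Finₚ.≟ v
    ... | yes ≡.refl = true⇒∈ v∈T
    ... | no w≢v = true⇒∈ (≡.trans (≡.sym (△-other T w≢v)) (∈⇒true w∈))

  remove-⊆ : ∀ {T : Subset n} {v} → lookup T v ≡ true → (T △ v) ⊆ᵇ T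
  remove-⊆ v∈T u u∈ = ∈⇒true (proj₁ (remove-⊂ v∈T) (true⇒∈ u∈))

  removed : ∀ (T : Subset n) {v} → lookup T v ≡ true → lookup (T △ v) v ≡ false
  removed T v∈T = ≡.trans (△-same T _) (≡.cong not v∈T)

  remove₂-⊂ : ∀ {X : Subset n} {k l} → k ≢ l → lookup X k ≡ true → lookup X l ≡ true → X △ k △ l ⊂ X
  remove₂-⊂ {X} {k} {l} k≢l k∈X l∈X =
    (λ u∈ → proj₁ (remove-⊂ k∈X) (proj₁ (remove-⊂ l∈X-k) u∈)) ,
    l , true⇒∈ l∈X , proj₂ (proj₂ (proj₂ (remove-⊂ l∈X-k)))
    where
    l∈X-k : lookup (X △ k) l ≡ true
    l∈X-k = ≡.trans (△-other X (k≢l ∘ ≡.sym)) l∈X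

  -- Closes a set under R inside N. The invariant P is rebuilt at each added element and so can
  -- record how that element was reached.
  grow : ∀ (P : Subset n → Set) (N : Subset n) (R : Fin n → Fin n → Bool) →
         (∀ {T u v} → P T → lookup T u ≡ true → lookup T v ≡ false → lookup N v ≡ true → R u v ≡ true → P (T △ v)) →
         ∀ {T} → P T → ∃ λ T′ → P T′ × (∀ u v → lookup T′ u ≡ true → lookup N v ≡ true → R u v ≡ true → lookup T′ v ≡ true)
  grow P N R add {T} p = go T p (⊃-wellFounded T)
    where
    go : ∀ T → P T → Acc _⊃_ T → ∃ λ T′ → P T′ × (∀ u v → lookup T′ u ≡ true → lookup N v ≡ true → R u v ≡ true → lookup T′ v ≡ true)
    go T p (acc rec) with Finₚ.any? (λ u → Finₚ.any? (λ v → (lookup T u Boolₚ.≟ true) ×-dec (lookup T v Boolₚ.≟ false) ×-dec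
                                                            (lookup N v Boolₚ.≟ true) ×-dec (R u v Boolₚ.≟ true)))
    ... | yes (u , v , u∈T , v∉T , v∈N , uv) = go (T △ v) (add p u∈T v∉T v∈N uv) (rec (add-⊃ v∉T))
    ... | no none = T , p , λ u v u∈T v∈N uv → Boolₚ.¬-not {lookup T v} {false} (λ v∉T → none (u , v , u∈T , v∉T , v∈N , uv))

module Gluing {n : ℕ} (M : Matroid n) (bin : BinaryPivots M) (noFano : NoFano M) where
  open MatroidFacts M
  open AdjacencyFacts M
  open PivotAdjacency M bin
  open TotallyUnimodular M
  open PathLemma M bin noFano
  open CommutativeRing F₃-ring using (zeroʳ; *-assoc; *-comm)

  private
    E : Subset n → Fin n → Fin n → Bool
    E = adj M

  data Connected (N B : Subset n) : Fin n → Fin n → Set where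
    here : ∀ {u} → Connected N B u u
    link : ∀ {u w} v → lookup N v ≡ true → E B u v ≡ true → Connected N B v w → Connected N B u w

  edge : ∀ {N B u v} → lookup N v ≡ true → E B u v ≡ true → Connected N B u v
  edge v∈N uv = link _ v∈N uv here

  infixr 5 _⟫_
  _⟫_ : ∀ {N B u v w} → Connected N B u v → Connected N B v w → Connected N B u w
  here ⟫ q = q
  link v v∈N uv p ⟫ q = link v v∈N uv (p ⟫ q)

  connected-sym : ∀ {N B u v} → lookup N u ≡ true → Connected N B u v → Connected N B v u
  connected-sym u∈N here = here
  connected-sym {B = B} {u} u∈N (link v v∈N uv p) = connected-sym v∈N p ⟫ edge u∈N (≡.trans (adj-sym B v u) uv)

  -- Edges alternate between the two sides of B, so a walk between elements of one side consists of
  -- double steps.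
  connected⇒path : ∀ {N B i j} → Basis B → lookup B i ≡ lookup B j → Connected N B i j → ∃ λ s → Path N B s i j
  connected⇒path bB col here = zero , nil
  connected⇒path bB col (link c c∈N ic here) = ⊥-elim (Boolₚ.not-¬ (≡.sym col) (adj-colour bB ic))
  connected⇒path bB col (link c c∈N ic (link k k∈N ck p))
    with connected⇒path bB (≡.trans (≡.sym (two-steps bB ic ck)) col) p
  ... | s , q = suc s , step c c∈N k∈N ic ck q

  TU-restrict : ∀ {W W′ B S} → W′ ⊆ᵇ W → TU W B S → TU W′ B S
  TU-restrict W′⊆W tu = record
    { alt = TU.alt tu
    ; nonsingular⇒basis = λ X X⊆W′ → TU.nonsingular⇒basis tu X λ u u∈X → W′⊆W u (X⊆W′ u u∈X)
    ; basis⇒nonsingular = λ X X⊆W′ → TU.basis⇒nonsingular tu X λ u u∈X → W′⊆W u (X⊆W′ u u∈X)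
    }

  TU-cong : ∀ {W B S T} → Alternating T → (∀ u v → lookup W u ≡ true → lookup W v ≡ true → S u v ≡ T u v) →
            TU W B S → TU W B T
  TU-cong {S = S} {T} alt e tu = record
    { alt = alt
    ; nonsingular⇒basis = λ X X⊆W ns → TU.nonsingular⇒basis tu X X⊆W
        (nonsingular-cong {T} {S} {X} (λ u v u∈X v∈X → ≡.sym (e u v (X⊆W u u∈X) (X⊆W v v∈X))) ns)
    ; basis⇒nonsingular = λ X X⊆W b →
        nonsingular-cong {S} {T} {X} (λ u v u∈X v∈X → e u v (X⊆W u u∈X) (X⊆W v v∈X)) (TU.basis⇒nonsingular tu X X⊆W b)
    }

  -- The congruence D S D with D the diagonal matrix of ϵ. Products with an alternating S stay
  -- alternating, which one-sided scaling would not ensure.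
  scale : (Fin n → Fin 3) → Matrix → Matrix
  scale ϵ S u v = ϵ u *₃ (ϵ v *₃ S u v)

  private
    sign-cancel : ∀ e x → e ≢ 0₃ → e *₃ (e *₃ x) ≡ x
    sign-cancel = from-yes (Finₚ.all? λ e → Finₚ.all? λ x → ¬? (e Finₚ.≟ 0₃) →-dec (e *₃ (e *₃ x) Finₚ.≟ x))

    neg-scale : ∀ e f x → e *₃ (f *₃ (-₃ x)) ≡ -₃ (f *₃ (e *₃ x))
    neg-scale = from-yes (Finₚ.all? λ e → Finₚ.all? λ f → Finₚ.all? λ x → e *₃ (f *₃ (-₃ x)) Finₚ.≟ -₃ (f *₃ (e *₃ x)))

    zero-scale : ∀ e f → e *₃ (f *₃ 0₃) ≡ 0₃
    zero-scale = from-yes (Finₚ.all? λ e → Finₚ.all? λ f → e *₃ (f *₃ 0₃) Finₚ.≟ 0₃)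

    regroup : ∀ e f x z → (e *₃ (f *₃ x)) *₃ z ≡ e *₃ (x *₃ (f *₃ z))
    regroup = from-yes (Finₚ.all? λ e → Finₚ.all? λ f → Finₚ.all? λ x → Finₚ.all? λ z →
      (e *₃ (f *₃ x)) *₃ z Finₚ.≟ e *₃ (x *₃ (f *₃ z)))

  scale-alternating : ∀ ϵ {S} → Alternating S → Alternating (scale ϵ S)
  scale-alternating ϵ {S} (diagonal , skew) =
    (λ u → ≡.trans (≡.cong (λ x → ϵ u *₃ (ϵ u *₃ x)) (diagonal u)) (zero-scale (ϵ u) (ϵ u))) ,
    λ u v → ≡.trans (≡.cong (λ x → ϵ u *₃ (ϵ v *₃ x)) (skew u v)) (neg-scale (ϵ u) (ϵ v) (S v u))

  scale-nonsingular : ∀ ϵ → (∀ u → ϵ u ≢ 0₃) → ∀ {S X} → Nonsingular S X → Nonsingular (scale ϵ S) X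
  scale-nonsingular ϵ nz {S} {X} ns z supp ker u = product-zero (nz u)
    (ns (λ v → ϵ v *₃ z v) (λ v v∉X → ≡.trans (≡.cong (ϵ v *₃_) (supp v v∉X)) (zeroʳ (ϵ v)))
      (λ v v∈X → product-zero (nz v) (≡.trans (≡.sym (apply v)) (ker v v∈X))) u)
    where
    apply : ∀ v → (scale ϵ S · z) v ≡ ϵ v *₃ (S · (λ w → ϵ w *₃ z w)) v
    apply v = ≡.trans (sum-cong λ w → regroup (ϵ v) (ϵ w) (S v w) (z w)) (sum-*ˡ (ϵ v) (λ w → S v w *₃ (ϵ w *₃ z w)))

  TU-scale : ∀ ϵ → (∀ u → ϵ u ≢ 0₃) → ∀ {W B S} → TU W B S → TU W B (scale ϵ S)
  TU-scale ϵ nz {S = S} tu = record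
    { alt = scale-alternating ϵ (TU.alt tu)
    ; nonsingular⇒basis = λ X X⊆W ns → TU.nonsingular⇒basis tu X X⊆W
        (nonsingular-cong {scale ϵ (scale ϵ S)} {S} {X} (λ u v _ _ → unscale u v) (scale-nonsingular ϵ nz {X = X} ns))
    ; basis⇒nonsingular = λ X X⊆W b → scale-nonsingular ϵ nz {X = X} (TU.basis⇒nonsingular tu X X⊆W b)
    }
    where
    unscale′ : ∀ e f x → e ≢ 0₃ → f ≢ 0₃ → e *₃ (f *₃ (e *₃ (f *₃ x))) ≡ x
    unscale′ = from-yes (Finₚ.all? λ e → Finₚ.all? λ f → Finₚ.all? λ x →
      ¬? (e Finₚ.≟ 0₃) →-dec (¬? (f Finₚ.≟ 0₃) →-dec (e *₃ (f *₃ (e *₃ (f *₃ x))) Finₚ.≟ x)))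
    unscale : ∀ u v → scale ϵ (scale ϵ S) u v ≡ S u v
    unscale u v = unscale′ (ϵ u) (ϵ v) (S u v) (nz u) (nz v)

  -- Two signings of the same exchange graph differ by a scaling: vertices where the columns of z
  -- disagree are connected only to vertices where they disagree as well.
  scaling-unique : ∀ {B S₁ S₂} N → Acc _⊂_ N → TU N B S₁ → TU N B S₂ →
    ∃ λ ϵ → (∀ u → ϵ u ≢ 0₃) × (∀ u v → lookup N u ≡ true → lookup N v ≡ true → S₁ u v ≡ scale ϵ S₂ u v)
  scaling-unique {B} {S₁} {S₂} N (acc rec) tu₁ tu₂ with Finₚ.any? (λ z → lookup N z Boolₚ.≟ true)
  ... | no empty = (λ _ → 1₃) , (λ _ ()) , λ u v u∈N _ → ⊥-elim (empty (u , u∈N))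
  ... | yes (z , z∈N) = extend (scaling-unique (N △ z) (rec (remove-⊂ z∈N))
          (TU-restrict (remove-⊆ z∈N) tu₁) (TU-restrict (remove-⊆ z∈N) tu₂))
    where
    bB : Basis B
    bB = TU-basis tu₁
    N′ : Subset n
    N′ = N △ z
    extend : (∃ λ ϵ → (∀ u → ϵ u ≢ 0₃) × (∀ u v → lookup N′ u ≡ true → lookup N′ v ≡ true → S₁ u v ≡ scale ϵ S₂ u v)) →
             ∃ λ ϵ → (∀ u → ϵ u ≢ 0₃) × (∀ u v → lookup N u ≡ true → lookup N v ≡ true → S₁ u v ≡ scale ϵ S₂ u v)
    extend (ϵ , ϵ≢0 , same) = (λ u → μ u *₃ ϵ u) , μϵ≢0 , λ u v u∈N v∈N →
        ≡.trans (final u v u∈N v∈N) (merge (μ u) (μ v) (ϵ u) (ϵ v) (S₂ u v))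
      where
      merge : ∀ a b e f x → a *₃ (b *₃ (e *₃ (f *₃ x))) ≡ (a *₃ e) *₃ ((b *₃ f) *₃ x)
      merge = from-yes (Finₚ.all? λ a → Finₚ.all? λ b → Finₚ.all? λ e → Finₚ.all? λ f → Finₚ.all? λ x →
        a *₃ (b *₃ (e *₃ (f *₃ x))) Finₚ.≟ (a *₃ e) *₃ ((b *₃ f) *₃ x))
      S₂′ : Matrix
      S₂′ = scale ϵ S₂
      tu₂′ : TU N B S₂′
      tu₂′ = TU-scale ϵ ϵ≢0 tu₂
      ctx : Context N′ B S₁ S₂′ z z
      ctx = record { W₁ = N ; W₂ = N ; tu₁ = tu₁ ; tu₂ = tu₂′ ; N⊆W₁ = remove-⊆ z∈N ; N⊆W₂ = remove-⊆ z∈N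
                   ; x∈W₁ = z∈N ; y∈W₂ = z∈N ; agree = same }
      -- As z is outside N′, flipping signs on whole components of N′ corrects column z and leaves
      -- the entries inside N′ alone. The components to flip are those containing a vertex where
      -- column z disagrees.
      Seed : Fin n → Set
      Seed u = lookup N′ u ≡ true × S₁ u z ≢ 0₃ × S₁ u z ≢ S₂′ u z
      seed? : ∀ u → Dec (Seed u)
      seed? u = (lookup N′ u Boolₚ.≟ true) ×-dec ¬? (S₁ u z Finₚ.≟ 0₃) ×-dec ¬? (S₁ u z Finₚ.≟ S₂′ u z)
      seeds : Subset n
      seeds = comprehension seed?
      Seeded : Subset n → Set
      Seeded T = (seeds ⊆ᵇ T) × (∀ u → lookup T u ≡ true → lookup N′ u ≡ true × ∃ λ s → Seed s × Connected N′ B u s)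
      add : ∀ {T u v} → Seeded T → lookup T u ≡ true → lookup T v ≡ false → lookup N′ v ≡ true → E B u v ≡ true → Seeded (T △ v)
      add {T} {u} {v} (contains , linked) u∈T v∉T v∈N′ uv =
        (λ w w∈ → ∈⇒true (proj₁ (add-⊃ v∉T) (true⇒∈ (contains w w∈)))) , linked′
        where
        linked′ : ∀ w → lookup (T △ v) w ≡ true → lookup N′ w ≡ true × ∃ λ s → Seed s × Connected N′ B w s
        linked′ w w∈ with w Finₚ.≟ v
        ... | no w≢v = linked w (≡.trans (≡.sym (△-other T w≢v)) w∈)
        ... | yes ≡.refl with linked u u∈T
        ...   | u∈N′ , s , seed , conn = v∈N′ , s , seed , link u u∈N′ (≡.trans (adj-sym B w u) uv) conn
      grown : ∃ λ T → Seeded T × (∀ u v → lookup T u ≡ true → lookup N′ v ≡ true → E B u v ≡ true → lookup T v ≡ true)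
      grown = grow Seeded N′ (E B) add {seeds}
        ((λ _ u∈ → u∈) , λ u u∈ → proj₁ (comprehension⇒ seed? u∈) , u , comprehension⇒ seed? u∈ , here)
      T : Subset n
      T = proj₁ grown
      seeded : Seeded T
      seeded = proj₁ (proj₂ grown)
      closed : ∀ u v → lookup T u ≡ true → lookup N′ v ≡ true → E B u v ≡ true → lookup T v ≡ true
      closed = proj₂ (proj₂ grown)
      sign : Bool → Fin 3
      sign b = if b then 2₃ else 1₃
      μ : Fin n → Fin 3
      μ u = sign (lookup T u)
      sign-nonzero : ∀ b e → e ≢ 0₃ → sign b *₃ e ≢ 0₃
      sign-nonzero b 0₃ nz = ⊥-elim (nz ≡.refl)
      sign-nonzero true 1₃ _ ()
      sign-nonzero true 2₃ _ ()
      sign-nonzero false (suc _) _ ()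
      μϵ≢0 : ∀ u → μ u *₃ ϵ u ≢ 0₃
      μϵ≢0 u = sign-nonzero (lookup T u) (ϵ u) (ϵ≢0 u)
      T-z : lookup T z ≡ false
      T-z = ¬true⇒false λ e → true≢false (≡.trans (≡.sym (proj₁ (proj₂ seeded z e))) (removed N z∈N))
      opposite : ∀ a b c d → c ≢ 0₃ → d ≢ 0₃ → a *₃ b ≡ c *₃ d → c ≢ d → a ≡ 2₃ *₃ (1₃ *₃ b)
      opposite = from-yes (Finₚ.all? λ a → Finₚ.all? λ b → Finₚ.all? λ c → Finₚ.all? λ d → ¬? (c Finₚ.≟ 0₃) →-dec
        (¬? (d Finₚ.≟ 0₃) →-dec ((a *₃ b Finₚ.≟ c *₃ d) →-dec (¬? (c Finₚ.≟ d) →-dec (a Finₚ.≟ 2₃ *₃ (1₃ *₃ b))))))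
      column : ∀ u → lookup N′ u ≡ true → S₁ u z ≡ sign (lookup T u) *₃ (1₃ *₃ S₂′ u z)
      column u u∈N′ with E B u z in uz
      ... | false = ≡.trans (non-adj⇒zero tu₁ (remove-⊆ z∈N u u∈N′) z∈N uz)
              (≡.sym (≡.trans (≡.cong (λ x → sign (lookup T u) *₃ (1₃ *₃ x)) (non-adj⇒zero tu₂′ (remove-⊆ z∈N u u∈N′) z∈N uz)) (zero-scale (sign (lookup T u)) 1₃)))
      ... | true with lookup T u in u∈T
      ...   | false = decidable-stable (S₁ u z Finₚ.≟ S₂′ u z) λ d →
                true≢false (≡.trans (≡.sym (proj₁ seeded u (⇒comprehension seed? (u∈N′ , adj⇒nonzero tu₁ (remove-⊆ z∈N u u∈N′) z∈N uz , d)))) u∈T)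
      ...   | true with proj₂ seeded u u∈T
      -- The product of the two entries at u equals the product at the seed s, where it is - 1.
      ...     | _ , s , (s∈N′ , nz , d) , conn =
                opposite (S₁ u z) (S₂′ u z) (S₁ s z) (S₂′ s z) nz (adj⇒nonzero tu₂′ (remove-⊆ z∈N s s∈N′) z∈N sz)
                  (signs-agree ctx u∈N′ s∈N′ uz uz sz sz (proj₂ path) (<-wellFounded (proj₁ path))) d
        where
        sz : E B s z ≡ true
        sz = nonzero⇒adj tu₁ (remove-⊆ z∈N s s∈N′) z∈N nz
        path : ∃ λ m → Path N′ B m u s
        path = connected⇒path bB (two-steps bB uz (≡.trans (adj-sym B z s) sz)) conn
      final : ∀ u v → lookup N u ≡ true → lookup N v ≡ true → S₁ u v ≡ scale μ S₂′ u v
      final u v u∈N v∈N with u Finₚ.≟ z | v Finₚ.≟ z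
      ... | yes ≡.refl | yes ≡.refl = ≡.trans (proj₁ (TU.alt tu₁) u) (≡.sym (proj₁ (scale-alternating μ (TU.alt tu₂′)) u))
      ... | no u≢z | yes ≡.refl = ≡.trans (column u (≡.trans (△-other N u≢z) u∈N))
              (≡.cong (λ b → μ u *₃ (sign b *₃ S₂′ u v)) (≡.sym T-z))
      ... | yes ≡.refl | no v≢z = ≡.trans (proj₂ (TU.alt tu₁) u v) (≡.trans (≡.cong -₃_
              (≡.trans (column v (≡.trans (△-other N v≢z) v∈N)) (≡.cong (λ b → μ v *₃ (sign b *₃ S₂′ v u)) (≡.sym T-z))))
              (≡.sym (proj₂ (scale-alternating μ (TU.alt tu₂′)) u v)))
      ... | no u≢z | no v≢z = ≡.trans (same u v u∈N′ v∈N′) inside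
        where
        u∈N′ : lookup N′ u ≡ true
        u∈N′ = ≡.trans (△-other N u≢z) u∈N
        v∈N′ : lookup N′ v ≡ true
        v∈N′ = ≡.trans (△-other N v≢z) v∈N
        equal-sides : ∀ b c x → b ≡ c → x ≡ sign b *₃ (sign c *₃ x)
        equal-sides true .true x ≡.refl = ≡.sym (sign-cancel 2₃ x λ ())
        equal-sides false .false x ≡.refl = ≡.refl
        inside : S₂′ u v ≡ scale μ S₂′ u v
        inside with E B u v in uv
        ... | false = ≡.trans z₀ (≡.sym (≡.trans (≡.cong (λ x → μ u *₃ (μ v *₃ x)) z₀) (zero-scale (μ u) (μ v))))
          where
          z₀ : S₂′ u v ≡ 0₃
          z₀ = non-adj⇒zero tu₂′ u∈N v∈N uv
        ... | true = equal-sides (lookup T u) (lookup T v) (S₂′ u v) T-same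
          where
          T-same : lookup T u ≡ lookup T v
          T-same with lookup T u in p | lookup T v in q
          ... | true | true = ≡.refl
          ... | false | false = ≡.refl
          ... | true | false = ≡.trans (≡.sym (closed u v p v∈N′ uv)) q
          ... | false | true = ≡.trans (≡.sym p) (closed v u q u∈N′ (≡.trans (adj-sym B v u) uv))

module Combining {n : ℕ} (M : Matroid n) (bin : BinaryPivots M) (noFano : NoFano M) where
  open MatroidFacts M
  open AdjacencyFacts M
  open PivotAdjacency M bin
  open TotallyUnimodular M
  open PathLemma M bin noFano
  open Gluing M bin noFano
  open CommutativeRing F₃-ring using (zeroʳ)

  private
    E : Subset n → Fin n → Fin n → Bool
    E = adj M

    vanish : ∀ s a p q t r → s ≡ 0₃ → (p ≡ 0₃ ⊎ q ≡ 0₃) → (t ≡ 0₃ ⊎ r ≡ 0₃) → s +₃ a *₃ (p *₃ q +₃ -₃ (t *₃ r)) ≡ 0₃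
    vanish s a p q t r ≡.refl pq tr = ≡.trans (≡.cong₂ (λ x y → a *₃ (x +₃ -₃ y)) (product pq) (product tr)) (zeroʳ a)
      where
      product : ∀ {x y} → (x ≡ 0₃ ⊎ y ≡ 0₃) → x *₃ y ≡ 0₃
      product (inj₁ ≡.refl) = ≡.refl
      product {x} (inj₂ ≡.refl) = zeroʳ x

  -- All edges inside X are at y. After a pivot on one of them, no edge remains on X without its two
  -- ends, since every product in the correction has a factor away from y.
  detects-star : ∀ {S B} → Alternating S → Basis B → ∀ X y → lookup X y ≡ true →
    (∀ u v → lookup X u ≡ true → lookup X v ≡ true → u ≢ y → v ≢ y → S u v ≡ 0₃ × E B u v ≡ false) →
    (∀ v → lookup X v ≡ true → (S y v ≡ 0₃ → E B y v ≡ false) × (E B y v ≡ false → S y v ≡ 0₃)) →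
    Detects S B X
  detects-star {S} {B} alt bB X y y∈X away at-y
    with Finₚ.any? (λ j → (lookup X j Boolₚ.≟ true) ×-dec (E B y j Boolₚ.≟ true))
  ... | no none = detects-no-edge X alt bB no-edge
    where
    at-y-none : ∀ v → lookup X v ≡ true → E B y v ≡ false
    at-y-none v v∈X = ¬true⇒false λ e → none (v , v∈X , e)
    no-edge : ∀ u v → lookup X u ≡ true → lookup X v ≡ true → S u v ≡ 0₃ × E B u v ≡ false
    no-edge u v u∈X v∈X with u Finₚ.≟ y | v Finₚ.≟ y
    ... | yes ≡.refl | _ = proj₂ (at-y v v∈X) (at-y-none v v∈X) , at-y-none v v∈X
    ... | no _ | yes ≡.refl = ≡.trans (proj₂ alt u v) (≡.cong -₃_ (proj₂ (at-y u u∈X) (at-y-none u u∈X))) , ≡.trans (adj-sym B u v) (at-y-none u u∈X)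
    ... | no u≢y | no v≢y = away u v u∈X v∈X u≢y v≢y
  ... | yes (j , j∈X , yj) = detects-unpivot alt y≢j nz (detects-no-edge (X △ y △ j) P.alternating (pivot-basis bB yj) no-edge)
    where
    y≢j : y ≢ j
    y≢j = adj-irrefl B yj
    nz : S y j ≢ 0₃
    nz z = true≢false (≡.trans (≡.sym yj) (proj₁ (at-y j j∈X) z))
    module P = Pivot alt y≢j ≡.refl (square₃ nz)
    no-edge : ∀ u v → lookup (X △ y △ j) u ≡ true → lookup (X △ y △ j) v ≡ true → P.S′ u v ≡ 0₃ × E (B △ y △ j) u v ≡ false
    no-edge u v u∈ v∈ = ≡.trans (P.pivot-other (≢y u∈) (≢j u∈) (≢y v∈) (≢j v∈))
          (vanish (S u v) (S y j) (S u j) (S v y) (S u y) (S v j) (proj₁ uv) (inj₁ (proj₁ uj)) (inj₂ (proj₁ vj))) ,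
        ≡.trans (pivot-value bB yj (≢y u∈) (≢j u∈) (≢y v∈) (≢j v∈) (proj₂ uv) (proj₂ uj) ≡.refl ≡.refl (proj₂ vj)) (Boolₚ.∧-zeroʳ (E B u y))
      where
      ≢y : ∀ {w} → lookup (X △ y △ j) w ≡ true → w ≢ y
      ≢y w∈ ≡.refl = true≢false (≡.trans (≡.sym w∈) (≡.trans (△△-∈ X y≢j) (≡.cong not y∈X)))
      ≢j : ∀ {w} → lookup (X △ y △ j) w ≡ true → w ≢ j
      ≢j w∈ ≡.refl = true≢false (≡.trans (≡.sym w∈) (≡.trans (△△-∈′ X y≢j) (≡.cong not j∈X)))
      in-X : ∀ {w} → lookup (X △ y △ j) w ≡ true → lookup X w ≡ true
      in-X w∈ = ≡.trans (≡.sym (△△-other X (≢y w∈) (≢j w∈))) w∈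
      uv = away u v (in-X u∈) (in-X v∈) (≢y u∈) (≢y v∈)
      uj = away u j (in-X u∈) j∈X (≢y u∈) (y≢j ∘ ≡.sym)
      vj = away v j (in-X v∈) j∈X (≢y v∈) (y≢j ∘ ≡.sym)

  module _ {N B : Subset n} {k l : Fin n} (bB : Basis B) (kl : E B k l ≡ true)
           (k∈N : lookup N k ≡ true) (l∈N : lookup N l ≡ true) where
    private
      B′ : Subset n
      B′ = B △ k △ l
      bB′ : Basis B′
      bB′ = pivot-basis bB kl
      kl′ : E B′ k l ≡ true
      kl′ = adj-kl bB kl
      lk′ : E B′ l k ≡ true
      lk′ = ≡.trans (adj-sym B′ l k) kl′
      back : ∀ u v → E (B′ △ k △ l) u v ≡ E B u v
      back u v = ≡.cong (λ X → E X u v) (△△-involutive B k l)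

    -- The pivot rule read backwards: an edge u v that is missing after the pivot is replaced by one
    -- of the walks u - l - k - v and u - k - l - v. Edges at k or l become walks of at most two
    -- edges.
    edge-connected : ∀ {u v} → lookup N u ≡ true → lookup N v ≡ true → E B u v ≡ true → Connected N B′ u v
    edge-connected {u} {v} u∈N v∈N uv with u Finₚ.≟ v
    ... | yes ≡.refl = here
    ... | no u≢v with u Finₚ.≟ k | u Finₚ.≟ l | v Finₚ.≟ k | v Finₚ.≟ l
    ...   | yes ≡.refl | _ | yes ≡.refl | _ = here
    ...   | yes ≡.refl | _ | _ | yes ≡.refl = edge v∈N kl′
    ...   | yes ≡.refl | _ | no v≢k | no v≢l = edge l∈N kl′ ⟫ edge v∈N (≡.trans (adj-l bB kl v≢k v≢l) uv)
    ...   | _ | yes ≡.refl | yes ≡.refl | _ = edge v∈N lk′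
    ...   | _ | yes ≡.refl | _ | yes ≡.refl = here
    ...   | _ | yes ≡.refl | no v≢k | no v≢l = edge k∈N lk′ ⟫ edge v∈N (≡.trans (adj-k bB kl v≢k v≢l) uv)
    ...   | no u≢k | no u≢l | yes ≡.refl | _ = edge l∈N (≡.trans (adj-sym B′ u l) (≡.trans (adj-l bB kl u≢k u≢l) (≡.trans (adj-sym B v u) uv))) ⟫ edge v∈N lk′
    ...   | no u≢k | no u≢l | _ | yes ≡.refl = edge k∈N (≡.trans (adj-sym B′ u k) (≡.trans (adj-k bB kl u≢k u≢l) (≡.trans (adj-sym B v u) uv))) ⟫ edge v∈N kl′
    ...   | no u≢k | no u≢l | no v≢k | no v≢l with E B′ u v in a | E B′ u l in b | E B′ v k in c | E B′ u k in d | E B′ v l in e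
    ...     | true | _ | _ | _ | _ = edge v∈N a
    ...     | false | true | true | _ | _ = edge l∈N b ⟫ edge k∈N lk′ ⟫ edge v∈N (≡.trans (adj-sym B′ k v) c)
    ...     | false | _ | _ | true | true = edge k∈N d ⟫ edge l∈N kl′ ⟫ edge v∈N (≡.trans (adj-sym B′ l v) e)
    ...     | false | false | _ | false | _ = ⊥-elim (true≢false (≡.trans (≡.sym uv) (≡.trans (≡.sym (back u v)) (pivot-value bB′ kl′ u≢k u≢l v≢k v≢l a b c d e))))
    ...     | false | false | _ | true | false = ⊥-elim (true≢false (≡.trans (≡.sym uv) (≡.trans (≡.sym (back u v)) (pivot-value bB′ kl′ u≢k u≢l v≢k v≢l a b c d e))))
    ...     | false | true | false | false | _ = ⊥-elim (true≢false (≡.trans (≡.sym uv) (≡.trans (≡.sym (back u v)) (pivot-value bB′ kl′ u≢k u≢l v≢k v≢l a b c d e))))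
    ...     | false | true | false | true | false = ⊥-elim (true≢false (≡.trans (≡.sym uv) (≡.trans (≡.sym (back u v)) (pivot-value bB′ kl′ u≢k u≢l v≢k v≢l a b c d e))))

    connected-pivot : ∀ {u v} → lookup N u ≡ true → Connected N B u v → Connected N B′ u v
    connected-pivot u∈N here = here
    connected-pivot u∈N (link v v∈N uv p) = edge-connected u∈N v∈N uv ⟫ connected-pivot v∈N p

    -- The pivot gives x new neighbours only by way of k or l: one of these was a neighbour of x
    -- before, and it is connected to the new neighbour.
    neighbour-pivot : ∀ {x} → x ≢ k → x ≢ l → ∀ {i} → lookup N i ≡ true → E B′ i x ≡ true →
                      ∃ λ j → lookup N j ≡ true × E B j x ≡ true × Connected N B′ i j
    neighbour-pivot {x} x≢k x≢l {i} i∈N ix with i Finₚ.≟ k | i Finₚ.≟ l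
    ... | yes ≡.refl | _ = l , l∈N , ≡.trans (≡.sym (adj-k bB kl x≢k x≢l)) ix , edge l∈N kl′
    ... | no _ | yes ≡.refl = k , k∈N , ≡.trans (≡.sym (adj-l bB kl x≢k x≢l)) ix , edge k∈N lk′
    ... | no i≢k | no i≢l with E B i x in a | E B i l in b | E B x k in c | E B i k in d | E B x l in e
    ...   | true | _ | _ | _ | _ = i , i∈N , a , here
    ...   | false | true | true | _ | _ = k , k∈N , ≡.trans (adj-sym B k x) c , edge-connected i∈N l∈N b ⟫ edge k∈N lk′
    ...   | false | _ | _ | true | true = l , l∈N , ≡.trans (adj-sym B l x) e , edge-connected i∈N k∈N d ⟫ edge l∈N kl′
    ...   | false | false | _ | false | _ = ⊥-elim (true≢false (≡.trans (≡.sym ix) (pivot-value bB kl i≢k i≢l x≢k x≢l a b c d e)))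
    ...   | false | false | _ | true | false = ⊥-elim (true≢false (≡.trans (≡.sym ix) (pivot-value bB kl i≢k i≢l x≢k x≢l a b c d e)))
    ...   | false | true | false | false | _ = ⊥-elim (true≢false (≡.trans (≡.sym ix) (pivot-value bB kl i≢k i≢l x≢k x≢l a b c d e)))
    ...   | false | true | false | true | false = ⊥-elim (true≢false (≡.trans (≡.sym ix) (pivot-value bB kl i≢k i≢l x≢k x≢l a b c d e)))

  module _ {W : Subset n} {x y : Fin n} (x≢y : x ≢ y) (x∈W : lookup W x ≡ true) (y∈W : lookup W y ≡ true) where

    rest : Subset n
    rest = W △ x △ y

    -- Weaker than connectedness of `rest`, but preserved by pivots inside `rest`; it supplies the
    -- paths along which `signs-agree` compares rows.
    NeighboursConnected : Subset n → Set
    NeighboursConnected B = ∀ i j → lookup rest i ≡ true → lookup rest j ≡ true → E B i x ≡ true → E B j x ≡ true → Connected rest B i j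

    private
      rest-≢x : ∀ {u} → lookup rest u ≡ true → u ≢ x
      rest-≢x u∈ ≡.refl = true≢false (≡.trans (≡.sym u∈) (≡.trans (△△-∈ W x≢y) (≡.cong not x∈W)))
      rest-≢y : ∀ {u} → lookup rest u ≡ true → u ≢ y
      rest-≢y u∈ ≡.refl = true≢false (≡.trans (≡.sym u∈) (≡.trans (△△-∈′ W x≢y) (≡.cong not y∈W)))
      rest-W : ∀ {u} → lookup rest u ≡ true → lookup W u ≡ true
      rest-W u∈ = ≡.trans (≡.sym (△△-other W (rest-≢x u∈) (rest-≢y u∈))) u∈
      rest-W-x : rest ⊆ᵇ (W △ x)
      rest-W-x u u∈ = ≡.trans (△-other W (rest-≢x u∈)) (rest-W u∈)
      rest-W-y : rest ⊆ᵇ (W △ y)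
      rest-W-y u u∈ = ≡.trans (△-other W (rest-≢y u∈)) (rest-W u∈)
      in-rest : ∀ {u} → lookup W u ≡ true → u ≢ x → u ≢ y → lookup rest u ≡ true
      in-rest u∈W u≢x u≢y = ≡.trans (△△-other W u≢x u≢y) u∈W
      x∈W-y : lookup (W △ y) x ≡ true
      x∈W-y = ≡.trans (△-other W x≢y) x∈W
      y∈W-x : lookup (W △ x) y ≡ true
      y∈W-x = ≡.trans (△-other W (x≢y ∘ ≡.sym)) y∈W

      minor-signs : ∀ p q r s → p *₃ q ≡ r *₃ s → p ≢ 0₃ → r ≢ 0₃ → -₃ s +₃ (-₃ p) *₃ ((-₃ q) *₃ r) ≡ 0₃
      minor-signs = from-yes (Finₚ.all? λ p → Finₚ.all? λ q → Finₚ.all? λ r → Finₚ.all? λ s →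
        (p *₃ q Finₚ.≟ r *₃ s) →-dec (¬? (p Finₚ.≟ 0₃) →-dec (¬? (r Finₚ.≟ 0₃) →-dec (-₃ s +₃ (-₃ p) *₃ ((-₃ q) *₃ r) Finₚ.≟ 0₃))))

      nonzero-minor : ∀ a p r → a ≢ 0₃ → p ≢ 0₃ → r ≢ 0₃ → a *₃ (p *₃ r) ≢ 0₃
      nonzero-minor = from-yes (Finₚ.all? λ a → Finₚ.all? λ p → Finₚ.all? λ r →
        ¬? (a Finₚ.≟ 0₃) →-dec (¬? (p Finₚ.≟ 0₃) →-dec (¬? (r Finₚ.≟ 0₃) →-dec ¬? (a *₃ (p *₃ r) Finₚ.≟ 0₃))))

    neighbours-pivot : ∀ {B k l} → Basis B → E B k l ≡ true → lookup rest k ≡ true → lookup rest l ≡ true →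
                       NeighboursConnected B → NeighboursConnected (B △ k △ l)
    neighbours-pivot {B} {k} {l} bB kl k∈ l∈ Q i j i∈ j∈ ix jx
      with neighbour-pivot bB kl k∈ l∈ (rest-≢x k∈ ∘ ≡.sym) (rest-≢x l∈ ∘ ≡.sym) i∈ ix
         | neighbour-pivot bB kl k∈ l∈ (rest-≢x k∈ ∘ ≡.sym) (rest-≢x l∈ ∘ ≡.sym) j∈ jx
    ... | i′ , i′∈ , i′x , ii′ | j′ , j′∈ , j′x , jj′ =
          ii′ ⟫ connected-pivot bB kl k∈ l∈ i′∈ (Q i′ j′ i′∈ j′∈ i′x j′x) ⟫ connected-sym j∈ jj′

    -- Only sets X containing both x and y are new. Edges of X away from x and y are pivoted out;
    -- then either x has no neighbour left in X or one more pivot is made at x, and in both cases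
    -- the remaining edges form a star at y. Its support is right because the 2 × 2 minors in the
    -- columns x and y without zero entries vanish.
    combine-detects : ∀ {B S} → lookup B x ≡ lookup B y → S x y ≡ 0₃ → TU (W △ y) B S → TU (W △ x) B S →
                      NeighboursConnected B → ∀ X → X ⊆ᵇ W → Acc _⊂_ X → Detects S B X
    combine-detects {B} {S} xy-side Sxy tuˣ tuʸ Q X X⊆W (acc rec) with lookup X x in x∈X | lookup X y in y∈X
    ... | false | _ = TU.nonsingular⇒basis tuʸ X X⊆ , TU.basis⇒nonsingular tuʸ X X⊆
      where
      X⊆ : X ⊆ᵇ (W △ x)
      X⊆ u u∈ = ≡.trans (△-other W (differ {X = X} u∈ x∈X)) (X⊆W u u∈)
    ... | true | false = TU.nonsingular⇒basis tuˣ X X⊆ , TU.basis⇒nonsingular tuˣ X X⊆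
      where
      X⊆ : X ⊆ᵇ (W △ y)
      X⊆ u u∈ = ≡.trans (△-other W (differ {X = X} u∈ y∈X)) (X⊆W u u∈)
    ... | true | true with Finₚ.any? (λ k → Finₚ.any? (λ l → (lookup X k Boolₚ.≟ true) ×-dec (lookup X l Boolₚ.≟ true) ×-dec
              ¬? (k Finₚ.≟ x) ×-dec ¬? (k Finₚ.≟ y) ×-dec ¬? (l Finₚ.≟ x) ×-dec ¬? (l Finₚ.≟ y) ×-dec (E B k l Boolₚ.≟ true)))
    ...   | yes (k , l , k∈X , l∈X , k≢x , k≢y , l≢x , l≢y , kl) =
            detects-unpivot alt k≢l nz (combine-detects xy-side′ Sxy′
              (TU-pivot tuˣ (rest-W-y k k∈) (rest-W-y l l∈) kl) (TU-pivot tuʸ (rest-W-x k k∈) (rest-W-x l l∈) kl)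
              (neighbours-pivot bB kl k∈ l∈ Q) (X △ k △ l) X′⊆W (rec (remove₂-⊂ k≢l k∈X l∈X)))
      where
      bB : Basis B
      bB = TU-basis tuˣ
      alt : Alternating S
      alt = TU.alt tuˣ
      k≢l : k ≢ l
      k≢l = adj-irrefl B kl
      k∈ : lookup rest k ≡ true
      k∈ = in-rest (X⊆W k k∈X) k≢x k≢y
      l∈ : lookup rest l ≡ true
      l∈ = in-rest (X⊆W l l∈X) l≢x l≢y
      nz : S k l ≢ 0₃
      nz = adj⇒nonzero tuˣ (rest-W-y k k∈) (rest-W-y l l∈) kl
      X′⊆W : (X △ k △ l) ⊆ᵇ W
      X′⊆W u u∈ = X⊆W u (∈⇒true (proj₁ (remove₂-⊂ k≢l k∈X l∈X) (true⇒∈ u∈)))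
      xy-side′ : lookup (B △ k △ l) x ≡ lookup (B △ k △ l) y
      xy-side′ = ≡.trans (△△-other B (k≢x ∘ ≡.sym) (l≢x ∘ ≡.sym)) (≡.trans xy-side (≡.sym (△△-other B (k≢y ∘ ≡.sym) (l≢y ∘ ≡.sym))))
      zero-x : ∀ {w} → lookup rest w ≡ true → lookup B x ≡ lookup B w → S x w ≡ 0₃
      zero-x w∈ e = non-adj⇒zero tuˣ x∈W-y (rest-W-y _ w∈) (same-colour bB e)
      zero-y : ∀ {w} → lookup rest w ≡ true → lookup B x ≡ lookup B w → S y w ≡ 0₃
      zero-y w∈ e = non-adj⇒zero tuʸ y∈W-x (rest-W-x _ w∈) (same-colour bB (≡.trans (≡.sym xy-side) e))
      -- x and y lie on one side while k and l do not, so each product in the correction has a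
      -- factor within a side.
      Sxy′ : pivot (S k l) k l S x y ≡ 0₃
      Sxy′ = ≡.trans (Pivot.pivot-other alt k≢l ≡.refl (square₃ nz) (k≢x ∘ ≡.sym) (l≢x ∘ ≡.sym) (k≢y ∘ ≡.sym) (l≢y ∘ ≡.sym)) zero-xy
        where
        zero-xy : S x y +₃ S k l *₃ (S x l *₃ S y k +₃ -₃ (S x k *₃ S y l)) ≡ 0₃
        zero-xy with lookup B x Boolₚ.≟ lookup B l
        ... | yes e = vanish (S x y) (S k l) (S x l) (S y k) (S x k) (S y l) Sxy (inj₁ (zero-x l∈ e)) (inj₂ (zero-y l∈ e))
        ... | no ne = vanish (S x y) (S k l) (S x l) (S y k) (S x k) (S y l) Sxy (inj₂ (zero-y k∈ e)) (inj₁ (zero-x k∈ e))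
          where
          e : lookup B x ≡ lookup B k
          e = ≡.trans (Boolₚ.¬-not ne) (≡.trans (≡.cong not (adj-colour bB kl)) (Boolₚ.not-involutive (lookup B k)))
    ...   | no none with Finₚ.any? (λ i → (lookup X i Boolₚ.≟ true) ×-dec ¬? (i Finₚ.≟ x) ×-dec ¬? (i Finₚ.≟ y) ×-dec (E B x i Boolₚ.≟ true))
    ...     | no isolated = detects-star (TU.alt tuˣ) bB X y y∈X away at-y
      where
      bB : Basis B
      bB = TU-basis tuˣ
      no-edge : ∀ u v → lookup X u ≡ true → lookup X v ≡ true → u ≢ y → v ≢ y → E B u v ≡ false
      no-edge u v u∈X v∈X u≢y v≢y = ¬true⇒false λ uv → helper uv (u Finₚ.≟ x) (v Finₚ.≟ x)
        where
        helper : E B u v ≡ true → Dec (u ≡ x) → Dec (v ≡ x) → ⊥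
        helper uv (yes ≡.refl) (yes ≡.refl) = adj-irrefl B uv ≡.refl
        helper uv (yes ≡.refl) (no v≢x) = isolated (v , v∈X , v≢x , v≢y , uv)
        helper uv (no u≢x) (yes ≡.refl) = isolated (u , u∈X , u≢x , u≢y , ≡.trans (adj-sym B v u) uv)
        helper uv (no u≢x) (no v≢x) = none (u , v , u∈X , v∈X , u≢x , u≢y , v≢x , v≢y , uv)
      away : ∀ u v → lookup X u ≡ true → lookup X v ≡ true → u ≢ y → v ≢ y → S u v ≡ 0₃ × E B u v ≡ false
      away u v u∈X v∈X u≢y v≢y = non-adj⇒zero tuˣ (≡.trans (△-other W u≢y) (X⊆W u u∈X)) (≡.trans (△-other W v≢y) (X⊆W v v∈X)) e , e
        where e = no-edge u v u∈X v∈X u≢y v≢y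
      at-y : ∀ v → lookup X v ≡ true → (S y v ≡ 0₃ → E B y v ≡ false) × (E B y v ≡ false → S y v ≡ 0₃)
      at-y v v∈X with v Finₚ.≟ x
      ... | yes ≡.refl = (λ _ → same-colour bB (≡.sym xy-side)) , λ _ → ≡.trans (proj₂ (TU.alt tuˣ) y v) (≡.cong -₃_ Sxy)
      ... | no v≢x = (λ z → ¬true⇒false λ e → adj⇒nonzero tuʸ y∈W-x (≡.trans (△-other W v≢x) (X⊆W v v∈X)) e z) ,
                     non-adj⇒zero tuʸ y∈W-x (≡.trans (△-other W v≢x) (X⊆W v v∈X))
    ...     | yes (i , i∈X , i≢x , i≢y , xi) = detects-unpivot alt x≢i nz
              (detects-star P.alternating (pivot-basis bB xi) (X △ x △ i) y y∈X′ away at-y)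
      where
      bB : Basis B
      bB = TU-basis tuˣ
      alt : Alternating S
      alt = TU.alt tuˣ
      x≢i : x ≢ i
      x≢i = i≢x ∘ ≡.sym
      i∈ : lookup rest i ≡ true
      i∈ = in-rest (X⊆W i i∈X) i≢x i≢y
      nz : S x i ≢ 0₃
      nz = adj⇒nonzero tuˣ x∈W-y (rest-W-y i i∈) xi
      module P = Pivot alt x≢i ≡.refl (square₃ nz)
      y∈X′ : lookup (X △ x △ i) y ≡ true
      y∈X′ = ≡.trans (△△-other X (x≢y ∘ ≡.sym) (i≢y ∘ ≡.sym)) y∈X
      ≢x : ∀ {w} → lookup (X △ x △ i) w ≡ true → w ≢ x
      ≢x w∈ ≡.refl = true≢false (≡.trans (≡.sym w∈) (≡.trans (△△-∈ X x≢i) (≡.cong not x∈X)))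
      ≢i : ∀ {w} → lookup (X △ x △ i) w ≡ true → w ≢ i
      ≢i w∈ ≡.refl = true≢false (≡.trans (≡.sym w∈) (≡.trans (△△-∈′ X x≢i) (≡.cong not i∈X)))
      in-X : ∀ {w} → lookup (X △ x △ i) w ≡ true → lookup X w ≡ true
      in-X w∈ = ≡.trans (≡.sym (△△-other X (≢x w∈) (≢i w∈))) w∈
      no-edge : ∀ {u v} → lookup X u ≡ true → lookup X v ≡ true → u ≢ x → u ≢ y → v ≢ x → v ≢ y → S u v ≡ 0₃ × E B u v ≡ false
      no-edge {u} {v} u∈X v∈X u≢x u≢y v≢x v≢y =
        non-adj⇒zero tuˣ (rest-W-y u (in-rest (X⊆W u u∈X) u≢x u≢y)) (rest-W-y v (in-rest (X⊆W v v∈X) v≢x v≢y)) e , e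
        where
        e : E B u v ≡ false
        e = ¬true⇒false λ uv → none (u , v , u∈X , v∈X , u≢x , u≢y , v≢x , v≢y , uv)
      away : ∀ u v → lookup (X △ x △ i) u ≡ true → lookup (X △ x △ i) v ≡ true → u ≢ y → v ≢ y →
             P.S′ u v ≡ 0₃ × E (B △ x △ i) u v ≡ false
      away u v u∈ v∈ u≢y v≢y = ≡.trans (P.pivot-other (≢x u∈) (≢i u∈) (≢x v∈) (≢i v∈))
            (vanish (S u v) (S x i) (S u i) (S v x) (S u x) (S v i) (proj₁ uv) (inj₁ (proj₁ ui)) (inj₂ (proj₁ vi))) ,
          ≡.trans (pivot-value bB xi (≢x u∈) (≢i u∈) (≢x v∈) (≢i v∈) (proj₂ uv) (proj₂ ui) ≡.refl ≡.refl (proj₂ vi)) (Boolₚ.∧-zeroʳ (E B u x))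
        where
        uv = no-edge (in-X u∈) (in-X v∈) (≢x u∈) u≢y (≢x v∈) v≢y
        ui = no-edge (in-X u∈) i∈X (≢x u∈) u≢y i≢x i≢y
        vi = no-edge (in-X v∈) i∈X (≢x v∈) v≢y i≢x i≢y
      Syx : S y x ≡ 0₃
      Syx = ≡.trans (proj₂ alt y x) (≡.cong -₃_ Sxy)
      at-y : ∀ v → lookup (X △ x △ i) v ≡ true →
             (P.S′ y v ≡ 0₃ → E (B △ x △ i) y v ≡ false) × (E (B △ x △ i) y v ≡ false → P.S′ y v ≡ 0₃)
      at-y v v∈ with v Finₚ.≟ y
      ... | yes ≡.refl = (λ _ → adj-refl (B △ x △ i) v) , λ _ → proj₁ P.alternating v
      ... | no v≢y = entry (E B y v) (E B y i) (E B v x) ≡.refl ≡.refl ≡.refl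
        where
        v∈r : lookup rest v ≡ true
        v∈r = in-rest (X⊆W v (in-X v∈)) (≢x v∈) v≢y
        value : P.S′ y v ≡ S y v +₃ S x i *₃ (S y i *₃ S v x)
        value = ≡.trans (P.pivot-other (x≢y ∘ ≡.sym) (i≢y ∘ ≡.sym) (≢x v∈) (≢i v∈))
          (≡.trans (≡.cong (λ e → S y v +₃ S x i *₃ (S y i *₃ S v x +₃ -₃ (e *₃ S v i))) Syx)
            (≡.cong (λ e → S y v +₃ S x i *₃ e) (CommutativeRing.+-identityʳ F₃-ring (S y i *₃ S v x))))
        yx : E B y x ≡ false
        yx = same-colour bB (≡.sym xy-side)
        entry : ∀ a b c → E B y v ≡ a → E B y i ≡ b → E B v x ≡ c →
                (P.S′ y v ≡ 0₃ → E (B △ x △ i) y v ≡ false) × (E (B △ x △ i) y v ≡ false → P.S′ y v ≡ 0₃)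
        adj′ : ∀ {a b c} → E B y v ≡ a → E B y i ≡ b → E B v x ≡ c → E (B △ x △ i) y v ≡ a xor ((b ∧ c) xor false)
        adj′ ea eb ec = pivot-value bB xi (x≢y ∘ ≡.sym) (i≢y ∘ ≡.sym) (≢x v∈) (≢i v∈) ea eb ec yx ≡.refl
        yv-zero : E B y v ≡ false → S y v ≡ 0₃
        yv-zero = non-adj⇒zero tuʸ y∈W-x (rest-W-x v v∈r)
        yv-nonzero : E B y v ≡ true → S y v ≢ 0₃
        yv-nonzero = adj⇒nonzero tuʸ y∈W-x (rest-W-x v v∈r)
        unchanged : S y i *₃ S v x ≡ 0₃ → P.S′ y v ≡ S y v
        unchanged z = ≡.trans value (≡.trans (≡.cong (λ e → S y v +₃ S x i *₃ e) z)
          (≡.trans (≡.cong (S y v +₃_) (zeroʳ (S x i))) (CommutativeRing.+-identityʳ F₃-ring (S y v))))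
        Syi-nonzero : E B y i ≡ true → S y i ≢ 0₃
        Syi-nonzero = adj⇒nonzero tuʸ y∈W-x (rest-W-x i i∈)
        Svx-nonzero : E B v x ≡ true → S v x ≢ 0₃
        Svx-nonzero = adj⇒nonzero tuˣ (rest-W-y v v∈r) x∈W-y
        no-product : ∀ {a} → E B y v ≡ a → S y i *₃ S v x ≡ 0₃ → E (B △ x △ i) y v ≡ a →
                     (P.S′ y v ≡ 0₃ → E (B △ x △ i) y v ≡ false) × (E (B △ x △ i) y v ≡ false → P.S′ y v ≡ 0₃)
        no-product {true} ea z ea′ = (λ z′ → ⊥-elim (yv-nonzero ea (≡.trans (≡.sym (unchanged z)) z′))) , λ f → ⊥-elim (true≢false (≡.trans (≡.sym ea′) f))
        no-product {false} ea z ea′ = (λ _ → ea′) , λ _ → ≡.trans (unchanged z) (yv-zero ea)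
        entry a false c ea eb ec = no-product ea (≡.cong (_*₃ S v x) (non-adj⇒zero tuʸ y∈W-x (rest-W-x i i∈) eb)) (≡.trans (adj′ ea eb ec) (Boolₚ.xor-identityʳ a))
        entry a true false ea eb ec = no-product ea (≡.trans (≡.cong (S y i *₃_) (non-adj⇒zero tuˣ (rest-W-y v v∈r) x∈W-y ec)) (zeroʳ (S y i))) (≡.trans (adj′ ea eb ec) (Boolₚ.xor-identityʳ a))
        entry false true true ea eb ec = (λ z → ⊥-elim (nonzero-minor (S x i) (S y i) (S v x) nz (Syi-nonzero eb) (Svx-nonzero ec)
              (≡.trans (≡.sym (≡.trans value (≡.cong (_+₃ S x i *₃ (S y i *₃ S v x)) (yv-zero ea)))) z))) ,
            λ f → ⊥-elim (true≢false (≡.trans (≡.sym (adj′ ea eb ec)) f))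
        -- The minor in the rows i , v and the columns x , y has no zero entry. The new entry is 0
        -- over F₂ by the pivot rule, and over F₃ by `signs-agree` along a path that
        -- `NeighboursConnected` provides.
        entry true true true ea eb ec = (λ _ → adj′ ea eb ec) , λ _ → ≡.trans value
            (≡.trans (≡.cong₂ _+₃_ (proj₂ alt y v) (≡.cong₂ (λ p q → p *₃ (q *₃ S v x)) (proj₂ alt x i) (proj₂ alt y i)))
              (minor-signs (S i x) (S i y) (S v x) (S v y) agreement
                (λ z → nz (≡.trans (proj₂ alt x i) (≡.cong -₃_ z))) (Svx-nonzero ec)))
          where
          ix : E B i x ≡ true
          ix = ≡.trans (adj-sym B i x) xi
          path : ∃ λ s → Path rest B s i v
          path = connected⇒path bB (two-steps bB ix (≡.trans (adj-sym B x v) ec)) (Q i v i∈ v∈r ix ec)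
          agreement : S i x *₃ S i y ≡ S v x *₃ S v y
          agreement = signs-agree
            (record { W₁ = W △ y ; W₂ = W △ x ; tu₁ = tuˣ ; tu₂ = tuʸ ; N⊆W₁ = rest-W-y ; N⊆W₂ = rest-W-x
                    ; x∈W₁ = x∈W-y ; y∈W₂ = y∈W-x ; agree = λ _ _ _ _ → ≡.refl })
            i∈ v∈r ix (≡.trans (adj-sym B i y) eb) ec (≡.trans (adj-sym B v y) ea) (proj₂ path) (<-wellFounded (proj₁ path))

    combine : ∀ {B S₁ S₂} → lookup B x ≡ lookup B y → TU (W △ x) B S₁ → TU (W △ y) B S₂ → NeighboursConnected B →
              ∃ λ S → TU W B S
    combine {B} {S₁} {S₂} xy-side tu₁ tu₂ Q = S , record
      { alt = alt
      ; nonsingular⇒basis = λ X X⊆W → proj₁ (detects X X⊆W)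
      ; basis⇒nonsingular = λ X X⊆W → proj₂ (detects X X⊆W)
      }
      where
      unique = scaling-unique rest (⊂-wellFounded rest) (TU-restrict rest-W-x tu₁) (TU-restrict rest-W-y tu₂)
      ϵ : Fin n → Fin 3
      ϵ = proj₁ unique
      S₃ : Matrix
      S₃ = scale ϵ S₂
      tu₃ : TU (W △ y) B S₃
      tu₃ = TU-scale ϵ (proj₁ (proj₂ unique)) tu₂
      -- Entries at x come from S₃ and those away from x from S₁. The entry between x and y, which
      -- neither signing knows, is 0 because x and y are on the same side.
      glue : Bool → Bool → Bool → Bool → Fin 3 → Fin 3 → Fin 3
      glue ux uy vx vy a b = if ux ∨ vx then (if uy ∨ vy then 0₃ else b) else a
      is : Fin n → Fin n → Bool
      is w u = does (u Finₚ.≟ w)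
      S : Matrix
      S u v = glue (is x u) (is y u) (is x v) (is y v) (S₁ u v) (S₃ u v)
      alt : Alternating S
      alt = (λ u → diagonal (is x u) (is y u)) , λ u v → skew (is x u) (is y u) (is x v) (is y v) (proj₂ (TU.alt tu₁) u v) (proj₂ (TU.alt tu₃) u v)
        where
        diagonal : ∀ {u} p q → glue p q p q (S₁ u u) (S₃ u u) ≡ 0₃
        diagonal {u} false q = proj₁ (TU.alt tu₁) u
        diagonal true true = ≡.refl
        diagonal {u} true false = proj₁ (TU.alt tu₃) u
        skew : ∀ p q r s {a a′ b b′} → a ≡ -₃ a′ → b ≡ -₃ b′ → glue p q r s a b ≡ -₃ (glue r s p q a′ b′)
        skew p q r s e f rewrite Boolₚ.∨-comm r p | Boolₚ.∨-comm s q with p ∨ r | q ∨ s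
        ... | false | _ = e
        ... | true | true = ≡.refl
        ... | true | false = f
      is-no : ∀ {w u} → u ≢ w → is w u ≡ false
      is-no {w} {u} u≢w with u Finₚ.≟ w
      ... | yes e = ⊥-elim (u≢w e)
      ... | no _ = ≡.refl
      is-yes : ∀ w → is w w ≡ true
      is-yes w with w Finₚ.≟ w
      ... | yes _ = ≡.refl
      ... | no q = ⊥-elim (q ≡.refl)
      away : ∀ {w u} → lookup W w ≡ true → lookup (W △ w) u ≡ true → is w u ≡ false
      away {w} {u} w∈W u∈ = is-no {w} {u} λ { ≡.refl → true≢false (≡.trans (≡.sym u∈) (removed W w∈W)) }
      away-∈ : ∀ {w u} → lookup W w ≡ true → lookup (W △ w) u ≡ true → lookup W u ≡ true
      away-∈ w∈W u∈ = remove-⊆ w∈W _ u∈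
      S≡S₁ : ∀ u v → lookup (W △ x) u ≡ true → lookup (W △ x) v ≡ true → S₁ u v ≡ S u v
      S≡S₁ u v u∈ v∈ = helper (away x∈W u∈) (away x∈W v∈)
        where
        helper : is x u ≡ false → is x v ≡ false → S₁ u v ≡ S u v
        helper e f rewrite e | f = ≡.refl
      S≡S₃ : ∀ u v → lookup (W △ y) u ≡ true → lookup (W △ y) v ≡ true → S₃ u v ≡ S u v
      S≡S₃ u v u∈ v∈ = helper (away y∈W u∈) (away y∈W v∈) (u Finₚ.≟ x) (v Finₚ.≟ x)
        where
        in-rest′ : ∀ {w} → lookup (W △ y) w ≡ true → w ≢ x → lookup rest w ≡ true
        in-rest′ w∈ w≢x = in-rest (away-∈ y∈W w∈) w≢x λ { ≡.refl → true≢false (≡.trans (≡.sym w∈) (removed W y∈W)) }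
        helper : is y u ≡ false → is y v ≡ false → Dec (u ≡ x) → Dec (v ≡ x) → S₃ u v ≡ S u v
        helper e f (yes ≡.refl) _ rewrite e | f | is-yes x = ≡.refl
        helper e f (no u≢x) (yes ≡.refl) rewrite e | f | is-yes x | is-no u≢x = ≡.refl
        helper e f (no u≢x) (no v≢x) rewrite is-no u≢x | is-no v≢x =
          ≡.sym (proj₂ (proj₂ unique) u v (in-rest′ u∈ u≢x) (in-rest′ v∈ v≢x))
      Sxy : S x y ≡ 0₃
      Sxy rewrite is-yes x | is-yes y | Boolₚ.∨-zeroʳ (is y x) = ≡.refl
      detects : ∀ X → X ⊆ᵇ W → Detects S B X
      detects X X⊆W = combine-detects xy-side Sxy (TU-cong alt S≡S₃ tu₃) (TU-cong alt S≡S₁ tu₁) Q X X⊆W (⊂-wellFounded X)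

-- Existence of a signing in the absence of Fano configurations.

module SigningExists {n : ℕ} (M : Matroid n) (bin : BinaryPivots M) (noFano : NoFano M) where
  open MatroidFacts M
  open AdjacencyFacts M
  open PivotAdjacency M bin
  open TotallyUnimodular M
  open Gluing M bin noFano
  open Combining M bin noFano

  private
    E : Subset n → Fin n → Fin n → Bool
    E = adj M

  GoodPair : Subset n → Subset n → Set
  GoodPair W B = ∃ λ x → ∃ λ y → ∃ λ (x≢y : x ≢ y) → ∃ λ (x∈W : lookup W x ≡ true) → ∃ λ (y∈W : lookup W y ≡ true) →
                 lookup B x ≡ lookup B y × NeighboursConnected {W} x≢y x∈W y∈W B

  Three : Subset n → Subset n → Set
  Three W B = ∃ λ w → lookup W w ≡ true × ∃ λ (a : Fin 3 → Fin n) → (∀ t → lookup W (a t) ≡ true × E B w (a t) ≡ true) ×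
              (∀ s t → s ≢ t → a s ≢ a t)

  -- A tree rooted at a vertex with three neighbours has three leaves, two of them on the same side;
  -- removing both leaves all other vertices of the tree connected to the root.
  module Tree {W B : Subset n} (w : Fin n) (w∈W : lookup W w ≡ true) where

    Inner : Subset n → (Fin 3 → Fin n) → Fin n → Set
    Inner T leaf v = lookup T v ≡ true × ∀ t → v ≢ leaf t

    -- With A the inner vertices, this is a walk to the root whose vertices after the first all
    -- survive the removal of any of the three leaves.
    data Up (A : Fin n → Set) : Fin n → Set where
      root : Up A w
      up : ∀ {u} v → E B u v ≡ true → A v → Up A v → Up A u

    up-map : ∀ {A A′ : Fin n → Set} → (∀ {v} → A v → A′ v) → ∀ {u} → Up A u → Up A′ u
    up-map f root = root
    up-map f (up v uv a p) = up v uv (f a) (up-map f p)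

    record Grown (T : Subset n) : Set where
      field
        inside : T ⊆ᵇ W
        root∈ : lookup T w ≡ true
        leaf : Fin 3 → Fin n
        leaf∈ : ∀ t → lookup T (leaf t) ≡ true
        leaf≢w : ∀ t → w ≢ leaf t
        leaf-distinct : ∀ s t → s ≢ t → leaf s ≢ leaf t
        climb : ∀ u → lookup T u ≡ true → Up (Inner T leaf) u

    -- If v hangs from one of the three leaves, it takes the place of that leaf, which becomes
    -- inner; otherwise the three leaves stay and v is one more vertex that climbs to the root.
    add : ∀ {T u v} → Grown T → lookup T u ≡ true → lookup T v ≡ false → lookup W v ≡ true → E B u v ≡ true → Grown (T △ v)
    add {T} {u} {v} g u∈T v∉T v∈W uv with Finₚ.any? (λ t → Grown.leaf g t Finₚ.≟ u)
    ... | no inner = record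
      { inside = inside′ ; root∈ = stay root∈ ; leaf = leaf ; leaf∈ = λ t → stay (leaf∈ t) ; leaf≢w = leaf≢w
      ; leaf-distinct = leaf-distinct ; climb = climb′ }
      where
      open Grown g
      stay : ∀ {z} → lookup T z ≡ true → lookup (T △ v) z ≡ true
      stay z∈ = ≡.trans (△-other T (differ {X = T} z∈ v∉T)) z∈
      inside′ : (T △ v) ⊆ᵇ W
      inside′ z z∈ with z Finₚ.≟ v
      ... | yes ≡.refl = v∈W
      ... | no z≢v = inside z (≡.trans (≡.sym (△-other T z≢v)) z∈)
      convert : ∀ {z} → Up (Inner T leaf) z → Up (Inner (T △ v) leaf) z
      convert = up-map λ { (z∈ , z≢) → stay z∈ , z≢ }
      climb′ : ∀ z → lookup (T △ v) z ≡ true → Up (Inner (T △ v) leaf) z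
      climb′ z z∈ with z Finₚ.≟ v
      ... | yes ≡.refl = up u (≡.trans (adj-sym B z u) uv) (stay u∈T , λ t e → inner (t , ≡.sym e)) (convert (climb u u∈T))
      ... | no z≢v = convert (climb z (≡.trans (≡.sym (△-other T z≢v)) z∈))
    ... | yes (t₀ , ≡.refl) = record
      { inside = inside′ ; root∈ = stay root∈ ; leaf = leaf′ ; leaf∈ = leaf′∈ ; leaf≢w = leaf′≢w
      ; leaf-distinct = distinct ; climb = climb′ }
      where
      open Grown g
      stay : ∀ {z} → lookup T z ≡ true → lookup (T △ v) z ≡ true
      stay z∈ = ≡.trans (△-other T (differ {X = T} z∈ v∉T)) z∈
      inside′ : (T △ v) ⊆ᵇ W
      inside′ z z∈ with z Finₚ.≟ v
      ... | yes ≡.refl = v∈W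
      ... | no z≢v = inside z (≡.trans (≡.sym (△-other T z≢v)) z∈)
      leaf′ : Fin 3 → Fin n
      leaf′ t = if does (t Finₚ.≟ t₀) then v else leaf t
      leaf′∈ : ∀ t → lookup (T △ v) (leaf′ t) ≡ true
      leaf′∈ t with t Finₚ.≟ t₀
      ... | yes _ = ≡.trans (△-same T v) (≡.cong not v∉T)
      ... | no _ = stay (leaf∈ t)
      leaf′≢w : ∀ t → w ≢ leaf′ t
      leaf′≢w t with t Finₚ.≟ t₀
      ... | yes _ = differ {X = T} root∈ v∉T
      ... | no _ = leaf≢w t
      distinct : ∀ s t → s ≢ t → leaf′ s ≢ leaf′ t
      distinct s t s≢t with s Finₚ.≟ t₀ | t Finₚ.≟ t₀
      ... | yes p | yes q = λ _ → s≢t (≡.trans p (≡.sym q))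
      ... | yes _ | no _ = differ {X = T} (leaf∈ t) v∉T ∘ ≡.sym
      ... | no _ | yes _ = differ {X = T} (leaf∈ s) v∉T
      ... | no _ | no _ = leaf-distinct s t s≢t
      convert : ∀ {z} → Up (Inner T leaf) z → Up (Inner (T △ v) leaf′) z
      convert = up-map λ { (z∈ , z≢) → stay z∈ , λ t → avoid z∈ z≢ t }
        where
        avoid : ∀ {z} → lookup T z ≡ true → (∀ t → z ≢ leaf t) → ∀ t → z ≢ leaf′ t
        avoid z∈ z≢ t with t Finₚ.≟ t₀
        ... | yes _ = differ {X = T} z∈ v∉T
        ... | no _ = z≢ t
      climb′ : ∀ z → lookup (T △ v) z ≡ true → Up (Inner (T △ v) leaf′) z
      climb′ z z∈ with z Finₚ.≟ v
      ... | yes ≡.refl = up u (≡.trans (adj-sym B z u) uv) (stay u∈T , now-inner) (convert (climb u u∈T))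
        where
        now-inner : ∀ t → leaf t₀ ≢ leaf′ t
        now-inner t with t Finₚ.≟ t₀
        ... | yes _ = differ {X = T} u∈T v∉T
        ... | no t≢t₀ = leaf-distinct t₀ t (t≢t₀ ∘ ≡.sym)
      ... | no z≢v = convert (climb z (≡.trans (≡.sym (△-other T z≢v)) z∈))

    module _ (a : Fin 3 → Fin n) (a∈ : ∀ t → lookup W (a t) ≡ true × E B w (a t) ≡ true)
             (a-distinct : ∀ s t → s ≢ t → a s ≢ a t) where

      Start : Fin n → Set
      Start u = u ≡ w ⊎ ∃ λ t → a t ≡ u

      start? : ∀ u → Dec (Start u)
      start? u with u Finₚ.≟ w | Finₚ.any? (λ t → a t Finₚ.≟ u)
      ... | yes p | _ = yes (inj₁ p)
      ... | no _ | yes q = yes (inj₂ q)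
      ... | no p | no q = no λ { (inj₁ e) → p e ; (inj₂ e) → q e }

      start : Subset n
      start = comprehension start?

      w≢a : ∀ t → w ≢ a t
      w≢a t = adj-irrefl B (proj₂ (a∈ t))

      grown-start : Grown start
      grown-start = record
        { inside = λ u u∈ → inside (comprehension⇒ start? u∈) ; root∈ = ⇒comprehension start? (inj₁ ≡.refl) ; leaf = a ; leaf∈ = λ t → ⇒comprehension start? (inj₂ (t , ≡.refl))
        ; leaf≢w = w≢a ; leaf-distinct = a-distinct ; climb = λ u u∈ → climb (comprehension⇒ start? u∈) }
        where
        inside : ∀ {u} → Start u → lookup W u ≡ true
        inside (inj₁ ≡.refl) = w∈W
        inside (inj₂ (t , ≡.refl)) = proj₁ (a∈ t)
        climb : ∀ {u} → Start u → Up (Inner start a) u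
        climb (inj₁ ≡.refl) = root
        climb (inj₂ (t , ≡.refl)) = up w (≡.trans (adj-sym B (a t) w) (proj₂ (a∈ t))) (⇒comprehension start? (inj₁ ≡.refl) , w≢a) root

      two-on-one-side : ∀ (f : Fin 3 → Bool) → ∃ λ s → ∃ λ t → s ≢ t × f s ≡ f t
      two-on-one-side f with f 0₃ in p | f 1₃ in q | f 2₃ in r
      ... | true | true | _ = 0₃ , 1₃ , (λ ()) , ≡.trans p (≡.sym q)
      ... | false | false | _ = 0₃ , 1₃ , (λ ()) , ≡.trans p (≡.sym q)
      ... | true | _ | true = 0₃ , 2₃ , (λ ()) , ≡.trans p (≡.sym r)
      ... | false | _ | false = 0₃ , 2₃ , (λ ()) , ≡.trans p (≡.sym r)
      ... | _ | true | true = 1₃ , 2₃ , (λ ()) , ≡.trans q (≡.sym r)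
      ... | _ | false | false = 1₃ , 2₃ , (λ ()) , ≡.trans q (≡.sym r)

      good-pair : GoodPair W B
      good-pair = choose (grow Grown W (E B) add grown-start)
        where
        choose : (∃ λ T → Grown T × (∀ u v → lookup T u ≡ true → lookup W v ≡ true → E B u v ≡ true → lookup T v ≡ true)) → GoodPair W B
        choose (T , g , closed) = pick (two-on-one-side (λ t → lookup B (Grown.leaf g t)))
          where
          open Grown g
          pick : (∃ λ s → ∃ λ t → s ≢ t × lookup B (leaf s) ≡ lookup B (leaf t)) → GoodPair W B
          pick (s , t , s≢t , side) = leaf s , leaf t , x≢y , x∈W , y∈W , side , connected
            where
            x≢y : leaf s ≢ leaf t
            x≢y = leaf-distinct s t s≢t
            x∈W : lookup W (leaf s) ≡ true
            x∈W = inside _ (leaf∈ s)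
            y∈W : lookup W (leaf t) ≡ true
            y∈W = inside _ (leaf∈ t)
            N : Subset n
            N = rest {W} x≢y x∈W y∈W
            climbing : ∀ {u} → Up (Inner T leaf) u → Connected N B u w
            climbing root = here
            climbing (up v uv (v∈T , v≢) p) = link v (≡.trans (△△-other W (v≢ s) (v≢ t)) (inside v v∈T)) uv (climbing p)
            in-T : ∀ {i} → lookup N i ≡ true → E B i (leaf s) ≡ true → lookup T i ≡ true
            in-T {i} i∈N ix = closed (leaf s) i (leaf∈ s) i∈W (≡.trans (adj-sym B (leaf s) i) ix)
              where
              i∈W : lookup W i ≡ true
              i∈W with i Finₚ.≟ leaf s | i Finₚ.≟ leaf t
              ... | yes ≡.refl | _ = x∈W
              ... | no _ | yes ≡.refl = y∈W
              ... | no p | no q = ≡.trans (≡.sym (△△-other W p q)) i∈N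
            -- T is closed under adjacency in W, so every neighbour of the first leaf lies in T and
            -- climbs to the root without passing either of the two removed leaves.
            connected : NeighboursConnected {W} x≢y x∈W y∈W B
            connected i j i∈ j∈ ix jx = climbing (climb i (in-T i∈ ix)) ⟫ connected-sym j∈ (climbing (climb j (in-T j∈ jx)))

  three⇒good : ∀ {W B} → Three W B → GoodPair W B
  three⇒good (w , w∈W , a , a∈ , distinct) = Tree.good-pair w w∈W a a∈ distinct

  triple : Fin n → Fin n → Fin n → Fin 3 → Fin n
  triple a b c 0₃ = a
  triple a b c 1₃ = b
  triple a b c 2₃ = c

  make-three : ∀ {W B} w → lookup W w ≡ true → ∀ a b c → lookup W a ≡ true → lookup W b ≡ true → lookup W c ≡ true →
               E B w a ≡ true → E B w b ≡ true → E B w c ≡ true → a ≢ b → a ≢ c → b ≢ c → Three W B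
  make-three w w∈W a b c a∈ b∈ c∈ wa wb wc a≢b a≢c b≢c = w , w∈W , triple a b c ,
    (λ { 0₃ → a∈ , wa ; 1₃ → b∈ , wb ; 2₃ → c∈ , wc }) ,
    λ { 0₃ 0₃ q → ⊥-elim (q ≡.refl) ; 0₃ 1₃ _ → a≢b ; 0₃ 2₃ _ → a≢c
      ; 1₃ 0₃ _ → a≢b ∘ ≡.sym ; 1₃ 1₃ q → ⊥-elim (q ≡.refl) ; 1₃ 2₃ _ → b≢c
      ; 2₃ 0₃ _ → a≢c ∘ ≡.sym ; 2₃ 1₃ _ → b≢c ∘ ≡.sym ; 2₃ 2₃ q → ⊥-elim (q ≡.refl) }

  three? : ∀ W B → Three W B ⊎ ¬ Three W B
  three? W B with Finₚ.any? (λ w → Finₚ.any? (λ a → Finₚ.any? (λ b → Finₚ.any? (λ c →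
      (lookup W w Boolₚ.≟ true) ×-dec (lookup W a Boolₚ.≟ true) ×-dec (lookup W b Boolₚ.≟ true) ×-dec (lookup W c Boolₚ.≟ true) ×-dec
      (E B w a Boolₚ.≟ true) ×-dec (E B w b Boolₚ.≟ true) ×-dec (E B w c Boolₚ.≟ true) ×-dec
      ¬? (a Finₚ.≟ b) ×-dec ¬? (a Finₚ.≟ c) ×-dec ¬? (b Finₚ.≟ c)))))
  ... | yes (w , a , b , c , w∈ , a∈ , b∈ , c∈ , wa , wb , wc , a≢b , a≢c , b≢c) =
        inj₁ (make-three {W} w w∈ a b c a∈ b∈ c∈ wa wb wc a≢b a≢c b≢c)
  ... | no none = inj₂ λ { (w , w∈ , a , a∈ , distinct) → none (w , a 0₃ , a 1₃ , a 2₃ , w∈ , proj₁ (a∈ 0₃) , proj₁ (a∈ 1₃) , proj₁ (a∈ 2₃) ,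
        proj₂ (a∈ 0₃) , proj₂ (a∈ 1₃) , proj₂ (a∈ 2₃) , distinct 0₃ 1₃ (λ ()) , distinct 0₃ 2₃ (λ ()) , distinct 1₃ 2₃ λ ()) }

  -- If x has no neighbour other than l, its neighbours are trivially connected, so it forms a good
  -- pair with any y on its side.
  second-neighbour : ∀ {W B} x y l → x ≢ y → lookup W x ≡ true → lookup W y ≡ true → Basis B → lookup B x ≡ lookup B y →
                     GoodPair W B ⊎ ∃ λ m → lookup W m ≡ true × E B x m ≡ true × m ≢ l
  second-neighbour {W} {B} x y l x≢y x∈W y∈W bB side
    with Finₚ.any? (λ m → (lookup W m Boolₚ.≟ true) ×-dec (E B x m Boolₚ.≟ true) ×-dec ¬? (m Finₚ.≟ l))
  ... | yes found = inj₂ found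
  ... | no none = inj₁ (x , y , x≢y , x∈W , y∈W , side , λ i j i∈ j∈ ix jx → same i j (is-l i i∈ ix) (is-l j j∈ jx))
    where
    is-l : ∀ i → lookup (W △ x △ y) i ≡ true → E B i x ≡ true → i ≡ l
    is-l i i∈ ix = decidable-stable (i Finₚ.≟ l) λ i≢l → none (i ,
      ≡.trans (≡.sym (△△-other W (adj-irrefl B ix) λ { ≡.refl → true≢false (≡.trans (≡.sym ix) (same-colour bB (≡.sym side))) })) i∈ ,
      ≡.trans (adj-sym B x i) ix , i≢l)
    same : ∀ {N} i j → i ≡ l → j ≡ l → Connected N B i j
    same i .i ≡.refl ≡.refl = here

  -- If k is alone on its side, all edges are at k, and on a star any choice of signs works; here
  -- row k receives 1 and column k receives - 1.
  star-signing : ∀ {W B} k → Basis B → lookup W k ≡ true → (∀ y → lookup W y ≡ true → y ≢ k → lookup B k ≢ lookup B y) → ∃ λ S → TU W B S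
  star-signing {W} {B} k bB k∈W lonely = S , record
    { alt = alt ; nonsingular⇒basis = λ X X⊆W → proj₁ (detects X X⊆W) ; basis⇒nonsingular = λ X X⊆W → proj₂ (detects X X⊆W) }
    where
    entry : Bool → Bool → Bool → Bool → Fin 3
    entry true true _ _ = 0₃
    entry true false a _ = if a then 1₃ else 0₃
    entry false true _ b = if b then 2₃ else 0₃
    entry false false _ _ = 0₃
    is : Fin n → Bool
    is u = does (u Finₚ.≟ k)
    is-yes : is k ≡ true
    is-yes with k Finₚ.≟ k
    ... | yes _ = ≡.refl
    ... | no q = ⊥-elim (q ≡.refl)
    is-no : ∀ {u} → u ≢ k → is u ≡ false
    is-no {u} u≢k with u Finₚ.≟ k
    ... | yes e = ⊥-elim (u≢k e)
    ... | no _ = ≡.refl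
    S : Matrix
    S u v = entry (is u) (is v) (E B k v) (E B k u)
    alt : Alternating S
    alt = (λ u → diagonal (is u)) , λ u v → skew (is u) (is v) (E B k v) (E B k u)
      where
      diagonal : ∀ p {a b} → entry p p a b ≡ 0₃
      diagonal true = ≡.refl
      diagonal false = ≡.refl
      skew : ∀ p q a b → entry p q a b ≡ -₃ entry q p b a
      skew true true a b = ≡.refl
      skew false false a b = ≡.refl
      skew true false true b = ≡.refl
      skew true false false b = ≡.refl
      skew false true a true = ≡.refl
      skew false true a false = ≡.refl
    away : ∀ u v → lookup W u ≡ true → lookup W v ≡ true → u ≢ k → v ≢ k → S u v ≡ 0₃ × E B u v ≡ false
    away u v u∈W v∈W u≢k v≢k = zero-entry (is-no u≢k) (is-no v≢k) , same-colour bB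
      (≡.trans (≡.trans (≡.sym (Boolₚ.not-involutive _)) (≡.cong not (≡.sym (Boolₚ.¬-not (lonely u u∈W u≢k)))))
        (≡.trans (≡.cong not (Boolₚ.¬-not (lonely v v∈W v≢k))) (Boolₚ.not-involutive _)))
      where
      zero-entry : is u ≡ false → is v ≡ false → S u v ≡ 0₃
      zero-entry e f rewrite e | f = ≡.refl
    at-k : ∀ v → (S k v ≡ 0₃ → E B k v ≡ false) × (E B k v ≡ false → S k v ≡ 0₃)
    at-k v = helper (v Finₚ.≟ k)
      where
      row : is k ≡ true → is v ≡ false → (S k v ≡ 0₃ → E B k v ≡ false) × (E B k v ≡ false → S k v ≡ 0₃)
      row e f rewrite e | f with E B k v
      ... | true = (λ ()) , λ ()
      ... | false = (λ _ → ≡.refl) , λ _ → ≡.refl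
      helper : Dec (v ≡ k) → (S k v ≡ 0₃ → E B k v ≡ false) × (E B k v ≡ false → S k v ≡ 0₃)
      helper (yes ≡.refl) = (λ _ → adj-refl B v) , λ _ → proj₁ alt v
      helper (no v≢k) = row is-yes (is-no v≢k)
    detects : ∀ X → X ⊆ᵇ W → Detects S B X
    detects X X⊆W with lookup X k in k∈X
    ... | true = detects-star alt bB X k k∈X (λ u v u∈ v∈ → away u v (X⊆W u u∈) (X⊆W v v∈)) λ v _ → at-k v
    ... | false = detects-no-edge X alt bB λ u v u∈ v∈ → away u v (X⊆W u u∈) (X⊆W v v∈) (differ {X = X} u∈ k∈X) (differ {X = X} v∈ k∈X)

  empty-signing : ∀ {W B} → Basis B → (∀ u v → lookup W u ≡ true → lookup W v ≡ true → E B u v ≡ false) → ∃ λ S → TU W B S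
  empty-signing {W} {B} bB no-edge = (λ _ _ → 0₃) , record
    { alt = alt ; nonsingular⇒basis = λ X X⊆W → proj₁ (detects X X⊆W) ; basis⇒nonsingular = λ X X⊆W → proj₂ (detects X X⊆W) }
    where
    alt : Alternating (λ _ _ → 0₃)
    alt = (λ _ → ≡.refl) , λ _ _ → ≡.refl
    detects : ∀ X → X ⊆ᵇ W → Detects (λ _ _ → 0₃) B X
    detects X X⊆W = detects-no-edge X alt bB λ u v u∈ v∈ → ≡.refl , no-edge u v (X⊆W u u∈) (X⊆W v v∈)

  module _ (W : Subset n) (smaller : ∀ {W′} → W′ ⊂ W → ∀ {B} → Basis B → ∃ λ S → TU W′ B S) where

    good⇒signing : ∀ {B} → Basis B → GoodPair W B → ∃ λ S → TU W B S
    good⇒signing bB (x , y , x≢y , x∈W , y∈W , side , Q) =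
      combine x≢y x∈W y∈W side (proj₂ (smaller (remove-⊂ x∈W) bB)) (proj₂ (smaller (remove-⊂ y∈W) bB)) Q

    module _ {B : Subset n} (bB : Basis B) (k l : Fin n) (k∈W : lookup W k ≡ true) (l∈W : lookup W l ≡ true) (kl : E B k l ≡ true) where

      private
        B′ : Subset n
        B′ = B △ k △ l
        bB′ : Basis B′
        bB′ = pivot-basis bB kl

      unpivot : (∃ λ S → TU W B′ S) → ∃ λ S → TU W B S
      unpivot (S , tu) = pivot (S k l) k l S ,
        ≡.subst (λ X → TU W X (pivot (S k l) k l S)) (△△-involutive B k l) (TU-pivot tu k∈W l∈W (adj-kl bB kl))

      pivoted : GoodPair W B′ → ∃ λ S → TU W B S
      pivoted good = unpivot (good⇒signing bB′ good)

      -- Now l – k – l₂ and k – l – k₂ – k₃. If k and k₂ have no third neighbour, then after the pivot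
      -- on {k , l} either k₂ has the three neighbours k, l₂, k₃ or k is its only neighbour.
      square-or-path : ¬ Three W B → ∀ l₂ k₂ k₃ → lookup W l₂ ≡ true → lookup W k₂ ≡ true → lookup W k₃ ≡ true →
                       E B k l₂ ≡ true → l₂ ≢ l → E B l k₂ ≡ true → k₂ ≢ k → E B k₂ k₃ ≡ true → k₃ ≢ l → GoodPair W B′
      square-or-path no-three l₂ k₂ k₃ l₂∈ k₂∈ k₃∈ kl₂ l₂≢l lk₂ k₂≢k k₂k₃ k₃≢l = decide (E B k₂ l₂) ≡.refl
        where
        k₂l : E B k₂ l ≡ true
        k₂l = ≡.trans (adj-sym B k₂ l) lk₂
        k₂k : E B k₂ k ≡ false
        k₂k = same-colour bB (two-steps bB k₂l (≡.trans (adj-sym B l k) kl))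
        k₂≢l : k₂ ≢ l
        k₂≢l = adj-irrefl B k₂l
        l₂≢k : l₂ ≢ k
        l₂≢k = adj-irrefl B kl₂ ∘ ≡.sym
        k-neighbour : ∀ {v} → lookup W v ≡ true → E B k v ≡ true → v ≢ l → v ≡ l₂
        k-neighbour {v} v∈ kv v≢l = decidable-stable (v Finₚ.≟ l₂) λ v≢l₂ →
          no-three (make-three {W} k k∈W l l₂ v l∈W l₂∈ v∈ kl kl₂ kv (l₂≢l ∘ ≡.sym) (v≢l ∘ ≡.sym) (v≢l₂ ∘ ≡.sym))
        k₂k′ : E B′ k₂ k ≡ true
        k₂k′ = ≡.trans (adj-sym B′ k₂ k) (≡.trans (adj-k bB kl k₂≢k k₂≢l) lk₂)
        decide : ∀ b → E B k₂ l₂ ≡ b → GoodPair W B′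
        decide false k₂l₂ = three⇒good {W} (make-three {W} k₂ k₂∈ k l₂ k₃ k∈W l₂∈ k₃∈ k₂k′ k₂l₂′ k₂k₃′ (l₂≢k ∘ ≡.sym) k≢k₃ l₂≢k₃)
          where
          k≢k₃ : k ≢ k₃
          k≢k₃ ≡.refl = true≢false (≡.trans (≡.sym k₂k₃) k₂k)
          l₂≢k₃ : l₂ ≢ k₃
          l₂≢k₃ ≡.refl = true≢false (≡.trans (≡.sym k₂k₃) k₂l₂)
          k₃k : E B k₃ k ≡ false
          k₃k = ¬true⇒false λ e → l₂≢k₃ (≡.sym (k-neighbour k₃∈ (≡.trans (adj-sym B k k₃) e) k₃≢l))
          k₂l₂′ : E B′ k₂ l₂ ≡ true
          k₂l₂′ = pivot-value bB kl k₂≢k k₂≢l l₂≢k l₂≢l k₂l₂ k₂l (≡.trans (adj-sym B l₂ k) kl₂) k₂k ≡.refl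
          k₂k₃′ : E B′ k₂ k₃ ≡ true
          k₂k₃′ = pivot-value bB kl k₂≢k k₂≢l (k≢k₃ ∘ ≡.sym) k₃≢l k₂k₃ k₂l k₃k k₂k ≡.refl
        decide true k₂l₂ = k₂ , l , k₂≢l , k₂∈ , l∈W , side , λ i j i∈ j∈ ik₂ jk₂ → same i j (is-k i i∈ ik₂) (is-k j j∈ jk₂)
          where
          side : lookup B′ k₂ ≡ lookup B′ l
          side = ≡.trans (△△-other B k₂≢k k₂≢l) (≡.trans (adj-colour bB lk₂) (≡.sym (△△-∈′ B (adj-irrefl B kl))))
          same : ∀ {N} i j → i ≡ k → j ≡ k → Connected N B′ i j
          same i .i ≡.refl ≡.refl = here
          is-k : ∀ i → lookup (W △ k₂ △ l) i ≡ true → E B′ i k₂ ≡ true → i ≡ k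
          is-k i i∈ ik₂ = decidable-stable (i Finₚ.≟ k) λ i≢k → absurd i≢k (E B i k₂) (E B i k) ≡.refl ≡.refl
            where
            i≢l : i ≢ l
            i≢l ≡.refl = true≢false (≡.trans (≡.sym i∈) (≡.trans (△△-∈′ W k₂≢l) (≡.cong not l∈W)))
            i∈W : lookup W i ≡ true
            i∈W = ≡.trans (≡.sym (△△-other W (adj-irrefl B′ ik₂) i≢l)) i∈
            value : ∀ {a d} → i ≢ k → E B i k₂ ≡ a → E B i k ≡ d → E B′ k₂ i ≡ a xor ((true ∧ d) xor (false ∧ E B i l))
            value i≢k ea ed = pivot-value bB kl k₂≢k k₂≢l i≢k i≢l (≡.trans (adj-sym B k₂ i) ea) k₂l ed k₂k ≡.refl
            absurd : i ≢ k → ∀ a d → E B i k₂ ≡ a → E B i k ≡ d → ⊥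
            absurd i≢k true true ea ed = true≢false (≡.trans (≡.sym ik₂) (≡.trans (adj-sym B′ i k₂) (value i≢k ea ed)))
            absurd i≢k false false ea ed = true≢false (≡.trans (≡.sym ik₂) (≡.trans (adj-sym B′ i k₂) (value i≢k ea ed)))
            absurd i≢k true false ea ed = no-three (make-three {W} k₂ k₂∈ l l₂ i l∈W l₂∈ i∈W k₂l k₂l₂ (≡.trans (adj-sym B k₂ i) ea)
              (l₂≢l ∘ ≡.sym) (i≢l ∘ ≡.sym) λ { ≡.refl → true≢false (≡.trans (≡.sym (≡.trans (adj-sym B i k) kl₂)) ed) })
            absurd i≢k false true ea ed = true≢false (≡.trans (≡.sym k₂l₂)
              (≡.trans (≡.cong (E B k₂) (≡.sym (k-neighbour i∈W (≡.trans (adj-sym B k i) ed) i≢l))) (≡.trans (adj-sym B k₂ i) ea)))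

    -- Without a vertex of three neighbours the graph consists of paths and cycles. Either some pair
    -- is already good, or all edges share one vertex's side, or there is a walk l₂ - k - l - k₂ -
    -- k₃, and a pivot on its edge k l creates a good pair.
    sign : ∀ {B} → Basis B → ∃ λ S → TU W B S
    sign {B} bB with three? W B
    ... | inj₁ three = good⇒signing bB (three⇒good three)
    ... | inj₂ no-three with Finₚ.any? (λ k → Finₚ.any? (λ l → (lookup W k Boolₚ.≟ true) ×-dec (lookup W l Boolₚ.≟ true) ×-dec (E B k l Boolₚ.≟ true)))
    ...   | no none = empty-signing bB λ u v u∈ v∈ → ¬true⇒false λ uv → none (u , v , u∈ , v∈ , uv)
    ...   | yes (k , l , k∈W , l∈W , kl) with Finₚ.any? (λ y → (lookup W y Boolₚ.≟ true) ×-dec ¬? (y Finₚ.≟ k) ×-dec (lookup B k Boolₚ.≟ lookup B y))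
    ...     | no lonely = star-signing k bB k∈W λ y y∈ y≢k e → lonely (y , y∈ , y≢k , e)
    ...     | yes (y , y∈W , y≢k , ky) with second-neighbour {W} {B} k y l (y≢k ∘ ≡.sym) k∈W y∈W bB ky
    ...       | inj₁ good = good⇒signing bB good
    ...       | inj₂ (l₂ , l₂∈ , kl₂ , l₂≢l) with second-neighbour {W} {B} l l₂ k (l₂≢l ∘ ≡.sym) l∈W l₂∈ bB (two-steps bB (≡.trans (adj-sym B l k) kl) kl₂)
    ...         | inj₁ good = good⇒signing bB good
    ...         | inj₂ (k₂ , k₂∈ , lk₂ , k₂≢k) with second-neighbour {W} {B} k₂ k l k₂≢k k₂∈ k∈W bB (two-steps bB (≡.trans (adj-sym B k₂ l) lk₂) (≡.trans (adj-sym B l k) kl))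
    ...           | inj₁ good = good⇒signing bB good
    ...           | inj₂ (k₃ , k₃∈ , k₂k₃ , k₃≢l) = pivoted bB k l k∈W l∈W kl
                      (square-or-path bB k l k∈W l∈W kl no-three l₂ k₂ k₃ l₂∈ k₂∈ k₃∈ kl₂ l₂≢l lk₂ k₂≢k k₂k₃ k₃≢l)

  signed : ∀ W → Acc _⊂_ W → ∀ {B} → Basis B → ∃ λ S → TU W B S
  signed W (acc rec) = sign W λ W′⊂W → signed _ (rec W′⊂W)

  signing : Signing M
  signing = record
    { State = TU ⊤
    ; basis = TU-basis
    ; alt = TU.alt
    ; nonzero⇒basis = λ {B} {S} {u} {v} tu nz → proj₂ (adj⇒Adj M {B} (nonzero⇒adj tu (∈⊤ u) (∈⊤ v) nz))
    ; basis⇒nonzero = λ {B} {S} {u} {v} tu uv → adj⇒nonzero tu (∈⊤ u) (∈⊤ v) (Adj⇒adj M uv)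
    ; pivot-state = λ {B} {S} {k} {l} tu k≢l nz → TU-pivot tu (∈⊤ k) (∈⊤ l) (nonzero⇒adj tu (∈⊤ k) (∈⊤ l) nz)
    ; base-state = proj₂ (signed ⊤ (⊂-wellFounded ⊤) (proj₂ (nonempty M)))
    }
    where
    ∈⊤ : ∀ u → lookup ⊤ u ≡ true
    ∈⊤ u = Vecₚ.lookup-replicate u true

-- Generating polynomials of minors.

ℚ-ring : CommutativeRing 0ℓ 0ℓ
ℚ-ring = ℚₚ.+-*-commutativeRing

module ℚ-Solver = IntegerSolver ℚ-ring

sumSub : ∀ {n} → (Subset n → ℚ) → ℚ
sumSub {zero} F = F []
sumSub {suc n} F = sumSub (λ C → F (true ∷ C)) ℚ.+ sumSub (λ C → F (false ∷ C))

sumSub-cong : ∀ {n} {F G : Subset n → ℚ} → (∀ C → F C ≡ G C) → sumSub F ≡ sumSub G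
sumSub-cong {zero} e = e []
sumSub-cong {suc n} e = ≡.cong₂ ℚ._+_ (sumSub-cong λ C → e (true ∷ C)) (sumSub-cong λ C → e (false ∷ C))

sumSub-+ : ∀ {n} (F G : Subset n → ℚ) → sumSub (λ C → F C ℚ.+ G C) ≡ sumSub F ℚ.+ sumSub G
sumSub-+ {zero} F G = ≡.refl
sumSub-+ {suc n} F G = ≡.trans (≡.cong₂ ℚ._+_ (sumSub-+ (λ C → F (true ∷ C)) λ C → G (true ∷ C)) (sumSub-+ (λ C → F (false ∷ C)) λ C → G (false ∷ C)))
  (ℚ-Solver.solve 4 (λ a b c d → (a ℚ-Solver.:+ b) ℚ-Solver.:+ (c ℚ-Solver.:+ d) ℚ-Solver.:= (a ℚ-Solver.:+ c) ℚ-Solver.:+ (b ℚ-Solver.:+ d)) ≡.refl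
    (sumSub λ C → F (true ∷ C)) (sumSub λ C → G (true ∷ C)) (sumSub λ C → F (false ∷ C)) (sumSub λ C → G (false ∷ C)))

sumSub-*ˡ : ∀ {n} x (F : Subset n → ℚ) → sumSub (λ C → x ℚ.* F C) ≡ x ℚ.* sumSub F
sumSub-*ˡ {zero} x F = ≡.refl
sumSub-*ˡ {suc n} x F = ≡.trans (≡.cong₂ ℚ._+_ (sumSub-*ˡ x λ C → F (true ∷ C)) (sumSub-*ˡ x λ C → F (false ∷ C)))
  (≡.sym (ℚₚ.*-distribˡ-+ x (sumSub λ C → F (true ∷ C)) (sumSub λ C → F (false ∷ C))))

sumSub-0 : ∀ {n} {F : Subset n → ℚ} → (∀ C → F C ≡ 0ℚ) → sumSub F ≡ 0ℚ
sumSub-0 {zero} e = e []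
sumSub-0 {suc n} e = ≡.trans (≡.cong₂ ℚ._+_ (sumSub-0 λ C → e (true ∷ C)) (sumSub-0 λ C → e (false ∷ C))) ≡.refl

sumSub-∅ : ∀ {n} {F : Subset n → ℚ} → (∀ C → C ≢ ∅ → F C ≡ 0ℚ) → sumSub F ≡ F ∅
sumSub-∅ {zero} e = ≡.refl
sumSub-∅ {suc n} {F} e = ≡.trans (≡.cong₂ ℚ._+_ (sumSub-0 λ C → e (true ∷ C) λ ()) (sumSub-∅ λ C C≢∅ → e (false ∷ C) λ { ≡.refl → C≢∅ ≡.refl }))
  (ℚₚ.+-identityˡ (F ∅))

foldr-++-+ : ∀ xs ys → foldr ℚ._+_ 0ℚ (xs ++ ys) ≡ foldr ℚ._+_ 0ℚ xs ℚ.+ foldr ℚ._+_ 0ℚ ys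
foldr-++-+ [] ys = ≡.sym (ℚₚ.+-identityˡ (foldr ℚ._+_ 0ℚ ys))
foldr-++-+ (x ∷ xs) ys = ≡.trans (≡.cong (x ℚ.+_) (foldr-++-+ xs ys)) (≡.sym (ℚₚ.+-assoc x (foldr ℚ._+_ 0ℚ xs) (foldr ℚ._+_ 0ℚ ys)))

foldr≡sumSub : ∀ n (F : Subset n → ℚ) → foldr ℚ._+_ 0ℚ (map F (allSubsets n)) ≡ sumSub F
foldr≡sumSub zero F = ℚₚ.+-identityʳ (F [])
foldr≡sumSub (suc n) F = ≡.trans (≡.cong (foldr ℚ._+_ 0ℚ) (Listₚ.map-++ F (map (true ∷_) (allSubsets n)) (map (false ∷_) (allSubsets n))))
  (≡.trans (foldr-++-+ (map F (map (true ∷_) (allSubsets n))) (map F (map (false ∷_) (allSubsets n))))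
    (≡.cong₂ ℚ._+_ (half true) (half false)))
  where
  half : ∀ b → foldr ℚ._+_ 0ℚ (map F (map (b ∷_) (allSubsets n))) ≡ sumSub (λ C → F (b ∷ C))
  half b = ≡.trans (≡.cong (foldr ℚ._+_ 0ℚ) (≡.sym (Listₚ.map-∘ (allSubsets n)))) (foldr≡sumSub n λ C → F (b ∷ C))

disjoint : ∀ {n} → Subset n → Subset n → Bool
disjoint [] [] = true
disjoint (k ∷ K) (c ∷ C) = not (k ∧ c) ∧ disjoint K C

disjoint⇒ : ∀ {n} (K C : Subset n) → disjoint K C ≡ true → ∀ u → lookup K u ≡ true → lookup C u ≡ false
disjoint⇒ (true ∷ K) (false ∷ C) d zero _ = ≡.refl
disjoint⇒ (true ∷ K) (true ∷ C) () zero _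
disjoint⇒ (k ∷ K) (c ∷ C) d (suc u) u∈K = disjoint⇒ K C (tail k c d) u u∈K
  where
  tail : ∀ k c {d} → not (k ∧ c) ∧ d ≡ true → d ≡ true
  tail true false e = e
  tail false c e = e

⇒disjoint : ∀ {n} (K C : Subset n) → (∀ u → lookup K u ≡ true → lookup C u ≡ false) → disjoint K C ≡ true
⇒disjoint [] [] _ = ≡.refl
⇒disjoint (k ∷ K) (c ∷ C) h = ≡.cong₂ _∧_ (head k c (h zero)) (⇒disjoint K C λ u → h (suc u))
  where
  head : ∀ k c → (k ≡ true → c ≡ false) → not (k ∧ c) ≡ true
  head true c f = ≡.cong not (f ≡.refl)
  head false c f = ≡.refl

opaque
  unfolding _△_

  sumSub-split : ∀ {n} (o : Fin n) (F : Subset n → ℚ) →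
                 sumSub F ≡ sumSub (λ C → if lookup C o then 0ℚ else F C ℚ.+ F (C △ o))
  sumSub-split {suc n} zero F = ≡.sym (≡.trans (≡.cong₂ ℚ._+_ (sumSub-0 {n} {F = λ C → 0ℚ} λ C → ≡.refl) (sumSub-+ (λ C → F (false ∷ C)) λ C → F (true ∷ C)))
    (≡.trans (ℚₚ.+-identityˡ (outside ℚ.+ inside)) (ℚₚ.+-comm outside inside)))
    where
    outside inside : ℚ
    outside = sumSub λ C → F (false ∷ C)
    inside = sumSub λ C → F (true ∷ C)
  sumSub-split (suc o) F = ≡.cong₂ ℚ._+_ (sumSub-split o λ C → F (true ∷ C)) (sumSub-split o λ C → F (false ∷ C))

  sumSub-△ : ∀ {n} (o : Fin n) (F : Subset n → ℚ) → sumSub F ≡ sumSub (λ C → F (C △ o))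
  sumSub-△ zero F = ℚₚ.+-comm (sumSub (λ C → F (true ∷ C))) (sumSub (λ C → F (false ∷ C)))
  sumSub-△ (suc o) F = ≡.cong₂ ℚ._+_ (sumSub-△ o λ C → F (true ∷ C)) (sumSub-△ o λ C → F (false ∷ C))

  sumSub-⊕ : ∀ {n} (I : Subset n) (F : Subset n → ℚ) → sumSub F ≡ sumSub (λ C → F (C ⊕ I))
  sumSub-⊕ [] F = ≡.refl
  sumSub-⊕ (true ∷ I) F = ≡.trans (ℚₚ.+-comm (sumSub (λ C → F (true ∷ C))) (sumSub (λ C → F (false ∷ C))))
    (≡.cong₂ ℚ._+_ (sumSub-⊕ I λ C → F (false ∷ C)) (sumSub-⊕ I λ C → F (true ∷ C)))
  sumSub-⊕ (false ∷ I) F = ≡.cong₂ ℚ._+_ (sumSub-⊕ I λ C → F (true ∷ C)) (sumSub-⊕ I λ C → F (false ∷ C))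

  prodOn-△ : ∀ {n} (C : Subset n) o y → lookup C o ≡ false → prodOn (C △ o) y ≡ y o ℚ.* prodOn C y
  prodOn-△ (false ∷ C) zero y _ = ≡.refl
  prodOn-△ (true ∷ C) (suc o) y e = ≡.trans (≡.cong (y zero ℚ.*_) (prodOn-△ C o (λ i → y (suc i)) e))
    (ℚ-Solver.solve 3 (λ a b c → a ℚ-Solver.:* (b ℚ-Solver.:* c) ℚ-Solver.:= b ℚ-Solver.:* (a ℚ-Solver.:* c)) ≡.refl (y zero) (y (suc o)) (prodOn C λ i → y (suc i)))
  prodOn-△ (false ∷ C) (suc o) y e = prodOn-△ C o (λ i → y (suc i)) e

  -- The substitution B = C ⊕ I turns the two conditions I ⊆ B and B ∩ J = ∅ into the single one
  -- that C avoids I ∪ J.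
  admissible-⊕ : ∀ {n} (I J C : Subset n) → disjoint I J ≡ true → admissible I J (C ⊕ I) ≡ disjoint (I ∪ J) C
  admissible-⊕ [] [] [] _ = ≡.refl
  admissible-⊕ (true ∷ I) (false ∷ J) (true ∷ C) d = ≡.refl
  admissible-⊕ (true ∷ I) (false ∷ J) (false ∷ C) d = admissible-⊕ I J C d
  admissible-⊕ (false ∷ I) (true ∷ J) (true ∷ C) d = ≡.refl
  admissible-⊕ (false ∷ I) (true ∷ J) (false ∷ C) d = admissible-⊕ I J C d
  admissible-⊕ (false ∷ I) (false ∷ J) (c ∷ C) d = admissible-⊕ I J C d

  remove-⊕ : ∀ {n} (I J C : Subset n) → disjoint (I ∪ J) C ≡ true → (C ⊕ I) ∩ ∁ I ≡ C
  remove-⊕ [] [] [] _ = ≡.refl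
  remove-⊕ (true ∷ I) (j ∷ J) (false ∷ C) d = ≡.cong (false ∷_) (remove-⊕ I J C d)
  remove-⊕ (false ∷ I) (true ∷ J) (false ∷ C) d = ≡.cong (false ∷_) (remove-⊕ I J C d)
  remove-⊕ (false ∷ I) (false ∷ J) (true ∷ C) d = ≡.cong (true ∷_) (remove-⊕ I J C d)
  remove-⊕ (false ∷ I) (false ∷ J) (false ∷ C) d = ≡.cong (false ∷_) (remove-⊕ I J C d)

prodOn-cong : ∀ {n} (C : Subset n) {y y′ : Fin n → ℚ} → (∀ u → lookup C u ≡ true → y u ≡ y′ u) → prodOn C y ≡ prodOn C y′
prodOn-cong [] e = ≡.refl
prodOn-cong (true ∷ C) e = ≡.cong₂ ℚ._*_ (e zero ≡.refl) (prodOn-cong C λ u → e (suc u))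
prodOn-cong (false ∷ C) e = prodOn-cong C λ u → e (suc u)

prodOn-∅ : ∀ n (y : Fin n → ℚ) → prodOn ∅ y ≡ 1ℚ
prodOn-∅ zero y = ≡.refl
prodOn-∅ (suc n) y = prodOn-∅ n λ i → y (suc i)

module Minors {n : ℕ} (M : Matroid n) where
  open MatroidFacts M

  value : Subset n → ℚ
  value C = if β C then 1ℚ else 0ℚ

  summand : Subset n → Subset n → (Fin n → ℚ) → Subset n → ℚ
  summand K D y C = if disjoint K C then value (C ⊕ D) ℚ.* prodOn C y else 0ℚ

  -- The generating polynomial of the sets C disjoint from K for which C ⊕ D is a basis.
  Z : Subset n → Subset n → (Fin n → ℚ) → ℚ
  Z K D y = sumSub (summand K D y)

  MIJ≡Z : ∀ I J y → disjoint I J ≡ true → MIJ M I J y ≡ Z (I ∪ J) I y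
  MIJ≡Z I J y d = ≡.trans (foldr≡sumSub n term) (≡.trans (sumSub-⊕ I term) (sumSub-cong same))
    where
    term : Subset n → ℚ
    term B = if β B ∧ admissible I J B then prodOn (B ∩ ∁ I) y else 0ℚ
    same : ∀ C → term (C ⊕ I) ≡ summand (I ∪ J) I y C
    same C rewrite admissible-⊕ I J C d with disjoint (I ∪ J) C in e
    ... | false = ≡.cong (if_then prodOn ((C ⊕ I) ∩ ∁ I) y else 0ℚ) (Boolₚ.∧-zeroʳ (β (C ⊕ I)))
    ... | true rewrite remove-⊕ I J C e with β (C ⊕ I)
    ...   | true = ≡.sym (ℚₚ.*-identityˡ (prodOn C y))
    ...   | false = ≡.sym (ℚₚ.*-zeroˡ (prodOn C y))

  -- `Z` is affine in y o. For o outside D the constant term belongs to the deletion of o and the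
  -- coefficient of y o to its contraction.
  Z-split : ∀ {K} D y {o} → lookup K o ≡ false → Z K D y ≡ Z (K △ o) D y ℚ.+ y o ℚ.* Z (K △ o) (D △ o) y
  Z-split {K} D y {o} o∉K = ≡.trans (sumSub-split o (summand K D y))
    (≡.trans (sumSub-cong same) (≡.trans (sumSub-+ (summand (K △ o) D y) λ C → y o ℚ.* summand (K △ o) (D △ o) y C)
      (≡.cong (Z (K △ o) D y ℚ.+_) (sumSub-*ˡ (y o) (summand (K △ o) (D △ o) y)))))
    where
    o∈K△o : lookup (K △ o) o ≡ true
    o∈K△o = ≡.trans (△-same K o) (≡.cong not o∉K)
    module _ (C : Subset n) (o∉C : lookup C o ≡ false) where
      ∈⇒≢o : ∀ {u} → lookup K u ≡ true → u ≢ o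
      ∈⇒≢o u∈K ≡.refl = true≢false (≡.trans (≡.sym u∈K) o∉K)
      same-K : disjoint (K △ o) C ≡ disjoint K C
      same-K = bool-ext
        (λ d → ⇒disjoint K C λ u u∈K → disjoint⇒ (K △ o) C d u (≡.trans (△-other K (∈⇒≢o u∈K)) u∈K))
        λ d → ⇒disjoint (K △ o) C (helper d)
        where
        helper : disjoint K C ≡ true → ∀ u → lookup (K △ o) u ≡ true → lookup C u ≡ false
        helper d u u∈ with u Finₚ.≟ o
        ... | yes ≡.refl = o∉C
        ... | no u≢o = disjoint⇒ K C d u (≡.trans (≡.sym (△-other K u≢o)) u∈)
      same-C : disjoint K (C △ o) ≡ disjoint K C
      same-C = bool-ext
        (λ d → ⇒disjoint K C λ u u∈K → ≡.trans (≡.sym (△-other C (∈⇒≢o u∈K))) (disjoint⇒ K (C △ o) d u u∈K))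
        λ d → ⇒disjoint K (C △ o) λ u u∈K → ≡.trans (△-other C (∈⇒≢o u∈K)) (disjoint⇒ K C d u u∈K)
      outside : summand K D y C ℚ.+ summand K D y (C △ o) ≡ summand (K △ o) D y C ℚ.+ y o ℚ.* summand (K △ o) (D △ o) y C
      outside rewrite same-K | same-C with disjoint K C
      ... | false = ≡.sym (≡.trans (ℚₚ.+-identityˡ (y o ℚ.* 0ℚ)) (ℚₚ.*-zeroʳ (y o)))
      ... | true rewrite prodOn-△ C o y o∉C | △-⊕ C D o | ⊕-△ C D o = ≡.cong (value (C ⊕ D) ℚ.* prodOn C y ℚ.+_)
            (ℚ-Solver.solve 3 (λ a b c → a ℚ-Solver.:* (b ℚ-Solver.:* c) ℚ-Solver.:= b ℚ-Solver.:* (a ℚ-Solver.:* c)) ≡.refl (value ((C ⊕ D) △ o)) (y o) (prodOn C y))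
    same : ∀ C → (if lookup C o then 0ℚ else summand K D y C ℚ.+ summand K D y (C △ o)) ≡
                 summand (K △ o) D y C ℚ.+ y o ℚ.* summand (K △ o) (D △ o) y C
    same C with lookup C o in o∈C
    ... | true rewrite ¬true⇒false {disjoint (K △ o) C} (λ d → true≢false (≡.trans (≡.sym o∈C) (disjoint⇒ (K △ o) C d o o∈K△o))) =
          ≡.sym (≡.trans (ℚₚ.+-identityˡ (y o ℚ.* 0ℚ)) (ℚₚ.*-zeroʳ (y o)))
    ... | false = outside C o∈C

  Z-cong : ∀ K D {y y′} → (∀ u → lookup K u ≡ false → y u ≡ y′ u) → Z K D y ≡ Z K D y′
  Z-cong K D {y} {y′} e = sumSub-cong same
    where
    same : ∀ C → summand K D y C ≡ summand K D y′ C
    same C with disjoint K C in d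
    ... | false = ≡.refl
    ... | true = ≡.cong (value (C ⊕ D) ℚ.*_) (prodOn-cong C λ u u∈C → e u (¬true⇒false λ u∈K → true≢false (≡.trans (≡.sym u∈C) (disjoint⇒ K C d u u∈K))))

  Z-⊤ : ∀ D y → Z ⊤ D y ≡ value D
  Z-⊤ D y = ≡.trans (sumSub-∅ {F = summand ⊤ D y} nonempty-zero) at-∅
    where
    ∈⊤ : ∀ u → lookup {n = n} ⊤ u ≡ true
    ∈⊤ u = Vecₚ.lookup-replicate u true
    nonempty-zero : ∀ C → C ≢ ∅ → summand ⊤ D y C ≡ 0ℚ
    nonempty-zero C C≢∅ with disjoint ⊤ C in d
    ... | false = ≡.refl
    ... | true = ⊥-elim (C≢∅ (subset-ext λ u → ≡.trans (disjoint⇒ ⊤ C d u (∈⊤ u)) (≡.sym (lookup-∅ u))))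
    at-∅ : summand ⊤ D y ∅ ≡ value D
    at-∅ rewrite ⇒disjoint {n} ⊤ ∅ (λ u _ → lookup-∅ u) | prodOn-∅ n y | ⊕-comm ∅ D | ⊕-∅ D = ℚₚ.*-identityʳ (value D)

  ⁅⁆-disjoint : ∀ {e f : Fin n} → e ≢ f → disjoint ⁅ e ⁆ ⁅ f ⁆ ≡ true
  ⁅⁆-disjoint {e} {f} e≢f = ⇒disjoint ⁅ e ⁆ ⁅ f ⁆ λ u u∈ → lookup-⁅⁆-≢ {u = f} {u} λ { ≡.refl → e≢f (≡.sym (Subsetₚ.x∈⁅y⁆⇒x≡y e (true⇒∈ u∈))) }

  ⁅⁆≡△ : ∀ (e : Fin n) → ⁅ e ⁆ ≡ ∅ △ e
  ⁅⁆≡△ e = ≡.trans (≡.sym (Subsetₚ.∪-identityˡ ⁅ e ⁆)) (∪≡△ ∅ e (lookup-∅ e))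

  ⁅⁆∪⁅⁆≡△△ : ∀ {e f : Fin n} → e ≢ f → ⁅ e ⁆ ∪ ⁅ f ⁆ ≡ ∅ △ e △ f
  ⁅⁆∪⁅⁆≡△△ {e} {f} e≢f = ≡.trans (∪≡△ ⁅ e ⁆ f (lookup-⁅⁆-≢ (e≢f ∘ ≡.sym))) (≡.cong (_△ f) (⁅⁆≡△ e))

  -- For D inside K and avoiding e and f, this is ΔM{e , f} of the minor obtained by contracting D
  -- and deleting the other elements of K except e and f.
  gap : Subset n → Subset n → Fin n → Fin n → (Fin n → ℚ) → ℚ
  gap K D e f y = Z K (D △ e) y ℚ.* Z K (D △ f) y ℚ.- Z K (D △ e △ f) y ℚ.* Z K D y

  ΔM≡gap : ∀ {e f} → e ≢ f → ∀ y → ΔM M e f y ≡ gap (∅ △ e △ f) ∅ e f y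
  ΔM≡gap {e} {f} e≢f y = ≡.cong₂ ℚ._-_ (≡.cong₂ ℚ._*_
      (≡.trans (MIJ≡Z ⁅ e ⁆ ⁅ f ⁆ y (⁅⁆-disjoint e≢f)) (≡.cong₂ (λ K D → Z K D y) (⁅⁆∪⁅⁆≡△△ e≢f) (⁅⁆≡△ e)))
      (≡.trans (MIJ≡Z ⁅ f ⁆ ⁅ e ⁆ y (⁅⁆-disjoint (e≢f ∘ ≡.sym))) (≡.cong₂ (λ K D → Z K D y) (≡.trans (Subsetₚ.∪-comm ⁅ f ⁆ ⁅ e ⁆) (⁅⁆∪⁅⁆≡△△ e≢f)) (⁅⁆≡△ f))))
    (≡.cong₂ ℚ._*_
      (≡.trans (MIJ≡Z (⁅ e ⁆ ∪ ⁅ f ⁆) ∅ y (⇒disjoint (⁅ e ⁆ ∪ ⁅ f ⁆) ∅ λ u _ → lookup-∅ u))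
        (≡.cong₂ (λ K D → Z K D y) (≡.trans (Subsetₚ.∪-identityʳ _) (⁅⁆∪⁅⁆≡△△ e≢f)) (⁅⁆∪⁅⁆≡△△ e≢f)))
      (≡.trans (MIJ≡Z ∅ (⁅ e ⁆ ∪ ⁅ f ⁆) y (⇒disjoint ∅ (⁅ e ⁆ ∪ ⁅ f ⁆) λ u u∈ → ⊥-elim (true≢false (≡.trans (≡.sym u∈) (lookup-∅ u)))))
        (≡.cong (λ K → Z K ∅ y) (≡.trans (Subsetₚ.∪-identityˡ _) (⁅⁆∪⁅⁆≡△△ e≢f)))))

-- Excluding the Fano matroid and its dual.

module ForbiddenMinor {n : ℕ} (M : Matroid n) (bin : BinaryPivots M) where
  open MatroidFacts M
  open AdjacencyFacts M
  open PivotAdjacency M bin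

  Table : Set
  Table = Fin 7 → Fin 7 → Bool

  flip : Subset 7 → Fin 7 → Subset 7
  flip T a = updateAt T a not

  pivot-table : Table → Fin 7 → Fin 7 → Table
  pivot-table g k l a b with a Finₚ.≟ k | a Finₚ.≟ l | b Finₚ.≟ k | b Finₚ.≟ l
  ... | yes _ | _ | yes _ | _ = false
  ... | yes _ | _ | no _ | yes _ = true
  ... | yes _ | _ | no _ | no _ = g l b
  ... | no _ | yes _ | yes _ | _ = true
  ... | no _ | yes _ | no _ | yes _ = false
  ... | no _ | yes _ | no _ | no _ = g k b
  ... | no _ | no _ | yes _ | _ = g l a
  ... | no _ | no _ | no _ | yes _ = g k a
  ... | no _ | no _ | no _ | no _ = g a b xor ((g a l ∧ g b k) xor (g a k ∧ g b l))

  edge? : (g : Table) (T : Subset 7) →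
          Dec (∃ λ k → ∃ λ l → lookup T k ≡ true × lookup T l ≡ true × g k l ≡ true)
  edge? g T = Finₚ.any? λ k → Finₚ.any? λ l → (lookup T k Boolₚ.≟ true) ×-dec (lookup T l Boolₚ.≟ true) ×-dec (g k l Boolₚ.≟ true)

  inhabited? : (T : Subset 7) → Dec (∃ λ a → lookup T a ≡ true)
  inhabited? T = Finₚ.any? λ a → lookup T a Boolₚ.≟ true

  opaque
    -- The first argument is fuel; every pivot removes two elements from T.
    decide : ℕ → Table → Subset 7 → Maybe Bool
    decide m g T with edge? g T
    decide m g T | no _ = just (not (does (inhabited? T)))
    decide zero g T | yes _ = nothing
    decide (suc m) g T | yes (k , l , _) = decide m (pivot-table g k l) (flip (flip T k) l)

  no-edge⇒not-basis : ∀ {B X} → Basis B → (∀ u v → lookup X u ≡ true → lookup X v ≡ true → adj M B u v ≡ false) →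
                      ∀ {x} → lookup X x ≡ true → ¬ Basis (B ⊕ X)
  no-edge⇒not-basis {B} {X} bB no-edge {x} x∈X b with ≡.trans (≡.sym (δ-refl x))
      (proj₂ (detects-no-edge {λ _ _ → 0₃} X ((λ _ → ≡.refl) , λ _ _ → ≡.refl) bB (λ u v u∈ v∈ → ≡.refl , no-edge u v u∈ v∈)) b
        (δ x) (λ w w∉ → δ-≢ (differ {X = X} x∈X w∉)) (λ u _ → sum-0 λ v → ≡.refl) x)
    where open TotallyUnimodular M
  ... | ()
    where open TotallyUnimodular M

  module _ (h : Fin 7 → Fin n) (h-injective : ∀ {a b} → h a ≡ h b → a ≡ b) where

    h-≢ : ∀ {a b} → a ≢ b → h a ≢ h b
    h-≢ a≢b e = a≢b (h-injective e)

    In : Subset 7 → Fin n → Set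
    In T w = ∃ λ a → lookup T a ≡ true × h a ≡ w

    in? : ∀ T w → Dec (In T w)
    in? T w = Finₚ.any? λ a → (lookup T a Boolₚ.≟ true) ×-dec (h a Finₚ.≟ w)

    image : Subset 7 → Subset n
    image T = comprehension (in? T)

    image-h : ∀ T a → lookup (image T) (h a) ≡ lookup T a
    image-h T a = bool-ext (λ e → back (comprehension⇒ (in? T) e)) λ e → ⇒comprehension (in? T) (a , e , ≡.refl)
      where
      back : In T (h a) → lookup T a ≡ true
      back (b , b∈ , e) = ≡.subst (λ c → lookup T c ≡ true) (h-injective e) b∈

    image-outside : ∀ T {w} → (∀ a → h a ≢ w) → lookup (image T) w ≡ false
    image-outside T out = ¬true⇒false λ e → out (proj₁ (comprehension⇒ (in? T) e)) (proj₂ (proj₂ (comprehension⇒ (in? T) e)))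

    image-flip : ∀ T a → image (flip T a) ≡ image T △ h a
    image-flip T a = subset-ext-at (h a)
      (≡.trans (image-h (flip T a) a) (≡.trans (Vecₚ.lookup∘updateAt a T) (≡.sym (≡.trans (△-same (image T) (h a)) (≡.cong not (image-h T a))))))
      λ w w≢ → ≡.trans (helper w w≢) (≡.sym (△-other (image T) w≢))
      where
      helper : ∀ w → w ≢ h a → lookup (image (flip T a)) w ≡ lookup (image T) w
      helper w w≢ with Finₚ.any? (λ b → h b Finₚ.≟ w)
      ... | yes (b , ≡.refl) = ≡.trans (image-h (flip T a) b) (≡.trans (Vecₚ.lookup∘updateAt′ b a (λ { ≡.refl → w≢ ≡.refl }) T) (≡.sym (image-h T b)))
      ... | no out = ≡.trans (image-outside (flip T a) λ b e → out (b , e)) (≡.sym (image-outside T λ b e → out (b , e)))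

    Matches : Subset n → Table → Set
    Matches B g = ∀ a b → adj M B (h a) (h b) ≡ g a b

    matches-pivot : ∀ {B g k l} → Basis B → Matches B g → g k l ≡ true → Matches (B △ h k △ h l) (pivot-table g k l)
    matches-pivot {B} {g} {k} {l} bB m gkl a b with a Finₚ.≟ k | a Finₚ.≟ l | b Finₚ.≟ k | b Finₚ.≟ l
    ... | yes ≡.refl | _ | yes ≡.refl | _ = adj-refl _ (h a)
    ... | yes ≡.refl | _ | no _ | yes ≡.refl = adj-kl bB (≡.trans (m a b) gkl)
    ... | yes ≡.refl | _ | no b≢k | no b≢l = ≡.trans (adj-k bB (≡.trans (m k l) gkl) (h-≢ b≢k) (h-≢ b≢l)) (m l b)
    ... | no _ | yes ≡.refl | yes ≡.refl | _ = ≡.trans (adj-sym _ (h a) (h b)) (adj-kl bB (≡.trans (m b a) gkl))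
    ... | no _ | yes ≡.refl | no _ | yes ≡.refl = adj-refl _ (h a)
    ... | no _ | yes ≡.refl | no b≢k | no b≢l = ≡.trans (adj-l bB (≡.trans (m k l) gkl) (h-≢ b≢k) (h-≢ b≢l)) (m k b)
    ... | no a≢k | no a≢l | yes ≡.refl | _ = ≡.trans (adj-sym _ (h a) (h b)) (≡.trans (adj-k bB (≡.trans (m k l) gkl) (h-≢ a≢k) (h-≢ a≢l)) (m l a))
    ... | no a≢k | no a≢l | no _ | yes ≡.refl = ≡.trans (adj-sym _ (h a) (h b)) (≡.trans (adj-l bB (≡.trans (m k l) gkl) (h-≢ a≢k) (h-≢ a≢l)) (m k a))
    ... | no a≢k | no a≢l | no b≢k | no b≢l = pivot-value bB (≡.trans (m k l) gkl) (h-≢ a≢k) (h-≢ a≢l) (h-≢ b≢k) (h-≢ b≢l)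
          (m a b) (m a l) (m b k) (m a k) (m b l)

    opaque
      unfolding decide

      -- A pivot on an edge inside T toggles the same two elements in B and in the image of T, so
      -- their sum is unchanged; when no edge is left, that sum is a basis exactly if T is empty.
      decide-correct : ∀ m {B g} T {b} → Basis B → Matches B g → decide m g T ≡ just b → β (B ⊕ image T) ≡ b
      decide-correct m {B} {g} T bB mt e with edge? g T
      decide-correct m {B} {g} T {b} bB mt e | no none = conclude (inhabited? T) e
        where
        no-edge : ∀ u v → lookup (image T) u ≡ true → lookup (image T) v ≡ true → adj M B u v ≡ false
        no-edge u v u∈ v∈ with comprehension⇒ (in? T) u∈ | comprehension⇒ (in? T) v∈
        ... | k , k∈ , ≡.refl | l , l∈ , ≡.refl = ¬true⇒false λ e → none (k , l , k∈ , l∈ , ≡.trans (≡.sym (mt k l)) e)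
        conclude : (d : Dec (∃ λ a → lookup T a ≡ true)) → just (not (does d)) ≡ just b → β (B ⊕ image T) ≡ b
        conclude (yes (a , a∈)) ≡.refl = ¬true⇒false (no-edge⇒not-basis bB no-edge (⇒comprehension (in? T) (a , a∈ , ≡.refl)))
        conclude (no empty) ≡.refl = ≡.trans (≡.cong β (≡.trans (≡.cong (B ⊕_) image≡∅) (⊕-∅ B))) bB
          where
          image≡∅ : image T ≡ ∅
          image≡∅ = subset-ext λ u → ≡.trans (¬true⇒false (λ e → empty (proj₁ (comprehension⇒ (in? T) e) , proj₁ (proj₂ (comprehension⇒ (in? T) e))))) (≡.sym (lookup-∅ u))
      decide-correct zero T bB mt () | yes _
      decide-correct (suc m) {B} {g} T bB mt e | yes (k , l , k∈ , l∈ , gkl) =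
        ≡.trans (≡.cong β same) (decide-correct m (flip (flip T k) l) (pivot-basis bB (≡.trans (mt k l) gkl)) (matches-pivot bB mt gkl) e)
        where
        same : B ⊕ image T ≡ (B △ h k △ h l) ⊕ image (flip (flip T k) l)
        same = ≡.sym (≡.trans (≡.cong ((B △ h k △ h l) ⊕_) (≡.trans (image-flip (flip T k) l) (≡.cong (_△ h l) (image-flip T k))))
          (≡.trans (TotallyUnimodular.⊕-△△ M (B △ h k △ h l) (image T) (h k) (h l))
            (≡.trans (≡.cong (λ X → X △ h k △ h l) (TotallyUnimodular.△△-⊕ M B (image T) (h k) (h l))) (△△-involutive (B ⊕ image T) (h k) (h l)))))

-- A nonnegative quadratic α + β t + γ t² has γ ≥ 0: otherwise take t = ± (α / -γ + 1).
leading-nonneg : ∀ α β γ → (∀ t → 0ℚ ℚ.≤ α ℚ.+ (t ℚ.* β ℚ.+ t ℚ.* t ℚ.* γ)) → 0ℚ ℚ.≤ γ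
leading-nonneg α β γ nonneg with 0ℚ ℚₚ.≤? γ
... | yes p = p
... | no γ≱0 = ⊥-elim (ℚₚ.<-irrefl ≡.refl (ℚₚ.≤-<-trans (≡.subst (0ℚ ℚ.≤_) twice (ℚₚ.+-mono-≤ (nonneg t) (nonneg (ℚ.- t))))
        (ℚₚ.neg-antimono-< (ℚₚ.+-mono-< X>0 X>0))))
  where
  open ℚ-Solver
  m : ℚ
  m = ℚ.- γ
  m>0 : 0ℚ ℚ.< m
  m>0 = ℚₚ.neg-antimono-< (ℚₚ.≰⇒> γ≱0)
  instance
    m-positive : ℚ.Positive m
    m-positive = ℚ.positive m>0
    m-nonzero : ℚ.NonZero m
    m-nonzero = ℚₚ.pos⇒nonZero m
  r t X : ℚ
  r = ℚ.1/ m
  t = α ℚ.* r ℚ.+ 1ℚ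
  X = (α ℚ.+ α ℚ.* (α ℚ.* r)) ℚ.+ m
  mr≡1 : m ℚ.* r ≡ 1ℚ
  mr≡1 = ℚₚ.*-inverseʳ m
  α≥0 : 0ℚ ℚ.≤ α
  α≥0 = ≡.subst (0ℚ ℚ.≤_) (solve 3 (λ a b c → a :+ (con (0 , 0) :* b :+ con (0 , 0) :* con (0 , 0) :* c) := a) ≡.refl α β γ) (nonneg 0ℚ)
  instance
    α-nonneg : ℚ.NonNegative α
    α-nonneg = ℚ.nonNegative α≥0
    r-nonneg : ℚ.NonNegative r
    r-nonneg = ℚₚ.pos⇒nonNeg r {{ℚₚ.1/pos⇒pos m}}
    αr-nonneg : ℚ.NonNegative (α ℚ.* r)
    αr-nonneg = ℚₚ.nonNeg*nonNeg⇒nonNeg α r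
    ααr-nonneg : ℚ.NonNegative (α ℚ.* (α ℚ.* r))
    ααr-nonneg = ℚₚ.nonNeg*nonNeg⇒nonNeg α (α ℚ.* r)
  X>0 : 0ℚ ℚ.< X
  X>0 = ℚₚ.+-mono-≤-< (ℚₚ.+-mono-≤ α≥0 (ℚₚ.nonNegative⁻¹ (α ℚ.* (α ℚ.* r)))) m>0
  -- Adding the values at t and - t removes β and leaves 2 (α - m t²). With r = 1 / m the choice t =
  -- α r + 1 gives m t² = α² r + 2 α + m, so the sum is - 2 X.
  twice : (α ℚ.+ (t ℚ.* β ℚ.+ t ℚ.* t ℚ.* γ)) ℚ.+ (α ℚ.+ (ℚ.- t ℚ.* β ℚ.+ ℚ.- t ℚ.* ℚ.- t ℚ.* γ)) ≡ ℚ.- (X ℚ.+ X)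
  twice = ≡.trans (solve 4 (λ α β γ r → let t = α :* r :+ con (1 , 0) in
        (α :+ (t :* β :+ t :* t :* γ)) :+ (α :+ ((:- t) :* β :+ (:- t) :* (:- t) :* γ)) :=
        expression α γ r ((:- γ) :* r)) ≡.refl α β γ r)
      (≡.trans (≡.cong (λ e → ((α ℚ.- (e ℚ.* (α ℚ.* (α ℚ.* r)) ℚ.+ (e ℚ.* α ℚ.+ e ℚ.* α))) ℚ.+ γ) ℚ.+ ((α ℚ.- (e ℚ.* (α ℚ.* (α ℚ.* r)) ℚ.+ (e ℚ.* α ℚ.+ e ℚ.* α))) ℚ.+ γ)) mr≡1)
        (solve 3 (λ α γ r → expression α γ r (con (1 , 0)) := :- (((α :+ α :* (α :* r)) :+ :- γ) :+ ((α :+ α :* (α :* r)) :+ :- γ))) ≡.refl α γ r))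
    where
    expression : ∀ {k} → Polynomial k → Polynomial k → Polynomial k → Polynomial k → Polynomial k
    expression α γ r e = ((α :- (e :* (α :* (α :* r)) :+ (e :* α :+ e :* α))) :+ γ) :+ ((α :- (e :* (α :* (α :* r)) :+ (e :* α :+ e :* α))) :+ γ)

all-subsets? : ∀ m {P : Subset m → Set} → (∀ T → Dec (P T)) → Dec (∀ T → P T)
all-subsets? zero P? = Decidable.map′ (λ p → λ { [] → p }) (λ f → f []) (P? [])
all-subsets? (suc m) P? = Decidable.map′ (λ { (f , g) → λ { (true ∷ T) → f T ; (false ∷ T) → g T } })
  (λ f → (λ T → f (true ∷ T)) , λ T → f (false ∷ T))
  (all-subsets? m (λ T → P? (true ∷ T)) ×-dec all-subsets? m (λ T → P? (false ∷ T)))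

is-just? : (x : Maybe Bool) → Dec (∃ λ b → x ≡ just b)
is-just? (just b) = yes (b , ≡.refl)
is-just? nothing = no λ ()

module FanoTable where

  pattern row-i = zero
  pattern row-k = suc zero
  pattern row-j = suc (suc zero)
  pattern col-x = suc (suc (suc zero))
  pattern col-y = suc (suc (suc (suc zero)))
  pattern col-c = suc (suc (suc (suc (suc zero))))
  pattern col-d = suc (suc (suc (suc (suc (suc zero)))))

  incident : Fin 3 → Fin 4 → Bool
  incident 0₃ = λ { zero → true ; (suc zero) → true ; (suc (suc zero)) → true ; (suc (suc (suc zero))) → false }
  incident 1₃ = λ { zero → true ; (suc zero) → false ; (suc (suc zero)) → true ; (suc (suc (suc zero))) → true }
  incident 2₃ = λ { zero → true ; (suc zero) → true ; (suc (suc zero)) → false ; (suc (suc (suc zero))) → true }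

  side : Fin 7 → Fin 3 ⊎ Fin 4
  side = splitAt 3

  between : Fin 3 ⊎ Fin 4 → Fin 3 ⊎ Fin 4 → Bool
  between (inj₁ r) (inj₂ c) = incident r c
  between (inj₂ c) (inj₁ r) = incident r c
  between _ _ = false

  table : Fin 7 → Fin 7 → Bool
  table a b = between (side a) (side b)

  -- Vertices of the pattern are told apart by their neighbourhoods, which is how seven elements
  -- with this adjacency are seen to be distinct.
  table-injective : ∀ a b → (∀ c → table a c ≡ table b c) → a ≡ b
  table-injective = from-yes (Finₚ.all? λ a → Finₚ.all? λ b → Finₚ.all? (λ c → table a c Boolₚ.≟ table b c) →-dec (a Finₚ.≟ b))

-- With e = i, f = j and all weights 1 except for y = e + f, the gap is a negative number.
module Fano {n : ℕ} (M : Matroid n) (bin : BinaryPivots M) where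
  open MatroidFacts M
  open AdjacencyFacts M
  open Minors M
  open ForbiddenMinor M bin
  open FanoTable

  opaque
    unfolding decide

    decided : ∀ T → ∃ λ b → decide 3 table T ≡ just b
    decided = from-yes (all-subsets? 7 λ T → is-just? (decide 3 table T))

  value₇ : Maybe Bool → ℚ
  value₇ (just true) = 1ℚ
  value₇ _ = 0ℚ

  -- If y has weight t and all other weights are 1, then ΔM{i , j} is 16 t (t + 1) for the Fano
  -- matroid, with its minimum at t = - 1/2, and 16 (t + 1) for the dual. Duality inverts the
  -- weights, whence - 2.
  weight : Bool → Fin 7 → ℚ
  weight true col-y = ℚ.- ℚ.½
  weight false col-y = ℚ.- (1ℚ ℚ.+ 1ℚ)
  weight _ _ = 1ℚ

  expand₇ : Bool → List (Fin 7) → Subset 7 → ℚ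
  expand₇ b [] T = value₇ (decide 3 table T)
  expand₇ b (o ∷ L) T = expand₇ b L T ℚ.+ weight b o ℚ.* expand₇ b L (flip T o)

  others : List (Fin 7)
  others = row-k ∷ col-x ∷ col-c ∷ col-d ∷ col-y ∷ []

  gap₇ : Bool → Subset 7 → ℚ
  gap₇ b T = expand₇ b others (flip T row-i) ℚ.* expand₇ b others (flip T row-j) ℚ.-
             expand₇ b others (flip (flip T row-i) row-j) ℚ.* expand₇ b others T

  rows : Bool → Subset 7
  rows b = b ∷ b ∷ b ∷ not b ∷ not b ∷ not b ∷ not b ∷ []

  opaque
    unfolding decide

    gap₇-negative : ∀ b → ¬ 0ℚ ℚ.≤ gap₇ b (rows b)
    gap₇-negative true = from-no (0ℚ ℚₚ.≤? gap₇ true (rows true))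
    gap₇-negative false = from-no (0ℚ ℚₚ.≤? gap₇ false (rows false))

  module _ (e f : Fin n) where

    Nonneg : Subset n → Subset n → Set
    Nonneg K D = ∀ y → 0ℚ ℚ.≤ gap K D e f y

    update : (Fin n → ℚ) → Fin n → ℚ → Fin n → ℚ
    update y o t u = if does (u Finₚ.≟ o) then t else y u

    update-≢ : ∀ y {o t u} → u ≢ o → update y o t u ≡ y u
    update-≢ y {o} {t} {u} u≢o with u Finₚ.≟ o
    ... | yes p = ⊥-elim (u≢o p)
    ... | no _ = ≡.refl

    update-≡ : ∀ y o t → update y o t o ≡ t
    update-≡ y o t with o Finₚ.≟ o
    ... | yes _ = ≡.refl
    ... | no q = ⊥-elim (q ≡.refl)

    -- Deleting or contracting an element o ∉ {e , f}: the limits y_o → 0 and y_o → ∞.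
    module _ {K D : Subset n} {o : Fin n} (o∉K : lookup K o ≡ false) (nonneg : Nonneg K D) where
      open ℚ-Solver

      private
        K′ : Subset n
        K′ = K △ o

        Z-update : ∀ D y t → Z K D (update y o t) ≡ Z K′ D y ℚ.+ t ℚ.* Z K′ (D △ o) y
        Z-update D y t = ≡.trans (Z-split {K} D (update y o t) o∉K)
          (≡.cong₂ ℚ._+_ (same D) (≡.cong₂ ℚ._*_ (update-≡ y o t) (same (D △ o))))
          where
          same : ∀ D → Z K′ D (update y o t) ≡ Z K′ D y
          same D = Z-cong K′ D λ u u∉ → update-≢ y λ { ≡.refl → true≢false (≡.trans (≡.sym (≡.trans (△-same K u) (≡.cong not o∉K))) u∉) }

        cross leading : (Fin n → ℚ) → ℚ
        cross y = (Z K′ (D △ e) y ℚ.* Z K′ (D △ f △ o) y ℚ.+ Z K′ (D △ e △ o) y ℚ.* Z K′ (D △ f) y) ℚ.-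
                  (Z K′ (D △ e △ f) y ℚ.* Z K′ (D △ o) y ℚ.+ Z K′ (D △ e △ f △ o) y ℚ.* Z K′ D y)
        leading y = Z K′ (D △ e △ o) y ℚ.* Z K′ (D △ f △ o) y ℚ.- Z K′ (D △ e △ f △ o) y ℚ.* Z K′ (D △ o) y

        -- The gap as a polynomial in y o: its constant term is the gap of the deletion of o and its
        -- leading coefficient that of the contraction, so nonnegativity for all t passes to both.
        quadratic : ∀ y t → 0ℚ ℚ.≤ gap K′ D e f y ℚ.+ (t ℚ.* cross y ℚ.+ t ℚ.* t ℚ.* leading y)
        quadratic y t = ≡.subst (0ℚ ℚ.≤_) (≡.trans
          (≡.cong₂ ℚ._-_ (≡.cong₂ ℚ._*_ (Z-update (D △ e) y t) (Z-update (D △ f) y t)) (≡.cong₂ ℚ._*_ (Z-update (D △ e △ f) y t) (Z-update D y t)))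
          (solve 9 (λ a b c d p q r s t → (a :+ t :* b) :* (c :+ t :* d) :- (p :+ t :* q) :* (r :+ t :* s) :=
              (a :* c :- p :* r) :+ (t :* ((a :* d :+ b :* c) :- (p :* s :+ q :* r)) :+ t :* t :* (b :* d :- q :* s))) ≡.refl
            (Z K′ (D △ e) y) (Z K′ (D △ e △ o) y) (Z K′ (D △ f) y) (Z K′ (D △ f △ o) y)
            (Z K′ (D △ e △ f) y) (Z K′ (D △ e △ f △ o) y) (Z K′ D y) (Z K′ (D △ o) y) t))
          (nonneg (update y o t))

        at-zero : ∀ α β γ → α ℚ.+ (0ℚ ℚ.* β ℚ.+ 0ℚ ℚ.* 0ℚ ℚ.* γ) ≡ α
        at-zero = solve 3 (λ α β γ → α :+ (con (0 , 0) :* β :+ con (0 , 0) :* con (0 , 0) :* γ) := α) ≡.refl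

      delete : Nonneg K′ D
      delete y = ≡.subst (0ℚ ℚ.≤_) (at-zero (gap K′ D e f y) (cross y) (leading y)) (quadratic y 0ℚ)

      contract : Nonneg K′ (D △ o)
      contract y = ≡.subst (0ℚ ℚ.≤_) (≡.cong₂ ℚ._-_
          (≡.cong₂ (λ A B → Z K′ A y ℚ.* Z K′ B y) (△-comm D e o) (△-comm D f o))
          (≡.cong (λ A → Z K′ A y ℚ.* Z K′ (D △ o) y) (≡.trans (△-comm (D △ e) f o) (≡.cong (_△ f) (△-comm D e o)))))
        (leading-nonneg (gap K′ D e f y) (cross y) (leading y) (quadratic y))

    module _ (B : Subset n) where

      -- The elements of K that are contracted; the other elements of K are deleted. Following B
      -- ensures that the rest of B is a basis of the minor.
      fixed : Subset n → Subset n
      fixed K = tabulate λ u → lookup K u ∧ (not (does (u Finₚ.≟ e)) ∧ (not (does (u Finₚ.≟ f)) ∧ lookup B u))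

      lookup-fixed : ∀ K u → lookup (fixed K) u ≡ lookup K u ∧ (not (does (u Finₚ.≟ e)) ∧ (not (does (u Finₚ.≟ f)) ∧ lookup B u))
      lookup-fixed K u = Vecₚ.lookup∘tabulate _ u

      fixed-∈ : ∀ {K u} → lookup K u ≡ true → u ≢ e → u ≢ f → lookup (fixed K) u ≡ lookup B u
      fixed-∈ {K} {u} u∈K u≢e u≢f rewrite lookup-fixed K u | u∈K with u Finₚ.≟ e | u Finₚ.≟ f
      ... | yes p | _ = ⊥-elim (u≢e p)
      ... | no _ | yes p = ⊥-elim (u≢f p)
      ... | no _ | no _ = ≡.refl

      fixed-∉ : ∀ {K u} → lookup K u ≡ false → lookup (fixed K) u ≡ false
      fixed-∉ {K} {u} u∉K rewrite lookup-fixed K u | u∉K = ≡.refl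

      fixed-e : ∀ K → lookup (fixed K) e ≡ false
      fixed-e K rewrite lookup-fixed K e with e Finₚ.≟ e
      ... | yes _ = Boolₚ.∧-zeroʳ (lookup K e)
      ... | no q = ⊥-elim (q ≡.refl)

      fixed-f : ∀ K → lookup (fixed K) f ≡ false
      fixed-f K rewrite lookup-fixed K f with f Finₚ.≟ f
      ... | yes _ = ≡.trans (≡.cong (lookup K f ∧_) (Boolₚ.∧-zeroʳ _)) (Boolₚ.∧-zeroʳ (lookup K f))
      ... | no q = ⊥-elim (q ≡.refl)

      fixed-△ : ∀ {K o} → lookup K o ≡ false → o ≢ e → o ≢ f →
                fixed (K △ o) ≡ (if lookup B o then fixed K △ o else fixed K)
      fixed-△ {K} {o} o∉K o≢e o≢f = subset-ext-at o at-o other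
        where
        at-o : lookup (fixed (K △ o)) o ≡ lookup (if lookup B o then fixed K △ o else fixed K) o
        at-o rewrite fixed-∈ {K △ o} (≡.trans (△-same K o) (≡.cong not o∉K)) o≢e o≢f with lookup B o
        ... | true = ≡.sym (≡.trans (△-same (fixed K) o) (≡.cong not (fixed-∉ {K} o∉K)))
        ... | false = ≡.sym (fixed-∉ {K} o∉K)
        other : ∀ v → v ≢ o → lookup (fixed (K △ o)) v ≡ lookup (if lookup B o then fixed K △ o else fixed K) v
        other v v≢o = ≡.trans (≡.trans (lookup-fixed (K △ o) v) (≡.trans (≡.cong (_∧ _) (△-other K v≢o)) (≡.sym (lookup-fixed K v)))) (helper (lookup B o))
          where
          helper : ∀ b → lookup (fixed K) v ≡ lookup (if b then fixed K △ o else fixed K) v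
          helper true = ≡.sym (△-other (fixed K) v≢o)
          helper false = ≡.refl

      reach : ∀ H K → K ⊆ᵇ H → lookup K e ≡ true → lookup K f ≡ true → Acc _⊃_ K → Nonneg K (fixed K) → Nonneg H (fixed H)
      reach H K K⊆H e∈K f∈K (acc rec) nonneg with Finₚ.any? (λ o → (lookup K o Boolₚ.≟ false) ×-dec (lookup H o Boolₚ.≟ true))
      ... | no none = ≡.subst (λ X → Nonneg X (fixed X)) K≡H nonneg
        where
        K≡H : K ≡ H
        K≡H = subset-ext λ u → bool-ext (K⊆H u) λ u∈H → Boolₚ.¬-not {lookup K u} {false} λ u∉K → none (u , u∉K , u∈H)
      ... | yes (o , o∉K , o∈H) = reach H (K △ o) K△o⊆H (keep e∈K) (keep f∈K) (rec (add-⊃ o∉K)) next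
        where
        keep : ∀ {u} → lookup K u ≡ true → lookup (K △ o) u ≡ true
        keep u∈K = ≡.trans (△-other K (differ {X = K} u∈K o∉K)) u∈K
        K△o⊆H : (K △ o) ⊆ᵇ H
        K△o⊆H u u∈ with u Finₚ.≟ o
        ... | yes ≡.refl = o∈H
        ... | no u≢o = K⊆H u (≡.trans (≡.sym (△-other K u≢o)) u∈)
        next : Nonneg (K △ o) (fixed (K △ o))
        next = ≡.subst (Nonneg (K △ o)) (≡.sym (fixed-△ {K} o∉K (differ {X = K} e∈K o∉K ∘ ≡.sym) (differ {X = K} f∈K o∉K ∘ ≡.sym))) (step (lookup B o))
          where
          step : ∀ b → Nonneg (K △ o) (if b then fixed K △ o else fixed K)
          step true = contract o∉K nonneg
          step false = delete o∉K nonneg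

    start : StronglyRayleigh M → e ≢ f → ∀ B → Nonneg (∅ △ e △ f) (fixed B (∅ △ e △ f))
    start sr e≢f B = ≡.subst (Nonneg (∅ △ e △ f)) (subset-ext λ u → ≡.sym (≡.trans (empty u) (≡.sym (lookup-∅ u))))
      λ y → ≡.subst (0ℚ ℚ.≤_) (ΔM≡gap e≢f y) (sr e f e≢f y)
      where
      empty : ∀ u → lookup (fixed B (∅ △ e △ f)) u ≡ false
      empty u with u Finₚ.≟ e | u Finₚ.≟ f
      ... | yes ≡.refl | _ = fixed-e B (∅ △ e △ f)
      ... | no _ | yes ≡.refl = fixed-f B (∅ △ e △ f)
      ... | no u≢e | no u≢f = fixed-∉ B {∅ △ e △ f} (≡.trans (△△-other ∅ u≢e u≢f) (lookup-∅ u))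

  module _ (h : Fin 7 → Fin n) (h-injective : ∀ {a b} → h a ≡ h b → a ≡ b) where

    kept : List (Fin 7) → Subset n
    kept [] = ⊤
    kept (o ∷ L) = kept L △ h o

    kept-∈ : ∀ L {w} → All (λ o → w ≢ h o) L → lookup (kept L) w ≡ true
    kept-∈ [] {w} _ = Vecₚ.lookup-replicate w true
    kept-∈ (o ∷ L) (w≢ ∷ rest) = ≡.trans (△-other (kept L) w≢) (kept-∈ L rest)

    kept-∉ : ∀ L → AllPairs (λ a b → h a ≢ h b) L → ∀ {o} → o ∈ₗ L → lookup (kept L) (h o) ≡ false
    kept-∉ (o ∷ L) (o∉L ∷ _) (here ≡.refl) = ≡.trans (△-same (kept L) (h o)) (≡.cong not (kept-∈ L o∉L))
    kept-∉ (o ∷ L) (o∉L ∷ distinct) (there o′∈) = ≡.trans (△-other (kept L) (All.lookup o∉L o′∈ ∘ ≡.sym)) (kept-∉ L distinct o′∈)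

    expand : (Fin n → ℚ) → List (Fin 7) → Subset n → ℚ
    expand y [] D = value D
    expand y (o ∷ L) D = expand y L D ℚ.+ y (h o) ℚ.* expand y L (D △ h o)

    Z-expand : ∀ y L → AllPairs (λ a b → h a ≢ h b) L → ∀ D → Z (kept L) D y ≡ expand y L D
    Z-expand y [] _ D = Z-⊤ D y
    Z-expand y (o ∷ L) (o∉L ∷ distinct) D = ≡.trans (Z-split {kept (o ∷ L)} D y (≡.trans (△-same (kept L) (h o)) (≡.cong not (kept-∈ L o∉L))))
      (≡.cong₂ ℚ._+_ (shorter D) (≡.cong (y (h o) ℚ.*_) (shorter (D △ h o))))
      where
      shorter : ∀ D → Z (kept (o ∷ L) △ h o) D y ≡ expand y L D
      shorter D = ≡.trans (≡.cong (λ K → Z K D y) (△-involutive (kept L) (h o))) (Z-expand y L distinct D)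

    module _ {B : Subset n} (bB : Basis B) (match : Matches h h-injective B table) where

      private
        img : Subset 7 → Subset n
        img = image h h-injective

      value-image : ∀ T → value (B ⊕ img T) ≡ value₇ (decide 3 table T)
      value-image T with decided T
      ... | b , e rewrite e | decide-correct h h-injective 3 T bB match e with b
      ...   | true = ≡.refl
      ...   | false = ≡.refl

      expand≡expand₇ : ∀ b y → (∀ o → y (h o) ≡ weight b o) → ∀ L T → expand y L (B ⊕ img T) ≡ expand₇ b L T
      expand≡expand₇ b y yh [] T = value-image T
      expand≡expand₇ b y yh (o ∷ L) T = ≡.cong₂ ℚ._+_ (expand≡expand₇ b y yh L T) (≡.cong₂ ℚ._*_ (yh o)
        (≡.trans (≡.cong (expand y L) (≡.trans (≡.sym (⊕-△ B (img T) (h o))) (≡.cong (B ⊕_) (≡.sym (image-flip h h-injective T o)))))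
          (expand≡expand₇ b y yh L (flip T o))))

      impossible : StronglyRayleigh M → ∀ b → (∀ a → lookup B (h a) ≡ lookup (rows b) a) → ⊥
      impossible sr b sides = gap₇-negative b (≡.subst (0ℚ ℚ.≤_) gap≡gap₇ (nonneg y))
        where
        e f : Fin n
        e = h row-i
        f = h row-j
        e≢f : e ≢ f
        e≢f = h-≢ h h-injective λ ()
        -- The minor has seven elements; H contains everything except the five that carry weights,
        -- since e and f always belong to K.
        H : Subset n
        H = kept others
        H-∈ : ∀ {w} → (∀ o → o ≢ row-i → o ≢ row-j → w ≢ h o) → lookup H w ≡ true
        H-∈ q = kept-∈ others (q row-k (λ ()) (λ ()) ∷ q col-x (λ ()) (λ ()) ∷ q col-c (λ ()) (λ ()) ∷ q col-d (λ ()) (λ ()) ∷ q col-y (λ ()) (λ ()) ∷ [])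
        e∈H : lookup H e ≡ true
        e∈H = H-∈ λ o o≢i _ → h-≢ h h-injective (o≢i ∘ ≡.sym)
        f∈H : lookup H f ≡ true
        f∈H = H-∈ λ o _ o≢j → h-≢ h h-injective (o≢j ∘ ≡.sym)
        distinct : AllPairs (λ a b → h a ≢ h b) others
        distinct = (d (λ ()) ∷ d (λ ()) ∷ d (λ ()) ∷ d (λ ()) ∷ []) ∷ (d (λ ()) ∷ d (λ ()) ∷ d (λ ()) ∷ []) ∷
          (d (λ ()) ∷ d (λ ()) ∷ []) ∷ (d (λ ()) ∷ []) ∷ [] ∷ []
          where
          d : ∀ {a b} → a ≢ b → h a ≢ h b
          d = h-≢ h h-injective
        start⊆H : (∅ △ e △ f) ⊆ᵇ H
        start⊆H u u∈ with u Finₚ.≟ e | u Finₚ.≟ f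
        ... | yes ≡.refl | _ = e∈H
        ... | no _ | yes ≡.refl = f∈H
        ... | no u≢e | no u≢f = ⊥-elim (true≢false (≡.trans (≡.sym u∈) (≡.trans (△△-other ∅ u≢e u≢f) (lookup-∅ u))))
        nonneg : Nonneg e f H (fixed e f B H)
        nonneg = reach e f B H (∅ △ e △ f) start⊆H (≡.trans (△△-∈ ∅ e≢f) (≡.cong not (lookup-∅ e))) (≡.trans (△△-∈′ ∅ e≢f) (≡.cong not (lookup-∅ f)))
          (⊃-wellFounded (∅ △ e △ f)) (start e f sr e≢f B)
        outside-H : ∀ a → a ≢ row-i → a ≢ row-j → lookup H (h a) ≡ false
        outside-H a a≢i a≢j = kept-∉ others distinct (among a a≢i a≢j)
          where
          among : ∀ a → a ≢ row-i → a ≢ row-j → a ∈ₗ others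
          among = from-yes (Finₚ.all? λ a → ¬? (a Finₚ.≟ row-i) →-dec (¬? (a Finₚ.≟ row-j) →-dec (Any.any? (a Finₚ.≟_) others)))
        y : Fin n → ℚ
        y u = if does (u Finₚ.≟ h col-y) then weight b col-y else 1ℚ
        weight-1 : ∀ b o → o ≢ col-y → weight b o ≡ 1ℚ
        weight-1 b col-y q = ⊥-elim (q ≡.refl)
        weight-1 true row-i _ = ≡.refl
        weight-1 true row-k _ = ≡.refl
        weight-1 true row-j _ = ≡.refl
        weight-1 true col-x _ = ≡.refl
        weight-1 true col-c _ = ≡.refl
        weight-1 true col-d _ = ≡.refl
        weight-1 false row-i _ = ≡.refl
        weight-1 false row-k _ = ≡.refl
        weight-1 false row-j _ = ≡.refl
        weight-1 false col-x _ = ≡.refl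
        weight-1 false col-c _ = ≡.refl
        weight-1 false col-d _ = ≡.refl
        yh : ∀ o → y (h o) ≡ weight b o
        yh o with h o Finₚ.≟ h col-y
        ... | yes p = ≡.cong (weight b) (≡.sym (h-injective p))
        ... | no q = ≡.sym (weight-1 b o λ { ≡.refl → q ≡.refl })
        -- None of the seven elements is contracted, and toggling the image of `rows b` removes from
        -- B precisely its elements among the seven.
        fixed≡ : fixed e f B H ≡ B ⊕ img (rows b)
        fixed≡ = subset-ext λ u → ≡.trans (at u) (≡.sym (lookup-⊕ B (img (rows b)) u))
          where
          at : ∀ u → lookup (fixed e f B H) u ≡ lookup B u xor lookup (img (rows b)) u
          at u with Finₚ.any? (λ a → h a Finₚ.≟ u)
          ... | yes (a , ≡.refl) rewrite image-h h h-injective (rows b) a | sides a = ≡.trans (zero-at a (a Finₚ.≟ row-i) (a Finₚ.≟ row-j)) (≡.sym (Boolₚ.xor-same (lookup (rows b) a)))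
            where
            zero-at : ∀ a → Dec (a ≡ row-i) → Dec (a ≡ row-j) → lookup (fixed e f B H) (h a) ≡ false
            zero-at a (yes ≡.refl) _ = fixed-e e f B H
            zero-at a (no _) (yes ≡.refl) = fixed-f e f B H
            zero-at a (no p) (no q) = fixed-∉ e f B {H} (outside-H a p q)
          ... | no none = ≡.trans (fixed-∈ e f B {H} (H-∈ λ o _ _ → away o) (away row-i) (away row-j))
                (≡.sym (≡.trans (≡.cong (lookup B u xor_) (image-outside h h-injective (rows b) λ a q → none (a , q))) (Boolₚ.xor-identityʳ _)))
            where
            away : ∀ o → u ≢ h o
            away o q = none (o , ≡.sym q)
        Z₇ : ∀ T → Z H (B ⊕ img T) y ≡ expand₇ b others T
        Z₇ T = ≡.trans (Z-expand y others distinct (B ⊕ img T)) (expand≡expand₇ b y yh others T)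
        flipped : ∀ T o → (B ⊕ img T) △ h o ≡ B ⊕ img (flip T o)
        flipped T o = ≡.trans (≡.sym (⊕-△ B (img T) (h o))) (≡.cong (B ⊕_) (≡.sym (image-flip h h-injective T o)))
        gap≡gap₇ : gap H (fixed e f B H) e f y ≡ gap₇ b (rows b)
        gap≡gap₇ = ≡.trans (≡.cong (λ D → gap H D e f y) fixed≡) (≡.cong₂ ℚ._-_
          (≡.cong₂ ℚ._*_ (≡.trans (≡.cong (λ D → Z H D y) (flipped (rows b) row-i)) (Z₇ (flip (rows b) row-i)))
                         (≡.trans (≡.cong (λ D → Z H D y) (flipped (rows b) row-j)) (Z₇ (flip (rows b) row-j))))
          (≡.cong₂ ℚ._*_ (≡.trans (≡.cong (λ D → Z H D y) (≡.trans (≡.cong (_△ f) (flipped (rows b) row-i)) (flipped (flip (rows b) row-i) row-j))) (Z₇ (flip (flip (rows b) row-i) row-j)))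
                         (Z₇ (rows b))))

  no-fano : StronglyRayleigh M → NoFano M
  no-fano sr {B} bB {i} {k} {j} {x} {y} {c} {d} ix iy ic id kx ky kc kd jx jy jc jd =
    -- The side of i decides whether the minor is the Fano matroid or its dual.
    impossible h (λ {a} {b} → h-injective a b) bB match sr (lookup B i) sides
    where
    left : Fin 3 → Fin n
    left 0₃ = i
    left 1₃ = k
    left 2₃ = j
    right : Fin 4 → Fin n
    right zero = x
    right (suc zero) = y
    right (suc (suc zero)) = c
    right (suc (suc (suc zero))) = d
    place : Fin 3 ⊎ Fin 4 → Fin n
    place (inj₁ r) = left r
    place (inj₂ s) = right s
    h : Fin 7 → Fin n
    h a = place (side a)
    incidence : ∀ r s → adj M B (left r) (right s) ≡ incident r s
    incidence 0₃ zero = ix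
    incidence 0₃ (suc zero) = iy
    incidence 0₃ (suc (suc zero)) = ic
    incidence 0₃ (suc (suc (suc zero))) = id
    incidence 1₃ zero = kx
    incidence 1₃ (suc zero) = ky
    incidence 1₃ (suc (suc zero)) = kc
    incidence 1₃ (suc (suc (suc zero))) = kd
    incidence 2₃ zero = jx
    incidence 2₃ (suc zero) = jy
    incidence 2₃ (suc (suc zero)) = jc
    incidence 2₃ (suc (suc (suc zero))) = jd
    left-side : ∀ r → lookup B (left r) ≡ lookup B i
    left-side 0₃ = ≡.refl
    left-side 1₃ = two-steps bB kx (≡.trans (adj-sym B x i) ix)
    left-side 2₃ = two-steps bB jx (≡.trans (adj-sym B x i) ix)
    right-side : ∀ s → lookup B (right s) ≡ not (lookup B i)
    right-side zero = adj-colour bB ix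
    right-side (suc zero) = adj-colour bB iy
    right-side (suc (suc zero)) = adj-colour bB ic
    right-side (suc (suc (suc zero))) = ≡.trans (adj-colour bB kd) (≡.cong not (left-side 1₃))
    match-place : ∀ p q → adj M B (place p) (place q) ≡ between p q
    match-place (inj₁ r) (inj₂ s) = incidence r s
    match-place (inj₂ s) (inj₁ r) = ≡.trans (adj-sym B (right s) (left r)) (incidence r s)
    match-place (inj₁ r) (inj₁ r′) = same-colour bB (≡.trans (left-side r) (≡.sym (left-side r′)))
    match-place (inj₂ s) (inj₂ s′) = same-colour bB (≡.trans (right-side s) (≡.sym (right-side s′)))
    match : ∀ a b → adj M B (h a) (h b) ≡ table a b
    match a b = match-place (side a) (side b)
    h-injective : ∀ a b → h a ≡ h b → a ≡ b
    h-injective a b e = table-injective a b λ z → ≡.trans (≡.sym (match a z)) (≡.trans (≡.cong (λ w → adj M B w (h z)) e) (match b z))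
    sides : ∀ a → lookup B (h a) ≡ lookup (rows (lookup B i)) a
    sides row-i = left-side 0₃
    sides row-k = left-side 1₃
    sides row-j = left-side 2₃
    sides col-x = right-side zero
    sides col-y = right-side (suc zero)
    sides col-c = right-side (suc (suc zero))
    sides col-d = right-side (suc (suc (suc zero)))

-- Exterior forms and Plücker relations.

opaque
  unfolding _△_

  size-△ : ∀ {n} (C : Subset n) g → lookup C g ≡ true → ∣ C ∣ ≡ suc ∣ C △ g ∣
  size-△ (true ∷ C) zero _ = ≡.refl
  size-△ (true ∷ C) (suc g) e = ≡.cong suc (size-△ C g e)
  size-△ (false ∷ C) (suc g) e = size-△ C g e

module Signs {c ℓ} (R : CommutativeRing c ℓ) where
  open CommutativeRing R renaming (Carrier to K) hiding (zero)
  open IntegerSolver R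

  -- (- 1) to the number of elements of C before g; whether g itself belongs to C does not count.
  sgn : ∀ {n} → Fin n → Subset n → K
  sgn zero (c ∷ C) = 1#
  sgn (suc g) (c ∷ C) = if c then - sgn g C else sgn g C

  sgn-square : ∀ {n} (g : Fin n) C → sgn g C * sgn g C ≈ 1#
  sgn-square zero (c ∷ C) = *-identityˡ 1#
  sgn-square (suc g) (false ∷ C) = sgn-square g C
  sgn-square (suc g) (true ∷ C) = trans (solve 1 (λ x → (:- x) :* (:- x) := x :* x) refl _) (sgn-square g C)

  opaque
    unfolding _△_

    sgn-same : ∀ {n} (g : Fin n) C → sgn g (C △ g) ≡ sgn g C
    sgn-same zero (c ∷ C) = ≡.refl
    sgn-same (suc g) (c ∷ C) = ≡.cong (λ x → if c then - x else x) (sgn-same g C)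

    -- One of g and h precedes the other; toggling it changes the sign at the other, and not
    -- conversely.
    sgn-anti : ∀ {n} {g h : Fin n} → g ≢ h → ∀ C → sgn g C * sgn h (C △ g) ≈ - (sgn h C * sgn g (C △ h))
    sgn-anti {g = zero} {zero} g≢h C = ⊥-elim (g≢h ≡.refl)
    sgn-anti {g = zero} {suc h} _ (true ∷ C) = solve 1 (λ x → con (1 , 0) :* x := :- ((:- x) :* con (1 , 0))) refl _
    sgn-anti {g = zero} {suc h} _ (false ∷ C) = solve 1 (λ x → con (1 , 0) :* (:- x) := :- (x :* con (1 , 0))) refl _
    sgn-anti {g = suc g} {zero} _ (true ∷ C) = solve 1 (λ x → (:- x) :* con (1 , 0) := :- (con (1 , 0) :* x)) refl _
    sgn-anti {g = suc g} {zero} _ (false ∷ C) = solve 1 (λ x → x :* con (1 , 0) := :- (con (1 , 0) :* (:- x))) refl _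
    sgn-anti {g = suc g} {suc h} g≢h (false ∷ C) = sgn-anti {g = g} {h} (λ { ≡.refl → g≢h ≡.refl }) C
    sgn-anti {g = suc g} {suc h} g≢h (true ∷ C) = trans (solve 2 (λ x y → (:- x) :* (:- y) := x :* y) refl _ _)
      (trans (sgn-anti {g = g} {h} (λ { ≡.refl → g≢h ≡.refl }) C) (solve 2 (λ x y → :- (x :* y) := :- ((:- x) :* (:- y))) refl _ _))

-- Exterior forms on the dual of Kⁿ in coordinates: ω C is the coefficient of the wedge of the
-- basis covectors in C. up g and down g are the coefficients of wedging with, and contracting by, g.
module Exterior {c ℓ} (R : CommutativeRing c ℓ) (n : ℕ)
                (halve : ∀ x → CommutativeRing._≈_ R x (CommutativeRing.-_ R x) → CommutativeRing._≈_ R x (CommutativeRing.0# R)) where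
  open CommutativeRing R renaming (Carrier to K) hiding (zero)
  open RingProperties (CommutativeRing.ring R) using (-0#≈0#; -‿involutive; -‿distribˡ-*; -‿distribʳ-*)
  open IntegerSolver R
  open LinearAlgebra R n
  open Signs R public
  open SetoidReasoning setoid

  Form : Set c
  Form = Subset n → K

  up down : Fin n → Subset n → K
  up g C = if lookup C g then sgn g C else 0#
  down g C = if lookup C g then 0# else sgn g C

  wedge contract : (Fin n → K) → Form → Form
  wedge a ω C = sum λ h → a h * (up h C * ω (C △ h))
  contract γ ω C = sum λ g → γ g * (down g C * ω (C △ g))

  up-∈ : ∀ {g C} → lookup C g ≡ true → up g C ≡ sgn g C
  up-∈ p rewrite p = ≡.refl
  up-∉ : ∀ {g C} → lookup C g ≡ false → up g C ≡ 0#
  up-∉ p rewrite p = ≡.refl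
  down-∈ : ∀ {g C} → lookup C g ≡ true → down g C ≡ 0#
  down-∈ p rewrite p = ≡.refl
  down-∉ : ∀ {g C} → lookup C g ≡ false → down g C ≡ sgn g C
  down-∉ p rewrite p = ≡.refl

  up-up : ∀ g h C → up g C * up h (C △ g) ≈ - (up h C * up g (C △ h))
  up-up g h C with g Finₚ.≟ h
  ... | yes ≡.refl = trans (zero-case (lookup C g) ≡.refl) (trans (sym -0#≈0#) (-‿cong (sym (zero-case (lookup C g) ≡.refl))))
    where
    zero-case : ∀ b → lookup C g ≡ b → up g C * up g (C △ g) ≈ 0#
    zero-case true e = trans (*-congˡ (reflexive (up-∉ {g} {C △ g} (≡.trans (△-same C g) (≡.cong not e))))) (zeroʳ _)
    zero-case false e = trans (*-congʳ (reflexive (up-∉ {g} {C} e))) (zeroˡ _)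
  ... | no g≢h rewrite △-other C g≢h | △-other C (g≢h ∘ ≡.sym) with lookup C g | lookup C h
  ...   | true | true = sgn-anti g≢h C
  ...   | true | false = solve 2 (λ x y → x :* con (0 , 0) := :- (con (0 , 0) :* y)) refl _ _
  ...   | false | true = solve 2 (λ x y → con (0 , 0) :* x := :- (y :* con (0 , 0))) refl _ _
  ...   | false | false = solve 0 (con (0 , 0) :* con (0 , 0) := :- (con (0 , 0) :* con (0 , 0))) refl

  down-up : ∀ {g h} → g ≢ h → ∀ C → down g C * up h (C △ g) ≈ - (up h C * down g (C △ h))
  down-up {g} {h} g≢h C rewrite △-other C g≢h | △-other C (g≢h ∘ ≡.sym) with lookup C g | lookup C h
  ... | false | true = sgn-anti g≢h C
  ... | true | true = solve 2 (λ x y → con (0 , 0) :* x := :- (y :* con (0 , 0))) refl _ _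
  ... | true | false = solve 0 (con (0 , 0) :* con (0 , 0) := :- (con (0 , 0) :* con (0 , 0))) refl
  ... | false | false = solve 2 (λ x y → x :* con (0 , 0) := :- (con (0 , 0) :* y)) refl _ _

  down-up-same : ∀ g C → down g C * up g (C △ g) + up g C * down g (C △ g) ≈ 1#
  down-up-same g C rewrite △-same C g | sgn-same g C with lookup C g
  ... | true = trans (+-congʳ (zeroˡ _)) (trans (+-identityˡ _) (sgn-square g C))
  ... | false = trans (+-congˡ (zeroˡ _)) (trans (+-identityʳ _) (sgn-square g C))

  -- The Clifford relation between contracting by g and wedging with h, in coordinates.
  anticommutator : ∀ g h (ω : Form) C → down g C * (up h (C △ g) * ω (C △ g △ h)) + up h C * (down g (C △ h) * ω (C △ h △ g)) ≈ δ g h * ω C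
  anticommutator g h ω C with g Finₚ.≟ h
  ... | yes ≡.refl = trans (+-cong (*-congˡ (*-congˡ same)) (*-congˡ (*-congˡ same))) (trans
          (solve 5 (λ a b c d w → a :* (b :* w) :+ c :* (d :* w) := (a :* b :+ c :* d) :* w) refl (down g C) (up g (C △ g)) (up g C) (down g (C △ g)) (ω C))
          (*-congʳ (down-up-same g C)))
    where
    same : ω (C △ g △ g) ≈ ω C
    same = reflexive (≡.cong ω (△-involutive C g))
  ... | no g≢h = trans (+-congˡ (*-congˡ (*-congˡ (reflexive (≡.cong ω (△-comm C h g)))))) (trans
          (solve 5 (λ a b c d w → a :* (b :* w) :+ c :* (d :* w) := (a :* b :+ c :* d) :* w) refl (down g C) (up h (C △ g)) (up h C) (down g (C △ h)) (ω (C △ g △ h)))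
          (trans (*-congʳ (trans (+-congʳ (down-up g≢h C)) (-‿inverseˡ _))) (trans (zeroˡ _) (sym (zeroˡ _)))))

  contract-wedge : ∀ γ a ω C → contract γ (wedge a ω) C + wedge a (contract γ ω) C ≈ sum (λ g → γ g * a g) * ω C
  contract-wedge γ a ω C = begin
    contract γ (wedge a ω) C + wedge a (contract γ ω) C
      ≈⟨ +-cong (sum-cong λ g → trans (*-congˡ (sym (sum-*ˡ (down g C) _))) (sym (sum-*ˡ (γ g) _)))
           (trans (sum-cong λ h → trans (*-congˡ (sym (sum-*ˡ (up h C) _))) (sym (sum-*ˡ (a h) _)))
             (sum-comm λ h g → a h * (up h C * (γ g * (down g (C △ h) * ω (C △ h △ g)))))) ⟩
    sum (λ g → sum λ h → γ g * (down g C * (a h * (up h (C △ g) * ω (C △ g △ h))))) +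
    sum (λ g → sum λ h → a h * (up h C * (γ g * (down g (C △ h) * ω (C △ h △ g)))))
      ≈⟨ sym (sum-+ _ _) ⟩
    sum (λ g → sum (λ h → γ g * (down g C * (a h * (up h (C △ g) * ω (C △ g △ h))))) +
               sum (λ h → a h * (up h C * (γ g * (down g (C △ h) * ω (C △ h △ g))))))
      ≈⟨ sum-cong (λ g → trans (sym (sum-+ _ _)) (sum-cong λ h → trans
           (solve 8 (λ γ a d u w u′ d′ w′ → γ :* (d :* (a :* (u :* w))) :+ a :* (u′ :* (γ :* (d′ :* w′)))
              := γ :* a :* (d :* (u :* w) :+ u′ :* (d′ :* w′))) refl (γ g) (a h) (down g C) (up h (C △ g)) (ω (C △ g △ h)) (up h C) (down g (C △ h)) (ω (C △ h △ g)))
           (*-congˡ (anticommutator g h ω C)))) ⟩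
    sum (λ g → sum λ h → γ g * a h * (δ g h * ω C))
      ≈⟨ sum-cong (λ g → trans (sum-cong λ h → solve 4 (λ γ a d w → γ :* a :* (d :* w) := γ :* w :* a :* d) refl (γ g) (a h) (δ g h) (ω C))
           (trans (sum-δ g (λ h → γ g * ω C * a h)) (solve 3 (λ γ w a → γ :* w :* a := γ :* a :* w) refl (γ g) (ω C) (a g)))) ⟩
    sum (λ g → γ g * a g * ω C)
      ≈⟨ sum-*ʳ _ (ω C) ⟩
    sum (λ g → γ g * a g) * ω C ∎

  -- The coefficient at (T , S) of the sum over g of the wedge of g with ω, tensored with the
  -- contraction of ω by g. It vanishes for decomposable forms, and in this shape it is stable under
  -- `wedge`.
  Plücker : Form → Set ℓ
  Plücker ω = ∀ S T → sum (λ g → up g T * ω (T △ g) * (down g S * ω (S △ g))) ≈ 0#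

  -- The coefficient of a ∧ a ∧ ω. Exchanging the summation indices reverses the sign, and `halve`
  -- turns x = - x into x = 0.
  wedge-wedge : ∀ (a : Fin n → K) (ω : Form) T → sum (λ g → a g * (sum λ h → a h * (up h T * (up g (T △ h) * ω (T △ h △ g))))) ≈ 0#
  wedge-wedge a ω T = halve _ (begin
    sum (λ g → a g * (sum λ h → a h * (up h T * (up g (T △ h) * ω (T △ h △ g)))))
      ≈⟨ sum-cong (λ g → sym (sum-*ˡ (a g) _)) ⟩
    sum (λ g → sum λ h → a g * (a h * (up h T * (up g (T △ h) * ω (T △ h △ g)))))
      ≈⟨ sum-cong (λ g → sum-cong λ h → trans
           (solve 5 (λ a b u v w → a :* (b :* (u :* (v :* w))) := a :* b :* ((u :* v) :* w)) refl (a g) (a h) (up h T) (up g (T △ h)) (ω (T △ h △ g)))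
           (trans (*-congˡ (*-cong (up-up h g T) (reflexive (≡.cong ω (△-comm T h g)))))
             (solve 5 (λ a b u v w → a :* b :* ((:- (u :* v)) :* w) := :- (b :* (a :* (u :* (v :* w))))) refl (a g) (a h) (up g T) (up h (T △ g)) (ω (T △ g △ h))))) ⟩
    sum (λ g → sum λ h → - (a h * (a g * (up g T * (up h (T △ g) * ω (T △ g △ h))))))
      ≈⟨ trans (sum-cong λ g → sum-neg λ h → a h * (a g * (up g T * (up h (T △ g) * ω (T △ g △ h))))) (sum-neg _) ⟩
    - sum (λ g → sum λ h → a h * (a g * (up g T * (up h (T △ g) * ω (T △ g △ h)))))
      ≈⟨ -‿cong (trans (sum-comm λ g h → a h * (a g * (up g T * (up h (T △ g) * ω (T △ g △ h))))) (sum-cong λ h → sum-*ˡ (a h) _)) ⟩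
    - sum (λ g → a g * (sum λ h → a h * (up h T * (up g (T △ h) * ω (T △ h △ g))))) ∎)

  -- Wedging with g anticommutes with wedging with a, and contracting a ∧ ω by g gives a_g ω minus a
  -- ∧ (ω contracted by g). The first term produces a ∧ a ∧ ω; the second is the relation for ω with
  -- a wedged onto both tensor factors.
  wedge-Plücker : ∀ a {ω} → Plücker ω → Plücker (wedge a ω)
  wedge-Plücker a {ω} plücker S T = begin
    sum (λ g → up g T * wedge a ω (T △ g) * (down g S * wedge a ω (S △ g)))
      ≈⟨ sum-cong (λ g → trans (*-cong (left g) (right g)) (solve 4 (λ x a w y → (:- x) :* (a :* w :- y) := (:- w) :* (a :* x) :+ x :* y) refl (X g) (a g) (ω S) (Y g))) ⟩
    sum (λ g → - ω S * (a g * X g) + X g * Y g)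
      ≈⟨ trans (sum-+ (λ g → - ω S * (a g * X g)) _) (+-cong (trans (sum-*ˡ (- ω S) _) (trans (*-congˡ (wedge-wedge a ω T)) (zeroʳ _))) products) ⟩
    0# + 0#
      ≈⟨ +-identityˡ 0# ⟩
    0# ∎
    where
    X Y : Fin n → K
    X g = sum λ h → a h * (up h T * (up g (T △ h) * ω (T △ h △ g)))
    Y g = sum λ k → a k * (up k S * (down g (S △ k) * ω (S △ k △ g)))
    left : ∀ g → up g T * wedge a ω (T △ g) ≈ - X g
    left g = trans (sym (sum-*ˡ (up g T) _)) (trans (sum-cong λ h → trans
        (solve 4 (λ u a v w → u :* (a :* (v :* w)) := a :* ((u :* v) :* w)) refl (up g T) (a h) (up h (T △ g)) (ω (T △ g △ h)))
        (trans (*-congˡ (*-cong (up-up g h T) (reflexive (≡.cong ω (△-comm T g h)))))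
          (solve 4 (λ u a v w → a :* ((:- (u :* v)) :* w) := :- (a :* (u :* (v :* w)))) refl (up h T) (a h) (up g (T △ h)) (ω (T △ h △ g)))))
      (sum-neg _))
    right : ∀ g → down g S * wedge a ω (S △ g) ≈ a g * ω S - Y g
    right g = begin
      down g S * wedge a ω (S △ g)
        ≈⟨ sym (sum-*ˡ (down g S) _) ⟩
      sum (λ k → down g S * (a k * (up k (S △ g) * ω (S △ g △ k))))
        ≈⟨ sum-cong (λ k → trans (solve 6 (λ d a u w u′ z → d :* (a :* (u :* w)) := a :* (d :* (u :* w) :+ u′ :* z) :- a :* (u′ :* z)) refl
             (down g S) (a k) (up k (S △ g)) (ω (S △ g △ k)) (up k S) (down g (S △ k) * ω (S △ k △ g)))
             (+-congʳ (trans (*-congˡ (anticommutator g k ω S)) (solve 3 (λ a d w → a :* (d :* w) := w :* a :* d) refl (a k) (δ g k) (ω S))))) ⟩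
      sum (λ k → ω S * a k * δ g k - a k * (up k S * (down g (S △ k) * ω (S △ k △ g))))
        ≈⟨ trans (sum-+ (λ k → ω S * a k * δ g k) _) (+-cong (trans (sum-δ g (λ k → ω S * a k)) (*-comm _ _)) (sum-neg _)) ⟩
      a g * ω S - Y g ∎
    products : sum (λ g → X g * Y g) ≈ 0#
    products = begin
      sum (λ g → X g * Y g)
        ≈⟨ sum-cong (λ g → trans (sym (sum-*ʳ _ (Y g))) (sum-cong λ h → sym (sum-*ˡ _ _))) ⟩
      sum (λ g → sum λ h → sum λ k → a h * (up h T * (up g (T △ h) * ω (T △ h △ g))) * (a k * (up k S * (down g (S △ k) * ω (S △ k △ g)))))
        ≈⟨ trans (sum-comm λ g h → sum λ k → a h * (up h T * (up g (T △ h) * ω (T △ h △ g))) * (a k * (up k S * (down g (S △ k) * ω (S △ k △ g)))))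
             (sum-cong λ h → sum-comm λ g k → a h * (up h T * (up g (T △ h) * ω (T △ h △ g))) * (a k * (up k S * (down g (S △ k) * ω (S △ k △ g))))) ⟩
      sum (λ h → sum λ k → sum λ g → a h * (up h T * (up g (T △ h) * ω (T △ h △ g))) * (a k * (up k S * (down g (S △ k) * ω (S △ k △ g)))))
        ≈⟨ sum-0 (λ h → sum-0 λ k → trans (sum-cong λ g →
             solve 6 (λ a u x b v y → a :* (u :* x) :* (b :* (v :* y)) := a :* u :* (b :* v) :* (x :* y)) refl
               (a h) (up h T) (up g (T △ h) * ω (T △ h △ g)) (a k) (up k S) (down g (S △ k) * ω (S △ k △ g)))
             (trans (sum-*ˡ (a h * up h T * (a k * up k S)) _) (trans (*-congˡ (plücker (S △ k) (T △ h))) (zeroʳ _)))) ⟩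
      0# ∎

  Homogeneous : ℕ → Form → Set ℓ
  Homogeneous r ω = ∀ C → ∣ C ∣ ≢ r → ω C ≈ 0#

  wedge-homogeneous : ∀ a {r ω} → Homogeneous r ω → Homogeneous (suc r) (wedge a ω)
  wedge-homogeneous a {r} {ω} hom C size = sum-0 each
    where
    each : ∀ h → a h * (up h C * ω (C △ h)) ≈ 0#
    each h with lookup C h in p
    ... | false = trans (*-congˡ (zeroˡ _)) (zeroʳ _)
    ... | true = trans (*-congˡ (trans (*-congˡ (hom (C △ h) λ e → size (≡.trans (size-△ C h p) (≡.cong suc e)))) (zeroʳ _))) (zeroʳ _)

  inhabited : (C : Subset n) → Dec (∃ λ u → lookup C u ≡ true)
  inhabited C = Finₚ.any? λ u → lookup C u Boolₚ.≟ true

  unit : Form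
  unit C = if does (inhabited C) then 0# else 1#

  unit-∋ : ∀ {C u} → lookup C u ≡ true → unit C ≡ 0#
  unit-∋ {C} {u} u∈C with inhabited C
  ... | yes _ = ≡.refl
  ... | no empty = ⊥-elim (empty (u , u∈C))

  unit-empty : ∀ {C} → (∀ u → lookup C u ≡ false) → unit C ≡ 1#
  unit-empty {C} empty with inhabited C
  ... | yes (u , u∈C) = ⊥-elim (true≢false (≡.trans (≡.sym u∈C) (empty u)))
  ... | no _ = ≡.refl

  down-unit : ∀ g S → down g S * unit (S △ g) ≈ 0#
  down-unit g S with lookup S g in p
  ... | true = zeroˡ _
  ... | false = trans (*-congˡ (reflexive (unit-∋ {S △ g} {g} (≡.trans (△-same S g) (≡.cong not p))))) (zeroʳ _)

  unit-Plücker : Plücker unit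
  unit-Plücker S T = sum-0 λ g → trans (*-congˡ (down-unit g S)) (zeroʳ _)

  contract-unit : ∀ γ C → contract γ unit C ≈ 0#
  contract-unit γ C = sum-0 λ g → trans (*-congˡ (down-unit g C)) (zeroʳ _)

-- The exterior form of a signed matroid.

module SpanningForm {n : ℕ} {M : Matroid n} (bin : BinaryPivots M) (Σ₃ : Signing M) {c ℓ} (R : CommutativeRing c ℓ)
    (halve : ∀ x → CommutativeRing._≈_ R x (CommutativeRing.-_ R x) → CommutativeRing._≈_ R x (CommutativeRing.0# R))
    (1≉0 : ¬ CommutativeRing._≈_ R (CommutativeRing.1# R) (CommutativeRing.0# R)) where
  open MatroidFacts M
  open Signing Σ₃
  open Signed bin Σ₃
  open Lift R
  open CommutativeRing R renaming (Carrier to K) hiding (zero)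
  open RingProperties (CommutativeRing.ring R) using (-0#≈0#; -‿involutive; -‿distribˡ-*; -‿distribʳ-*)
  open IntegerSolver R
  open Kernel R n
  open LinearAlgebra R n using (sum-only; sum-two; sum-0; sum-cong; sum-*ˡ; sum; δ; δ-≢; δ-refl)
  open Exterior R n halve
  open LinearAlgebra F₃-ring n using (Matrix)

  -- The coefficients play the role of maximal minors. `annihilated` relates coefficients at sets
  -- that differ by one exchange, `homogeneous` settles the sets of the wrong size, and `unimodular`
  -- fixes the scale at one set.
  record Spanning (T : Subset n) : Set (c ⊔ ℓ) where
    field
      form : Form
      plücker : Plücker form
      homogeneous : Homogeneous ∣ T ∣ form
      annihilated : ∀ γ → InKernel base ⟪ S₀ ⟫ γ → ∀ C → contract γ form C ≈ 0#
      unimodular : form T * form T ≈ 1#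

  -- The wedge of the rows belonging to T ⊆ base; on T itself these rows are an identity matrix.
  spanning : ∀ T → Acc _⊂_ T → T ⊆ᵇ base → Spanning T
  spanning T (acc rec) T⊆base with inhabited T
  ... | no empty = record
    { form = unit ; plücker = unit-Plücker
    ; homogeneous = λ C size → reflexive (homogeneous C size)
    ; annihilated = λ γ _ C → contract-unit γ C
    ; unimodular = trans (*-cong (reflexive unit-T) (reflexive unit-T)) (*-identityˡ 1#)
    }
    where
    unit-T : unit T ≡ 1#
    unit-T = unit-empty {T} λ u → ¬true⇒false λ e → empty (u , e)
    homogeneous : ∀ C → ∣ C ∣ ≢ ∣ T ∣ → unit C ≡ 0#
    homogeneous C size with inhabited C
    ... | yes _ = ≡.refl
    ... | no q = ⊥-elim (size (≡.cong ∣_∣ (subset-ext {A = C} {T} λ u → ≡.trans (¬true⇒false λ e → q (u , e)) (≡.sym (¬true⇒false λ e → empty (u , e))))))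
  ... | yes (i , i∈T) = record
    { form = wedge (row i) form ; plücker = wedge-Plücker (row i) {form} plücker
    ; homogeneous = ≡.subst (λ r → Homogeneous r (wedge (row i) form)) (≡.sym (size-△ T i i∈T)) (wedge-homogeneous (row i) homogeneous)
    ; annihilated = λ γ ker C → trans (sym (+-identityʳ _)) (trans (+-congˡ (sym (rest γ ker C)))
        (trans (contract-wedge γ (row i) form C) (trans (*-congʳ (row-killed γ ker i)) (zeroˡ _))))
    ; unimodular = trans (*-cong at-T at-T) (trans (solve 2 (λ s w → (s :* w) :* (s :* w) := (s :* s) :* (w :* w)) refl (sgn i T) (form (T △ i)))
        (trans (*-cong (sgn-square i T) unimodular) (*-identityˡ 1#)))
    }
    where
    open Spanning (spanning (T △ i) (rec (remove-⊂ i∈T)) (λ u u∈ → T⊆base u (remove-⊆ {T = T} i∈T u u∈)))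
    rest : ∀ γ → InKernel base ⟪ S₀ ⟫ γ → ∀ C → wedge (row i) (contract γ form) C ≈ 0#
    rest γ ker C = sum-0 λ h → trans (*-congˡ (trans (*-congˡ (annihilated γ ker (C △ h))) (zeroʳ _))) (zeroʳ _)
    row-base : ∀ h → lookup base h ≡ true → row i h ≡ δ i h
    row-base h e rewrite e = ≡.refl
    other : ∀ h → h ≢ i → row i h * (up h T * form (T △ h)) ≈ 0#
    other h h≢i with lookup T h in h∈T
    ... | false = trans (*-congˡ (zeroˡ _)) (zeroʳ _)
    ... | true = trans (*-congʳ (reflexive (≡.trans (row-base h (T⊆base h h∈T)) (δ-≢ (h≢i ∘ ≡.sym))))) (zeroˡ _)
    at-T : wedge (row i) form T ≈ sgn i T * form (T △ i)
    at-T = trans (sum-only i other) (trans (*-cong (reflexive (≡.trans (row-base i (T⊆base i i∈T)) (δ-refl i))) (*-congʳ (reflexive (up-∈ {i} {T} i∈T))))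
      (*-identityˡ _))

  open Spanning (spanning base (⊂-wellFounded base) (λ u u∈ → u∈)) public

  ω : Form
  ω = form

  Unit : Subset n → Matrix → Set _
  Unit B S = SameKernel B S × ω B * ω B ≈ 1#

  circuit-contract : ∀ {B S} → State B S → SameKernel B S → ∀ v → lookup B v ≡ false → ∀ C → contract (circuit S v) ω C ≈ 0#
  circuit-contract {B} {S} st same v v∉B = annihilated (circuit S v) (proj₂ (same (circuit S v)) (circuit-kernel st v v∉B))

  -- The contraction by the circuit of v is evaluated at B - u. Only g = u and g = v contribute, so
  -- the coefficients at B and at B - u + v agree up to sign.
  unit-exchange : ∀ {B S} → State B S → Unit B S → ∀ {u v} → lookup B u ≡ true → lookup B v ≡ false → S u v ≢ 0₃ →
                  ω (B △ u △ v) * ω (B △ u △ v) ≈ 1#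
  unit-exchange {B} {S} st (same , unimod) {u} {v} u∈B v∉B nz = trans square-exchange unimod
    where
    u≢v : u ≢ v
    u≢v = differ {X = B} u∈B v∉B
    C B′ : Subset n
    C = B △ u
    B′ = B △ u △ v
    γ : Fin n → K
    γ = circuit S v
    other : ∀ g → g ≢ u → g ≢ v → γ g * (down g C * ω (C △ g)) ≈ 0#
    other g g≢u g≢v with lookup B g in p
    ... | true = trans (*-congˡ (trans (*-congʳ (reflexive (down-∈ {g} {C} (≡.trans (△-other B g≢u) p)))) (zeroˡ _))) (zeroʳ _)
    ... | false = trans (*-congʳ (circuit-zero S g≢v (same-side st (≡.trans p (≡.sym v∉B))))) (zeroˡ _)
    relation : γ u * (down u C * ω (C △ u)) + γ v * (down v C * ω (C △ v)) ≈ 0#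
    relation = trans (sym (sum-two u v u≢v other)) (circuit-contract st same v v∉B C)
    down-u : down u C ≡ sgn u C
    down-u = down-∉ {u} {C} (≡.trans (△-same B u) (≡.cong not u∈B))
    down-v : down v C ≡ sgn v C
    down-v = down-∉ {v} {C} (≡.trans (△-other B (u≢v ∘ ≡.sym)) v∉B)
    opposite : ∀ x y → x + y ≈ 0# → x * x ≈ y * y
    opposite x y e = trans (solve 2 (λ x y → x :* x := y :* y :+ (x :+ y) :* (x :- y)) refl x y)
      (trans (+-congˡ (trans (*-congʳ e) (zeroˡ _))) (+-identityʳ _))
    signs : ∀ a s w → a * a ≈ 1# → s * s ≈ 1# → a * (s * w) * (a * (s * w)) ≈ w * w
    signs a s w a² s² = trans (solve 3 (λ a s w → a :* (s :* w) :* (a :* (s :* w)) := (a :* a) :* ((s :* s) :* (w :* w))) refl a s w)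
      (trans (*-cong a² (trans (*-congʳ s²) (*-identityˡ _))) (*-identityˡ _))
    γu² : γ u * γ u ≈ 1#
    γu² = trans (*-cong (circuit-other S u≢v) (circuit-other S u≢v))
      (trans (solve 1 (λ x → (:- x) :* (:- x) := x :* x) refl (lift R (S u v))) (lift-square nz))
    square-exchange : ω B′ * ω B′ ≈ ω B * ω B
    square-exchange = trans (sym (signs (γ v) (down v C) (ω B′) (trans (*-cong (circuit-self st v) (circuit-self st v)) (*-identityˡ 1#))
        (trans (*-cong (reflexive down-v) (reflexive down-v)) (sgn-square v C))))
      (trans (sym (opposite _ _ relation)) (trans (signs (γ u) (down u C) (ω (C △ u)) γu² (trans (*-cong (reflexive down-u) (reflexive down-u)) (sgn-square u C)))
        (*-cong (reflexive (≡.cong ω (△-involutive B u))) (reflexive (≡.cong ω (△-involutive B u))))))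

  unit-pivot : ∀ {B S k l} → State B S → Unit B S → k ≢ l → S k l ≢ 0₃ → Unit (B △ k △ l) (LinearAlgebra.pivot F₃-ring n (S k l) k l S)
  unit-pivot {B} {S} {k} {l} st u@(same , unimod) k≢l nz = same-kernel-pivot st same k≢l nz , square
    where
    kl : lookup B l ≡ not (lookup B k)
    kl = Adj⇒differ (basis st) (nonzero⇒Adj st {k} {l} nz)
    square : ω (B △ k △ l) * ω (B △ k △ l) ≈ 1#
    square with lookup B k in p
    ... | true = unit-exchange st u p (≡.trans kl (≡.cong not p)) nz
    ... | false = trans (*-cong (reflexive (≡.cong ω (△-comm B k l))) (reflexive (≡.cong ω (△-comm B k l))))
            (unit-exchange st u (≡.trans kl (≡.cong not p)) p λ z → nz (≡.trans (proj₂ (alt st) k l) (≡.cong -₃_ z)))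

  unit-base : Unit base S₀
  unit-base = same-kernel-base , unimodular

  Reached : Subset n → Set (c ⊔ ℓ)
  Reached C = ∃ λ B → ∃ λ S → State B S × Unit B S × Final C B S

  reached-from-base : ∀ C → Reached C
  reached-from-base C = towards Unit unit-pivot C base-state unit-base

  -- At a state moved as far into C as possible, an element v of C outside B has its circuit inside
  -- C, and the contraction by it at C - v consists of ω C alone, up to sign. If there is no such v,
  -- then C is a proper subset of a basis and too small for a nonzero coefficient.
  nonbasis-zero : ∀ C → β C ≡ false → Reached C → ω C ≈ 0#
  nonbasis-zero C nb (B , S , st , (same , unimod) , final) with Finₚ.any? (λ v → (lookup C v Boolₚ.≟ true) ×-dec (lookup B v Boolₚ.≟ false))
  ... | yes (v , v∈C , v∉B) = trans (sym (*-identityˡ _)) (trans (*-congʳ (sym (sgn-square v (C △ v))))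
          (trans (*-assoc _ _ _) (trans (*-congˡ vanishes) (zeroʳ _))))
    where
    other : ∀ g → g ≢ v → circuit S v g * (down g (C △ v) * ω (C △ v △ g)) ≈ 0#
    other g g≢v with lookup C g in p
    ... | true = trans (*-congˡ (trans (*-congʳ (reflexive (down-∈ {g} {C △ v} (≡.trans (△-other C g≢v) p)))) (zeroˡ _))) (zeroʳ _)
    ... | false = trans (*-congʳ (circuit-inside {C} st final v∈C v∉B g p)) (zeroˡ _)
    vanishes : sgn v (C △ v) * ω C ≈ 0#
    vanishes = trans (sym (trans (*-cong (circuit-self st v) (*-cong (reflexive (down-∉ {v} {C △ v} (≡.trans (△-same C v) (≡.cong not v∈C))))
        (reflexive (≡.cong ω (△-involutive C v))))) (*-identityˡ _)))
      (trans (sym (sum-only v other)) (circuit-contract st same v v∉B (C △ v)))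
  ... | no none = homogeneous C λ size → small (≡.trans size (≡.sym size-B))
    where
    size-B : ∣ B ∣ ≡ ∣ base ∣
    size-B = decidable-stable (∣ B ∣ ℕ.≟ ∣ base ∣) λ q → 1≉0 (trans (sym unimod) (trans (*-congʳ (homogeneous B q)) (zeroˡ _)))
    C⊆B : ∀ u → lookup C u ≡ true → lookup B u ≡ true
    C⊆B u u∈C = Boolₚ.¬-not {lookup B u} {false} λ u∉B → none (u , u∈C , u∉B)
    small : ∣ C ∣ ≢ ∣ B ∣
    small size with Finₚ.any? (λ u → (lookup B u Boolₚ.≟ true) ×-dec (lookup C u Boolₚ.≟ false))
    ... | yes (u , u∈B , u∉C) = ℕₚ.<⇒≢ (Subsetₚ.p⊂q⇒∣p∣<∣q∣ {p = C} {B} ((λ {x} x∈C → true⇒∈ (C⊆B x (∈⇒true x∈C))) , u , true⇒∈ u∈B , false⇒∉ u∉C)) size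
    ... | no equal = true≢false (≡.trans (≡.sym (basis st)) (≡.trans (≡.cong β (subset-ext λ u → bool-ext
          (λ u∈B → Boolₚ.¬-not {lookup C u} {false} λ u∉C → equal (u , u∈B , u∉C)) (C⊆B u))) nb))

  basis-unit : ∀ C → Basis C → Reached C → ω C * ω C ≈ 1#
  basis-unit C bC (B , S , st , (same , unimod) , final) = trans (reflexive (≡.cong (λ X → ω X * ω X) (reached st bC final))) unimod

  ω-square : ∀ C → ω C * ω C ≈ (if β C then 1# else 0#)
  ω-square C with β C in e
  ... | true = basis-unit C e (reached-from-base C)
  ... | false = trans (*-congʳ (nonbasis-zero C e (reached-from-base C))) (zeroˡ _)

-- Writing ΔM as a square for a signed matroid.

halve-ℚ : ∀ x → x ≡ ℚ.- x → x ≡ 0ℚ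
halve-ℚ x e with ℚₚ.<-cmp x 0ℚ
... | tri≈ _ x≡0 _ = x≡0
... | tri< x<0 _ _ = ⊥-elim (ℚₚ.<-asym x<0 (≡.subst (0ℚ ℚ.<_) (≡.sym e) (ℚₚ.neg-antimono-< x<0)))
... | tri> _ _ x>0 = ⊥-elim (ℚₚ.<-asym x>0 (≡.subst (ℚ._< 0ℚ) (≡.sym e) (ℚₚ.neg-antimono-< x>0)))

square-nonneg : ∀ x → 0ℚ ℚ.≤ x ℚ.* x
square-nonneg x with ℚₚ.≤-total 0ℚ x
... | inj₁ x≥0 = ℚₚ.nonNegative⁻¹ (x ℚ.* x) {{ℚₚ.nonNeg*nonNeg⇒nonNeg x {{ℚ.nonNegative x≥0}} x {{ℚ.nonNegative x≥0}}}}
... | inj₂ x≤0 = ≡.subst (0ℚ ℚ.≤_) (ℚ-Solver.solve 1 (λ x → (ℚ-Solver.:- x) ℚ-Solver.:* (ℚ-Solver.:- x) ℚ-Solver.:= x ℚ-Solver.:* x) ≡.refl x)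
        (ℚₚ.nonNegative⁻¹ (ℚ.- x ℚ.* ℚ.- x) {{ℚₚ.nonNeg*nonNeg⇒nonNeg (ℚ.- x) {{ℚ.nonNegative (ℚₚ.neg-antimono-≤ x≤0)}} (ℚ.- x) {{ℚ.nonNegative (ℚₚ.neg-antimono-≤ x≤0)}}}})

module SquareGap {n : ℕ} {M : Matroid n} (bin : BinaryPivots M) (Σ₃ : Signing M) where
  open MatroidFacts M
  open Minors M
  open SpanningForm bin Σ₃ ℚ-ring halve-ℚ (λ ()) using (ω; ω-square; plücker)
  open Exterior ℚ-ring n halve-ℚ using (sgn; sgn-square; sgn-same; sgn-anti; up; down; up-∈; up-∉; down-∈; down-∉)
  open LinearAlgebra ℚ-ring n using (sum; sum-cong; sum-0; sum-+; sum-*ˡ; sum-*ʳ; sum-δ; δ; δ-refl; δ-≢)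
  open CommutativeRing ℚ-ring using (_+_; _*_; -_; _-_; 0#; 1#; *-comm; *-assoc; zeroˡ; zeroʳ; +-identityˡ; +-identityʳ; *-identityˡ; -‿inverseˡ; -‿inverseʳ)
  open ℚ-Solver

  sumSub-sum : ∀ {m} (F : Subset m → Fin n → ℚ) → sumSub (λ C → sum (F C)) ≡ sum (λ g → sumSub λ C → F C g)
  sumSub-sum {zero} F = ≡.refl
  sumSub-sum {suc m} F = ≡.trans (≡.cong₂ _+_ (sumSub-sum λ C → F (true ∷ C)) (sumSub-sum λ C → F (false ∷ C)))
    (≡.sym (sum-+ (λ g → sumSub λ C → F (true ∷ C) g) (λ g → sumSub λ C → F (false ∷ C) g)))

  module _ {e f : Fin n} (e≢f : e ≢ f) where

    -- The coefficients of ω over sets containing neither e nor f, both, or one of them.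
    a p q d : Subset n → ℚ
    a C = ω C
    p C = sgn e C * ω (C △ e)
    q C = sgn f C * ω (C △ f)
    d C = sgn f C * sgn e (C △ f) * ω (C △ f △ e)

    private
      -- The signs are ±1, so an equation may be multiplied by any of them.
      cancel : ∀ (g : Fin n) C x → sgn g C * (sgn g C * x) ≡ x
      cancel g C x = ≡.trans (≡.sym (*-assoc (sgn g C) (sgn g C) x)) (≡.trans (≡.cong (_* x) (sgn-square g C)) (*-identityˡ x))

      sum-with-two : ∀ {t u : Fin n → ℚ} {X Y} → t e ≡ X → t f ≡ Y → (∀ g → g ≢ e → g ≢ f → t g ≡ u g) →
                     u e ≡ 0# → u f ≡ 0# → sum t ≡ (X + Y) + sum u
      sum-with-two {t} {u} {X} {Y} te tf other ue uf = ≡.trans (sum-cong pointwise)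
        (≡.trans (sum-+ (λ g → X * δ e g + Y * δ f g) u) (≡.cong (_+ sum u)
          (≡.trans (sum-+ (λ g → X * δ e g) (λ g → Y * δ f g)) (≡.cong₂ _+_ (sum-δ e (λ _ → X)) (sum-δ f (λ _ → Y))))))
        where
        first second neither : ∀ x y z → ℚ
        first x y z = (x * 1# + y * 0#) + z
        second x y z = (x * 0# + y * 1#) + z
        neither x y z = (x * 0# + y * 0#) + z
        first≡ : ∀ x y → first x y 0# ≡ x
        first≡ = solve 2 (λ x y → (x :* con (1 , 0) :+ y :* con (0 , 0)) :+ con (0 , 0) := x) ≡.refl
        second≡ : ∀ x y → second x y 0# ≡ y
        second≡ = solve 2 (λ x y → (x :* con (0 , 0) :+ y :* con (1 , 0)) :+ con (0 , 0) := y) ≡.refl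
        neither≡ : ∀ x y z → neither x y z ≡ z
        neither≡ = solve 3 (λ x y z → (x :* con (0 , 0) :+ y :* con (0 , 0)) :+ z := z) ≡.refl
        pointwise : ∀ g → t g ≡ (X * δ e g + Y * δ f g) + u g
        pointwise g with g Finₚ.≟ e | g Finₚ.≟ f
        ... | yes ≡.refl | _ = ≡.trans te (≡.trans (≡.sym (first≡ X Y))
              (≡.cong₂ _+_ (≡.cong₂ (λ x y → X * x + Y * y) (≡.sym (δ-refl g)) (≡.sym (δ-≢ (e≢f ∘ ≡.sym)))) (≡.sym ue)))
        ... | no _ | yes ≡.refl = ≡.trans tf (≡.trans (≡.sym (second≡ X Y))
              (≡.cong₂ _+_ (≡.cong₂ (λ x y → X * x + Y * y) (≡.sym (δ-≢ e≢f)) (≡.sym (δ-refl g))) (≡.sym uf)))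
        ... | no g≢e | no g≢f = ≡.trans (other g g≢e g≢f) (≡.trans (≡.sym (neither≡ X Y (u g)))
              (≡.cong₂ (λ x y → (X * x + Y * y) + u g) (≡.sym (δ-≢ (g≢e ∘ ≡.sym))) (≡.sym (δ-≢ (g≢f ∘ ≡.sym)))))

      scaled : ∀ s (t : Fin n → ℚ) → sum t ≡ 0# → sum (λ g → s * t g) ≡ 0#
      scaled s t t≡0 = ≡.trans (sum-*ˡ s t) (≡.trans (≡.cong (s *_) t≡0) (zeroʳ s))

    module _ {C C′ : Subset n} (e∉C : lookup C e ≡ false) (f∉C : lookup C f ≡ false)
             (e∉C′ : lookup C′ e ≡ false) (f∉C′ : lookup C′ f ≡ false) where

      private
        zero-up : ∀ {g x y} → lookup C g ≡ false → up g C * x * y ≡ 0#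
        zero-up {g} {x} {y} g∉C = ≡.trans (≡.cong (λ z → z * x * y) (up-∉ {g} {C} g∉C))
          (solve 2 (λ x y → con (0 , 0) :* x :* y := con (0 , 0)) ≡.refl x y)

      -- The Plücker relation of C + e + f and C′, multiplied by the sign in d C.
      relation₁ : (q C * p C′ + - p C * q C′) + sum (λ g → up g C * d (C △ g) * (down g C′ * a (C′ △ g))) ≡ 0#
      relation₁ = ≡.trans (≡.sym (sum-with-two at-e at-f other (zero-up e∉C) (zero-up f∉C)))
        (scaled s (λ g → up g T * ω (T △ g) * (down g C′ * ω (C′ △ g))) (plücker C′ T))
        where
        T : Subset n
        T = C △ e △ f
        s : ℚ
        s = sgn f C * sgn e (C △ f)
        t u : Fin n → ℚ
        t g = s * (up g T * ω (T △ g) * (down g C′ * ω (C′ △ g)))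
        u g = up g C * d (C △ g) * (down g C′ * a (C′ △ g))
        at-e : t e ≡ q C * p C′
        at-e = ≡.trans (≡.cong₂ (λ x y → s * (x * y * (down e C′ * ω (C′ △ e)))) up-e (≡.cong ω T-e))
          (≡.trans (≡.cong (λ z → s * (sgn e (C △ f) * ω (C △ f) * (z * ω (C′ △ e)))) (down-∉ {e} {C′} e∉C′))
            (≡.trans (solve 4 (λ x y w z → (x :* y) :* (y :* w :* z) := y :* (y :* (x :* w :* z))) ≡.refl (sgn f C) (sgn e (C △ f)) (ω (C △ f)) (p C′))
              (cancel e (C △ f) (q C * p C′))))
          where
          up-e : up e T ≡ sgn e (C △ f)
          up-e = ≡.trans (up-∈ {e} {T} (≡.trans (△△-∈ C e≢f) (≡.cong not e∉C))) (≡.trans (≡.cong (sgn e) (△-comm C e f)) (sgn-same e (C △ f)))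
          T-e : T △ e ≡ C △ f
          T-e = ≡.trans (≡.cong (_△ e) (△-comm C e f)) (△-involutive (C △ f) e)
        at-f : t f ≡ - p C * q C′
        at-f = ≡.trans (≡.cong₂ (λ x y → s * (x * y * (down f C′ * ω (C′ △ f)))) up-f (≡.cong ω (△-involutive (C △ e) f)))
          (≡.trans (≡.cong₂ (λ x z → x * (sgn f (C △ e) * ω (C △ e) * (z * ω (C′ △ f)))) (sgn-anti (e≢f ∘ ≡.sym) C) (down-∉ {f} {C′} f∉C′))
            (≡.trans (solve 4 (λ x y w z → (:- (x :* y)) :* (y :* w :* z) := y :* (y :* ((:- (x :* w)) :* z))) ≡.refl (sgn e C) (sgn f (C △ e)) (ω (C △ e)) (q C′))
              (cancel f (C △ e) (- p C * q C′))))
          where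
          up-f : up f T ≡ sgn f (C △ e)
          up-f = ≡.trans (up-∈ {f} {T} (≡.trans (△△-∈′ C e≢f) (≡.cong not f∉C))) (sgn-same f (C △ e))
        other : ∀ g → g ≢ e → g ≢ f → t g ≡ u g
        other g g≢e g≢f = ≡.trans (solve 4 (λ s x w z → s :* (x :* w :* z) := (s :* (x :* w)) :* z) ≡.refl s (up g T) (ω (T △ g)) (down g C′ * ω (C′ △ g)))
          (≡.cong (_* (down g C′ * ω (C′ △ g))) factor)
          where
          T-g : T △ g ≡ C △ g △ f △ e
          T-g = ≡.trans (≡.cong (_△ g) (△-comm C e f)) (≡.trans (△-comm (C △ f) e g) (≡.cong (_△ e) (△-comm C f g)))
          factor : s * (up g T * ω (T △ g)) ≡ up g C * d (C △ g)
          factor with lookup C g in g∈C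
          ... | false = ≡.trans (≡.cong (λ x → s * (x * ω (T △ g))) (up-∉ {g} {T} (≡.trans (△△-other C g≢e g≢f) g∈C)))
                (solve 3 (λ s w z → s :* (con (0 , 0) :* w) := con (0 , 0) :* z) ≡.refl s (ω (T △ g)) (d (C △ g)))
          ... | true = ≡.trans (≡.cong₂ (λ x w → s * (x * w)) (≡.trans (up-∈ {g} {T} (≡.trans (△△-other C g≢e g≢f) g∈C)) (≡.cong (sgn g) (△-comm C e f))) (≡.cong ω T-g))
                (≡.trans (solve 4 (λ x y z w → x :* y :* (z :* w) := x :* (y :* z) :* w) ≡.refl (sgn f C) (sgn e (C △ f)) (sgn g (C △ f △ e)) W)
                (≡.trans (≡.cong (λ z → sgn f C * z * W) (sgn-anti (g≢e ∘ ≡.sym) (C △ f)))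
                (≡.trans (solve 4 (λ x y z w → x :* (:- (y :* z)) :* w := (:- (x :* y)) :* (z :* w)) ≡.refl (sgn f C) (sgn g (C △ f)) (sgn e (C △ f △ g)) W)
                (≡.trans (≡.cong₂ (λ x z → - x * (z * W)) (sgn-anti (g≢f ∘ ≡.sym) C) (≡.cong (sgn e) (△-comm C f g)))
                (solve 4 (λ x y z w → (:- (:- (x :* y))) :* (z :* w) := x :* (y :* z :* w)) ≡.refl (sgn g C) (sgn f (C △ g)) (sgn e (C △ g △ f)) W)))))
            where
            W : ℚ
            W = ω (C △ g △ f △ e)

      -- The Plücker relation of C + e and C′ + f, multiplied by the signs in p C and q C′. Since f
      -- is not in C + e, the term at f is 0; it is written as a product to match the shape of
      -- `relation₁`.
      relation₂ : (a C * d C′ + 0# * 0#) + sum (λ g → up g C * p (C △ g) * (down g C′ * q (C′ △ g))) ≡ 0#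
      relation₂ = ≡.trans (≡.sym (sum-with-two at-e at-f other (zero-up e∉C) (zero-up f∉C)))
        (scaled s (λ g → up g T * ω (T △ g) * (down g T′ * ω (T′ △ g))) (plücker T′ T))
        where
        T T′ : Subset n
        T = C △ e
        T′ = C′ △ f
        s : ℚ
        s = sgn e C * sgn f C′
        t u : Fin n → ℚ
        t g = s * (up g T * ω (T △ g) * (down g T′ * ω (T′ △ g)))
        u g = up g C * p (C △ g) * (down g C′ * q (C′ △ g))
        at-e : t e ≡ a C * d C′
        at-e = ≡.trans (≡.cong₂ (λ x w → s * (x * w * (down e T′ * ω (T′ △ e)))) up-e (≡.cong ω (△-involutive C e)))
          (≡.trans (≡.cong (λ x → s * (sgn e C * ω C * (x * ω (T′ △ e)))) (down-∉ {e} {T′} (≡.trans (△-other C′ e≢f) e∉C′)))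
            (≡.trans (solve 5 (λ x y w z v → x :* y :* (x :* w :* (z :* v)) := x :* (x :* (w :* (y :* z :* v)))) ≡.refl (sgn e C) (sgn f C′) (ω C) (sgn e T′) (ω (T′ △ e)))
              (cancel e C (a C * d C′))))
          where
          up-e : up e T ≡ sgn e C
          up-e = ≡.trans (up-∈ {e} {T} (≡.trans (△-same C e) (≡.cong not e∉C))) (sgn-same e C)
        at-f : t f ≡ 0# * 0#
        at-f = ≡.trans (≡.cong (λ x → s * (x * ω (T △ f) * (down f T′ * ω (T′ △ f)))) (up-∉ {f} {T} (≡.trans (△-other C (e≢f ∘ ≡.sym)) f∉C)))
          (solve 3 (λ s w z → s :* (con (0 , 0) :* w :* z) := con (0 , 0) :* con (0 , 0)) ≡.refl s (ω (T △ f)) (down f T′ * ω (T′ △ f)))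
        other : ∀ g → g ≢ e → g ≢ f → t g ≡ u g
        other g g≢e g≢f = ≡.trans (solve 4 (λ x y z w → x :* y :* (z :* w) := (x :* z) :* (y :* w)) ≡.refl (sgn e C) (sgn f C′) (up g T * ω (T △ g)) (down g T′ * ω (T′ △ g)))
          (≡.trans (≡.cong₂ _*_ left right) (solve 2 (λ x y → (:- x) :* (:- y) := x :* y) ≡.refl (up g C * p (C △ g)) (down g C′ * q (C′ △ g))))
          where
          move : ∀ x y z v w → x * y ≡ - (z * v) → x * (y * w) ≡ - (z * (v * w))
          move x y z v w xy = ≡.trans (≡.sym (*-assoc x y w)) (≡.trans (≡.cong (_* w) xy) (solve 3 (λ z v w → (:- (z :* v)) :* w := :- (z :* (v :* w))) ≡.refl z v w))
          no-term : ∀ x w z → x * (0# * w) ≡ - (0# * z)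
          no-term = solve 3 (λ x w z → x :* (con (0 , 0) :* w) := :- (con (0 , 0) :* z)) ≡.refl
          left : sgn e C * (up g T * ω (T △ g)) ≡ - (up g C * p (C △ g))
          left with lookup C g in g∈C
          ... | false = ≡.trans (≡.cong (λ x → sgn e C * (x * ω (T △ g))) (up-∉ {g} {T} (≡.trans (△-other C g≢e) g∈C))) (no-term (sgn e C) (ω (T △ g)) (p (C △ g)))
          ... | true = ≡.trans (≡.cong₂ (λ x X → sgn e C * (x * ω X)) (up-∈ {g} {T} (≡.trans (△-other C g≢e) g∈C)) (△-comm C e g))
                (move (sgn e C) (sgn g T) (sgn g C) (sgn e (C △ g)) (ω (C △ g △ e)) (sgn-anti (g≢e ∘ ≡.sym) C))
          right : sgn f C′ * (down g T′ * ω (T′ △ g)) ≡ - (down g C′ * q (C′ △ g))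
          right with lookup C′ g in g∈C′
          ... | true = ≡.trans (≡.cong (λ x → sgn f C′ * (x * ω (T′ △ g))) (down-∈ {g} {T′} (≡.trans (△-other C′ g≢f) g∈C′))) (no-term (sgn f C′) (ω (T′ △ g)) (q (C′ △ g)))
          ... | false = ≡.trans (≡.cong₂ (λ x X → sgn f C′ * (x * ω X)) (down-∉ {g} {T′} (≡.trans (△-other C′ g≢f) g∈C′)) (△-comm C′ f g))
                (move (sgn f C′) (sgn g T′) (sgn g C′) (sgn f (C′ △ g)) (ω (C′ △ g △ f)) (sgn-anti (g≢f ∘ ≡.sym) C′))

    module _ (y : Fin n → ℚ) where

      w : Subset n → ℚ
      w C = if disjoint (∅ △ e △ f) C then prodOn C y else 0#

      -- The inner product weighted by y^C over the sets C avoiding e and f. The four polynomials in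
      -- ΔM are its values on the diagonal at a, p, q and d, because ω² is the indicator of the
      -- bases.
      pair : (Subset n → ℚ) → (Subset n → ℚ) → ℚ
      pair u v = sumSub λ C → w C * (u C * v C)

      w-zero : ∀ {C} g → lookup (∅ △ e △ f) g ≡ true → lookup C g ≡ true → w C ≡ 0#
      w-zero {C} g g∈K g∈C with disjoint (∅ △ e △ f) C in dis
      ... | false = ≡.refl
      ... | true = ⊥-elim (true≢false (≡.trans (≡.sym g∈C) (disjoint⇒ (∅ △ e △ f) C dis g g∈K)))

      e∈K : lookup (∅ △ e △ f) e ≡ true
      e∈K = ≡.trans (△△-∈ ∅ e≢f) (≡.cong not (lookup-∅ e))

      f∈K : lookup (∅ △ e △ f) f ≡ true
      f∈K = ≡.trans (△△-∈′ ∅ e≢f) (≡.cong not (lookup-∅ f))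

      on-disjoint : ∀ C {x} → (lookup C e ≡ false → lookup C f ≡ false → x ≡ 0#) → w C * x ≡ 0#
      on-disjoint C {x} h with disjoint (∅ △ e △ f) C in dis
      ... | false = zeroˡ x
      ... | true = ≡.trans (≡.cong (prodOn C y *_) (h (disjoint⇒ (∅ △ e △ f) C dis e e∈K) (disjoint⇒ (∅ △ e △ f) C dis f f∈K))) (zeroʳ (prodOn C y))

      Z≡pair : ∀ D (u : Subset n → ℚ) → (∀ C → u C * u C ≡ value (C ⊕ D)) → Z (∅ △ e △ f) D y ≡ pair u u
      Z≡pair D u u² = sumSub-cong same
        where
        same : ∀ C → summand (∅ △ e △ f) D y C ≡ w C * (u C * u C)
        same C with disjoint (∅ △ e △ f) C
        ... | false = ≡.sym (zeroˡ (u C * u C))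
        ... | true = ≡.trans (*-comm (value (C ⊕ D)) (prodOn C y)) (≡.cong (prodOn C y *_) (≡.sym (u² C)))

      sumSub-*ʳ : ∀ (F : Subset n → ℚ) x → sumSub (λ C → F C * x) ≡ sumSub F * x
      sumSub-*ʳ F x = ≡.trans (sumSub-cong λ C → *-comm (F C) x) (≡.trans (sumSub-*ˡ x F) (*-comm x (sumSub F)))

      pair-linear : ∀ x α β (X Y : ℚ) (U : Fin n → Subset n → ℚ) (V : Fin n → ℚ) →
                    sumSub (λ C → w C * (x C * ((α C * X + β C * Y) + sum λ g → U g C * V g))) ≡
                    (pair x α * X + pair x β * Y) + sum (λ g → pair x (U g) * V g)
      pair-linear x α β X Y U V = ≡.trans (sumSub-cong λ C → ≡.trans
            (solve 7 (λ w x a X b Y s → w :* (x :* ((a :* X :+ b :* Y) :+ s)) := (w :* (x :* a) :* X :+ w :* (x :* b) :* Y) :+ (w :* x) :* s) ≡.refl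
              (w C) (x C) (α C) X (β C) Y (sum λ g → U g C * V g))
            (≡.cong ((w C * (x C * α C) * X + w C * (x C * β C) * Y) +_) (≡.trans (≡.sym (sum-*ˡ (w C * x C) (λ g → U g C * V g)))
              (sum-cong λ g → solve 4 (λ w x u v → (w :* x) :* (u :* v) := w :* (x :* u) :* v) ≡.refl (w C) (x C) (U g C) (V g)))))
        (≡.trans (sumSub-+ (λ C → w C * (x C * α C) * X + w C * (x C * β C) * Y) (λ C → sum λ g → w C * (x C * U g C) * V g))
          (≡.cong₂ _+_
            (≡.trans (sumSub-+ (λ C → w C * (x C * α C) * X) (λ C → w C * (x C * β C) * Y)) (≡.cong₂ _+_ (sumSub-*ʳ (λ C → w C * (x C * α C)) X) (sumSub-*ʳ (λ C → w C * (x C * β C)) Y)))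
            (≡.trans (sumSub-sum (λ C g → w C * (x C * U g C) * V g)) (sum-cong λ g → sumSub-*ʳ (λ C → w C * (x C * U g C)) (V g)))))

      -- An identity in C and C′ is summed against x C and x′ C′ with the weights; the disjointness
      -- built into `w` supplies its hypotheses.
      pair-relation : ∀ (x x′ α β γ η : Subset n → ℚ) (U V : Fin n → Subset n → ℚ) →
        (∀ {C C′} → lookup C e ≡ false → lookup C f ≡ false → lookup C′ e ≡ false → lookup C′ f ≡ false →
          (α C * β C′ + γ C * η C′) + sum (λ g → U g C * V g C′) ≡ 0#) →
        (pair x α * pair x′ β + pair x γ * pair x′ η) + sum (λ g → pair x (U g) * pair x′ (V g)) ≡ 0#
      pair-relation x x′ α β γ η U V relation = ≡.trans (≡.sym (pair-linear x α γ (pair x′ β) (pair x′ η) U λ g → pair x′ (V g)))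
        (sumSub-0 λ C → on-disjoint C λ e∉C f∉C → ≡.trans (≡.cong (x C *_) (inner e∉C f∉C)) (zeroʳ (x C)))
        where
        inner : ∀ {C} → lookup C e ≡ false → lookup C f ≡ false →
                (α C * pair x′ β + γ C * pair x′ η) + sum (λ g → U g C * pair x′ (V g)) ≡ 0#
        inner {C} e∉C f∉C = ≡.trans (≡.cong₂ _+_ (≡.cong₂ _+_ (*-comm (α C) (pair x′ β)) (*-comm (γ C) (pair x′ η))) (sum-cong λ g → *-comm (U g C) (pair x′ (V g))))
          (≡.trans (≡.sym (pair-linear x′ β η (α C) (γ C) V λ g → U g C))
            (sumSub-0 λ C′ → on-disjoint C′ λ e∉C′ f∉C′ → ≡.trans (≡.cong (x′ C′ *_) (≡.trans
              (≡.cong₂ _+_ (≡.cong₂ _+_ (*-comm (β C′) (α C)) (*-comm (η C′) (γ C))) (sum-cong λ g → *-comm (V g C′) (U g C)))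
              (relation e∉C f∉C e∉C′ f∉C′))) (zeroʳ (x′ C′))))

      raise lower : Fin n → (Subset n → ℚ) → Subset n → ℚ
      raise g u C = up g C * u (C △ g)
      lower g u C = down g C * u (C △ g)

      raise-zero : ∀ {g} → lookup (∅ △ e △ f) g ≡ true → ∀ u v → pair u (raise g v) ≡ 0#
      raise-zero {g} g∈K u v = sumSub-0 each
        where
        each : ∀ C → w C * (u C * (up g C * v (C △ g))) ≡ 0#
        each C = by-side (lookup C g) ≡.refl
          where
          by-side : ∀ b → lookup C g ≡ b → w C * (u C * (up g C * v (C △ g))) ≡ 0#
          by-side true g∈C = ≡.trans (≡.cong (_* (u C * (up g C * v (C △ g)))) (w-zero {C} g g∈K g∈C)) (zeroˡ (u C * (up g C * v (C △ g))))
          by-side false g∈C = ≡.trans (≡.cong (λ z → w C * (u C * (z * v (C △ g)))) (up-∉ {g} {C} g∈C))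
              (solve 3 (λ w u v → w :* (u :* (con (0 , 0) :* v)) := con (0 , 0)) ≡.refl (w C) (u C) (v (C △ g)))

      -- Replacing C by C △ g exchanges the sets with and without g; the factor y g appears because
      -- y^C gains it when g is added.
      adjoint : ∀ {g} → lookup (∅ △ e △ f) g ≡ false → ∀ u v → pair u (raise g v) ≡ y g * pair v (lower g u)
      adjoint {g} g∉K u v = ≡.trans (sumSub-△ g (λ C → w C * (u C * (up g C * v (C △ g)))))
        (≡.trans (sumSub-cong each) (sumSub-*ˡ (y g) (λ C → w C * (v C * (down g C * u (C △ g))))))
        where
        K-≢ : ∀ {u} → lookup (∅ △ e △ f) u ≡ true → u ≢ g
        K-≢ u∈K ≡.refl = true≢false (≡.trans (≡.sym u∈K) g∉K)
        same-disjoint : ∀ C → disjoint (∅ △ e △ f) (C △ g) ≡ disjoint (∅ △ e △ f) C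
        same-disjoint C = bool-ext
          (λ dis → ⇒disjoint (∅ △ e △ f) C λ u u∈K → ≡.trans (≡.sym (△-other C (K-≢ u∈K))) (disjoint⇒ (∅ △ e △ f) (C △ g) dis u u∈K))
          λ dis → ⇒disjoint (∅ △ e △ f) (C △ g) λ u u∈K → ≡.trans (△-other C (K-≢ u∈K)) (disjoint⇒ (∅ △ e △ f) C dis u u∈K)
        w-△ : ∀ {C} → lookup C g ≡ false → w (C △ g) ≡ y g * w C
        w-△ {C} g∉C rewrite same-disjoint C with disjoint (∅ △ e △ f) C
        ... | true = prodOn-△ C g y g∉C
        ... | false = ≡.sym (zeroʳ (y g))
        each : ∀ C → w (C △ g) * (u (C △ g) * (up g (C △ g) * v (C △ g △ g))) ≡ y g * (w C * (v C * (down g C * u (C △ g))))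
        each C = by-side (lookup C g) ≡.refl
          where
          by-side : ∀ b → lookup C g ≡ b → w (C △ g) * (u (C △ g) * (up g (C △ g) * v (C △ g △ g))) ≡ y g * (w C * (v C * (down g C * u (C △ g))))
          by-side true g∈C = ≡.trans (≡.cong (λ z → w (C △ g) * (u (C △ g) * (z * v (C △ g △ g)))) (up-∉ {g} {C △ g} (≡.trans (△-same C g) (≡.cong not g∈C))))
              (≡.trans (solve 7 (λ w u v y w′ v′ u′ → w :* (u :* (con (0 , 0) :* v)) := y :* (w′ :* (v′ :* (con (0 , 0) :* u)))) ≡.refl
                 (w (C △ g)) (u (C △ g)) (v (C △ g △ g)) (y g) (w C) (v C) (u C))
                (≡.cong (λ z → y g * (w C * (v C * (z * u (C △ g))))) (≡.sym (down-∈ {g} {C} g∈C))))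
          by-side false g∈C = ≡.trans (≡.cong₂ (λ a b → a * (u (C △ g) * b)) (w-△ g∈C) (≡.cong₂ _*_
                (≡.trans (up-∈ {g} {C △ g} (≡.trans (△-same C g) (≡.cong not g∈C))) (sgn-same g C)) (≡.cong v (△-involutive C g))))
              (≡.trans (solve 5 (λ y w u s v → (y :* w) :* (u :* (s :* v)) := y :* (w :* (v :* (s :* u)))) ≡.refl (y g) (w C) (u (C △ g)) (sgn g C) (v C))
                (≡.cong (λ z → y g * (w C * (v C * (z * u (C △ g))))) (≡.sym (down-∉ {g} {C} g∈C))))

      -- By `adjoint` both terms equal y g times `pair d (lower g q)` times `pair p (lower g a)`,
      -- and for g = e and g = f both vanish. This is why the remaining sums of the two Plücker
      -- relations cancel.
      same-sums : sum (λ g → pair q (raise g d) * pair p (lower g a)) ≡ sum (λ g → pair a (raise g p) * pair d (lower g q))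
      same-sums = sum-cong each
        where
        each : ∀ g → pair q (raise g d) * pair p (lower g a) ≡ pair a (raise g p) * pair d (lower g q)
        each g with lookup (∅ △ e △ f) g in g∈K
        ... | true = ≡.trans (≡.cong (_* pair p (lower g a)) (raise-zero g∈K q d)) (≡.trans (zeroˡ (pair p (lower g a)))
              (≡.sym (≡.trans (≡.cong (_* pair d (lower g q)) (raise-zero g∈K a p)) (zeroˡ (pair d (lower g q))))))
        ... | false = ≡.trans (≡.cong (_* pair p (lower g a)) (adjoint g∈K q d))
              (≡.trans (solve 3 (λ y x z → y :* x :* z := y :* z :* x) ≡.refl (y g) (pair d (lower g q)) (pair p (lower g a)))
                (≡.cong (_* pair d (lower g q)) (≡.sym (adjoint g∈K a p))))

      pair-neg : pair q (λ C → - p C) ≡ - pair p q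
      pair-neg = ≡.trans (sumSub-cong λ C → solve 3 (λ w q p → w :* (q :* (:- p)) := (:- con (1 , 0)) :* (w :* (p :* q))) ≡.refl (w C) (q C) (p C))
        (≡.trans (sumSub-*ˡ (- 1#) (λ C → w C * (p C * q C))) (solve 1 (λ x → (:- con (1 , 0)) :* x := :- x) ≡.refl (pair p q)))

      pair-zero : pair a (λ _ → 0#) ≡ 0#
      pair-zero = sumSub-0 λ C → solve 2 (λ w a → w :* (a :* con (0 , 0)) := con (0 , 0)) ≡.refl (w C) (a C)

      -- `relation₁` summed against q and p gives ⟨q , q⟩ ⟨p , p⟩ - ⟨p , q⟩² + Σ₁ = 0, and
      -- `relation₂` summed against a and d gives ⟨a , a⟩ ⟨d , d⟩ + Σ₁ = 0; the difference is the
      -- identity.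
      pair-identity : pair p p * pair q q - pair d d * pair a a ≡ pair p q * pair p q
      pair-identity = ≡.trans (solve 7 (λ P Q A D N s X → P :* Q :- D :* A :=
              ((Q :* P :+ (:- N) :* N) :+ s) :- ((A :* D :+ con (0 , 0) :* X) :+ s) :+ N :* N) ≡.refl
            (pair p p) (pair q q) (pair a a) (pair d d) (pair p q) Σ₁ (pair d (λ _ → 0#)))
        (≡.trans (≡.cong₂ (λ A B → A - B + pair p q * pair p q) identity₁ identity₂)
          (solve 1 (λ N → con (0 , 0) :- con (0 , 0) :+ N := N) ≡.refl (pair p q * pair p q)))
        where
        Σ₁ : ℚ
        Σ₁ = sum λ g → pair q (raise g d) * pair p (lower g a)
        identity₁ : (pair q q * pair p p + - pair p q * pair p q) + Σ₁ ≡ 0#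
        identity₁ = ≡.trans (≡.cong (λ N → (pair q q * pair p p + N * pair p q) + Σ₁) (≡.sym pair-neg))
          (pair-relation q p q p (λ C → - p C) q (λ g → raise g d) (λ g → lower g a) λ {C} {C′} → relation₁ {C} {C′})
        identity₂ : (pair a a * pair d d + 0# * pair d (λ _ → 0#)) + Σ₁ ≡ 0#
        identity₂ = ≡.trans (≡.cong₂ (λ N s → (pair a a * pair d d + N * pair d (λ _ → 0#)) + s) (≡.sym pair-zero) same-sums)
          (pair-relation a d a d (λ _ → 0#) (λ _ → 0#) (λ g → raise g p) (λ g → lower g q) λ {C} {C′} → relation₂ {C} {C′})

      private
        signed-square : ∀ s x → s * s ≡ 1# → (s * x) * (s * x) ≡ x * x
        signed-square s x s² = ≡.trans (solve 2 (λ s x → (s :* x) :* (s :* x) := (s :* s) :* (x :* x)) ≡.refl s x)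
          (≡.trans (≡.cong (_* (x * x)) s²) (*-identityˡ (x * x)))

        ⊕-∅△ : ∀ (C : Subset n) g → C ⊕ (∅ △ g) ≡ C △ g
        ⊕-∅△ C g = ≡.trans (⊕-△ C ∅ g) (≡.cong (_△ g) (⊕-∅ C))

        a² : ∀ C → a C * a C ≡ value (C ⊕ ∅)
        a² C = ≡.trans (ω-square C) (≡.cong value (≡.sym (⊕-∅ C)))

        p² : ∀ C → p C * p C ≡ value (C ⊕ (∅ △ e))
        p² C = ≡.trans (signed-square (sgn e C) (ω (C △ e)) (sgn-square e C)) (≡.trans (ω-square (C △ e)) (≡.cong value (≡.sym (⊕-∅△ C e))))

        q² : ∀ C → q C * q C ≡ value (C ⊕ (∅ △ f))
        q² C = ≡.trans (signed-square (sgn f C) (ω (C △ f)) (sgn-square f C)) (≡.trans (ω-square (C △ f)) (≡.cong value (≡.sym (⊕-∅△ C f))))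

        d² : ∀ C → d C * d C ≡ value (C ⊕ (∅ △ e △ f))
        d² C = ≡.trans (signed-square (sgn f C * sgn e (C △ f)) (ω (C △ f △ e))
            (≡.trans (signed-square (sgn f C) (sgn e (C △ f)) (sgn-square f C)) (sgn-square e (C △ f))))
          (≡.trans (ω-square (C △ f △ e)) (≡.cong value (≡.trans (△-comm C f e) (≡.sym (≡.trans (⊕-△ C (∅ △ e) f) (≡.cong (_△ f) (⊕-∅△ C e)))))))

      gap≡square : gap (∅ △ e △ f) ∅ e f y ≡ pair p q * pair p q
      gap≡square = ≡.trans (≡.cong₂ _-_ (≡.cong₂ _*_ (Z≡pair (∅ △ e) p p²) (Z≡pair (∅ △ f) q q²)) (≡.cong₂ _*_ (Z≡pair (∅ △ e △ f) d d²) (Z≡pair ∅ a a²)))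
        pair-identity

  strongly-Rayleigh : StronglyRayleigh M
  strongly-Rayleigh e f e≢f y = ≡.subst (0ℚ ℚ.≤_) (≡.sym (≡.trans (ΔM≡gap e≢f y) (gap≡square e≢f y))) (square-nonneg (pair e≢f y (p e≢f) (q e≢f)))

theorem5p5 : ∀ (n : ℕ) (M : Matroid n) → Binary M → StronglyRayleigh M ⇔ω Regular M
theorem5p5 n M binary = record { to = regular ; from = rayleigh }
  where
  bin : BinaryPivots M
  bin = binary-pivots M binary
  regular : StronglyRayleigh M → Regular M
  regular sr F = Signed.Lift.representable bin (SigningExists.signing M bin (Fano.no-fano M bin sr)) (Field.commutativeRing F) (Field.1≉0 F)
  rayleigh : Regular M → StronglyRayleigh M
  rayleigh reg = SquareGap.strongly-Rayleigh bin (representation⇒signing M (reg F₃-field))
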